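{- As $n\to\infty$, \[\frac{1}{2} n^{3/2} + o(n^{3/2}) \leq \mathrm{ex}(n,\mathrm{Tr}_3(C_4))\le \frac{5}{6}n^{3/2}+o(n^{3/2}).\]
   Context: Let $F$ be a graph. A 3-uniform hypergraph $H$ contains $F$ as a trace if there is a set $S\subseteq V(H)$ and a bijection $\psi$ from $V(F)$ onto $S$, together with an injective map $\phi$ from $E(F)$ into $E(H)$, such that for every edge $ab\in E(F)$ we have $\phi(ab)\cap S=\{\psi(a),\psi(b)\}$. $\mathrm{ex}(n,\mathrm{Tr}_3(F))$ is the maximum number of edges in an $n$-vertex 3-uniform hypergraph that does not contain $F$ as a trace. $C_4$ is the cycle on four vertices. -}

module Defs where

open import Data.Nat using (ℕ; suc; _^_)
open import Data.Fin using (Fin) renaming (_<_ to _<ᶠ_)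
open import Data.Product using (Σ; _×_; _,_)
open import Data.Sum using (_⊎_)
open import Data.List using (List; length; lookup; _∷_; [])
open import Data.List.Relation.Unary.All using (All)
open import Data.List.Relation.Unary.Unique.Propositional using (Unique)
open import Data.Integer using (+_)
open import Data.Rational using (ℚ; _/_; _*_; _≤_)
open import Function.Definitions using (Injective)
open import Relation.Binary.PropositionalEquality using (_≡_)
open import Function.Bundles using (_⇔_)

record Graph : Set where
  field
    k     : ℕ
    edges : List (Fin k × Fin k)
    ordered : All (λ e → Data.Product.proj₁ e <ᶠ Data.Product.proj₂ e) edges
    nodup : Unique edges

record Hyp3 (n : ℕ) : Set where
  field
    edges : List (Fin n × Fin n × Fin n)
    ordered : All (λ { (a , b , c) → a <ᶠ b × b <ᶠ c }) edges
    nodup : Unique edges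

∣E∣ : ∀ {n} → Hyp3 n → ℕ
∣E∣ H = length (Hyp3.edges H)

_∈₃_ : ∀ {n} → Fin n → Fin n × Fin n × Fin n → Set
v ∈₃ (a , b , c) = (v ≡ a) ⊎ (v ≡ b) ⊎ (v ≡ c)

-- H contains F as a trace: an injective ψ : V(F) → V(H) (a bijection onto
-- S = image ψ) and an injective φ : E(F) → E(H) with φ(ab) ∩ S = {ψ a, ψ b},
-- i.e. for every vertex v of F:  ψ v ∈ φ(ab)  ⇔  v = a or v = b.
ContainsTrace : ∀ {n} → Graph → Hyp3 n → Set
ContainsTrace {n} F H =
  Σ (Fin (Graph.k F) → Fin n) λ ψ →
  Σ (Fin (length (Graph.edges F)) → Fin (length (Hyp3.edges H))) λ φ →
    Injective _≡_ _≡_ ψ × Injective _≡_ _≡_ φ ×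
    (∀ i (v : Fin (Graph.k F)) →
       (ψ v ∈₃ lookup (Hyp3.edges H) (φ i))
         ⇔ ((v ≡ Data.Product.proj₁ (lookup (Graph.edges F) i))
             ⊎ (v ≡ Data.Product.proj₂ (lookup (Graph.edges F) i))))

open import Data.Fin using (zero; suc)
open import Data.Nat using (z<s; s<s)
open import Data.List.Relation.Unary.All using ([]; _∷_)
open import Data.List.Relation.Unary.AllPairs using ([]; _∷_)
open import Relation.Nullary using (¬_)

private
  v0 v1 v2 v3 : Fin 4
  v0 = zero
  v1 = suc zero
  v2 = suc (suc zero)
  v3 = suc (suc (suc zero))

C4 : Graph
C4 = record
  { k = 4
  ; edges = (v0 , v1) ∷ (v1 , v2) ∷ (v2 , v3) ∷ (v0 , v3) ∷ []
  ; ordered = z<s ∷ s<s z<s ∷ s<s (s<s z<s) ∷ z<s ∷ []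
  ; nodup = (d1 ∷ d2 ∷ d3 ∷ []) ∷ (d4 ∷ d5 ∷ []) ∷ (d6 ∷ []) ∷ [] ∷ []
  }
  where
  d1 : ¬ ((v0 , v1) ≡ (v1 , v2))
  d1 ()
  d2 : ¬ ((v0 , v1) ≡ (v2 , v3))
  d2 ()
  d3 : ¬ ((v0 , v1) ≡ (v0 , v3))
  d3 ()
  d4 : ¬ ((v1 , v2) ≡ (v2 , v3))
  d4 ()
  d5 : ¬ ((v1 , v2) ≡ (v0 , v3))
  d5 ()
  d6 : ¬ ((v2 , v3) ≡ (v0 , v3))
  d6 ()

ℕ→ℚ : ℕ → ℚ
ℕ→ℚ m = + m / 1

-- c · n^{3/2} ≤ m, for c ≥ 0, via squaring:  c² n³ ≤ m²
-- (and m ≤ c · n^{3/2} similarly via m² ≤ c² n³).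

{-# OPTIONS --termination-depth=2 #-}
module Submission where

-- Lower bound.  For a prime p, joining a fixed vertex to the edges of the graph y + v ≡ x u on
-- (ℤ/p)² gives a triple system without a C₄ trace, because two points of this graph have at most
-- one common neighbour.  With p ~ √n this yields n^{3/2} / 2 triples, so one needs consecutive
-- primes to have ratio tending to 1.  This is proved by Selberg's symmetry formula and Erdős'
-- argument: if every interval (x , (1 + C) x] carries a positive proportion of prime mass, then
-- so does every interval with 3 C / 4 in place of C.  Logarithms are replaced by a completely
-- additive ℓ : ℕ → ℚ which is close to the harmonic sums up to a given X.
--
-- Upper bound.  Call a pair light if it lies in one triple and heavy if it lies in several.
-- Selecting one light pair from each triple that has one gives a C₄-free graph, with about
-- n^{3/2} / 2 edges at most.  In the graph of heavy pairs two vertices have at most two common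
-- neighbours, and two only if they lie in a common triple, so that it has about n^{3/2} / 2
-- edges at most as well.  A heavy pair lies in at most two triples all of whose pairs are heavy,
-- hence there are about n^{3/2} / 3 of these triples at most.

-- Selberg's identity Λ log + Λ ∗ Λ = μ ∗ log² needs only that the logarithm is completely additive,
-- so it holds exactly for any weights on the primes. Approximation enters only through partial
-- sums, where `ℓ n` has to stay within 1/n of H n minus a constant. Errors are kept qualitative, as
-- a fraction 1/j of the main term beyond a threshold depending on j: an error o(x log x) in
-- Selberg's formula is enough. The factor 3/4 comes from the following balance. The integers a
-- between m / (1 + C/2) and (1 + C/2) m span a ratio of at least 1 + C and so carry prime mass. The
-- intervals of ratio 1 + 3C/4 rescaled by 1/a and by 1/m are shifted by a ratio of at most 1 + C/2,
-- hence still overlap; if the one at a has nearly the maximal mass and the one at m almost none,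
-- the part outside the overlap is too short for that mass. In the heavy graph, the ordered pairs
-- with a second common neighbour number at most 6 |E|, a multiple of the very quantity to be
-- bounded. This is harmless, because that term enters the bound for the square linearly and with a
-- factor n only.

open import Defs
open import Data.Nat using (ℕ; _≥_; _^_)
open import Data.Product using (Σ; _×_)
open import Data.Sum using (_⊎_)
open import Data.Integer using (+_)
open import Data.Rational using (ℚ; _/_; _+_; _-_; _*_; _≤_; _<_; 0ℚ)
open import Relation.Nullary using (¬_)

open Defs using () renaming (ℕ→ℚ to ι)
open import Data.Bool using (Bool; true; false; _∧_; _∨_; if_then_else_) renaming (T to IsTrue)
open import Data.Empty using (⊥; ⊥-elim)
open import Data.Fin as Fin using (Fin; toℕ; fromℕ<)
import Data.Fin.Properties as Finₚ
open import Data.Integer as ℤ using (ℤ; -[1+_])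
import Data.Integer.Properties as ℤₚ
open import Data.List using (List; []; _∷_; map; length; lookup; _++_; upTo; cartesianProduct; allFin)
open import Data.List.Membership.Propositional using (_∈_; lose) renaming (find to find∈)
open import Data.List.Membership.Propositional.Properties using (∈-lookup; ∈-allFin; ∈-map⁻)
import Data.List.Properties as Listₚ
open import Data.List.Relation.Unary.All as All using (All; []; _∷_)
import Data.List.Relation.Unary.All.Properties as Allₚ
open import Data.List.Relation.Unary.AllPairs using ([]; _∷_)
open import Data.List.Relation.Unary.Any as Any using (Any; here; there; any?)
import Data.List.Relation.Unary.Any.Properties as Anyₚ
open import Data.List.Relation.Unary.Unique.Propositional using (Unique)
import Data.List.Relation.Unary.Unique.Propositional.Properties as Uniqueₚ
open import Data.Maybe using (Maybe; just; nothing)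
open import Data.Nat as ℕ using (zero; suc; z≤n; s≤s; NonZero)
  renaming (_+_ to _+ₙ_; _*_ to _*ₙ_; _∸_ to _∸ₙ_; _≤_ to _≤ₙ_; _<_ to _<ₙ_)
open import Data.Nat.Coprimality as Coprimality using (coprime-divisor; prime⇒coprime)
open import Data.Nat.Divisibility using (_∣_; divides; _∣?_; ∣-trans; ∣⇒≤; *-cancelˡ-∣; m∣m*n; n∣m*n; ∣-refl; ∣m⇒∣m*n; ∣n⇒∣m*n; ∣1⇒≡1; ∣m+n∣m⇒∣n)
import Data.Nat.DivMod as ℕ/
open import Data.Nat.Primality using (Prime; prime?; euclidsLemma; prime⇒nonZero; prime⇒irreducible; ¬prime[1]; ¬prime[0])
open import Data.Nat.Primality.Factorisation using (factorise)
import Data.Nat.Properties as ℕₚ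
open import Data.Product using (∃-syntax; _,_; proj₁; proj₂)
open import Data.Product.Properties using (≡-dec)
open import Data.Rational as ℚ using (mkℚ; 1ℚ; -_; ∣_∣)
import Data.Rational.Properties as ℚₚ
import Data.Rational.Unnormalised as ℚᵘ
import Data.Rational.Unnormalised.Properties as ℚᵘₚ
open import Data.Sum using (inj₁; inj₂; [_,_]′)
open import Data.Unit using (⊤; tt)
open import Function using (_∘_; id; case_of_)
open import Function.Bundles using (Equivalence; mk⇔; _⇔_)
open import Relation.Binary using (DecidableEquality)
open import Relation.Binary.PropositionalEquality using (_≡_; _≢_; refl; sym; trans; cong; cong₂; subst; subst₂; setoid; module ≡-Reasoning)
open import Relation.Nullary using (Dec; yes; no; contradiction; _×-dec_; _⊎-dec_; ¬?)

-- Certified linear arithmetic over ℚ and ℕ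

ιᶻ : ℤ → ℚ
ιᶻ z = z / 1

private
  toℚᵘ-ιᶻ : ∀ z → ℚ.toℚᵘ (ιᶻ z) ℚᵘ.≃ ℚᵘ.mkℚᵘ z 0
  toℚᵘ-ιᶻ z = ℚₚ.toℚᵘ-fromℚᵘ (ℚᵘ.mkℚᵘ z 0)

ιᶻ-+ : ∀ a b → ιᶻ (a ℤ.+ b) ≡ ιᶻ a + ιᶻ b
ιᶻ-+ a b = ℚₚ.toℚᵘ-injective (ℚᵘₚ.≃-trans (toℚᵘ-ιᶻ (a ℤ.+ b))
  (ℚᵘₚ.≃-sym (ℚᵘₚ.≃-trans (ℚₚ.toℚᵘ-homo-+ (ιᶻ a) (ιᶻ b))
    (ℚᵘₚ.≃-trans (ℚᵘₚ.+-cong (toℚᵘ-ιᶻ a) (toℚᵘ-ιᶻ b))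
      (ℚᵘ.*≡* (cong (ℤ._* + 1) (cong₂ ℤ._+_ (ℤₚ.*-identityʳ a) (ℤₚ.*-identityʳ b))))))))

ιᶻ-* : ∀ a b → ιᶻ (a ℤ.* b) ≡ ιᶻ a * ιᶻ b
ιᶻ-* a b = ℚₚ.toℚᵘ-injective (ℚᵘₚ.≃-trans (toℚᵘ-ιᶻ (a ℤ.* b))
  (ℚᵘₚ.≃-sym (ℚᵘₚ.≃-trans (ℚₚ.toℚᵘ-homo-* (ιᶻ a) (ιᶻ b))
    (ℚᵘₚ.*-cong (toℚᵘ-ιᶻ a) (toℚᵘ-ιᶻ b)))))

ιᶻ-mono : ∀ {a b} → a ℤ.≤ b → ιᶻ a ≤ ιᶻ b
ιᶻ-mono {a} {b} a≤b = ℚₚ.toℚᵘ-cancel-≤ (ℚᵘₚ.≤-respˡ-≃ (ℚᵘₚ.≃-sym (toℚᵘ-ιᶻ a))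
  (ℚᵘₚ.≤-respʳ-≃ (ℚᵘₚ.≃-sym (toℚᵘ-ιᶻ b)) (ℚᵘ.*≤* (ℤₚ.*-monoʳ-≤-nonNeg (+ 1) a≤b))))

ιᶻ-cancel : ∀ {a b} → ιᶻ a ≤ ιᶻ b → a ℤ.≤ b
ιᶻ-cancel {a} {b} h with ℚᵘₚ.≤-respˡ-≃ (toℚᵘ-ιᶻ a) (ℚᵘₚ.≤-respʳ-≃ (toℚᵘ-ιᶻ b) (ℚₚ.toℚᵘ-mono-≤ h))
... | ℚᵘ.*≤* p = subst₂ ℤ._≤_ (ℤₚ.*-identityʳ a) (ℤₚ.*-identityʳ b) p

ι-+ : ∀ a b → ι (a +ₙ b) ≡ ι a + ι b
ι-+ a b = trans (cong ιᶻ (ℤₚ.pos-+ a b)) (ιᶻ-+ (+ a) (+ b))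

ι-* : ∀ a b → ι (a *ₙ b) ≡ ι a * ι b
ι-* a b = trans (cong ιᶻ (ℤₚ.pos-* a b)) (ιᶻ-* (+ a) (+ b))

ι-mono : ∀ {a b} → a ≤ₙ b → ι a ≤ ι b
ι-mono = ιᶻ-mono ∘ ℤ.+≤+

ι-cancel : ∀ {a b} → ι a ≤ ι b → a ≤ₙ b
ι-cancel {a} {b} h with ιᶻ-cancel {+ a} {+ b} h
... | ℤ.+≤+ p = p

0≤ι : ∀ n → 0ℚ ≤ ι n
0≤ι n = ι-mono {0} {n} z≤n

*-mono-nonNeg : ∀ {a b c d} → 0ℚ ≤ c → a ≤ b → c ≤ d → 0ℚ ≤ b → a * c ≤ b * d
*-mono-nonNeg {a} {b} {c} {d} 0≤c a≤b c≤d 0≤b =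
  ℚₚ.≤-trans (ℚₚ.*-monoʳ-≤-nonNeg c {{ℚ.nonNegative 0≤c}} a≤b) (ℚₚ.*-monoˡ-≤-nonNeg b {{ℚ.nonNegative 0≤b}} c≤d)

*-nonNeg : ∀ {a b} → 0ℚ ≤ a → 0ℚ ≤ b → 0ℚ ≤ a * b
*-nonNeg {a} {b} 0≤a 0≤b = subst (_≤ a * b) (ℚₚ.*-zeroʳ a) (ℚₚ.*-monoˡ-≤-nonNeg a {{ℚ.nonNegative 0≤a}} 0≤b)

private
  module Identities where
    open import Data.Rational.Solver
    open +-*-Solver using (solve; _:+_; _:*_; _:-_; :-_; _:=_)

    left-comm* : ∀ a b c → a * (b * c) ≡ b * (a * c)
    left-comm* = solve 3 (λ a b c → a :* (b :* c) := b :* (a :* c)) refl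
    mul-term : ∀ c m d n r → c * (d * (m * n)) + c * m * r ≡ c * m * (d * n + r)
    mul-term = solve 5 (λ c m d n r → c :* (d :* (m :* n)) :+ c :* m :* r := c :* m :* (d :* n :+ r)) refl
    collect : ∀ c d m r → (c + d) * m + r ≡ c * m + (d * m + r)
    collect = solve 4 (λ c d m r → (c :+ d) :* m :+ r := c :* m :+ (d :* m :+ r)) refl
    bring : ∀ a b c → a + (b + c) ≡ b + (a + c)
    bring = solve 3 (λ a b c → a :+ (b :+ c) := b :+ (a :+ c)) refl
    swap* : ∀ a b c d → (a * b) * (c * d) ≡ (a * c) * (b * d)
    swap* = solve 4 (λ a b c d → (a :* b) :* (c :* d) := (a :* c) :* (b :* d)) refl
    dist- : ∀ a b → (- a) * b ≡ - (a * b)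
    dist- = solve 2 (λ a b → (:- a) :* b := :- (a :* b)) refl
    cancel-sub : ∀ a b → (b - a) + a ≡ b
    cancel-sub = solve 2 (λ a b → (b :- a) :+ a := b) refl

-- Reflected inequalities and their polynomial normal forms

infixl 7 _:*_
infixl 6 _:+_ _:-_
infix 4 _⊑_ _⊏_ _≐_ _⊑ₙ_ _⊏ₙ_ _≐ₙ_

data NExp : Set where
  ν # : ℕ → NExp
  _:+_ _:*_ : NExp → NExp → NExp

data QExp : Set where
  χ ν # : ℕ → QExp
  ⌜_⌝ : NExp → QExp
  _:+_ _:-_ _:*_ : QExp → QExp → QExp
  :-_ : QExp → QExp

data Rel : Set where
  _⊑_ _⊏_ _≐_ : QExp → QExp → Rel
  _⊑ₙ_ _⊏ₙ_ _≐ₙ_ : NExp → NExp → Rel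

-- Natural and rational variables are kept apart: a product of natural variables is nonnegative, so
-- the sign of a term can be read off when its second list is empty.
Mono : Set
Mono = List ℕ × List ℕ

Poly : Set
Poly = List (ℤ × Mono)

nth : ∀ {A : Set} → A → List A → ℕ → A
nth d [] _ = d
nth d (x ∷ xs) zero = x
nth d (x ∷ xs) (suc i) = nth d xs i

insert : ℕ → List ℕ → List ℕ
insert x [] = x ∷ []
insert x (y ∷ ys) = if x ℕ.≤ᵇ y then x ∷ y ∷ ys else y ∷ insert x ys

merge : List ℕ → List ℕ → List ℕ
merge [] ys = ys
merge (x ∷ xs) ys = insert x (merge xs ys)

eqList : List ℕ → List ℕ → Bool
eqList [] [] = true
eqList (x ∷ xs) (y ∷ ys) = (x ℕ.≡ᵇ y) ∧ eqList xs ys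
eqList _ _ = false

addTerm : ℤ → Mono → Poly → Poly
addTerm c m [] = (c , m) ∷ []
addTerm c m ((d , m′) ∷ p) =
  if eqList (proj₁ m) (proj₁ m′) ∧ eqList (proj₂ m) (proj₂ m′)
  then (c ℤ.+ d , m′) ∷ p else (d , m′) ∷ addTerm c m p

_⊞_ : Poly → Poly → Poly
[] ⊞ q = q
((c , m) ∷ p) ⊞ q = addTerm c m (p ⊞ q)

mulTerm : ℤ → Mono → Poly → Poly
mulTerm c m [] = []
mulTerm c m ((d , m′) ∷ p) = (c ℤ.* d , merge (proj₁ m) (proj₁ m′) , merge (proj₂ m) (proj₂ m′)) ∷ mulTerm c m p

_⊠_ : Poly → Poly → Poly
[] ⊠ q = []
((c , m) ∷ p) ⊠ q = mulTerm c m q ⊞ (p ⊠ q)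

scale : ℤ → Poly → Poly
scale c = mulTerm c ([] , [])

polyₙ : NExp → Poly
polyₙ (ν i) = (+ 1 , i ∷ [] , []) ∷ []
polyₙ (# n) = (+ n , [] , []) ∷ []
polyₙ (a :+ b) = polyₙ a ⊞ polyₙ b
polyₙ (a :* b) = polyₙ a ⊠ polyₙ b

poly : QExp → Poly
poly (χ i) = (+ 1 , [] , i ∷ []) ∷ []
poly (ν i) = polyₙ (ν i)
poly (# n) = polyₙ (# n)
poly ⌜ e ⌝ = polyₙ e
poly (a :+ b) = poly a ⊞ poly b
poly (a :- b) = poly a ⊞ scale -[1+ 0 ] (poly b)
poly (a :* b) = poly a ⊠ poly b
poly (:- a) = scale -[1+ 0 ] (poly a)

gap : Rel → QExp
gap (a ⊑ b) = b :- a
gap (a ⊏ b) = b :- a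
gap (a ≐ b) = b :- a
gap (a ⊑ₙ b) = ⌜ b ⌝ :- ⌜ a ⌝
-- A strict inequality between naturals is worth a whole unit.
gap (a ⊏ₙ b) = ⌜ b ⌝ :- ⌜ # 1 :+ a ⌝
gap (a ≐ₙ b) = ⌜ b ⌝ :- ⌜ a ⌝

-- Cancelled terms stay in a `Poly` with coefficient 0, whatever their monomial; the first clause
-- lets them pass.
nonNegTerm : ℤ × Mono → Bool
nonNegTerm (+ 0 , _) = true
nonNegTerm (+ _ , _ , []) = true
nonNegTerm _ = false

nonNegPoly : Poly → Bool
nonNegPoly [] = true
nonNegPoly (t ∷ p) = nonNegTerm t ∧ nonNegPoly p

hasPosConstant : Poly → Bool
hasPosConstant [] = false
hasPosConstant ((+ suc _ , [] , []) ∷ p) = true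
hasPosConstant (_ ∷ p) = hasPosConstant p

posPoly : Poly → Bool
posPoly p = nonNegPoly p ∧ hasPosConstant p

zeroPoly : Poly → Bool
zeroPoly [] = true
zeroPoly ((+ 0 , _) ∷ p) = zeroPoly p
zeroPoly _ = false

module Linear (ns : List ℕ) (qs : List ℚ) where

  evₙ : NExp → ℕ
  evₙ (ν i) = nth 0 ns i
  evₙ (# n) = n
  evₙ (a :+ b) = evₙ a +ₙ evₙ b
  evₙ (a :* b) = evₙ a *ₙ evₙ b

  ev : QExp → ℚ
  ev (χ i) = nth 0ℚ qs i
  ev (ν i) = ι (nth 0 ns i)
  ev (# n) = ι n
  ev ⌜ e ⌝ = ι (evₙ e)
  ev (a :+ b) = ev a + ev b
  ev (a :- b) = ev a - ev b
  ev (a :* b) = ev a * ev b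
  ev (:- a) = - ev a

  ⟦_⟧ : Rel → Set
  ⟦ a ⊑ b ⟧ = ev a ≤ ev b
  ⟦ a ⊏ b ⟧ = ev a < ev b
  ⟦ a ≐ b ⟧ = ev a ≡ ev b
  ⟦ a ⊑ₙ b ⟧ = evₙ a ≤ₙ evₙ b
  ⟦ a ⊏ₙ b ⟧ = evₙ a <ₙ evₙ b
  ⟦ a ≐ₙ b ⟧ = evₙ a ≡ evₙ b

  prodₙ prodq : List ℕ → ℚ
  prodₙ [] = ι 1
  prodₙ (i ∷ is) = ι (nth 0 ns i) * prodₙ is
  prodq [] = ι 1
  prodq (i ∷ is) = nth 0ℚ qs i * prodq is

  evM : Mono → ℚ
  evM (a , b) = prodₙ a * prodq b

  evP : Poly → ℚ
  evP [] = 0ℚ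
  evP ((c , m) ∷ p) = ιᶻ c * evM m + evP p

  private
    module _ (f : List ℕ → ℚ) (g : ℕ → ℚ) (f-∷ : ∀ i is → f (i ∷ is) ≡ g i * f is) where
      insert-ok : ∀ x is → f (insert x is) ≡ g x * f is
      insert-ok x [] = f-∷ x []
      insert-ok x (y ∷ is) with x ℕ.≤ᵇ y
      ... | true = f-∷ x (y ∷ is)
      ... | false = trans (f-∷ y _) (trans (cong (g y *_) (insert-ok x is))
              (trans (Identities.left-comm* (g y) (g x) (f is)) (cong (g x *_) (sym (f-∷ y is)))))

      merge-ok : f [] ≡ ι 1 → ∀ xs is → f (merge xs is) ≡ f xs * f is
      merge-ok e [] is = sym (trans (cong (_* f is) e) (ℚₚ.*-identityˡ (f is)))
      merge-ok e (x ∷ xs) is = trans (insert-ok x (merge xs is)) (trans (cong (g x *_) (merge-ok e xs is))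
        (trans (sym (ℚₚ.*-assoc (g x) (f xs) (f is))) (cong (_* f is) (sym (f-∷ x xs)))))

    eqList-ok : ∀ xs ys → IsTrue (eqList xs ys) → xs ≡ ys
    eqList-ok [] [] _ = refl
    eqList-ok (x ∷ xs) (y ∷ ys) t with x ℕ.≡ᵇ y in e
    ... | true = cong₂ _∷_ (ℕₚ.≡ᵇ⇒≡ x y (subst IsTrue (sym e) tt)) (eqList-ok xs ys t)

    addTerm-ok : ∀ c m p → evP (addTerm c m p) ≡ ιᶻ c * evM m + evP p
    addTerm-ok c m [] = refl
    addTerm-ok c m ((d , m′) ∷ p) with eqList (proj₁ m) (proj₁ m′) in e₁ | eqList (proj₂ m) (proj₂ m′) in e₂
    ... | true | true rewrite eqList-ok (proj₁ m) (proj₁ m′) (subst IsTrue (sym e₁) tt)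
                            | eqList-ok (proj₂ m) (proj₂ m′) (subst IsTrue (sym e₂) tt)
                            | ιᶻ-+ c d = Identities.collect (ιᶻ c) (ιᶻ d) (evM m′) (evP p)
    ... | true | false = trans (cong (ℚ._+_ (ιᶻ d * evM m′)) (addTerm-ok c m p)) (Identities.bring (ιᶻ d * evM m′) (ιᶻ c * evM m) (evP p))
    ... | false | true = trans (cong (ℚ._+_ (ιᶻ d * evM m′)) (addTerm-ok c m p)) (Identities.bring (ιᶻ d * evM m′) (ιᶻ c * evM m) (evP p))
    ... | false | false = trans (cong (ℚ._+_ (ιᶻ d * evM m′)) (addTerm-ok c m p)) (Identities.bring (ιᶻ d * evM m′) (ιᶻ c * evM m) (evP p))

    ⊞-ok : ∀ p q → evP (p ⊞ q) ≡ evP p + evP q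
    ⊞-ok [] q = sym (ℚₚ.+-identityˡ (evP q))
    ⊞-ok ((c , m) ∷ p) q = trans (addTerm-ok c m (p ⊞ q)) (trans (cong (ℚ._+_ (ιᶻ c * evM m)) (⊞-ok p q))
      (sym (ℚₚ.+-assoc (ιᶻ c * evM m) (evP p) (evP q))))

    mulTerm-ok : ∀ c m p → evP (mulTerm c m p) ≡ ιᶻ c * evM m * evP p
    mulTerm-ok c m [] = sym (ℚₚ.*-zeroʳ (ιᶻ c * evM m))
    mulTerm-ok c m@(a , b) ((d , a′ , b′) ∷ p) = trans
      (cong₂ _+_
        (trans (cong₂ _*_ (ιᶻ-* c d) (trans
            (cong₂ _*_ (merge-ok prodₙ (λ i → ι (nth 0 ns i)) (λ _ _ → refl) refl a a′)
                       (merge-ok prodq (nth 0ℚ qs) (λ _ _ → refl) refl b b′))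
            (Identities.swap* (prodₙ a) (prodₙ a′) (prodq b) (prodq b′))))
          (ℚₚ.*-assoc (ιᶻ c) (ιᶻ d) (evM m * evM (a′ , b′))))
        (mulTerm-ok c m p))
      (Identities.mul-term (ιᶻ c) (evM m) (ιᶻ d) (evM (a′ , b′)) (evP p))

    ⊠-ok : ∀ p q → evP (p ⊠ q) ≡ evP p * evP q
    ⊠-ok [] q = sym (ℚₚ.*-zeroˡ (evP q))
    ⊠-ok ((c , m) ∷ p) q = trans (⊞-ok (mulTerm c m q) (p ⊠ q)) (trans (cong₂ _+_ (mulTerm-ok c m q) (⊠-ok p q))
      (sym (ℚₚ.*-distribʳ-+ (evP q) (ιᶻ c * evM m) (evP p))))

    scale-ok : ∀ c p → evP (scale c p) ≡ ιᶻ c * evP p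
    scale-ok c p = trans (mulTerm-ok c ([] , []) p) (cong (_* evP p) (ℚₚ.*-identityʳ (ιᶻ c)))

    neg-ok : ∀ p → evP (scale -[1+ 0 ] p) ≡ - evP p
    neg-ok p = trans (scale-ok -[1+ 0 ] p) (trans (Identities.dist- (ι 1) (evP p)) (cong -_ (ℚₚ.*-identityˡ (evP p))))

    atom-ok : ∀ x → ι 1 * x + 0ℚ ≡ x
    atom-ok x = trans (ℚₚ.+-identityʳ _) (ℚₚ.*-identityˡ x)

    polyₙ-ok : ∀ e → evP (polyₙ e) ≡ ι (evₙ e)
    polyₙ-ok (ν i) = trans (atom-ok _) (trans (ℚₚ.*-identityʳ _) (ℚₚ.*-identityʳ _))
    polyₙ-ok (# n) = trans (ℚₚ.+-identityʳ _) (ℚₚ.*-identityʳ _)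
    polyₙ-ok (a :+ b) = trans (⊞-ok (polyₙ a) (polyₙ b)) (trans (cong₂ _+_ (polyₙ-ok a) (polyₙ-ok b)) (sym (ι-+ (evₙ a) (evₙ b))))
    polyₙ-ok (a :* b) = trans (⊠-ok (polyₙ a) (polyₙ b)) (trans (cong₂ _*_ (polyₙ-ok a) (polyₙ-ok b)) (sym (ι-* (evₙ a) (evₙ b))))

    poly-ok : ∀ e → evP (poly e) ≡ ev e
    poly-ok (χ i) = trans (atom-ok _) (trans (ℚₚ.*-identityˡ _) (ℚₚ.*-identityʳ _))
    poly-ok (ν i) = polyₙ-ok (ν i)
    poly-ok (# n) = polyₙ-ok (# n)
    poly-ok ⌜ e ⌝ = polyₙ-ok e
    poly-ok (a :+ b) = trans (⊞-ok (poly a) (poly b)) (cong₂ _+_ (poly-ok a) (poly-ok b))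
    poly-ok (a :- b) = trans (⊞-ok (poly a) _) (cong₂ _+_ (poly-ok a) (trans (neg-ok (poly b)) (cong -_ (poly-ok b))))
    poly-ok (a :* b) = trans (⊠-ok (poly a) (poly b)) (cong₂ _*_ (poly-ok a) (poly-ok b))
    poly-ok (:- a) = trans (neg-ok (poly a)) (cong -_ (poly-ok a))

    0≤d⇒ : ∀ {a b} → a ≤ b → 0ℚ ≤ b - a
    0≤d⇒ {a} {b} h = subst (_≤ b - a) (ℚₚ.+-inverseʳ a) (ℚₚ.+-monoˡ-≤ (- a) h)

    cancel-sub : ∀ a b → (b - a) + a ≡ b
    cancel-sub = Identities.cancel-sub

    ⇒0≤d : ∀ {a b} → 0ℚ ≤ b - a → a ≤ b
    ⇒0≤d {a} {b} h = subst₂ _≤_ (ℚₚ.+-identityˡ a) (cancel-sub a b) (ℚₚ.+-monoˡ-≤ a h)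

    0<d⇒ : ∀ {a b} → a < b → 0ℚ < b - a
    0<d⇒ {a} {b} h = subst (_< b - a) (ℚₚ.+-inverseʳ a) (ℚₚ.+-monoˡ-< (- a) h)

    ⇒0<d : ∀ {a b} → 0ℚ < b - a → a < b
    ⇒0<d {a} {b} h = subst₂ _<_ (ℚₚ.+-identityˡ a) (cancel-sub a b) (ℚₚ.+-monoˡ-< a h)

    prodₙ-nonNeg : ∀ is → 0ℚ ≤ prodₙ is
    prodₙ-nonNeg [] = 0≤ι 1
    prodₙ-nonNeg (i ∷ is) = *-nonNeg (0≤ι (nth 0 ns i)) (prodₙ-nonNeg is)

    nonNegTerm-ok : ∀ t → IsTrue (nonNegTerm t) → 0ℚ ≤ ιᶻ (proj₁ t) * evM (proj₂ t)
    nonNegTerm-ok (+ 0 , m) _ = ℚₚ.≤-reflexive (sym (ℚₚ.*-zeroˡ (evM m)))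
    nonNegTerm-ok (+ suc n , is , []) _ = *-nonNeg (0≤ι (suc n)) (*-nonNeg (prodₙ-nonNeg is) (0≤ι 1))

    zeroPoly-ok : ∀ p → IsTrue (zeroPoly p) → evP p ≡ 0ℚ
    zeroPoly-ok [] _ = refl
    zeroPoly-ok ((+ 0 , m) ∷ p) t = cong₂ _+_ (ℚₚ.*-zeroˡ (evM m)) (zeroPoly-ok p t)

    nonNegPoly-ok : ∀ p → IsTrue (nonNegPoly p) → 0ℚ ≤ evP p
    nonNegPoly-ok [] _ = ℚₚ.≤-refl
    nonNegPoly-ok (t ∷ p) h with nonNegTerm t in e
    ... | true = ℚₚ.+-mono-≤ (nonNegTerm-ok t (subst IsTrue (sym e) tt)) (nonNegPoly-ok p h)

  private
    0<ι : ∀ k → 0ℚ < ι (suc k)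
    0<ι k = ℚₚ.≰⇒> λ h → ℕₚ.<⇒≱ (ℕ.s≤s z≤n) (ι-cancel {suc k} {0} h)

    hasPosConstant-ok : ∀ p → IsTrue (nonNegPoly p) → IsTrue (hasPosConstant p) → 0ℚ < evP p
    hasPosConstant-ok ((+ suc n , [] , []) ∷ p) h _ =
      ℚₚ.+-mono-<-≤ (subst (0ℚ <_) (sym (ℚₚ.*-identityʳ _)) (0<ι n)) (nonNegPoly-ok p h)
    hasPosConstant-ok (t@(+ 0 , _) ∷ p) h c = ℚₚ.+-mono-≤-< (nonNegTerm-ok t tt) (hasPosConstant-ok p h c)
    hasPosConstant-ok (t@(+ suc _ , _ ∷ _ , []) ∷ p) h c = ℚₚ.+-mono-≤-< (nonNegTerm-ok t tt) (hasPosConstant-ok p h c)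

    posPoly-ok : ∀ p → IsTrue (posPoly p) → 0ℚ < evP p
    posPoly-ok p t with nonNegPoly p in e
    ... | true = hasPosConstant-ok p (subst IsTrue (sym e) tt) t

  infix 6 _✕_∶_
  data Fact : Set where
    _✕_∶_ : (k : ℕ) (P : Rel) → ⟦ P ⟧ → Fact

  sumOf : List Fact → Poly
  sumOf [] = []
  sumOf (k ✕ P ∶ _ ∷ fs) = scale (+ k) (poly (gap P)) ⊞ sumOf fs

  -- Only strictness over ℚ has to be tracked: over ℕ it is already in `gap` as a unit. A multiplier
  -- 0 contributes nothing.
  isStrict : ℕ → Rel → Bool
  isStrict (suc _) (_ ⊏ _) = true
  isStrict _ _ = false

  strict : List Fact → Bool
  strict [] = false
  strict (k ✕ P ∶ _ ∷ fs) = isStrict k P ∨ strict fs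

  equation : Rel → Bool
  equation (_ ≐ _) = true
  equation (_ ≐ₙ _) = true
  equation _ = false

  equations : List Fact → Bool
  equations [] = true
  equations (_ ✕ P ∶ _ ∷ fs) = equation P ∧ equations fs

  private
    gap-zero : ∀ P → ⟦ P ⟧ → IsTrue (equation P) → ev (gap P) ≡ 0ℚ
    gap-zero (a ≐ b) h _ = trans (cong (λ t → ev b - t) h) (ℚₚ.+-inverseʳ (ev b))
    gap-zero (a ≐ₙ b) h _ = trans (cong (λ t → ι (evₙ b) - ι t) h) (ℚₚ.+-inverseʳ (ι (evₙ b)))

    gap-nonNeg : ∀ P → ⟦ P ⟧ → 0ℚ ≤ ev (gap P)
    gap-nonNeg (a ⊑ b) h = 0≤d⇒ h
    gap-nonNeg (a ⊏ b) h = 0≤d⇒ (ℚₚ.<⇒≤ h)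
    gap-nonNeg (a ≐ b) h = 0≤d⇒ (ℚₚ.≤-reflexive h)
    gap-nonNeg (a ⊑ₙ b) h = 0≤d⇒ (ι-mono h)
    gap-nonNeg (a ⊏ₙ b) h = 0≤d⇒ (ι-mono h)
    gap-nonNeg (a ≐ₙ b) h = 0≤d⇒ (ℚₚ.≤-reflexive (cong ι h))

    sum-∷ : ∀ k P fs → evP (scale (+ k) (poly (gap P)) ⊞ sumOf fs) ≡ ι k * ev (gap P) + evP (sumOf fs)
    sum-∷ k P fs = trans (⊞-ok (scale (+ k) (poly (gap P))) (sumOf fs))
      (cong (ℚ._+ evP (sumOf fs)) (trans (scale-ok (+ k) (poly (gap P))) (cong (ι k *_) (poly-ok (gap P)))))

    sum-nonNeg : ∀ fs → 0ℚ ≤ evP (sumOf fs)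
    sum-nonNeg [] = ℚₚ.≤-refl
    sum-nonNeg (k ✕ P ∶ h ∷ fs) = subst (0ℚ ≤_) (sym (sum-∷ k P fs))
      (ℚₚ.+-mono-≤ (*-nonNeg (0≤ι k) (gap-nonNeg P h)) (sum-nonNeg fs))

    sum-zero : ∀ fs → IsTrue (equations fs) → evP (sumOf fs) ≡ 0ℚ
    sum-zero [] _ = refl
    sum-zero (k ✕ P ∶ h ∷ fs) t with equation P in e
    ... | true = trans (sum-∷ k P fs) (cong₂ _+_
      (trans (cong (ι k *_) (gap-zero P h (subst IsTrue (sym e) tt))) (ℚₚ.*-zeroʳ (ι k))) (sum-zero fs t))

    *-pos : ∀ {a b} → 0ℚ < a → 0ℚ < b → 0ℚ < a * b
    *-pos {a} {b} 0<a 0<b = subst (_< a * b) (ℚₚ.*-zeroʳ a) (ℚₚ.*-monoʳ-<-pos a {{ℚ.positive 0<a}} 0<b)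

    term-pos : ∀ k P → ⟦ P ⟧ → IsTrue (isStrict k P) → 0ℚ < ι k * ev (gap P)
    term-pos (suc k) (a ⊏ b) h _ = *-pos (0<ι k) (0<d⇒ h)

    sum-pos : ∀ fs → IsTrue (strict fs) → 0ℚ < evP (sumOf fs)
    sum-pos (k ✕ P ∶ h ∷ fs) t with isStrict k P in e
    ... | true = subst (0ℚ <_) (sym (sum-∷ k P fs)) (ℚₚ.+-mono-<-≤ (term-pos k P h (subst IsTrue (sym e) tt)) (sum-nonNeg fs))
    ... | false = subst (0ℚ <_) (sym (sum-∷ k P fs)) (ℚₚ.+-mono-≤-< (*-nonNeg (0≤ι k) (gap-nonNeg P h)) (sum-pos fs t))

  -- Farkas certificates, with the monomials as unknowns: 1 + k times the gap of the goal is the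
  -- combination of the gaps of fs plus a remainder whose sign is visible from its coefficients.
  remainder : ℕ → List Fact → QExp → Poly
  remainder k fs e = scale (+ suc k) (poly e) ⊞ scale -[1+ 0 ] (sumOf fs)

  private
    remainder-ev : ∀ k fs e → evP (remainder k fs e) ≡ ι (suc k) * ev e - evP (sumOf fs)
    remainder-ev k fs e = trans (⊞-ok (scale (+ suc k) (poly e)) (scale -[1+ 0 ] (sumOf fs)))
      (cong₂ _+_ (trans (scale-ok (+ suc k) (poly e)) (cong (ι (suc k) *_) (poly-ok e))) (neg-ok (sumOf fs)))

    remainder-ok : ∀ k fs e → IsTrue (nonNegPoly (remainder k fs e)) → evP (sumOf fs) ≤ ι (suc k) * ev e
    remainder-ok k fs e t = ⇒0≤d (subst (0ℚ ≤_) (remainder-ev k fs e) (nonNegPoly-ok (remainder k fs e) t))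

    0≤k*⇒ : ∀ k {x} → 0ℚ ≤ ι (suc k) * x → 0ℚ ≤ x
    0≤k*⇒ k {x} h = ℚₚ.*-cancelˡ-≤-pos (ι (suc k)) {{ℚ.positive (0<ι k)}} (subst (_≤ ι (suc k) * x) (sym (ℚₚ.*-zeroʳ (ι (suc k)))) h)

    0<k*⇒ : ∀ k {x} → 0ℚ < ι (suc k) * x → 0ℚ < x
    0<k*⇒ k {x} h = ℚₚ.*-cancelˡ-<-nonNeg (ι (suc k)) {{ℚ.nonNegative (ℚₚ.<⇒≤ (0<ι k))}} (subst (_< ι (suc k) * x) (sym (ℚₚ.*-zeroʳ (ι (suc k)))) h)

    k*≡0⇒ : ∀ k {x} → ι (suc k) * x ≡ 0ℚ → x ≡ 0ℚ
    k*≡0⇒ k {x} h = ℚₚ.≤-antisym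
      (ℚₚ.*-cancelˡ-≤-pos (ι (suc k)) {{ℚ.positive (0<ι k)}} (ℚₚ.≤-reflexive (trans h (sym (ℚₚ.*-zeroʳ (ι (suc k)))))))
      (0≤k*⇒ k (ℚₚ.≤-reflexive (sym h)))

  exceeds : ℕ → List Fact → QExp → QExp → Bool
  exceeds k fs x y = posPoly (remainder k fs (y :- x)) ∨ (strict fs ∧ nonNegPoly (remainder k fs (y :- x)))

  -- An integral gap only has to exceed −1.
  check : ℕ → List Fact → Rel → Bool
  check k fs P@(_ ⊑ _) = nonNegPoly (remainder k fs (gap P))
  check k fs (a ⊏ b) = exceeds k fs a b
  check k fs (a ⊑ₙ b) = exceeds k fs ⌜ a ⌝ ⌜ b :+ # 1 ⌝
  check k fs (a ⊏ₙ b) = exceeds k fs ⌜ a ⌝ ⌜ b ⌝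
  check k fs P@(_ ≐ _) = equations fs ∧ zeroPoly (remainder k fs (gap P))
  check k fs P@(_ ≐ₙ _) = equations fs ∧ zeroPoly (remainder k fs (gap P))

  private
    positive : ∀ k fs x y → IsTrue (exceeds k fs x y) → ev x < ev y
    positive k fs x y t with posPoly (remainder k fs (y :- x)) in p
    ... | true = ⇒0<d (0<k*⇒ k (ℚₚ.≤-<-trans (sum-nonNeg fs)
      (⇒0<d (subst (0ℚ <_) (remainder-ev k fs (y :- x)) (posPoly-ok (remainder k fs (y :- x)) (subst IsTrue (sym p) tt))))))
    ... | false with strict fs in s
    ...   | true = ⇒0<d (0<k*⇒ k (ℚₚ.<-≤-trans (sum-pos fs (subst IsTrue (sym s) tt)) (remainder-ok k fs (y :- x) t)))

    equal : ∀ k fs x y → IsTrue (equations fs ∧ zeroPoly (remainder k fs (y :- x))) → ev x ≡ ev y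
    equal k fs x y t with equations fs in s
    ... | true = trans (sym (ℚₚ.+-identityˡ (ev x))) (trans (cong (ℚ._+ ev x) (sym (k*≡0⇒ k
      (trans (sym (ℚₚ.+-identityʳ _)) (trans (cong (λ r → ι (suc k) * ev (y :- x) - r) (sym (sum-zero fs (subst IsTrue (sym s) tt))))
        (trans (sym (remainder-ev k fs (y :- x))) (zeroPoly-ok (remainder k fs (y :- x)) t)))))))
      (Identities.cancel-sub (ev x) (ev y)))

    ι-cancel-< : ∀ {m n} → ι m < ι n → m <ₙ n
    ι-cancel-< {m} {n} h = ℕₚ.≰⇒> λ k → ℚₚ.<-irrefl refl (ℚₚ.<-≤-trans h (ι-mono k))

  -- `check` runs on closed syntax, so the hidden argument computes to the unit type and evaluation
  -- verifies each use. Nonlinear steps are supplied among the facts as inequalities already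
  -- multiplied out.
  certify : (k : ℕ) (fs : List Fact) (P : Rel) {_ : IsTrue (check k fs P)} → ⟦ P ⟧
  certify k fs (a ⊑ b) {t} = ⇒0≤d (0≤k*⇒ k (ℚₚ.≤-trans (sum-nonNeg fs) (remainder-ok k fs (b :- a) t)))
  certify k fs (a ⊏ b) {t} = positive k fs a b t
  certify k fs (a ⊑ₙ b) {t} = ℕₚ.m<1+n⇒m≤n (subst (evₙ a <ₙ_) (ℕₚ.+-comm (evₙ b) 1)
    (ι-cancel-< {evₙ a} {evₙ (b :+ # 1)} (positive k fs ⌜ a ⌝ ⌜ b :+ # 1 ⌝ t)))
  certify k fs (a ⊏ₙ b) {t} = ι-cancel-< {evₙ a} {evₙ b} (positive k fs ⌜ a ⌝ ⌜ b ⌝ t)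
  certify k fs (a ≐ b) {t} = equal k fs a b t
  certify k fs (a ≐ₙ b) {t} = ℕₚ.≤-antisym (ι-cancel (ℚₚ.≤-reflexive eq)) (ι-cancel (ℚₚ.≤-reflexive (sym eq)))
    where eq = equal k fs ⌜ a ⌝ ⌜ b ⌝ t

open Linear public using (certify; _✕_∶_)

0<1 : 0ℚ < 1ℚ
0<1 = ℚₚ.positive⁻¹ 1ℚ

-- Sums over 1 ≤ i ≤ n

∑ : ℕ → (ℕ → ℚ) → ℚ
∑ zero f = 0ℚ
∑ (suc n) f = ∑ n f + f (suc n)

∑-mono : ∀ n {f g} → (∀ i → i <ₙ n → f (suc i) ≤ g (suc i)) → ∑ n f ≤ ∑ n g
∑-mono zero h = ℚₚ.≤-refl
∑-mono (suc n) h = ℚₚ.+-mono-≤ (∑-mono n λ i i<n → h i (ℕₚ.m<n⇒m<1+n i<n)) (h n ℕₚ.≤-refl)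

∑-cong : ∀ n {f g} → (∀ i → i <ₙ n → f (suc i) ≡ g (suc i)) → ∑ n f ≡ ∑ n g
∑-cong zero h = refl
∑-cong (suc n) h = cong₂ _+_ (∑-cong n λ i i<n → h i (ℕₚ.m<n⇒m<1+n i<n)) (h n ℕₚ.≤-refl)

∑-+ : ∀ n f g → ∑ n (λ i → f i + g i) ≡ ∑ n f + ∑ n g
∑-+ zero f g = refl
∑-+ (suc n) f g = trans (cong (ℚ._+ (f (suc n) + g (suc n))) (∑-+ n f g))
  (certify [] (∑ n f ∷ ∑ n g ∷ f (suc n) ∷ g (suc n) ∷ []) 0 [] (χ 0 :+ χ 1 :+ (χ 2 :+ χ 3) ≐ χ 0 :+ χ 2 :+ (χ 1 :+ χ
      3)))

∑-- : ∀ n f g → ∑ n (λ i → f i - g i) ≡ ∑ n f - ∑ n g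
∑-- zero f g = refl
∑-- (suc n) f g = trans (cong (ℚ._+ (f (suc n) - g (suc n))) (∑-- n f g))
  (certify [] (∑ n f ∷ ∑ n g ∷ f (suc n) ∷ g (suc n) ∷ []) 0 [] (χ 0 :- χ 1 :+ (χ 2 :- χ 3) ≐ χ 0 :+ χ 2 :- (χ 1 :+ χ
      3)))

∑-*ˡ : ∀ n c f → ∑ n (λ i → c * f i) ≡ c * ∑ n f
∑-*ˡ zero c f = sym (ℚₚ.*-zeroʳ c)
∑-*ˡ (suc n) c f = trans (cong (ℚ._+ (c * f (suc n))) (∑-*ˡ n c f)) (sym (ℚₚ.*-distribˡ-+ c (∑ n f) (f (suc n))))

∑-*ʳ : ∀ n c f → ∑ n (λ i → f i * c) ≡ ∑ n f * c
∑-*ʳ n c f = trans (∑-cong n λ i _ → ℚₚ.*-comm (f (suc i)) c) (trans (∑-*ˡ n c f) (ℚₚ.*-comm c (∑ n f)))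

∑-const : ∀ n c → ∑ n (λ _ → c) ≡ ι n * c
∑-const zero c = sym (ℚₚ.*-zeroˡ c)
∑-const (suc n) c = trans (cong (ℚ._+ c) (∑-const n c)) (certify (n ∷ []) (c ∷ []) 0 [] (ν 0 :* χ 0 :+ χ 0 ≐ ⌜ # 1 :+
    ν 0 ⌝ :* χ 0))

∑-zero : ∀ n {f} → (∀ i → i <ₙ n → f (suc i) ≡ 0ℚ) → ∑ n f ≡ 0ℚ
∑-zero n h = trans (∑-cong n h) (trans (∑-const n 0ℚ) (ℚₚ.*-zeroʳ (ι n)))

∑-nonNeg : ∀ n {f} → (∀ i → i <ₙ n → 0ℚ ≤ f (suc i)) → 0ℚ ≤ ∑ n f
∑-nonNeg n {f} h = subst (_≤ ∑ n f) (∑-zero n {λ _ → 0ℚ} λ _ _ → refl) (∑-mono n h)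

∑-swap : ∀ m n (f : ℕ → ℕ → ℚ) → ∑ m (λ i → ∑ n (f i)) ≡ ∑ n (λ j → ∑ m (λ i → f i j))
∑-swap zero n f = sym (∑-zero n λ _ _ → refl)
∑-swap (suc m) n f = trans (cong (ℚ._+ ∑ n (f (suc m))) (∑-swap m n f)) (sym (∑-+ n (λ j → ∑ m (λ i → f i j)) (f (suc m))))

∣∑∣≤ : ∀ n f → ∣ ∑ n f ∣ ≤ ∑ n (λ i → ∣ f i ∣)
∣∑∣≤ zero f = ℚₚ.≤-refl
∣∑∣≤ (suc n) f = ℚₚ.≤-trans (ℚₚ.∣p+q∣≤∣p∣+∣q∣ (∑ n f) (f (suc n))) (ℚₚ.+-monoˡ-≤ ∣ f (suc n) ∣ (∣∑∣≤ n f))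

∑-upTo-mono : ∀ {m n} f → (∀ i → 0ℚ ≤ f i) → m ≤ₙ n → ∑ m f ≤ ∑ n f
∑-upTo-mono {m} {n} f h m≤n with ℕₚ.m≤n⇒m<n∨m≡n m≤n
... | inj₂ refl = ℚₚ.≤-refl
∑-upTo-mono {m} {suc n} f h m≤n | inj₁ (s≤s m≤n′) =
  (certify [] (∑ m f ∷ ∑ n f ∷ f (suc n) ∷ []) 0 (1 ✕ χ 0 ⊑ χ 1 ∶ ∑-upTo-mono f h m≤n′ ∷ 1 ✕ # 0 ⊑ χ 2 ∶ h (suc n) ∷
      []) (χ 0 ⊑ χ 1 :+ χ 2))

∑-extend : ∀ {m n} f → m ≤ₙ n → (∀ i → m ≤ₙ i → i <ₙ n → f (suc i) ≡ 0ℚ) → ∑ n f ≡ ∑ m f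
∑-extend {m} {n} f m≤n h with ℕₚ.m≤n⇒m<n∨m≡n m≤n
... | inj₂ refl = refl
∑-extend {m} {suc n} f m≤n h | inj₁ (s≤s m≤n′) =
  trans (cong₂ _+_ (∑-extend f m≤n′ λ i a b → h i a (ℕₚ.m<n⇒m<1+n b)) (h n m≤n′ ℕₚ.≤-refl)) (ℚₚ.+-identityʳ (∑ m f))

∑-between : ∀ m n f g → m ≤ₙ n → (∀ i → m ≤ₙ i → i <ₙ n → f (suc i) ≤ g (suc i)) → ∑ n f - ∑ m f ≤ ∑ n g - ∑ m g
∑-between m n f g m≤n h with ℕₚ.m≤n⇒m<n∨m≡n m≤n
... | inj₂ refl = certify [] (∑ m f ∷ ∑ m g ∷ []) 0 [] (χ 0 :- χ 0 ⊑ χ 1 :- χ 1)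
∑-between m (suc n) f g m≤n h | inj₁ (s≤s m≤n′) =
  (certify [] (∑ n f ∷ ∑ m f ∷ ∑ n g ∷ ∑ m g ∷ f (suc n) ∷ g (suc n) ∷ []) 0 (1 ✕ χ 0 :- χ 1 ⊑ χ 2 :- χ 3 ∶ ∑-between
      m n f g m≤n′ (λ i a b → h i a (ℕₚ.m<n⇒m<1+n b)) ∷ 1 ✕ χ 4 ⊑ χ 5 ∶ h n m≤n′ ℕₚ.≤-refl ∷ []) (χ 0 :+ χ 4 :- χ 1 ⊑
      χ 2 :+ χ 5 :- χ 3))

-- Indicators of decidable propositions

𝟙 : ∀ {P : Set} → Dec P → ℚ
𝟙 (yes _) = 1ℚ
𝟙 (no _) = 0ℚ

𝟙-yes : ∀ {P : Set} (d : Dec P) → P → 𝟙 d ≡ 1ℚ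
𝟙-yes (yes _) _ = refl
𝟙-yes (no ¬p) p = contradiction p ¬p

𝟙-no : ∀ {P : Set} (d : Dec P) → ¬ P → 𝟙 d ≡ 0ℚ
𝟙-no (yes p) ¬p = contradiction p ¬p
𝟙-no (no _) _ = refl

𝟙-nonNeg : ∀ {P : Set} (d : Dec P) → 0ℚ ≤ 𝟙 d
𝟙-nonNeg (yes _) = ℚₚ.<⇒≤ 0<1
𝟙-nonNeg (no _) = ℚₚ.≤-refl

𝟙-≤1 : ∀ {P : Set} (d : Dec P) → 𝟙 d ≤ 1ℚ
𝟙-≤1 (yes _) = ℚₚ.≤-refl
𝟙-≤1 (no _) = ℚₚ.<⇒≤ 0<1

𝟙-*-cong : ∀ {P : Set} (d : Dec P) {x y} → (P → x ≡ y) → 𝟙 d * x ≡ 𝟙 d * y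
𝟙-*-cong (yes p) h = cong (1ℚ *_) (h p)
𝟙-*-cong (no _) {x} {y} h = trans (ℚₚ.*-zeroˡ x) (sym (ℚₚ.*-zeroˡ y))

𝟙-iff : ∀ {P Q : Set} (d : Dec P) (e : Dec Q) → (P → Q) → (Q → P) → 𝟙 d ≡ 𝟙 e
𝟙-iff (yes p) e f g = sym (𝟙-yes e (f p))
𝟙-iff (no ¬p) e f g = sym (𝟙-no e (¬p ∘ g))

𝟙-elim : ∀ {P : Set} (d : Dec P) (C : ℚ → Set) → (P → C 1ℚ) → C 0ℚ → C (𝟙 d)
𝟙-elim (yes p) C f g = f p
𝟙-elim (no _) C f g = g

∑-𝟙-≤ : ∀ {m n} f → m ≤ₙ n → ∑ n (λ i → 𝟙 (i ℕ.≤? m) * f i) ≡ ∑ m f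
∑-𝟙-≤ {m} {n} f m≤n = trans
  (∑-extend (λ i → 𝟙 (i ℕ.≤? m) * f i) m≤n
    (λ i m≤i _ → trans (cong (_* f (suc i)) (𝟙-no (suc i ℕ.≤? m) (λ i<m → ℕₚ.<⇒≱ i<m m≤i))) (ℚₚ.*-zeroˡ (f (suc i)))))
  (∑-cong m λ i i<m → trans (cong (_* f (suc i)) (𝟙-yes (suc i ℕ.≤? m) i<m)) (ℚₚ.*-identityˡ (f (suc i))))

∑-single : ∀ n k f → 1 ≤ₙ k → k ≤ₙ n → (∀ i → i <ₙ n → suc i ≢ k → f (suc i) ≡ 0ℚ) → ∑ n f ≡ f k
∑-single n (suc k) f _ k≤n h = trans
  (∑-extend f k≤n λ i k<i i<n → h i i<n (λ e → ℕₚ.<-irrefl (sym e) (s≤s k<i)))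
  (trans (cong (ℚ._+ f (suc k)) (∑-zero k λ i i<k → h i (ℕₚ.<-trans i<k k≤n) (λ e → ℕₚ.<-irrefl e (s≤s i<k)))) (ℚₚ.+-identityˡ (f (suc k))))

infixl 7 _÷_
_÷_ : ℕ → ℕ → ℕ
x ÷ zero = 0
x ÷ suc a = x ℕ./ suc a

÷-lower : ∀ x a → (x ÷ a) *ₙ a ≤ₙ x
÷-lower x zero = z≤n
÷-lower x (suc a) = ℕ/.m/n*n≤m x (suc a)

÷-upper : ∀ x a → 1 ≤ₙ a → x <ₙ (x ÷ a) *ₙ a +ₙ a
÷-upper x (suc a) _ = subst (_<ₙ (x ℕ./ suc a) *ₙ suc a +ₙ suc a) (sym (trans (ℕ/.m≡m%n+[m/n]*n x (suc a)) (ℕₚ.+-comm (x ℕ.% suc a) _)))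
  (ℕₚ.+-monoʳ-< ((x ℕ./ suc a) *ₙ suc a) (ℕ/.m%n<n x (suc a)))

÷-greatest : ∀ {x a b} → 1 ≤ₙ a → b *ₙ a ≤ₙ x → b ≤ₙ x ÷ a
÷-greatest {x} {a} {b} 1≤a h = ℕₚ.m<1+n⇒m≤n (ℕₚ.*-cancelʳ-< a b (suc (x ÷ a))
  (ℕₚ.≤-<-trans h (subst (x <ₙ_) (ℕₚ.+-comm ((x ÷ a) *ₙ a) a) (÷-upper x a 1≤a))))

÷-smallest : ∀ {x a b} → b ≤ₙ x ÷ a → b *ₙ a ≤ₙ x
÷-smallest {x} {a} {b} h = ℕₚ.≤-trans (ℕₚ.*-monoˡ-≤ a h) (÷-lower x a)

÷-÷ : ∀ x a b → x ÷ a ÷ b ≡ x ÷ (a *ₙ b)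
÷-÷ x zero zero = refl
÷-÷ x zero (suc b) = ℕ/.0/n≡0 (suc b)
÷-÷ x (suc a) zero rewrite ℕₚ.*-zeroʳ a = refl
÷-÷ x (suc a) (suc b) = ℕ/.m/n/o≡m/[n*o] x (suc a) (suc b)

÷-comm : ∀ x a b → x ÷ a ÷ b ≡ x ÷ b ÷ a
÷-comm x a b = trans (÷-÷ x a b) (trans (cong (x ÷_) (ℕₚ.*-comm a b)) (sym (÷-÷ x b a)))

÷-monoˡ : ∀ {x y} a → x ≤ₙ y → x ÷ a ≤ₙ y ÷ a
÷-monoˡ zero h = z≤n
÷-monoˡ (suc a) h = ℕ/./-monoˡ-≤ (suc a) h

÷-≤ : ∀ x a → x ÷ a ≤ₙ x
÷-≤ x zero = z≤n
÷-≤ x (suc a) = ℕ/.m/n≤m x (suc a)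

÷-antimonoʳ : ∀ x {a b} → 1 ≤ₙ a → a ≤ₙ b → x ÷ b ≤ₙ x ÷ a
÷-antimonoʳ x {a} {b} 1≤a a≤b = ÷-greatest 1≤a (ℕₚ.≤-trans (ℕₚ.*-monoʳ-≤ (x ÷ b) a≤b) (÷-lower x b))

÷-small : ∀ {x a} → x <ₙ a → x ÷ a ≡ 0
÷-small {x} {suc a} h = ℕ/.m<n⇒m/n≡0 h

÷-big : ∀ {x a} → 1 ≤ₙ a → a ≤ₙ x → 1 ≤ₙ x ÷ a
÷-big {x} {a} 1≤a a≤x = ÷-greatest 1≤a (subst (_≤ₙ x) (sym (ℕₚ.*-identityˡ a)) a≤x)

-- Partial sums of Dirichlet convolutions: the region a b ≤ x, symmetric although the definition is
-- not.
∬ : ℕ → (ℕ → ℕ → ℚ) → ℚ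
∬ x F = ∑ x (λ a → ∑ (x ÷ a) (F a))

∬-cong : ∀ x {F G} → (∀ a b → F (suc a) (suc b) ≡ G (suc a) (suc b)) → ∬ x F ≡ ∬ x G
∬-cong x h = ∑-cong x λ a _ → ∑-cong (x ÷ suc a) λ b _ → h a b

∬-+ : ∀ x F G → ∬ x (λ a b → F a b + G a b) ≡ ∬ x F + ∬ x G
∬-+ x F G = trans (∑-cong x λ a _ → ∑-+ (x ÷ suc a) (F (suc a)) (G (suc a))) (∑-+ x _ _)

∬-box : ∀ x F → ∬ x F ≡ ∑ x (λ a → ∑ x (λ b → 𝟙 (b *ₙ a ℕ.≤? x) * F a b))
∬-box x F = ∑-cong x λ a _ → trans (sym (∑-𝟙-≤ (F (suc a)) (÷-≤ x (suc a))))
  (∑-cong x λ b _ → cong (_* F (suc a) (suc b)) (𝟙-iff (suc b ℕ.≤? x ÷ suc a) (suc b *ₙ suc a ℕ.≤? x) ÷-smallest (÷-greatest (s≤s z≤n))))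

∬-swap : ∀ x F → ∬ x F ≡ ∬ x (λ a b → F b a)
∬-swap x F = trans (∬-box x F) (trans (∑-swap x x (λ a b → 𝟙 (b *ₙ a ℕ.≤? x) * F a b)) (trans
  (∑-cong x λ a _ → ∑-cong x λ b _ → cong (_* F (suc b) (suc a))
    (𝟙-iff (suc a *ₙ suc b ℕ.≤? x) (suc b *ₙ suc a ℕ.≤? x)
      (subst (_≤ₙ x) (ℕₚ.*-comm (suc a) (suc b))) (subst (_≤ₙ x) (ℕₚ.*-comm (suc b) (suc a)))))
  (sym (∬-box x (λ a b → F b a)))))

private
  ÷-suc-∣ : ∀ x a → suc a ∣ suc x → suc x ÷ suc a ≡ suc (x ÷ suc a)
  ÷-suc-∣ x a (divides q e) = ℕₚ.≤-antisym
    (ℕₚ.m<1+n⇒m≤n (ℕₚ.*-cancelʳ-< (suc a) (suc x ÷ suc a) (suc (suc (x ÷ suc a)))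
      (ℕₚ.≤-<-trans (÷-lower (suc x) (suc a)) (certify (x ∷ x ÷ suc a ∷ a ∷ []) [] 0 (1 ✕ ν 0 ⊏ₙ ν 1 :* (# 1 :+ ν 2)
          :+ (# 1 :+ ν 2) ∶ ÷-upper x (suc a) (s≤s z≤n) ∷ []) (# 1 :+ ν 0 ⊏ₙ (# 1 :+ (# 1 :+ ν 1)) :* (# 1 :+ ν 2))))))
    (÷-greatest (s≤s z≤n) (subst (suc (x ÷ suc a) *ₙ suc a ≤ₙ_) (sym e) (ℕₚ.*-monoˡ-≤ (suc a)
      (ℕₚ.*-cancelʳ-< (suc a) (x ÷ suc a) q (ℕₚ.≤-<-trans (÷-lower x (suc a)) (subst (x <ₙ_) e ℕₚ.≤-refl))))))

  ÷-suc-∤ : ∀ x a → ¬ (suc a ∣ suc x) → suc x ÷ suc a ≡ x ÷ suc a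
  ÷-suc-∤ x a ∤ = ℕₚ.≤-antisym
    (÷-greatest (s≤s z≤n) (ℕₚ.m<1+n⇒m≤n (ℕₚ.≤∧≢⇒< (÷-lower (suc x) (suc a)) λ e → ∤ (divides (suc x ÷ suc a) (sym e)))))
    (÷-monoˡ (suc a) (ℕₚ.n≤1+n x))

∑-multiples : ∀ x a (g : ℕ → ℚ) → 1 ≤ₙ a → ∑ x (λ n → 𝟙 (a ∣? n) * g n) ≡ ∑ (x ÷ a) (λ b → g (a *ₙ b))
∑-multiples zero (suc a) g _ = cong (λ k → ∑ k (λ b → g (suc a *ₙ b))) (sym (ℕ/.0/n≡0 (suc a)))
∑-multiples (suc x) (suc a) g 1≤a with suc a ∣? suc x
... | yes a∣x@(divides q e) = trans (cong₂ _+_ (∑-multiples x (suc a) g 1≤a) (trans (ℚₚ.*-identityˡ (g (suc x))) (cong g x≡)))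
        (cong (λ k → ∑ k (λ b → g (suc a *ₙ b))) (sym (÷-suc-∣ x a a∣x)))
  where x≡ : suc x ≡ suc a *ₙ suc (x ÷ suc a)
        x≡ = trans e (trans (cong (_*ₙ suc a) (trans (sym (ℕ/.m*n/n≡m q (suc a))) (trans (cong (_÷ suc a) (sym e)) (÷-suc-∣ x a a∣x))))
               (ℕₚ.*-comm (suc (x ÷ suc a)) (suc a)))
... | no a∤x = trans (cong₂ _+_ (∑-multiples x (suc a) g 1≤a) (ℚₚ.*-zeroˡ (g (suc x)))) (trans (ℚₚ.+-identityʳ _)
        (cong (λ k → ∑ k (λ b → g (suc a *ₙ b))) (sym (÷-suc-∤ x a a∤x))))

∑-divisors : ∀ x (G : ℕ → ℕ → ℚ) → ∑ x (λ n → ∑ x (λ a → 𝟙 (a ∣? n) * G a n)) ≡ ∬ x (λ a b → G a (a *ₙ b))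
∑-divisors x G = trans (∑-swap x x (λ n a → 𝟙 (a ∣? n) * G a n)) (∑-cong x λ a _ → ∑-multiples x (suc a) (G (suc a)) (s≤s z≤n))

-- Valuations and von Mangoldt weights

prime⇒2≤ : ∀ {p} → Prime p → 2 ≤ₙ p
prime⇒2≤ {0} pr = contradiction pr ¬prime[0]
prime⇒2≤ {1} pr = contradiction pr ¬prime[1]
prime⇒2≤ {suc (suc p)} _ = s≤s (s≤s z≤n)

primeDivisor : ∀ n → 2 ≤ₙ n → ∃[ p ] ∃[ m ] (Prime p × n ≡ p *ₙ m)
primeDivisor n@(suc n-1) 2≤n with factorise n
... | record { factors = [] ; isFactorisation = e } = contradiction (subst (2 ≤ₙ_) e 2≤n) λ { (s≤s ()) }
... | record { factors = p ∷ ps ; isFactorisation = e ; factorsPrime = pr ∷ _ } = p , _ , pr , e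

≤-^ : ∀ {p} v → 2 ≤ₙ p → v <ₙ p ^ v
≤-^ zero _ = s≤s z≤n
≤-^ {p} (suc v) 2≤p = ℕₚ.≤-trans (certify (v ∷ p ^ v ∷ []) [] 0 (2 ✕ ν 0 ⊏ₙ ν 1 ∶ ≤-^ v 2≤p ∷ []) (# 1 :+ (# 1 :+ ν
    0) ⊑ₙ # 2 :* ν 1)) (ℕₚ.*-monoˡ-≤ (p ^ v) 2≤p)

^-∣ : ∀ p {k v} → k ≤ₙ v → p ^ k ∣ p ^ v
^-∣ p {k} {v} k≤v = divides (p ^ (v ∸ₙ k)) (trans (cong (p ^_) (sym (ℕₚ.m∸n+n≡m k≤v))) (ℕₚ.^-distribˡ-+-* p (v ∸ₙ k) k))

1≤^ : ∀ {p} k → 1 ≤ₙ p → 1 ≤ₙ p ^ k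
1≤^ zero _ = ℕₚ.≤-refl
1≤^ {p} (suc k) h = ℕₚ.*-mono-≤ h (1≤^ k h)

padic : ∀ {p} → Prime p → ∀ f n → n ≤ₙ f → 1 ≤ₙ n → ∃[ v ] ∃[ u ] (n ≡ p ^ v *ₙ u × ¬ (p ∣ u))
padic pr zero zero _ ()
padic {p} pr (suc f) n n≤f 1≤n with p ∣? n
... | no p∤n = 0 , n , sym (ℕₚ.*-identityˡ n) , p∤n
... | yes (divides zero e) = contradiction (subst (1 ≤ₙ_) e 1≤n) λ ()
... | yes (divides q@(suc q-1) e) with padic pr f q (ℕₚ.m<1+n⇒m≤n (ℕₚ.<-≤-trans q<n n≤f)) (s≤s z≤n)
  where q<n : q <ₙ n
        q<n = subst (q <ₙ_) (sym e) (ℕₚ.m<m*n q p (prime⇒2≤ pr))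
...   | v , u , e′ , p∤u = suc v , u , trans e (trans (ℕₚ.*-comm q p) (trans (cong (p *ₙ_) e′) (sym (ℕₚ.*-assoc p (p ^ v) u)))) , p∤u

^∣⇒≤ : ∀ {p} → Prime p → ∀ {u} → ¬ (p ∣ u) → ∀ v k → p ^ k ∣ p ^ v *ₙ u → k ≤ₙ v
^∣⇒≤ {p} pr {u} p∤u v k d = ℕₚ.≮⇒≥ λ v<k → p∤u (*-cancelˡ-∣ (p ^ v) {{ℕₚ.m^n≢0 p v {{prime⇒nonZero pr}}}}
  (subst (_∣ p ^ v *ₙ u) (ℕₚ.*-comm p (p ^ v)) (∣-trans (^-∣ p v<k) d)))

-- For a prime p and 1 ≤ n ≤ X this is the exponent of p in n. Counting the powers of p that divide
-- n makes it comparable with sums of `Λ` over divisors.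
count : ℕ → ℕ → ℕ → ℚ
count X p n = ∑ X (λ k → 𝟙 (p ^ k ∣? n))

count-padic : ∀ X {p} → Prime p → ∀ v u → ¬ (p ∣ u) → v ≤ₙ X → count X p (p ^ v *ₙ u) ≡ ι v
count-padic X {p} pr v u p∤u v≤X = trans
  (∑-cong X λ k _ → trans (𝟙-iff (p ^ suc k ∣? p ^ v *ₙ u) (suc k ℕ.≤? v) (^∣⇒≤ pr p∤u v (suc k)) (λ k≤v → ∣m⇒∣m*n u (^-∣ p k≤v)))
    (sym (ℚₚ.*-identityʳ (𝟙 (suc k ℕ.≤? v)))))
  (trans (∑-𝟙-≤ (λ _ → 1ℚ) v≤X) (trans (∑-const v 1ℚ) (ℚₚ.*-identityʳ (ι v))))

count-* : ∀ X {p} → Prime p → ∀ a b → 1 ≤ₙ a → 1 ≤ₙ b → a *ₙ b ≤ₙ X → count X p (a *ₙ b) ≡ count X p a + count X p b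
count-* X {p} pr a b 1≤a 1≤b ab≤X with padic pr a a ℕₚ.≤-refl 1≤a | padic pr b b ℕₚ.≤-refl 1≤b
... | v , u , refl , p∤u | w , t , refl , p∤t = trans (cong (count X p) rearrange) (trans
    (count-padic X pr (v +ₙ w) (u *ₙ t) p∤ut v+w≤X) (trans (ι-+ v w)
      (sym (cong₂ _+_ (count-padic X pr v u p∤u (ℕₚ.≤-trans (ℕₚ.m≤m+n v w) v+w≤X)) (count-padic X pr w t p∤t (ℕₚ.≤-trans (ℕₚ.m≤n+m w v) v+w≤X))))))
  where
  p∤ut : ¬ (p ∣ u *ₙ t)
  p∤ut d with euclidsLemma u t pr d
  ... | inj₁ d′ = p∤u d′
  ... | inj₂ d′ = p∤t d′
  rearrange : (p ^ v *ₙ u) *ₙ (p ^ w *ₙ t) ≡ p ^ (v +ₙ w) *ₙ (u *ₙ t)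
  rearrange = trans (certify (p ^ v ∷ u ∷ p ^ w ∷ t ∷ []) [] 0 [] (ν 0 :* ν 1 :* (ν 2 :* ν 3) ≐ₙ ν 0 :* ν 2 :* (ν 1
      :* ν 3)))
                (cong (_*ₙ (u *ₙ t)) (sym (ℕₚ.^-distribˡ-+-* p v w)))
  1≤ut : 1 ≤ₙ u *ₙ t
  1≤ut = ℕₚ.n≢0⇒n>0 λ e → p∤ut (subst (p ∣_) (sym e) (divides 0 refl))
  v+w≤X : v +ₙ w ≤ₙ X
  v+w≤X = ℕₚ.≤-trans (ℕₚ.<⇒≤ (≤-^ (v +ₙ w) (prime⇒2≤ pr))) (ℕₚ.≤-trans
    (subst (p ^ (v +ₙ w) ≤ₙ_) (sym rearrange) (subst (_≤ₙ p ^ (v +ₙ w) *ₙ (u *ₙ t)) (ℕₚ.*-identityʳ (p ^ (v +ₙ w))) (ℕₚ.*-monoʳ-≤ (p ^ (v +ₙ w)) 1≤ut)))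
    ab≤X)

count-self : ∀ X {p} → Prime p → 1 ≤ₙ X → count X p p ≡ 1ℚ
count-self X {p} pr 1≤X = trans (cong (count X p) (sym (trans (ℕₚ.*-identityʳ (p *ₙ 1)) (ℕₚ.*-identityʳ p))))
  (count-padic X pr 1 1 (λ d → contradiction (subst (2 ≤ₙ_) (∣1⇒≡1 d) (prime⇒2≤ pr)) λ { (s≤s ()) }) 1≤X)

count-∤ : ∀ X {p n} → Prime p → ¬ (p ∣ n) → count X p n ≡ 0ℚ
count-∤ X {p} {n} pr p∤n = ∑-zero X λ k _ → 𝟙-no (p ^ suc k ∣? n) λ d → p∤n (∣-trans (m∣m*n (p ^ k)) d)

-- All functions of this module agree with their arithmetic meaning on arguments up to X.
module Mangoldt (X : ℕ) (w : ℕ → ℚ) (0≤w : ∀ p → 0ℚ ≤ w p) where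

  wₚ : ℕ → ℚ
  wₚ p = 𝟙 (prime? p) * w p

  0≤wₚ : ∀ p → 0ℚ ≤ wₚ p
  0≤wₚ p = *-nonNeg (𝟙-nonNeg (prime? p)) (0≤w p)

  wₚ-prime : ∀ {p} → Prime p → wₚ p ≡ w p
  wₚ-prime {p} pr = trans (cong (_* w p) (𝟙-yes (prime? p) pr)) (ℚₚ.*-identityˡ (w p))

  wₚ-cong : ∀ p {x y} → (Prime p → x ≡ y) → wₚ p * x ≡ wₚ p * y
  wₚ-cong p {x} {y} h = trans (ℚₚ.*-assoc (𝟙 (prime? p)) (w p) x) (trans (𝟙-*-cong (prime? p) (λ pr → cong (w p *_) (h pr)))
    (sym (ℚₚ.*-assoc (𝟙 (prime? p)) (w p) y)))

  -- For w p = log p this would be the logarithm, and `Λ` below von Mangoldt's function.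
  ℓ : ℕ → ℚ
  ℓ n = ∑ X (λ p → wₚ p * count X p n)

  Λ : ℕ → ℚ
  Λ n = ∑ X (λ p → wₚ p * ∑ X (λ k → 𝟙 (p ^ k ℕ.≟ n)))

  Λ-nonNeg : ∀ n → 0ℚ ≤ Λ n
  Λ-nonNeg n = ∑-nonNeg X λ p _ → *-nonNeg (0≤wₚ (suc p)) (∑-nonNeg X λ k _ → 𝟙-nonNeg (suc p ^ suc k ℕ.≟ n))

  ℓ-nonNeg : ∀ n → 0ℚ ≤ ℓ n
  ℓ-nonNeg n = ∑-nonNeg X λ p _ → *-nonNeg (0≤wₚ (suc p)) (∑-nonNeg X λ k _ → 𝟙-nonNeg (suc p ^ suc k ∣? n))

  ℓ-* : ∀ a b → 1 ≤ₙ a → 1 ≤ₙ b → a *ₙ b ≤ₙ X → ℓ (a *ₙ b) ≡ ℓ a + ℓ b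
  ℓ-* a b 1≤a 1≤b h = trans
    (∑-cong X λ p _ → trans (wₚ-cong (suc p) λ pr → count-* X pr a b 1≤a 1≤b h)
      (ℚₚ.*-distribˡ-+ (wₚ (suc p)) (count X (suc p) a) (count X (suc p) b)))
    (∑-+ X (λ p → wₚ p * count X p a) (λ p → wₚ p * count X p b))

  ℓ-prime : ∀ {p} → Prime p → p ≤ₙ X → ℓ p ≡ w p
  ℓ-prime {p} pr p≤X = trans (∑-single X p (λ q → wₚ q * count X q p) 1≤p p≤X other)
    (trans (cong₂ _*_ (wₚ-prime pr) (count-self X pr (ℕₚ.≤-trans 1≤p p≤X))) (ℚₚ.*-identityʳ (w p)))
    where
    1≤p = ℕₚ.<⇒≤ (prime⇒2≤ pr)
    other : ∀ q-1 → q-1 <ₙ X → suc q-1 ≢ p → wₚ (suc q-1) * count X (suc q-1) p ≡ 0ℚ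
    other q-1 _ q≢p = trans (wₚ-cong q {y = 0ℚ} λ prq → count-∤ X prq (q∤p prq)) (ℚₚ.*-zeroʳ (wₚ q))
      where q = suc q-1
            q∤p : Prime q → ¬ (q ∣ p)
            q∤p prq d with prime⇒irreducible pr d
            ... | inj₁ refl = ¬prime[1] prq
            ... | inj₂ e = q≢p e

  -- The identity log = 1 ∗ Λ. It is exact for arbitrary weights, since for each prime both sides
  -- count its powers dividing n.
  ℓ-divisors : ∀ x n → 1 ≤ₙ n → n ≤ₙ x → ∑ x (λ a → 𝟙 (a ∣? n) * Λ a) ≡ ℓ n
  ℓ-divisors x n 1≤n n≤x = trans
    (∑-cong x λ a _ → sym (∑-*ˡ X (𝟙 (suc a ∣? n)) (λ p → wₚ p * ∑ X (λ k → 𝟙 (p ^ k ℕ.≟ suc a)))))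
    (trans (∑-swap x X (λ a p → 𝟙 (a ∣? n) * (wₚ p * ∑ X (λ k → 𝟙 (p ^ k ℕ.≟ a)))))
    (∑-cong X λ p _ → inner (suc p) (s≤s z≤n)))
    where
    module _ (p : ℕ) (1≤p : 1 ≤ₙ p) where
      pick : ∀ k → ∑ x (λ a → 𝟙 (a ∣? n) * 𝟙 (p ^ k ℕ.≟ a)) ≡ 𝟙 (p ^ k ∣? n)
      pick k with p ^ k ∣? n
      ... | yes d = trans (∑-single x (p ^ k) (λ a → 𝟙 (a ∣? n) * 𝟙 (p ^ k ℕ.≟ a)) (1≤^ k 1≤p) (ℕₚ.≤-trans (∣⇒≤ {{ℕ.>-nonZero 1≤n}} d) n≤x)
              (λ a _ a≢ → trans (cong (𝟙 (suc a ∣? n) *_) (𝟙-no (p ^ k ℕ.≟ suc a) (a≢ ∘ sym))) (ℚₚ.*-zeroʳ (𝟙 (suc a ∣? n)))))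
              (cong₂ _*_ (𝟙-yes (p ^ k ∣? n) d) (𝟙-yes (p ^ k ℕ.≟ p ^ k) refl))
      ... | no ∤ = ∑-zero x λ a _ → trans (𝟙-*-cong (suc a ∣? n) {y = 0ℚ} λ a∣n → 𝟙-no (p ^ k ℕ.≟ suc a) λ e → ∤ (subst (_∣ n) (sym e) a∣n))
                                     (ℚₚ.*-zeroʳ (𝟙 (suc a ∣? n)))
      inner : ∑ x (λ a → 𝟙 (a ∣? n) * (wₚ p * ∑ X (λ k → 𝟙 (p ^ k ℕ.≟ a)))) ≡ wₚ p * count X p n
      inner = trans
        (∑-cong x λ a _ → trans (certify [] (𝟙 (suc a ∣? n) ∷ wₚ p ∷ ∑ X (λ k → 𝟙 (p ^ k ℕ.≟ suc a)) ∷ []) 0 [] (χ 0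
            :* (χ 1 :* χ 2) ≐ χ 1 :* (χ 0 :* χ 2)))
          (cong (wₚ p *_) (sym (∑-*ˡ X (𝟙 (suc a ∣? n)) (λ k → 𝟙 (p ^ k ℕ.≟ suc a))))))
        (trans (∑-*ˡ x (wₚ p) (λ a → ∑ X (λ k → 𝟙 (a ∣? n) * 𝟙 (p ^ k ℕ.≟ a))))
          (cong (wₚ p *_) (trans (∑-swap x X (λ a k → 𝟙 (a ∣? n) * 𝟙 (p ^ k ℕ.≟ a))) (∑-cong X λ k _ → pick (suc k)))))

-- Möbius inversion by sieving

unless : ∀ {P : Set} → Dec P → ℚ → ℚ
unless (yes _) x = 0ℚ
unless (no _) x = x

-- The indicator of n having no divisor d with 2 ≤ d ≤ k.
rough : ℕ → ℕ → ℚ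
rough zero n = 1ℚ
rough (suc zero) n = 1ℚ
rough (suc (suc k)) n = unless (suc (suc k) ∣? n) (rough (suc k) n)

-- The Möbius function, set to 0 at every d with a prime factor above k. The recursion is
-- multiplication by the Euler factor of p = suc k; where p² divides d both of its terms vanish by
-- `sieve-vanish`.
sieve : ℕ → ℕ → ℚ
sieve zero d = 𝟙 (1 ℕ.≟ d)
sieve (suc k) d with prime? (suc k)
... | yes _ = sieve k d - 𝟙 (suc k ∣? d) * sieve k (d ÷ suc k)
... | no _ = sieve k d

rough-divisor : ∀ k {j n} → 2 ≤ₙ j → j ≤ₙ k → j ∣ n → rough k n ≡ 0ℚ
rough-divisor (suc zero) (s≤s ()) (s≤s z≤n) _
rough-divisor (suc (suc k)) {j} {n} 2≤j j≤k j∣n with suc (suc k) ∣? n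
... | yes _ = refl
... | no ∤ with ℕₚ.m≤n⇒m<n∨m≡n j≤k
...   | inj₁ (s≤s j≤k′) = rough-divisor (suc k) 2≤j j≤k′ j∣n
...   | inj₂ refl = contradiction j∣n ∤

rough-1 : ∀ k → rough k 1 ≡ 1ℚ
rough-1 zero = refl
rough-1 (suc zero) = refl
rough-1 (suc (suc k)) with suc (suc k) ∣? 1
... | yes d = contradiction (∣1⇒≡1 d) λ ()
... | no _ = rough-1 (suc k)

rough-prime* : ∀ {p} → Prime p → ∀ k m → k <ₙ p → rough k (p *ₙ m) ≡ rough k m
rough-prime* pr zero m _ = refl
rough-prime* pr (suc zero) m _ = refl
rough-prime* {p} pr (suc (suc k)) m k<p with suc (suc k) ∣? p *ₙ m | suc (suc k) ∣? m
... | yes _ | yes _ = refl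
... | yes d | no ∤ = contradiction (coprime-divisor (Coprimality.sym (prime⇒coprime pr k<p)) d) ∤
... | no ∤ | yes d = contradiction (∣n⇒∣m*n p d) ∤
... | no _ | no _ = rough-prime* pr (suc k) m (ℕₚ.<-trans (ℕₚ.n<1+n (suc k)) k<p)

-- The multiples of a composite number have already been removed through its prime factors.
rough-composite : ∀ k n → ¬ Prime (suc k) → rough (suc k) n ≡ rough k n
rough-composite zero n _ = refl
rough-composite (suc k) n ¬pr with suc (suc k) ∣? n
... | no _ = refl
... | yes d with primeDivisor (suc (suc k)) (s≤s (s≤s z≤n))
...   | p , m , pr , e = sym (rough-divisor (suc k) (prime⇒2≤ pr)
          (ℕₚ.m<1+n⇒m≤n (ℕₚ.≤∧≢⇒< (∣⇒≤ p∣) λ { refl → ¬pr pr })) (∣-trans p∣ d))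
  where p∣ : p ∣ suc (suc k)
        p∣ = subst (p ∣_) (sym e) (m∣m*n m)

rough-prime : ∀ k n → Prime (suc k) → rough (suc k) n ≡ rough k n - 𝟙 (suc k ∣? n) * rough k n
rough-prime zero n pr = contradiction pr ¬prime[1]
rough-prime (suc k) n pr with suc (suc k) ∣? n
... | yes _ = certify [] (rough (suc k) n ∷ []) 0 [] (# 0 ≐ χ 0 :- # 1 :* χ 0)
... | no _ = certify [] (rough (suc k) n ∷ []) 0 [] (χ 0 ≐ χ 0 :- # 0 :* χ 0)

module _ (V : ℕ → ℚ) where

  private
    W : ℕ → ℚ
    W y = ∑ y (λ c → V (y ÷ c))

    ∑-sieve-step : ∀ k x (f : ℕ → ℚ) (g : ℕ → ℚ) → ∑ x (λ n → 𝟙 (suc k ∣? n) * f (n ÷ suc k) * g n)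
                   ≡ ∑ (x ÷ suc k) (λ m → f m * g (suc k *ₙ m))
    ∑-sieve-step k x f g = trans
      (∑-cong x λ n _ → ℚₚ.*-assoc (𝟙 (suc k ∣? suc n)) (f (suc n ÷ suc k)) (g (suc n)))
      (trans (∑-multiples x (suc k) (λ n → f (n ÷ suc k) * g n) (s≤s z≤n))
        (∑-cong (x ÷ suc k) λ m _ → cong (λ t → f t * g (suc k *ₙ suc m))
          (trans (cong (_÷ suc k) (ℕₚ.*-comm (suc k) (suc m))) (ℕ/.m*n/n≡m (suc m) (suc k)))))

    -- Legendre's sieve identity, by induction over the sieving primes: removing the multiples of p
    -- subtracts the same sum at x ÷ p, by `rough-prime*`, and W (x ÷ p ÷ d) is W (x ÷ (p d)).
    sifted : ∀ k x → ∑ x (λ n → rough k n * V (x ÷ n)) ≡ ∑ x (λ d → sieve k d * W (x ÷ d))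
    sifted zero zero = refl
    sifted zero x@(suc x-1) = trans (∑-cong x λ n _ → ℚₚ.*-identityˡ (V (x ÷ suc n)))
      (sym (trans (∑-single x 1 (λ d → 𝟙 (1 ℕ.≟ d) * W (x ÷ d)) ℕₚ.≤-refl (s≤s z≤n)
        (λ d _ d≢1 → trans (cong (_* W (x ÷ suc d)) (𝟙-no (1 ℕ.≟ suc d) (d≢1 ∘ sym))) (ℚₚ.*-zeroˡ (W (x ÷ suc d)))))
        (trans (ℚₚ.*-identityˡ (W (x ÷ 1))) (cong W (ℕ/.n/1≡n x)))))
    sifted (suc k) x with prime? (suc k)
    ... | no ¬pr = trans (∑-cong x λ n _ → cong (_* V (x ÷ suc n)) (rough-composite k (suc n) ¬pr)) (sifted k x)
    ... | yes pr = begin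
        ∑ x (λ n → rough p n * V (x ÷ n))
          ≡⟨ ∑-cong x (λ n _ → trans (cong (_* V (x ÷ suc n)) (rough-prime k (suc n) pr))
               (certify [] (rough k (suc n) ∷ 𝟙 (p ∣? suc n) ∷ V (x ÷ suc n) ∷ []) 0 [] ((χ 0 :- χ 1 :* χ 0) :* χ 2 ≐
                   χ 0 :* χ 2 :- χ 1 :* (χ 0 :* χ 2)))) ⟩
        ∑ x (λ n → rough k n * V (x ÷ n) - 𝟙 (p ∣? n) * (rough k n * V (x ÷ n)))
          ≡⟨ ∑-- x (λ n → rough k n * V (x ÷ n)) (λ n → 𝟙 (p ∣? n) * (rough k n * V (x ÷ n))) ⟩
        ∑ x (λ n → rough k n * V (x ÷ n)) - ∑ x (λ n → 𝟙 (p ∣? n) * (rough k n * V (x ÷ n)))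
          ≡⟨ cong₂ _-_ (sifted k x) (∑-multiples x p (λ n → rough k n * V (x ÷ n)) (s≤s z≤n)) ⟩
        S - ∑ (x ÷ p) (λ m → rough k (p *ₙ m) * V (x ÷ (p *ₙ m)))
          ≡⟨ cong (ℚ._-_ S) (∑-cong (x ÷ p) λ m _ → cong₂ _*_ (rough-prime* pr k (suc m) ℕₚ.≤-refl) (cong V (sym (÷-÷ x p (suc m))))) ⟩
        S - ∑ (x ÷ p) (λ m → rough k m * V (x ÷ p ÷ m))
          ≡⟨ cong (ℚ._-_ S) (sifted k (x ÷ p)) ⟩
        S - ∑ (x ÷ p) (λ d → sieve k d * W (x ÷ p ÷ d))
          ≡⟨ cong (ℚ._-_ S) (∑-cong (x ÷ p) λ d _ → cong (λ t → sieve k (suc d) * W t) (÷-÷ x p (suc d))) ⟩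
        S - ∑ (x ÷ p) (λ d → sieve k d * W (x ÷ (p *ₙ d)))
          ≡⟨ cong (ℚ._-_ S) (sym (∑-sieve-step k x (sieve k) (λ n → W (x ÷ n)))) ⟩
        S - ∑ x (λ d → 𝟙 (p ∣? d) * sieve k (d ÷ p) * W (x ÷ d))
          ≡⟨ sym (∑-- x (λ d → sieve k d * W (x ÷ d)) (λ d → 𝟙 (p ∣? d) * sieve k (d ÷ p) * W (x ÷ d))) ⟩
        ∑ x (λ d → sieve k d * W (x ÷ d) - 𝟙 (p ∣? d) * sieve k (d ÷ p) * W (x ÷ d))
          ≡⟨ ∑-cong x (λ d _ → (certify [] (sieve k (suc d) ∷ W (x ÷ suc d) ∷ 𝟙 (p ∣? suc d) ∷ sieve k (suc d ÷ p) ∷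
              []) 0 [] (χ 0 :* χ 1 :- χ 2 :* χ 3 :* χ 1 ≐ (χ 0 :- χ 2 :* χ 3) :* χ 1))) ⟩
        ∑ x (λ d → (sieve k d - 𝟙 (p ∣? d) * sieve k (d ÷ p)) * W (x ÷ d)) ∎
      where open ≡-Reasoning
            p = suc k
            S = ∑ x (λ d → sieve k d * W (x ÷ d))

  sieve-vanish : ∀ k {q d} → Prime q → k <ₙ q → q ∣ d → 1 ≤ₙ d → sieve k d ≡ 0ℚ
  sieve-vanish zero {q} {d} prq _ q∣d _ = 𝟙-no (1 ℕ.≟ d) λ { refl → contradiction (subst (2 ≤ₙ_) (∣1⇒≡1 q∣d) (prime⇒2≤ prq)) λ { (s≤s ()) } }
  sieve-vanish (suc k) {q} {d} prq k<q q∣d 1≤d with prime? (suc k)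
  ... | no _ = sieve-vanish k prq (ℕₚ.<-trans (ℕₚ.n<1+n k) k<q) q∣d 1≤d
  ... | yes pr = trans (cong₂ _-_ (sieve-vanish k prq (ℕₚ.<-trans (ℕₚ.n<1+n k) k<q) q∣d 1≤d)
        (trans (𝟙-*-cong (suc k ∣? d) {y = 0ℚ} λ p∣d → sieve-vanish k prq (ℕₚ.<-trans (ℕₚ.n<1+n k) k<q) (q∣÷ p∣d)
          (÷-big (s≤s z≤n) (∣⇒≤ {{ℕ.>-nonZero 1≤d}} p∣d))) (ℚₚ.*-zeroʳ (𝟙 (suc k ∣? d))))) refl
    where
    q∣÷ : suc k ∣ d → q ∣ d ÷ suc k
    q∣÷ (divides t refl) with euclidsLemma t (suc k) prq q∣d
    ... | inj₁ h = subst (q ∣_) (sym (ℕ/.m*n/n≡m t (suc k))) h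
    ... | inj₂ h = contradiction (∣⇒≤ h) (ℕₚ.<⇒≱ k<q)

  -- When p divides d the first term of the recursion is 0 by `sieve-vanish`, so the two terms never
  -- add up.
  ∣sieve∣≤1 : ∀ k d → 1 ≤ₙ d → ∣ sieve k d ∣ ≤ 1ℚ
  ∣sieve∣≤1 zero d _ = subst (_≤ 1ℚ) (sym (ℚₚ.0≤p⇒∣p∣≡p (𝟙-nonNeg (1 ℕ.≟ d)))) (𝟙-≤1 (1 ℕ.≟ d))
  ∣sieve∣≤1 (suc k) d 1≤d with prime? (suc k)
  ... | no _ = ∣sieve∣≤1 k d 1≤d
  ... | yes pr with suc k ∣? d
  ...   | no _ = subst (λ t → ∣ t ∣ ≤ 1ℚ) (certify [] (sieve k d ∷ sieve k (d ÷ suc k) ∷ []) 0 [] (χ 0 ≐ χ 0 :- # 0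
      :* χ 1)) (∣sieve∣≤1 k d 1≤d)
  ...   | yes p∣d = subst (_≤ 1ℚ) (trans (sym (ℚₚ.∣-p∣≡∣p∣ (sieve k (d ÷ suc k)))) (cong ∣_∣ eq))
                      (∣sieve∣≤1 k (d ÷ suc k) (÷-big (s≤s z≤n) (∣⇒≤ {{ℕ.>-nonZero 1≤d}} p∣d)))
    where eq : - sieve k (d ÷ suc k) ≡ sieve k d - 1ℚ * sieve k (d ÷ suc k)
          eq = certify [] (sieve k d ∷ sieve k (d ÷ suc k) ∷ []) 0 (1 ✕ # 0 ≐ χ 0 ∶ sym (sieve-vanish k pr ℕₚ.≤-refl
              p∣d 1≤d) ∷ []) (:- χ 1 ≐ χ 0 :- # 1 :* χ 1)

  -- At level x only n = 1 survives the sieve, and `sifted` becomes the Möbius inversion V x = Σ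
  -- μ(d) W (x ÷ d); then |μ| ≤ 1 suffices.
  ∣V∣≤∑∣W∣ : ∀ x → 1 ≤ₙ x → ∣ V x ∣ ≤ ∑ x (λ d → ∣ ∑ (x ÷ d) (λ c → V (x ÷ d ÷ c)) ∣)
  ∣V∣≤∑∣W∣ x@(suc x-1) 1≤x = subst (λ t → ∣ t ∣ ≤ ∑ x (λ d → ∣ W (x ÷ d) ∣)) (sym V≡)
    (ℚₚ.≤-trans (∣∑∣≤ x (λ d → sieve x d * W (x ÷ d)))
    (∑-mono x {λ d → ∣ sieve x d * W (x ÷ d) ∣} {λ d → ∣ W (x ÷ d) ∣} λ d _ →
      subst₂ _≤_ (sym (ℚₚ.∣p*q∣≡∣p∣*∣q∣ (sieve x (suc d)) (W (x ÷ suc d)))) (ℚₚ.*-identityˡ ∣ W (x ÷ suc d) ∣)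
      (ℚₚ.*-monoʳ-≤-nonNeg ∣ W (x ÷ suc d) ∣ {{ℚₚ.∣-∣-nonNeg (W (x ÷ suc d))}} (∣sieve∣≤1 x (suc d) (s≤s z≤n)))))
    where
    V≡ : V x ≡ ∑ x (λ d → sieve x d * W (x ÷ d))
    V≡ = trans (sym (trans (∑-single x 1 (λ n → rough x n * V (x ÷ n)) ℕₚ.≤-refl 1≤x other)
           (trans (cong₂ _*_ (rough-1 x) (cong V (ℕ/.n/1≡n x))) (ℚₚ.*-identityˡ (V x))))) (sifted x x)
      where
      other : ∀ n → n <ₙ x → suc n ≢ 1 → rough x (suc n) * V (x ÷ suc n) ≡ 0ℚ
      other n n<x n≢1 = trans (cong (_* V (x ÷ suc n)) (rough-divisor x (ℕₚ.≤∧≢⇒< (s≤s z≤n) (n≢1 ∘ sym)) n<x ∣-refl)) (ℚₚ.*-zeroˡ (V (x ÷ suc n)))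

-- Harmonic sums as approximate logarithms

private
  ι-pos : ∀ n → ℚ.Positive (ι (suc n))
  ι-pos n = ℚ.positive (certify (n ∷ []) [] 0 [] (# 0 ⊏ ⌜ # 1 :+ ν 0 ⌝))

inv : ℕ → ℚ
inv zero = 0ℚ
inv (suc n) = (ℚ.1/ ι (suc n)) {{ℚₚ.pos⇒nonZero (ι (suc n)) {{ι-pos n}}}}

ι*inv : ∀ {n} → 1 ≤ₙ n → ι n * inv n ≡ 1ℚ
ι*inv {suc n} _ = ℚₚ.*-inverseʳ (ι (suc n)) {{ℚₚ.pos⇒nonZero (ι (suc n)) {{ι-pos n}}}}

0≤inv : ∀ n → 0ℚ ≤ inv n
0≤inv zero = ℚₚ.≤-refl
0≤inv (suc n) = ℚₚ.<⇒≤ (ℚₚ.positive⁻¹ (inv (suc n)) {{ℚₚ.1/pos⇒pos (ι (suc n)) {{ι-pos n}}}})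

*-monoˡ : ∀ {a b} c → 0ℚ ≤ c → a ≤ b → c * a ≤ c * b
*-monoˡ c 0≤c = ℚₚ.*-monoˡ-≤-nonNeg c {{ℚ.nonNegative 0≤c}}

inv-anti : ∀ {m n} → 1 ≤ₙ m → m ≤ₙ n → inv n ≤ inv m
inv-anti {m} {n} 1≤m m≤n =
  (certify (m ∷ n ∷ []) (inv n ∷ inv m ∷ []) 0 (1 ✕ χ 0 :* χ 1 :* ν 0 ⊑ χ 0 :* χ 1 :* ν 1 ∶ *-monoˡ (inv n * inv m)
      (*-nonNeg (0≤inv n) (0≤inv m)) (ι-mono m≤n) ∷ 1 ✕ χ 0 :* # 1 ≐ χ 0 :* (ν 0 :* χ 1) ∶ sym (cong (inv n *_) (ι*inv
      1≤m)) ∷ 1 ✕ χ 1 :* (ν 1 :* χ 0) ≐ χ 1 :* # 1 ∶ cong (inv m *_) (ι*inv (ℕₚ.≤-trans 1≤m m≤n)) ∷ []) (χ 0 ⊑ χ 1))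

ι*inv-* : ∀ {a b} → 1 ≤ₙ a → 1 ≤ₙ b → ι a * inv (a *ₙ b) ≡ inv b
ι*inv-* {a} {b} 1≤a 1≤b =
  (certify (a ∷ b ∷ []) (inv b ∷ inv (a *ₙ b) ∷ []) 0 (1 ✕ χ 0 :* (⌜ ν 0 :* ν 1 ⌝ :* χ 1) ≐ χ 0 :* # 1 ∶ cong (inv b
      *_) (ι*inv (ℕₚ.*-mono-≤ 1≤a 1≤b)) ∷ 1 ✕ # 1 :* (ν 0 :* χ 1) ≐ ν 1 :* χ 0 :* (ν 0 :* χ 1) ∶ sym (cong (λ t → t *
      (ι a * inv (a *ₙ b))) (ι*inv 1≤b)) ∷ []) (ν 0 :* χ 1 ≐ χ 0))

inv≤1 : ∀ n → inv n ≤ 1ℚ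
inv≤1 zero = ℚₚ.<⇒≤ 0<1
inv≤1 (suc n) = inv-anti {1} {suc n} ℕₚ.≤-refl (s≤s z≤n)

÷≤ : ∀ x {a} → 1 ≤ₙ a → ι (x ÷ a) ≤ ι x * inv a
÷≤ x {a} 1≤a = certify (x ÷ a ∷ a ∷ x ∷ []) (inv a ∷ []) 0 (1 ✕ χ 0 :* ⌜ ν 0 :* ν 1 ⌝ ⊑ χ 0 :* ν 2 ∶ *-monoˡ (inv a)
    (0≤inv a) (ι-mono (÷-lower x a)) ∷ 1 ✕ ν 0 :* # 1 ≐ ν 0 :* (ν 1 :* χ 0) ∶ sym (cong (ι (x ÷ a) *_) (ι*inv 1≤a)) ∷
    []) (ν 0 ⊑ ν 2 :* χ 0)

÷≥ : ∀ x {a} → 1 ≤ₙ a → ι x * inv a - 1ℚ ≤ ι (x ÷ a)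
÷≥ x {a} 1≤a = certify (x ∷ x ÷ a ∷ a ∷ []) (inv a ∷ []) 0 (1 ✕ χ 0 :* ν 0 ⊑ χ 0 :* ⌜ ν 1 :* ν 2 :+ ν 2 ⌝ ∶ *-monoˡ
    (inv a) (0≤inv a) (ι-mono (ℕₚ.<⇒≤ (÷-upper x a 1≤a))) ∷ 1 ✕ ν 1 :* (ν 2 :* χ 0) ≐ ν 1 :* # 1 ∶ cong (ι (x ÷ a) *_)
    (ι*inv 1≤a) ∷ 1 ✕ ν 2 :* χ 0 ≐ # 1 ∶ ι*inv 1≤a ∷ []) (ν 0 :* χ 0 :- # 1 ⊑ ν 1)

∑-split : ∀ m n f → ∑ (m +ₙ n) f ≡ ∑ m f + ∑ n (λ i → f (m +ₙ i))
∑-split m zero f = trans (cong (λ k → ∑ k f) (ℕₚ.+-identityʳ m)) (sym (ℚₚ.+-identityʳ (∑ m f)))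
∑-split m (suc n) f = trans (cong (λ k → ∑ k f) (ℕₚ.+-suc m n))
  (trans (cong₂ _+_ (∑-split m n f) (cong f (sym (ℕₚ.+-suc m n)))) (ℚₚ.+-assoc (∑ m f) (∑ n (λ i → f (m +ₙ i))) (f (m +ₙ suc n))))

∑-≤ : ∀ n {f} c → (∀ i → i <ₙ n → f (suc i) ≤ c) → ∑ n f ≤ ι n * c
∑-≤ n {f} c h = subst (∑ n f ≤_) (∑-const n c) (∑-mono n h)

∑-≥ : ∀ n {f} c → (∀ i → i <ₙ n → c ≤ f (suc i)) → ι n * c ≤ ∑ n f
∑-≥ n {f} c h = subst (_≤ ∑ n f) (∑-const n c) (∑-mono n h)

∑-between-≤ : ∀ m n {f} c → m ≤ₙ n → (∀ i → m ≤ₙ i → i <ₙ n → f (suc i) ≤ c) → ∑ n f - ∑ m f ≤ (ι n - ι m) * c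
∑-between-≤ m n {f} c m≤n h =
  (certify (n ∷ m ∷ []) (∑ n f ∷ ∑ m f ∷ ∑ n (λ _ → c) ∷ ∑ m (λ _ → c) ∷ c ∷ []) 0 (1 ✕ χ 0 :- χ 1 ⊑ χ 2 :- χ 3 ∶
      ∑-between m n f (λ _ → c) m≤n h ∷ 1 ✕ χ 2 ≐ ν 0 :* χ 4 ∶ ∑-const n c ∷ 1 ✕ ν 1 :* χ 4 ≐ χ 3 ∶ sym (∑-const m c)
      ∷ []) (χ 0 :- χ 1 ⊑ (ν 0 :- ν 1) :* χ 4))

∑-between-≥ : ∀ m n {f} c → m ≤ₙ n → (∀ i → m ≤ₙ i → i <ₙ n → c ≤ f (suc i)) → (ι n - ι m) * c ≤ ∑ n f - ∑ m f
∑-between-≥ m n {f} c m≤n h =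
  (certify (n ∷ m ∷ []) (∑ n (λ _ → c) ∷ ∑ m (λ _ → c) ∷ ∑ n f ∷ ∑ m f ∷ c ∷ []) 0 (1 ✕ χ 0 :- χ 1 ⊑ χ 2 :- χ 3 ∶
      ∑-between m n (λ _ → c) f m≤n h ∷ 1 ✕ ν 0 :* χ 4 ≐ χ 0 ∶ sym (∑-const n c) ∷ 1 ✕ χ 1 ≐ ν 1 :* χ 4 ∶ ∑-const m c
      ∷ []) ((ν 0 :- ν 1) :* χ 4 ⊑ χ 2 :- χ 3))

H : ℕ → ℚ
H n = ∑ n inv

H-mono : ∀ {m n} → m ≤ₙ n → H m ≤ H n
H-mono = ∑-upTo-mono inv 0≤inv

0≤H : ∀ n → 0ℚ ≤ H n
0≤H n = H-mono {0} {n} z≤n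

H-≤ : ∀ n → H n ≤ ι n
H-≤ n = ℚₚ.≤-trans (∑-≤ n 1ℚ λ i _ → inv≤1 (suc i)) (ℚₚ.≤-reflexive (ℚₚ.*-identityʳ (ι n)))

1≤H : ∀ {n} → 1 ≤ₙ n → 1ℚ ≤ H n
1≤H = H-mono {1}

H-growth : ∀ {m n} → 1 ≤ₙ m → m ≤ₙ n → H n - H m ≤ (ι n - ι m) * inv m
H-growth {m} {n} 1≤m m≤n = ∑-between-≤ m n (inv m) m≤n λ i m≤i _ → inv-anti 1≤m (ℕₚ.m≤n⇒m≤1+n m≤i)

-- h b M approximates log b as M grows.
h : ℕ → ℕ → ℚ
h b M = H (b *ₙ M) - H M

private
  module _ (b M : ℕ) (1≤b : 1 ≤ₙ b) (1≤M : 1 ≤ₙ M) where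
    block : ℚ
    block = ∑ b (λ i → inv (b *ₙ M +ₙ i))

    H-block : H (b *ₙ suc M) ≡ H (b *ₙ M) + block
    H-block = trans (cong H (trans (ℕₚ.*-suc b M) (ℕₚ.+-comm b (b *ₙ M)))) (∑-split (b *ₙ M) b inv)

    block-≤ : block ≤ inv M
    block-≤ = ℚₚ.≤-trans (∑-≤ b (inv (b *ₙ M)) λ i _ → inv-anti (ℕₚ.*-mono-≤ 1≤b 1≤M) (ℕₚ.m≤m+n (b *ₙ M) (suc i)))
      (ℚₚ.≤-reflexive (ι*inv-* 1≤b 1≤M))

    block-≥ : inv (suc M) ≤ block
    block-≥ = ℚₚ.≤-trans (ℚₚ.≤-reflexive (sym (ι*inv-* {b} {suc M} 1≤b (s≤s z≤n)))) (∑-≥ b (inv (b *ₙ suc M)) λ i i<b →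
      inv-anti (ℕₚ.≤-trans (s≤s z≤n) (ℕₚ.m≤n+m (suc i) (b *ₙ M)))
        (subst (b *ₙ M +ₙ suc i ≤ₙ_) (sym (trans (ℕₚ.*-suc b M) (ℕₚ.+-comm b (b *ₙ M)))) (ℕₚ.+-monoʳ-≤ (b *ₙ M) i<b)))

-- Raising M by one adds to H (b M) a block of b reciprocals with sum between inv (suc M) and inv M,
-- and adds inv (suc M) to H M. So the difference grows by at most inv M - inv (suc M), which
-- telescopes.
h-bounds : ∀ {b M} M′ → 1 ≤ₙ b → 1 ≤ₙ M → M ≤ₙ M′ → h b M ≤ h b M′ × h b M′ ≤ h b M + inv M - inv M′
h-bounds {b} {M} M′ 1≤b 1≤M M≤M′ with ℕₚ.m≤n⇒m<n∨m≡n M≤M′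
... | inj₂ refl = ℚₚ.≤-refl , (certify [] (h b M ∷ inv M ∷ []) 0 [] (χ 0 ⊑ χ 0 :+ χ 1 :- χ 1))
h-bounds {b} {M} (suc M′) 1≤b 1≤M _ | inj₁ (s≤s M≤M′) =
  (certify [] (HbM ∷ H M ∷ HbM′ ∷ H M′ ∷ HbS ∷ blk ∷ inv (suc M′) ∷ []) 0 (1 ✕ χ 0 :- χ 1 ⊑ χ 2 :- χ 3 ∶ ih₁ ∷ 1 ✕ χ
      2 :+ χ 5 ≐ χ 4 ∶ sym (hb) ∷ 1 ✕ χ 6 ⊑ χ 5 ∶ lo ∷ []) (χ 0 :- χ 1 ⊑ χ 4 :- (χ 3 :+ χ 6))) ,
  (certify [] (HbM′ ∷ H M′ ∷ HbM ∷ H M ∷ inv M ∷ inv M′ ∷ HbS ∷ blk ∷ inv (suc M′) ∷ []) 0 (1 ✕ χ 0 :- χ 1 ⊑ χ 2 :- χ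
      3 :+ χ 4 :- χ 5 ∶ ih₂ ∷ 1 ✕ χ 6 ≐ χ 0 :+ χ 7 ∶ hb ∷ 1 ✕ χ 7 ⊑ χ 5 ∶ hi ∷ []) (χ 6 :- (χ 1 :+ χ 8) ⊑ χ 2 :- χ 3
      :+ χ 4 :- χ 8))
  where
  ih = h-bounds {b} {M} M′ 1≤b 1≤M M≤M′
  ih₁ = proj₁ ih
  ih₂ = proj₂ ih
  1≤M′ = ℕₚ.≤-trans 1≤M M≤M′
  HbM = H (b *ₙ M)
  HbM′ = H (b *ₙ M′)
  HbS = H (b *ₙ suc M′)
  blk = block b M′ 1≤b 1≤M′
  hb = H-block b M′ 1≤b 1≤M′
  hi = block-≤ b M′ 1≤b 1≤M′
  lo = block-≥ b M′ 1≤b 1≤M′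

-- The two bounds hold for the true logarithm with Euler's constant as `γ`. They are sharp enough
-- that the upper bound at n meets the lower bound at suc n, which makes `ℓ` monotone.
record LogUpTo (X : ℕ) : Set where
  field
    w : ℕ → ℚ
    0≤w : ∀ p → 0ℚ ≤ w p
    γ : ℚ
  open Mangoldt X w 0≤w public
  field
    ℓ-upper : ∀ n → 1 ≤ₙ n → n ≤ₙ X → ℓ n ≤ H n - γ
    ℓ-lower : ∀ n → 1 ≤ₙ n → n ≤ₙ X → H n - γ - inv n ≤ ℓ n

module _ (X : ℕ) (1≤X : 1 ≤ₙ X) where
  private
    -- This makes the additivity error n / M at most 1 / X, exactly the slack that `h-bounds` leaves
    -- between n and X.
    M = X *ₙ X
    1≤M : 1 ≤ₙ M
    1≤M = ℕₚ.*-mono-≤ 1≤X 1≤X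

    w : ℕ → ℚ
    w zero = 0ℚ
    w (suc p) = h (suc p) M

    0≤w : ∀ p → 0ℚ ≤ w p
    0≤w zero = ℚₚ.≤-refl
    0≤w (suc p) = certify [] (H M ∷ H (suc p *ₙ M) ∷ []) 0 (1 ✕ χ 0 ⊑ χ 1 ∶ (H-mono {M} {suc p *ₙ M} (ℕₚ.m≤m+n M (p
        *ₙ M))) ∷ []) (# 0 ⊑ χ 1 :- χ 0)

    open Mangoldt X w 0≤w

    w≡h : ∀ {p} → 1 ≤ₙ p → w p ≡ h p M
    w≡h {suc p} _ = refl

    ℓ-1 : ℓ 1 ≡ 0ℚ
    ℓ-1 = certify [] (ℓ 1 ∷ []) 0 (1 ✕ χ 0 :+ χ 0 ≐ χ 0 ∶ sym (ℓ-* 1 1 ℕₚ.≤-refl ℕₚ.≤-refl 1≤X) ∷ []) (χ 0 ≐ # 0)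

    -- Splitting off a prime, h (p m) M = h p (m M) + h m M, and h p (m M) exceeds the weight h p M
    -- by at most 1 / M. As suc m ≤ p m, the error n / M absorbs one more such loss.
    ℓ≈h : ∀ f n → n ≤ₙ f → 1 ≤ₙ n → n ≤ₙ X → ℓ n ≤ h n M × h n M ≤ ℓ n + ι n * inv M
    ℓ≈h zero zero _ () _
    ℓ≈h (suc f) n n≤f 1≤n n≤X with ℕₚ.m≤n⇒m<n∨m≡n 1≤n
    ... | inj₂ refl = (certify [] (ℓ 1 ∷ H (1 *ₙ M) ∷ H M ∷ []) 0 (1 ✕ χ 0 ≐ # 0 ∶ ℓ-1 ∷ 1 ✕ χ 2 ≐ χ 1 ∶ sym (h1) ∷
        []) (χ 0 ⊑ χ 1 :- χ 2)) ,
                      (certify [] (ℓ 1 ∷ H (1 *ₙ M) ∷ H M ∷ inv M ∷ []) 0 (1 ✕ # 0 ≐ χ 0 ∶ sym (ℓ-1) ∷ 1 ✕ χ 1 ≐ χ 2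
                          ∶ h1 ∷ 1 ✕ # 0 ⊑ χ 3 ∶ 0≤inv M ∷ []) (χ 1 :- χ 2 ⊑ χ 0 :+ # 1 :* χ 3))
      where h1 : H (1 *ₙ M) ≡ H M
            h1 = cong H (ℕₚ.*-identityˡ M)
    ... | inj₁ 2≤n with primeDivisor n 2≤n
    ...   | p , m , pr , refl = goal
      where
      2≤p = prime⇒2≤ pr
      1≤p = ℕₚ.<⇒≤ 2≤p
      1≤m : 1 ≤ₙ m
      1≤m = ℕₚ.n≢0⇒n>0 λ e → contradiction (subst (1 ≤ₙ_) (trans (cong (p *ₙ_) e) (ℕₚ.*-zeroʳ p)) 1≤n) λ ()
      m<n : suc m ≤ₙ p *ₙ m
      m<n = ℕₚ.≤-trans (certify (m ∷ []) [] 0 (1 ✕ # 1 ⊑ₙ ν 0 ∶ 1≤m ∷ []) (# 1 :+ ν 0 ⊑ₙ # 2 :* ν 0)) (ℕₚ.*-monoˡ-≤ m 2≤p)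
      m≤X = ℕₚ.≤-trans (ℕₚ.<⇒≤ m<n) n≤X
      p≤X = ℕₚ.≤-trans (subst (_≤ₙ p *ₙ m) (ℕₚ.*-identityʳ p) (ℕₚ.*-monoʳ-≤ p 1≤m)) n≤X
      ih = ℓ≈h f m (ℕₚ.m<1+n⇒m≤n (ℕₚ.<-≤-trans m<n n≤f)) 1≤m m≤X
      ih₁ = proj₁ ih
      ih₂ = proj₂ ih
      ℓ≡ : ℓ (p *ₙ m) ≡ (H (p *ₙ M) - H M) + ℓ m
      ℓ≡ = trans (ℓ-* p m 1≤p 1≤m n≤X) (cong (ℚ._+ ℓ m) (trans (ℓ-prime pr p≤X) (w≡h 1≤p)))
      M≤mM : M ≤ₙ m *ₙ M
      M≤mM = subst (_≤ₙ m *ₙ M) (ℕₚ.*-identityˡ M) (ℕₚ.*-monoˡ-≤ M 1≤m)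
      hb = h-bounds {p} {M} (m *ₙ M) 1≤p 1≤M M≤mM
      hb₁ = proj₁ hb
      hb₂ = proj₂ hb
      assoc : H (p *ₙ m *ₙ M) ≡ H (p *ₙ (m *ₙ M))
      assoc = cong H (ℕₚ.*-assoc p m M)
      grow : (ι m + ι 1) * inv M ≤ ι (p *ₙ m) * inv M
      grow = ℚₚ.*-monoʳ-≤-nonNeg (inv M) {{ℚ.nonNegative (0≤inv M)}} (certify (m ∷ p ∷ []) [] 0 (1 ✕ # 1 :+ ν 0 ⊑ₙ ν
          1 :* ν 0 ∶ m<n ∷ []) (ν 0 :+ # 1 ⊑ ⌜ ν 1 :* ν 0 ⌝))
      goal : ℓ (p *ₙ m) ≤ h (p *ₙ m) M × h (p *ₙ m) M ≤ ℓ (p *ₙ m) + ι (p *ₙ m) * inv M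
      goal =
        (certify [] (ℓ m ∷ H (m *ₙ M) ∷ H M ∷ ℓ (p *ₙ m) ∷ H (p *ₙ M) ∷ H (p *ₙ (m *ₙ M)) ∷ H (p *ₙ m *ₙ M) ∷ []) 0
            (1 ✕ χ 0 ⊑ χ 1 :- χ 2 ∶ ih₁ ∷ 1 ✕ χ 3 ≐ χ 4 :- χ 2 :+ χ 0 ∶ ℓ≡ ∷ 1 ✕ χ 4 :- χ 2 ⊑ χ 5 :- χ 1 ∶ hb₁ ∷ 1 ✕ χ
            5 ≐ χ 6 ∶ sym (assoc) ∷ []) (χ 3 ⊑ χ 6 :- χ 2)) ,
        (certify (m ∷ p ∷ []) (H (m *ₙ M) ∷ H M ∷ ℓ m ∷ inv M ∷ ℓ (p *ₙ m) ∷ H (p *ₙ M) ∷ H (p *ₙ (m *ₙ M)) ∷ inv (m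
            *ₙ M) ∷ H (p *ₙ m *ₙ M) ∷ []) 0 (1 ✕ χ 0 :- χ 1 ⊑ χ 2 :+ ν 0 :* χ 3 ∶ ih₂ ∷ 1 ✕ χ 5 :- χ 1 :+ χ 2 ≐ χ 4 ∶
            sym (ℓ≡) ∷ 1 ✕ χ 6 :- χ 0 ⊑ χ 5 :- χ 1 :+ χ 3 :- χ 7 ∶ hb₂ ∷ 1 ✕ # 0 ⊑ χ 7 ∶ 0≤inv (m *ₙ M) ∷ 1 ✕ χ 8 ≐ χ
            6 ∶ assoc ∷ 1 ✕ (ν 0 :+ # 1) :* χ 3 ⊑ ⌜ ν 1 :* ν 0 ⌝ :* χ 3 ∶ grow ∷ []) (χ 8 :- χ 1 ⊑ χ 4 :+ ⌜ ν 1 :* ν 0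
            ⌝ :* χ 3))

    module _ (n : ℕ) (1≤n : 1 ≤ₙ n) (n≤X : n ≤ₙ X) where
      -- Read this way, h n M is H n - H M + h M n, and h M n hardly depends on n; this is how the
      -- constant `γ` arises.
      flip-h : H (n *ₙ M) ≡ H (M *ₙ n)
      flip-h = cong H (ℕₚ.*-comm n M)
      ap = ℓ≈h n n ℕₚ.≤-refl 1≤n n≤X
      ap₁ = proj₁ ap
      ap₂ = proj₂ ap
      hb = h-bounds {M} {n} X 1≤M 1≤n n≤X
      hb₁ = proj₁ hb
      hb₂ = proj₂ hb
      small : ι n * inv M ≤ inv X
      small = ℚₚ.≤-trans (ℚₚ.*-monoʳ-≤-nonNeg (inv M) {{ℚ.nonNegative (0≤inv M)}} (ι-mono n≤X)) (ℚₚ.≤-reflexive (ι*inv-* 1≤X 1≤X))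
      up : ℓ n ≤ H n - (H M - (H (M *ₙ X) - H X))
      up = certify [] (ℓ n ∷ H (n *ₙ M) ∷ H M ∷ H (M *ₙ n) ∷ H n ∷ H (M *ₙ X) ∷ H X ∷ []) 0 (1 ✕ χ 0 ⊑ χ 1 :- χ 2 ∶
          ap₁ ∷ 1 ✕ χ 1 ≐ χ 3 ∶ flip-h ∷ 1 ✕ χ 3 :- χ 4 ⊑ χ 5 :- χ 6 ∶ hb₁ ∷ []) (χ 0 ⊑ χ 4 :- (χ 2 :- (χ 5 :- χ 6)))
      low : H n - (H M - (H (M *ₙ X) - H X)) - inv n ≤ ℓ n
      low = certify (n ∷ []) (H (n *ₙ M) ∷ H M ∷ ℓ n ∷ inv M ∷ H (M *ₙ n) ∷ inv X ∷ H (M *ₙ X) ∷ H X ∷ H n ∷ inv n ∷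
          []) 0 (1 ✕ χ 0 :- χ 1 ⊑ χ 2 :+ ν 0 :* χ 3 ∶ ap₂ ∷ 1 ✕ χ 4 ≐ χ 0 ∶ sym (flip-h) ∷ 1 ✕ ν 0 :* χ 3 ⊑ χ 5 ∶
          small ∷ 1 ✕ χ 6 :- χ 7 ⊑ χ 4 :- χ 8 :+ χ 9 :- χ 5 ∶ hb₂ ∷ []) (χ 8 :- (χ 1 :- (χ 6 :- χ 7)) :- χ 9 ⊑ χ 2)

  logUpTo : LogUpTo X
  logUpTo = record { w = w ; 0≤w = 0≤w ; γ = H M - h M X ; ℓ-upper = up ; ℓ-lower = low }

-- Selberg's symmetry formula

∬-cong-≤ : ∀ x {F G} → (∀ a b → suc a *ₙ suc b ≤ₙ x → F (suc a) (suc b) ≡ G (suc a) (suc b)) → ∬ x F ≡ ∬ x G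
∬-cong-≤ x h = ∑-cong x λ a _ → ∑-cong (x ÷ suc a) λ b b< → h a b (subst (_≤ₙ x) (ℕₚ.*-comm (suc b) (suc a)) (÷-smallest b<))

isqrt : ∀ y → ∃[ s ] (s *ₙ s ≤ₙ y × y <ₙ suc s *ₙ suc s)
isqrt zero = 0 , z≤n , s≤s z≤n
isqrt (suc y) with isqrt y
... | s , lo , hi with suc s *ₙ suc s ℕ.≤? suc y
...   | yes h = suc s , h , (certify (y ∷ s ∷ []) [] 0 (1 ✕ ν 0 ⊏ₙ (# 1 :+ ν 1) :* (# 1 :+ ν 1) ∶ hi ∷ []) (# 1 :+ ν
    0 ⊏ₙ (# 1 :+ (# 1 :+ ν 1)) :* (# 1 :+ (# 1 :+ ν 1))))
...   | no h = s , ℕₚ.m≤n⇒m≤1+n lo , ℕₚ.≰⇒> h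

∑H : ∀ y → ∑ y H ≡ (ι y + 1ℚ) * H y - ι y
∑H zero = refl
∑H (suc y) = certify (y ∷ []) (∑ y H ∷ H y ∷ inv (suc y) ∷ []) 0 (1 ✕ χ 0 ≐ (ν 0 :+ # 1) :* χ 1 :- ν 0 ∶ ∑H y ∷ 1 ✕ #
    1 ≐ ⌜ # 1 :+ ν 0 ⌝ :* χ 2 ∶ sym (ι*inv {suc y} (s≤s z≤n)) ∷ []) (χ 0 :+ (χ 1 :+ χ 2) ≐ (⌜ # 1 :+ ν 0 ⌝ :+ # 1) :*
    (χ 1 :+ χ 2) :- ⌜ # 1 :+ ν 0 ⌝)

n≤n*n : ∀ n → n ≤ₙ n *ₙ n
n≤n*n zero = z≤n
n≤n*n (suc n) = certify (n ∷ []) [] 0 [] (# 1 :+ ν 0 ⊑ₙ (# 1 :+ ν 0) :* (# 1 :+ ν 0))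

Dsum : ℕ → ℚ
Dsum y = ∑ y (λ a → ι (y ÷ a))

-- Dirichlet's hyperbola method: no lattice point under the hyperbola has both coordinates above s,
-- so two strips cover all of them and the square of side s is counted twice.
hyperbola : ∀ y s → s *ₙ s ≤ₙ y → y <ₙ suc s *ₙ suc s → Dsum y ≡ ι 2 * ∑ s (λ a → ι (y ÷ a)) - ι s * ι s
hyperbola y s lo hi = certify (s ∷ []) (Dsum y ∷ ∑ y G ∷ ∑ s (λ a → ι (y ÷ a)) ∷ []) 0 (1 ✕ χ 0 :- χ 1 ≐ χ 2 :- ν 0
    :* ν 0 ∶ diff ∷ 1 ✕ χ 1 ≐ χ 2 ∶ swapped ∷ []) (χ 0 ≐ # 2 :* χ 2 :- ν 0 :* ν 0)
  where
  G : ℕ → ℚ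
  G a = ∑ s (λ b → 𝟙 (b *ₙ a ℕ.≤? y))
  s≤y : s ≤ₙ y
  s≤y = ℕₚ.≤-trans (n≤n*n s) lo
  swapped : ∑ y G ≡ ∑ s (λ a → ι (y ÷ a))
  swapped = trans (∑-swap y s (λ a b → 𝟙 (b *ₙ a ℕ.≤? y))) (∑-cong s λ b _ → trans
    (∑-cong y λ a _ → trans (𝟙-iff (suc b *ₙ suc a ℕ.≤? y) (suc a ℕ.≤? y ÷ suc b)
       (λ p → ÷-greatest (s≤s z≤n) (subst (_≤ₙ y) (ℕₚ.*-comm (suc b) (suc a)) p)) (λ p → subst (_≤ₙ y) (ℕₚ.*-comm (suc a) (suc b)) (÷-smallest p)))
       (sym (ℚₚ.*-identityʳ (𝟙 (suc a ℕ.≤? y ÷ suc b)))))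
    (trans (∑-𝟙-≤ (λ _ → 1ℚ) (÷-≤ y (suc b))) (trans (∑-const (y ÷ suc b) 1ℚ) (ℚₚ.*-identityʳ (ι (y ÷ suc b))))))
  beyond : ∀ a → s ≤ₙ a → a <ₙ y → ι (y ÷ suc a) - G (suc a) ≡ 0ℚ
  beyond a s≤a _ = trans (cong (ℚ._-_ (ι (y ÷ suc a))) G≡) (ℚₚ.+-inverseʳ (ι (y ÷ suc a)))
    where
    q≤s : y ÷ suc a ≤ₙ s
    q≤s = ℕₚ.m<1+n⇒m≤n (ℕₚ.*-cancelʳ-< (suc s) (y ÷ suc a) (suc s) (ℕₚ.≤-<-trans (ℕₚ.≤-trans (ℕₚ.*-monoʳ-≤ (y ÷ suc a) (s≤s s≤a)) (÷-lower y (suc a))) hi))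
    G≡ : G (suc a) ≡ ι (y ÷ suc a)
    G≡ = trans (∑-cong s λ b _ → trans (𝟙-iff (suc b *ₙ suc a ℕ.≤? y) (suc b ℕ.≤? y ÷ suc a) (÷-greatest (s≤s z≤n)) ÷-smallest)
           (sym (ℚₚ.*-identityʳ (𝟙 (suc b ℕ.≤? y ÷ suc a)))))
         (trans (∑-𝟙-≤ (λ _ → 1ℚ) q≤s) (trans (∑-const (y ÷ suc a) 1ℚ) (ℚₚ.*-identityʳ (ι (y ÷ suc a)))))
  diff : Dsum y - ∑ y G ≡ ∑ s (λ a → ι (y ÷ a)) - ι s * ι s
  diff = trans (sym (∑-- y (λ a → ι (y ÷ a)) G)) (trans (∑-extend (λ a → ι (y ÷ a) - G a) s≤y beyond)
    (trans (∑-- s (λ a → ι (y ÷ a)) G) (cong (ℚ._-_ (∑ s (λ a → ι (y ÷ a))))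
      (trans (∑-cong s λ a a<s → trans (∑-cong s λ b b<s → 𝟙-yes (suc b *ₙ suc a ℕ.≤? y) (ℕₚ.≤-trans (ℕₚ.*-mono-≤ b<s a<s) lo))
                                         (trans (∑-const s 1ℚ) (ℚₚ.*-identityʳ (ι s))))
             (∑-const s (ι s))))))

Dsum-bounds : ∀ y s → s *ₙ s ≤ₙ y → y <ₙ suc s *ₙ suc s →
  ι 2 * ι y * H s - ι 2 * ι s - ι s * ι s ≤ Dsum y × Dsum y ≤ ι 2 * ι y * H s - ι s * ι s
Dsum-bounds y s lo hi =
  (certify (s ∷ y ∷ []) (Dsum y ∷ P ∷ H s ∷ []) 0 (1 ✕ # 2 :* χ 1 :- ν 0 :* ν 0 ≐ χ 0 ∶ sym (hyp) ∷ 2 ✕ ν 1 :* χ 2 :-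
      ν 0 ⊑ χ 1 ∶ P≥ ∷ []) (# 2 :* ν 1 :* χ 2 :- # 2 :* ν 0 :- ν 0 :* ν 0 ⊑ χ 0)) ,
  (certify (s ∷ y ∷ []) (Dsum y ∷ P ∷ H s ∷ []) 0 (1 ✕ χ 0 ≐ # 2 :* χ 1 :- ν 0 :* ν 0 ∶ hyp ∷ 2 ✕ χ 1 ⊑ ν 1 :* χ 2 ∶
      P≤ ∷ []) (χ 0 ⊑ # 2 :* ν 1 :* χ 2 :- ν 0 :* ν 0))
  where
  hyp = hyperbola y s lo hi
  P = ∑ s (λ a → ι (y ÷ a))
  P≤ : P ≤ ι y * H s
  P≤ = ℚₚ.≤-trans (∑-mono s {g = λ a → ι y * inv a} λ a _ → ÷≤ y (s≤s z≤n)) (ℚₚ.≤-reflexive (∑-*ˡ s (ι y) inv))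
  P≥ : ι y * H s - ι s ≤ P
  P≥ = ℚₚ.≤-trans (ℚₚ.≤-reflexive (trans (cong₂ _-_ (sym (∑-*ˡ s (ι y) inv)) (sym (trans (∑-const s 1ℚ) (ℚₚ.*-identityʳ (ι s)))))
         (sym (∑-- s (λ a → ι y * inv a) (λ _ → 1ℚ))))) (∑-mono s λ a _ → ÷≥ y (s≤s z≤n))

∣∣≤ : ∀ {x c} → - c ≤ x → x ≤ c → ∣ x ∣ ≤ c
∣∣≤ {x} {c} lo hi with ℚₚ.∣p∣≡p∨∣p∣≡-p x
... | inj₁ e = subst (_≤ c) (sym e) hi
... | inj₂ e = subst (_≤ c) (sym e) (certify [] (c ∷ x ∷ []) 0 (1 ✕ :- χ 0 ⊑ χ 1 ∶ lo ∷ []) (:- χ 1 ⊑ χ 0))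

≤∣∣ : ∀ x → x ≤ ∣ x ∣
≤∣∣ x with ℚₚ.≤-total 0ℚ x
... | inj₁ h = ℚₚ.≤-reflexive (sym (ℚₚ.0≤p⇒∣p∣≡p h))
... | inj₂ h = ℚₚ.≤-trans h (ℚₚ.0≤∣p∣ x)

-∣∣≤ : ∀ x → - ∣ x ∣ ≤ x
-∣∣≤ x = certify [] (x ∷ ∣ x ∣ ∷ []) 0 (1 ✕ :- χ 0 ⊑ χ 1 ∶ subst (- x ≤_) (ℚₚ.∣-p∣≡∣p∣ x) (≤∣∣ (- x)) ∷ []) (:- χ 1 ⊑
    χ 0)

module Selberg {X : ℕ} (L : LogUpTo X) (1≤X : 1 ≤ₙ X) where
  open LogUpTo L

  ψ T : ℕ → ℚ
  ψ y = ∑ y Λ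
  T y = ∑ y ℓ

  ψ-mono : ∀ {a b} → a ≤ₙ b → ψ a ≤ ψ b
  ψ-mono = ∑-upTo-mono Λ Λ-nonNeg

  0≤ψ : ∀ y → 0ℚ ≤ ψ y
  0≤ψ y = ψ-mono {0} {y} z≤n

  ℓ1 : ℓ 1 ≡ 0ℚ
  ℓ1 = certify [] (ℓ 1 ∷ []) 0 (1 ✕ χ 0 :+ χ 0 ≐ χ 0 ∶ sym (ℓ-* 1 1 ℕₚ.≤-refl ℕₚ.≤-refl 1≤X) ∷ []) (χ 0 ≐ # 0)

  H1 : H 1 ≡ 1ℚ
  H1 = refl

  0≤γ : 0ℚ ≤ γ
  0≤γ = certify [] (H 1 ∷ γ ∷ inv 1 ∷ ℓ 1 ∷ []) 0 (1 ✕ χ 0 :- χ 1 :- χ 2 ⊑ χ 3 ∶ ℓ-lower 1 ℕₚ.≤-refl 1≤X ∷ 1 ✕ χ 3 ≐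
      # 0 ∶ ℓ1 ∷ 1 ✕ # 1 ≐ χ 0 ∶ sym (H1) ∷ 1 ✕ χ 2 ⊑ # 1 ∶ inv≤1 1 ∷ []) (# 0 ⊑ χ 1)

  γ≤1 : γ ≤ 1ℚ
  γ≤1 = certify [] (ℓ 1 ∷ H 1 ∷ γ ∷ []) 0 (1 ✕ χ 0 ⊑ χ 1 :- χ 2 ∶ ℓ-upper 1 ℕₚ.≤-refl 1≤X ∷ 1 ✕ # 0 ≐ χ 0 ∶ sym (ℓ1)
      ∷ 1 ✕ χ 1 ≐ # 1 ∶ H1 ∷ []) (χ 2 ⊑ # 1)

  T-upper : ∀ y → y ≤ₙ X → T y ≤ (ι y + 1ℚ) * H y - ι y - γ * ι y
  T-upper y y≤X = certify (y ∷ []) (∑ y ℓ ∷ ∑ y (λ n → H n - γ) ∷ ∑ y H ∷ ∑ y (λ _ → γ) ∷ γ ∷ H y ∷ []) 0 (1 ✕ χ 0 ⊑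
      χ 1 ∶ ∑-mono y (λ i i<y → ℓ-upper (suc i) (s≤s z≤n) (ℕₚ.≤-trans i<y y≤X)) ∷ 1 ✕ χ 1 ≐ χ 2 :- χ 3 ∶ ∑-- y H (λ _
      → γ) ∷ 1 ✕ ν 0 :* χ 4 ≐ χ 3 ∶ sym (∑-const y γ) ∷ 1 ✕ χ 2 ≐ (ν 0 :+ # 1) :* χ 5 :- ν 0 ∶ ∑H y ∷ []) (χ 0 ⊑ (ν 0
      :+ # 1) :* χ 5 :- ν 0 :- χ 4 :* ν 0)

  T-lower : ∀ y → y ≤ₙ X → ι y * H y - ι y - γ * ι y ≤ T y
  T-lower y y≤X = certify (y ∷ []) (∑ y (λ n → H n - γ - inv n) ∷ ∑ y ℓ ∷ ∑ y (λ n → H n - γ) ∷ H y ∷ ∑ y H ∷ ∑ y (λ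
      _ → γ) ∷ γ ∷ []) 0 (1 ✕ χ 0 ⊑ χ 1 ∶ ∑-mono y (λ i i<y → ℓ-lower (suc i) (s≤s z≤n) (ℕₚ.≤-trans i<y y≤X)) ∷ 1 ✕ χ
      2 :- χ 3 ≐ χ 0 ∶ sym (∑-- y (λ n → H n - γ) inv) ∷ 1 ✕ χ 4 :- χ 5 ≐ χ 2 ∶ sym (∑-- y H (λ _ → γ)) ∷ 1 ✕ χ 5 ≐ ν
      0 :* χ 6 ∶ ∑-const y γ ∷ 1 ✕ (ν 0 :+ # 1) :* χ 3 :- ν 0 ≐ χ 4 ∶ sym (∑H y) ∷ []) (ν 0 :* χ 3 :- ν 0 :- χ 6 :* ν
      0 ⊑ χ 1)

  module _ (y s : ℕ) (1≤s : 1 ≤ₙ s) (lo : s *ₙ s ≤ₙ y) (hi : y <ₙ suc s *ₙ suc s) (y≤X : y ≤ₙ X) where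
    private
      ss≤X = ℕₚ.≤-trans lo y≤X
      1≤ss = ℕₚ.*-mono-≤ 1≤s 1≤s
      s≤ss : s ≤ₙ s *ₙ s
      s≤ss = subst (_≤ₙ s *ₙ s) (ℕₚ.*-identityʳ s) (ℕₚ.*-monoʳ-≤ s 1≤s)
      s≤X = ℕₚ.≤-trans s≤ss ss≤X
      ℓss : ℓ (s *ₙ s) ≡ ℓ s + ℓ s
      ℓss = ℓ-* s s 1≤s 1≤s ss≤X
      i≤ : inv (s *ₙ s) ≤ inv s
      i≤ = inv-anti 1≤s s≤ss
      tail : H y - H (s *ₙ s) ≤ ι 2 * inv s
      tail = certify (y ∷ s ∷ []) (H y ∷ H (s *ₙ s) ∷ inv (s *ₙ s) ∷ inv s ∷ []) 0 (1 ✕ χ 0 :- χ 1 ⊑ (ν 0 :- ⌜ ν 1 :*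
          ν 1 ⌝) :* χ 2 ∶ H-growth 1≤ss lo ∷ 1 ✕ χ 2 :* ν 0 ⊑ χ 2 :* ⌜ ν 1 :* ν 1 :+ # 2 :* ν 1 ⌝ ∶ *-monoˡ (inv (s *ₙ
          s)) (0≤inv (s *ₙ s)) (ι-mono (certify (y ∷ s ∷ []) [] 0 (1 ✕ ν 0 ⊏ₙ (# 1 :+ ν 1) :* (# 1 :+ ν 1) ∶ hi ∷ [])
          (ν 0 ⊑ₙ ν 1 :* ν 1 :+ # 2 :* ν 1))) ∷ 2 ✕ ν 1 :* χ 2 ≐ χ 3 ∶ ι*inv-* 1≤s 1≤s ∷ []) (χ 0 :- χ 1 ⊑ # 2 :* χ 3)

    -- Stands for log y = 2 log √y: additivity gives ℓ (s s) = 2 ℓ s, and y exceeds s s by at most 2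
    -- s.
    H-sqrt-upper : H y ≤ ι 2 * H s - γ + ι 3 * inv s
    H-sqrt-upper = certify [] (H y ∷ H (s *ₙ s) ∷ inv s ∷ γ ∷ inv (s *ₙ s) ∷ ℓ (s *ₙ s) ∷ ℓ s ∷ H s ∷ []) 0 (1 ✕ χ 0
        :- χ 1 ⊑ # 2 :* χ 2 ∶ tail ∷ 1 ✕ χ 1 :- χ 3 :- χ 4 ⊑ χ 5 ∶ ℓ-lower (s *ₙ s) 1≤ss ss≤X ∷ 1 ✕ χ 5 ≐ χ 6 :+ χ 6 ∶
        ℓss ∷ 2 ✕ χ 6 ⊑ χ 7 :- χ 3 ∶ ℓ-upper s 1≤s s≤X ∷ 1 ✕ χ 4 ⊑ χ 2 ∶ i≤ ∷ []) (χ 0 ⊑ # 2 :* χ 7 :- χ 3 :+ # 3 :* χ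
        2)

    H-sqrt-lower : ι 2 * H s - γ - ι 2 * inv s ≤ H y
    H-sqrt-lower = certify [] (H (s *ₙ s) ∷ H y ∷ ℓ (s *ₙ s) ∷ γ ∷ ℓ s ∷ H s ∷ inv s ∷ []) 0 (1 ✕ χ 0 ⊑ χ 1 ∶ H-mono
        lo ∷ 1 ✕ χ 2 ⊑ χ 0 :- χ 3 ∶ ℓ-upper (s *ₙ s) 1≤ss ss≤X ∷ 1 ✕ χ 4 :+ χ 4 ≐ χ 2 ∶ sym (ℓss) ∷ 2 ✕ χ 5 :- χ 3 :-
        χ 6 ⊑ χ 4 ∶ ℓ-lower s 1≤s s≤X ∷ []) (# 2 :* χ 5 :- χ 3 :- # 2 :* χ 6 ⊑ χ 1)

    H≤5s : H y ≤ ι 5 * ι s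
    H≤5s = certify (s ∷ []) (H y ∷ H s ∷ γ ∷ inv s ∷ []) 0 (1 ✕ χ 0 ⊑ # 2 :* χ 1 :- χ 2 :+ # 3 :* χ 3 ∶ H-sqrt-upper
        ∷ 2 ✕ χ 1 ⊑ ν 0 ∶ H-≤ s ∷ 1 ✕ # 0 ⊑ χ 2 ∶ 0≤γ ∷ 3 ✕ χ 3 ⊑ # 1 ∶ inv≤1 s ∷ 3 ✕ # 1 ⊑ₙ ν 0 ∶ 1≤s ∷ []) (χ 0 ⊑ #
        5 :* ν 0)

    private
      D = Dsum-bounds y s lo hi
      D₁ = proj₁ D
      D₂ = proj₂ D
      y/s : ι y * inv s ≤ ι 3 * ι s
      y/s = certify (y ∷ s ∷ []) (inv s ∷ []) 0 (1 ✕ χ 0 :* ν 0 ⊑ χ 0 :* ⌜ ν 1 :* ν 1 :+ # 2 :* ν 1 ⌝ ∶ *-monoˡ (inv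
          s) (0≤inv s) (ι-mono (certify (y ∷ s ∷ []) [] 0 (1 ✕ ν 0 ⊏ₙ (# 1 :+ ν 1) :* (# 1 :+ ν 1) ∶ hi ∷ []) (ν 0 ⊑ₙ
          ν 1 :* ν 1 :+ # 2 :* ν 1))) ∷ 1 ✕ ν 1 :* (ν 1 :* χ 0) ≐ ν 1 :* # 1 ∶ cong (ι s *_) (ι*inv 1≤s) ∷ 2 ✕ ν 1 :*
          χ 0 ≐ # 1 ∶ ι*inv 1≤s ∷ 2 ✕ # 1 ⊑ₙ ν 1 ∶ 1≤s ∷ []) (ν 0 :* χ 0 ⊑ # 3 :* ν 1)

    -- With L = log y, T y is about y L - y and Dsum y about y L + (2γ - 1) y. All terms of order y
    -- cancel, and what remains is the O(√y) of Dirichlet's divisor sum.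
    E-upper : T y - Dsum y + ι 2 * γ * ι y ≤ ι 16 * ι s
    E-upper = certify (y ∷ s ∷ []) (T y ∷ H y ∷ γ ∷ H s ∷ inv s ∷ Dsum y ∷ []) 0 (1 ✕ χ 0 ⊑ (ν 0 :+ # 1) :* χ 1 :- ν
        0 :- χ 2 :* ν 0 ∶ T-upper y y≤X ∷ 1 ✕ ν 0 :* χ 1 ⊑ ν 0 :* (# 2 :* χ 3 :- χ 2 :+ # 3 :* χ 4) ∶ *-monoˡ (ι y)
        (0≤ι y) H-sqrt-upper ∷ 3 ✕ ν 0 :* χ 4 ⊑ # 3 :* ν 1 ∶ y/s ∷ 1 ✕ # 2 :* ν 0 :* χ 3 :- # 2 :* ν 1 :- ν 1 :* ν 1 ⊑
        χ 5 ∶ D₁ ∷ 1 ✕ χ 1 ⊑ # 5 :* ν 1 ∶ H≤5s ∷ 1 ✕ ν 1 :* ν 1 ⊑ₙ ν 0 ∶ lo ∷ []) (χ 0 :- χ 5 :+ # 2 :* χ 2 :* ν 0 ⊑ #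
        16 :* ν 1)

    E-lower : - (ι 16 * ι s) ≤ T y - Dsum y + ι 2 * γ * ι y
    E-lower = certify (y ∷ s ∷ []) (H y ∷ γ ∷ T y ∷ H s ∷ inv s ∷ Dsum y ∷ []) 0 (1 ✕ ν 0 :* χ 0 :- ν 0 :- χ 1 :* ν 0
        ⊑ χ 2 ∶ T-lower y y≤X ∷ 1 ✕ ν 0 :* (# 2 :* χ 3 :- χ 1 :- # 2 :* χ 4) ⊑ ν 0 :* χ 0 ∶ *-monoˡ (ι y) (0≤ι y)
        H-sqrt-lower ∷ 2 ✕ ν 0 :* χ 4 ⊑ # 3 :* ν 1 ∶ y/s ∷ 1 ✕ χ 5 ⊑ # 2 :* ν 0 :* χ 3 :- ν 1 :* ν 1 ∶ D₂ ∷ 1 ✕ ν 0 ⊏ₙ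
        (# 1 :+ ν 1) :* (# 1 :+ ν 1) ∶ hi ∷ []) (:- (# 16 :* ν 1) ⊑ χ 2 :- χ 5 :+ # 2 :* χ 1 :* ν 0)

  τ : ℕ → ℚ
  τ m = ∑ X (λ a → 𝟙 (a ∣? m) * 1ℚ)

  divisors-≤ : ∀ {y m} (G : ℕ → ℚ) → 1 ≤ₙ m → m ≤ₙ y → y ≤ₙ X → ∑ X (λ a → 𝟙 (a ∣? m) * G a) ≡ ∑ y (λ a → 𝟙 (a ∣? m) * G a)
  divisors-≤ {y} {m} G 1≤m m≤y y≤X = ∑-extend (λ a → 𝟙 (a ∣? m) * G a) y≤X λ a y≤a _ →
    trans (cong (_* G (suc a)) (𝟙-no (suc a ∣? m) λ d → ℕₚ.<⇒≱ (s≤s (ℕₚ.≤-trans m≤y y≤a)) (∣⇒≤ {{ℕ.>-nonZero 1≤m}} d))) (ℚₚ.*-zeroˡ (G (suc a)))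

  private
    weighted : ∀ y → y ≤ₙ X → (f G : ℕ → ℚ) → ∑ y (λ m → f m * ∑ X (λ a → 𝟙 (a ∣? m) * G a)) ≡ ∬ y (λ a b → G a * f (a *ₙ b))
    weighted y y≤X f G = trans
      (∑-cong y λ m m<y → trans (cong (f (suc m) *_) (divisors-≤ G (s≤s z≤n) m<y y≤X)) (trans (sym (∑-*ˡ y (f (suc m)) (λ a → 𝟙 (a ∣? suc m) * G a)))
        (∑-cong y λ a _ → (certify [] (f (suc m) ∷ 𝟙 (suc a ∣? suc m) ∷ G (suc a) ∷ []) 0 [] (χ 0 :* (χ 1 :* χ 2) ≐ χ
            1 :* (χ 2 :* χ 0))))))
      (∑-divisors y (λ a m → G a * f m))

    ℓ-box : ∀ {m} → 1 ≤ₙ m → m ≤ₙ X → ∑ X (λ a → 𝟙 (a ∣? m) * Λ a) ≡ ℓ m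
    ℓ-box {m} 1≤m m≤X = ℓ-divisors X m 1≤m m≤X

    ∬-outer : ∀ y (F : ℕ → ℚ) → ∬ y (λ a _ → F a) ≡ ∑ y (λ a → F a * ι (y ÷ a))
    ∬-outer y F = ∑-cong y λ a _ → trans (∑-const (y ÷ suc a) (F (suc a))) (ℚₚ.*-comm (ι (y ÷ suc a)) (F (suc a)))

    one*ℓ : ∀ y → y ≤ₙ X → T y ≡ ∬ y (λ a _ → Λ a)
    one*ℓ y y≤X = trans (∑-cong y λ m m<y → trans (sym (ℓ-box (s≤s z≤n) (ℕₚ.≤-trans m<y y≤X))) (sym (ℚₚ.*-identityˡ _)))
      (trans (weighted y y≤X (λ _ → 1ℚ) Λ) (∬-cong y λ a b → ℚₚ.*-identityʳ (Λ (suc a))))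

  T≡∑Λ÷ : ∀ y → y ≤ₙ X → T y ≡ ∑ y (λ a → Λ a * ι (y ÷ a))
  T≡∑Λ÷ y y≤X = trans (one*ℓ y y≤X) (∬-outer y Λ)

  T≡∑ψ : ∀ y → y ≤ₙ X → T y ≡ ∑ y (λ c → ψ (y ÷ c))
  T≡∑ψ y y≤X = trans (one*ℓ y y≤X) (∬-swap y (λ a _ → Λ a))

  ∑τ≡Dsum : ∀ y → y ≤ₙ X → ∑ y τ ≡ Dsum y
  ∑τ≡Dsum y y≤X = trans (∑-cong y λ m _ → sym (ℚₚ.*-identityˡ (τ (suc m)))) (trans (weighted y y≤X (λ _ → 1ℚ) (λ _ → 1ℚ))
    (trans (∬-outer y (λ _ → 1ℚ * 1ℚ)) (∑-cong y λ a _ → ℚₚ.*-identityˡ (ι (y ÷ suc a)))))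

  -- `S` is the left side of Selberg's formula. The term 2γψ in `V` corresponds to the constant 2γ
  -- in `g`, which is what makes the partial sums of `g` small.
  S V W g : ℕ → ℚ
  S z = ∑ z (λ a → Λ a * ℓ a) + ∑ z (λ a → Λ a * ψ (z ÷ a))
  V z = S z - ι 2 * T z + ι 2 * γ * ψ z
  g m = ℓ m - τ m + ι 2 * γ
  W y = ∑ y (λ m → ℓ m * g m)

  ∑g : ∀ y → y ≤ₙ X → ∑ y g ≡ T y - Dsum y + ι 2 * γ * ι y
  ∑g y y≤X = trans (∑-+ y (λ m → ℓ m - τ m) (λ _ → ι 2 * γ)) (cong₂ _+_
    (trans (∑-- y ℓ τ) (cong (ℚ._-_ (T y)) (∑τ≡Dsum y y≤X))) (trans (∑-const y (ι 2 * γ)) (ℚₚ.*-comm (ι y) (ι 2 * γ))))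

  private
    -- The identity log² = 1 ∗ (Λ log + Λ ∗ Λ) in summed form: one factor ℓ m is expanded over the
    -- divisors a of m = a b, the other is split as ℓ a + ℓ b.
    ℓℓ : ∀ y → y ≤ₙ X → ∑ y (λ m → ℓ m * ℓ m) ≡ ∑ y (λ c → S (y ÷ c))
    ℓℓ y y≤X = begin
      ∑ y (λ m → ℓ m * ℓ m)
        ≡⟨ ∑-cong y (λ m m<y → cong (ℓ (suc m) *_) (sym (ℓ-box (s≤s z≤n) (ℕₚ.≤-trans m<y y≤X)))) ⟩
      ∑ y (λ m → ℓ m * ∑ X (λ a → 𝟙 (a ∣? m) * Λ a))
        ≡⟨ weighted y y≤X ℓ Λ ⟩
      ∬ y (λ a b → Λ a * ℓ (a *ₙ b))
        ≡⟨ ∬-cong-≤ y (λ a b h → trans (cong (Λ (suc a) *_) (ℓ-* (suc a) (suc b) (s≤s z≤n) (s≤s z≤n) (ℕₚ.≤-trans h y≤X)))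
             (ℚₚ.*-distribˡ-+ (Λ (suc a)) (ℓ (suc a)) (ℓ (suc b)))) ⟩
      ∬ y (λ a b → Λ a * ℓ a + Λ a * ℓ b)
        ≡⟨ ∬-+ y (λ a b → Λ a * ℓ a) (λ a b → Λ a * ℓ b) ⟩
      ∬ y (λ a b → Λ a * ℓ a) + ∬ y (λ a b → Λ a * ℓ b)
        ≡⟨ cong₂ _+_ (∬-swap y (λ a b → Λ a * ℓ a)) second ⟩
      ∑ y (λ c → ∑ (y ÷ c) (λ a → Λ a * ℓ a)) + ∑ y (λ c → ∑ (y ÷ c) (λ a → Λ a * ψ (y ÷ c ÷ a)))
        ≡⟨ sym (∑-+ y (λ c → ∑ (y ÷ c) (λ a → Λ a * ℓ a)) (λ c → ∑ (y ÷ c) (λ a → Λ a * ψ (y ÷ c ÷ a)))) ⟩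
      ∑ y (λ c → S (y ÷ c)) ∎
      where
      open ≡-Reasoning
      second : ∬ y (λ a b → Λ a * ℓ b) ≡ ∑ y (λ c → ∑ (y ÷ c) (λ a → Λ a * ψ (y ÷ c ÷ a)))
      second = trans (∑-cong y λ a _ → trans (∑-*ˡ (y ÷ suc a) (Λ (suc a)) ℓ)
          (trans (cong (Λ (suc a) *_) (T≡∑ψ (y ÷ suc a) (ℕₚ.≤-trans (÷-≤ y (suc a)) y≤X))) (sym (∑-*ˡ (y ÷ suc a) (Λ (suc a)) (λ c → ψ (y ÷ suc a ÷ c))))))
        (trans (∬-swap y (λ a c → Λ a * ψ (y ÷ a ÷ c)))
          (∬-cong y {λ c a → Λ a * ψ (y ÷ a ÷ c)} λ c a → cong (λ t → Λ (suc a) * ψ t) (÷-comm y (suc a) (suc c))))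

    ℓτ : ∀ y → y ≤ₙ X → ∑ y (λ m → ℓ m * τ m) ≡ ι 2 * ∑ y (λ c → T (y ÷ c))
    ℓτ y y≤X = begin
      ∑ y (λ m → ℓ m * τ m) ≡⟨ weighted y y≤X ℓ (λ _ → 1ℚ) ⟩
      ∬ y (λ a b → 1ℚ * ℓ (a *ₙ b))
        ≡⟨ ∬-cong-≤ y (λ a b h → trans (ℚₚ.*-identityˡ (ℓ (suc a *ₙ suc b))) (ℓ-* (suc a) (suc b) (s≤s z≤n) (s≤s z≤n) (ℕₚ.≤-trans h y≤X))) ⟩
      ∬ y (λ a b → ℓ a + ℓ b) ≡⟨ ∬-+ y (λ a _ → ℓ a) (λ _ b → ℓ b) ⟩
      ∬ y (λ a _ → ℓ a) + ∬ y (λ _ b → ℓ b) ≡⟨ cong (ℚ._+ ∬ y (λ _ b → ℓ b)) (∬-swap y (λ a _ → ℓ a)) ⟩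
      Z + Z ≡⟨ (certify [] (Z ∷ []) 0 [] (χ 0 :+ χ 0 ≐ # 2 :* χ 0)) ⟩
      ι 2 * Z ∎
      where open ≡-Reasoning
            Z = ∑ y (λ c → T (y ÷ c))

  -- Convolution with 1 turns the three terms of `V` into ℓ², ℓ τ and 2γ ℓ. All contain ℓ, which
  -- leaves ℓ g, a product suited to summation by parts.
  V*1≡W : ∀ y → y ≤ₙ X → ∑ y (λ c → V (y ÷ c)) ≡ W y
  V*1≡W y y≤X = trans
    (trans (∑-+ y (λ c → S (y ÷ c) - ι 2 * T (y ÷ c)) (λ c → ι 2 * γ * ψ (y ÷ c)))
      (cong₂ _+_ (trans (∑-- y (λ c → S (y ÷ c)) (λ c → ι 2 * T (y ÷ c))) (cong₂ _-_ (sym (ℓℓ y y≤X))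
                   (trans (∑-*ˡ y (ι 2) (λ c → T (y ÷ c))) (sym (ℓτ y y≤X)))))
                 (trans (∑-*ˡ y (ι 2 * γ) (λ c → ψ (y ÷ c))) (cong (ι 2 * γ *_) (sym (T≡∑ψ y y≤X))))))
    (sym (trans (∑-cong y λ m _ → (certify [] (ℓ (suc m) ∷ τ (suc m) ∷ γ ∷ []) 0 [] (χ 0 :* (χ 0 :- χ 1 :+ # 2 :* χ
        2) ≐ χ 0 :* χ 0 :- χ 0 :* χ 1 :+ # 2 :* χ 2 :* χ 0)))
      (trans (∑-+ y (λ m → ℓ m * ℓ m - ℓ m * τ m) (λ m → ι 2 * γ * ℓ m))
        (cong₂ _+_ (∑-- y (λ m → ℓ m * ℓ m) (λ m → ℓ m * τ m)) (∑-*ˡ y (ι 2 * γ) ℓ)))))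

-- Chebyshev and Mertens bounds

ι-cancelˡ : ∀ {x a b} → 1 ≤ₙ x → ι x * a ≤ ι x * b → a ≤ b
ι-cancelˡ {suc x} _ = ℚₚ.*-cancelˡ-≤-pos (ι (suc x)) {{ℚ.positive (certify (x ∷ []) [] 0 [] (# 0 ⊏ ⌜ # 1 :+ ν 0 ⌝))}}

mul-bounds : ∀ {d e D c} → 0ℚ ≤ d → d ≤ D → - c ≤ e → e ≤ c → - (D * c) ≤ d * e × d * e ≤ D * c
mul-bounds {d} {e} {D} {c} 0≤d d≤D -c≤e e≤c =
  (certify [] (d ∷ c ∷ e ∷ D ∷ []) 0 (1 ✕ χ 0 :* :- χ 1 ⊑ χ 0 :* χ 2 ∶ *-monoˡ d 0≤d -c≤e ∷ 1 ✕ χ 1 :* χ 0 ⊑ χ 1 :* χ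
      3 ∶ *-monoˡ c 0≤c d≤D ∷ []) (:- (χ 3 :* χ 1) ⊑ χ 0 :* χ 2)) ,
  (certify [] (d ∷ e ∷ c ∷ D ∷ []) 0 (1 ✕ χ 0 :* χ 1 ⊑ χ 0 :* χ 2 ∶ *-monoˡ d 0≤d e≤c ∷ 1 ✕ χ 2 :* χ 0 ⊑ χ 2 :* χ 3 ∶
      *-monoˡ c 0≤c d≤D ∷ []) (χ 0 :* χ 1 ⊑ χ 3 :* χ 2))
  where 0≤c : 0ℚ ≤ c
        0≤c = certify [] (c ∷ e ∷ []) 1 (1 ✕ :- χ 0 ⊑ χ 1 ∶ -c≤e ∷ 1 ✕ χ 1 ⊑ χ 0 ∶ e≤c ∷ []) (# 0 ⊑ χ 0)

-- Absorbs a term linear in s into a small multiple of s², without square roots.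
am : ∀ s {q} → 1 ≤ₙ q → ι s ≤ ι q + ι s * ι s * inv q
am s {q} 1≤q with ℕₚ.≤-total s q
... | inj₁ s≤q = certify (s ∷ q ∷ []) (inv q ∷ []) 0 (1 ✕ ν 0 ⊑ ν 1 ∶ ι-mono s≤q ∷ 1 ✕ # 0 ⊑ ν 0 :* ν 0 :* χ 0 ∶
    *-nonNeg (*-nonNeg (0≤ι s) (0≤ι s)) (0≤inv q) ∷ []) (ν 0 ⊑ ν 1 :+ ν 0 :* ν 0 :* χ 0)
... | inj₂ q≤s = certify (s ∷ q ∷ []) (inv q ∷ []) 0 (1 ✕ ν 0 :* χ 0 :* ν 1 ⊑ ν 0 :* χ 0 :* ν 0 ∶ *-monoˡ (ι s * inv
    q) (*-nonNeg (0≤ι s) (0≤inv q)) (ι-mono q≤s) ∷ 1 ✕ ν 0 :* # 1 ≐ ν 0 :* (ν 1 :* χ 0) ∶ sym (cong (ι s *_) (ι*inv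
    1≤q)) ∷ []) (ν 0 ⊑ ν 1 :+ ν 0 :* ν 0 :* χ 0)

H-sublinear : ∀ s {k} → 1 ≤ₙ k → H s ≤ ι k + ι s * inv k
H-sublinear s {k} 1≤k with ℕₚ.≤-total s k
... | inj₁ s≤k = certify (s ∷ k ∷ []) (H s ∷ inv k ∷ []) 0 (1 ✕ χ 0 ⊑ ν 0 ∶ H-≤ s ∷ 1 ✕ ν 0 ⊑ ν 1 ∶ ι-mono s≤k ∷ 1 ✕
    # 0 ⊑ ν 0 :* χ 1 ∶ *-nonNeg (0≤ι s) (0≤inv k) ∷ []) (χ 0 ⊑ ν 1 :+ ν 0 :* χ 1)
... | inj₂ k≤s = certify (k ∷ s ∷ []) (H k ∷ H s ∷ inv k ∷ []) 0 (1 ✕ χ 0 ⊑ ν 0 ∶ H-≤ k ∷ 1 ✕ χ 1 :- χ 0 ⊑ (ν 1 :- ν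
    0) :* χ 2 ∶ H-growth 1≤k k≤s ∷ 1 ✕ # 0 ⊑ ν 0 :* χ 2 ∶ *-nonNeg (0≤ι k) (0≤inv k) ∷ []) (χ 1 ⊑ ν 0 :+ ν 1 :* χ 2)

-- Kept abstract since normalising products with numerals is expensive.
abstract
  B : ℕ → ℕ
  B j = 48 *ₙ (144 *ₙ j) *ₙ ((2 *ₙ (144 *ₙ j) +ₙ 3) *ₙ (2 *ₙ (144 *ₙ j) +ₙ 3))

  B-def : ∀ j → B j ≡ 48 *ₙ (144 *ₙ j) *ₙ ((2 *ₙ (144 *ₙ j) +ₙ 3) *ₙ (2 *ₙ (144 *ₙ j) +ₙ 3))
  B-def j = refl

module Bounds {X : ℕ} (L : LogUpTo X) (1≤X : 1 ≤ₙ X) where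
  open LogUpTo L
  open Selberg L 1≤X

  private
    module _ (y s : ℕ) (1≤s : 1 ≤ₙ s) (lo : s *ₙ s ≤ₙ y) (hi : y <ₙ suc s *ₙ suc s) (y≤X : y ≤ₙ X) where
      c : ℚ
      c = ι 16 * ι s

      E-bounds : ∀ m → m ≤ₙ y → - c ≤ ∑ m g × ∑ m g ≤ c
      E-bounds zero _ = (certify (s ∷ []) [] 0 [] (:- (# 16 :* ν 0) ⊑ # 0)) , (certify (s ∷ []) [] 0 [] (# 0 ⊑ # 16
          :* ν 0))
      E-bounds m@(suc _) m≤y with isqrt m
      ... | zero , lo′ , s≤s ()
      ... | r@(suc _) , lo′ , hi′ =
        (certify (r ∷ m ∷ s ∷ []) (T m ∷ Dsum m ∷ γ ∷ ∑ m g ∷ []) 0 (1 ✕ :- (# 16 :* ν 0) ⊑ χ 0 :- χ 1 :+ # 2 :* χ 2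
            :* ν 1 ∶ E-lower m r (s≤s z≤n) lo′ hi′ m≤X ∷ 1 ✕ χ 0 :- χ 1 :+ # 2 :* χ 2 :* ν 1 ≐ χ 3 ∶ sym (∑g m m≤X) ∷
            16 ✕ ν 0 ⊑ₙ ν 2 ∶ r≤s ∷ []) (:- (# 16 :* ν 2) ⊑ χ 3)) ,
        (certify (m ∷ r ∷ s ∷ []) (T m ∷ Dsum m ∷ γ ∷ ∑ m g ∷ []) 0 (1 ✕ χ 0 :- χ 1 :+ # 2 :* χ 2 :* ν 0 ⊑ # 16 :* ν
            1 ∶ E-upper m r (s≤s z≤n) lo′ hi′ m≤X ∷ 1 ✕ χ 3 ≐ χ 0 :- χ 1 :+ # 2 :* χ 2 :* ν 0 ∶ ∑g m m≤X ∷ 16 ✕ ν 1 ⊑ₙ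
            ν 2 ∶ r≤s ∷ []) (χ 3 ⊑ # 16 :* ν 2))
        where
        m≤X = ℕₚ.≤-trans m≤y y≤X
        r≤s : r ≤ₙ s
        r≤s = ℕₚ.≮⇒≥ λ s<r → ℕₚ.<⇒≱ (ℕₚ.≤-<-trans (ℕₚ.≤-trans lo′ m≤y) hi) (ℕₚ.*-mono-≤ s<r s<r)

      -- Summation by parts: the increments of ℓ lie between 0 and 2 / n, and the partial sums of
      -- `g` between - c and c.
      abel : ∀ m → suc m ≤ₙ y → - (ι 2 * c * H m) ≤ W (suc m) - ℓ (suc m) * ∑ (suc m) g × W (suc m) - ℓ (suc m) * ∑ (suc m) g ≤ ι 2 * c * H m
      abel zero _ = (certify [] (c ∷ ℓ 1 ∷ g 1 ∷ []) 0 [] (:- (# 2 :* χ 0 :* # 0) ⊑ # 0 :+ χ 1 :* χ 2 :- χ 1 :* (# 0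
          :+ χ 2))) , (certify [] (ℓ 1 ∷ g 1 ∷ c ∷ []) 0 [] (# 0 :+ χ 0 :* χ 1 :- χ 0 :* (# 0 :+ χ 1) ⊑ # 2 :* χ 2 :*
              # 0))
      abel (suc m) m<y =
        (certify [] (c ∷ H m ∷ Wn ∷ ℓ n ∷ En ∷ ℓ (suc n) ∷ inv n ∷ g (suc n) ∷ []) 0 (1 ✕ :- (# 2 :* χ 0 :* χ 1) ⊑ χ
            2 :- χ 3 :* χ 4 ∶ ih₁ ∷ 1 ✕ (χ 5 :- χ 3) :* χ 4 ⊑ # 2 :* χ 6 :* χ 0 ∶ mb₂ ∷ []) (:- (# 2 :* χ 0 :* (χ 1 :+
            χ 6)) ⊑ χ 2 :+ χ 5 :* χ 7 :- χ 5 :* (χ 4 :+ χ 7))) ,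
        (certify [] (Wn ∷ ℓ n ∷ En ∷ c ∷ H m ∷ inv n ∷ ℓ (suc n) ∷ g (suc n) ∷ []) 0 (1 ✕ χ 0 :- χ 1 :* χ 2 ⊑ # 2 :*
            χ 3 :* χ 4 ∶ ih₂ ∷ 1 ✕ :- (# 2 :* χ 5 :* χ 3) ⊑ (χ 6 :- χ 1) :* χ 2 ∶ mb₁ ∷ []) (χ 0 :+ χ 6 :* χ 7 :- χ 6
            :* (χ 2 :+ χ 7) ⊑ # 2 :* χ 3 :* (χ 4 :+ χ 5)))
        where
        n = suc m
        Wn = W n
        En = ∑ n g
        ih = abel m (ℕₚ.<⇒≤ m<y)
        ih₁ = proj₁ ih
        ih₂ = proj₂ ih
        n<X = ℕₚ.≤-trans m<y y≤X
        n≤X = ℕₚ.<⇒≤ n<X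
        up = ℓ-upper (suc n) (s≤s z≤n) n<X
        low = ℓ-lower n (s≤s z≤n) n≤X
        up′ = ℓ-upper n (s≤s z≤n) n≤X
        low′ = ℓ-lower (suc n) (s≤s z≤n) n<X
        d≤ : ℓ (suc n) - ℓ n ≤ ι 2 * inv n
        d≤ = certify [] (ℓ (suc n) ∷ H n ∷ inv (suc n) ∷ γ ∷ inv n ∷ ℓ n ∷ []) 0 (1 ✕ χ 0 ⊑ χ 1 :+ χ 2 :- χ 3 ∶ up ∷
            1 ✕ χ 1 :- χ 3 :- χ 4 ⊑ χ 5 ∶ low ∷ 1 ✕ χ 2 ⊑ χ 4 ∶ inv-anti {n} (s≤s z≤n) (ℕₚ.n≤1+n n) ∷ []) (χ 0 :- χ 5
            ⊑ # 2 :* χ 4)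
        -- The upper bound for ℓ n and the lower bound for ℓ (suc n) are both H n - γ.
        0≤d : 0ℚ ≤ ℓ (suc n) - ℓ n
        0≤d = certify [] (ℓ n ∷ H n ∷ γ ∷ inv (suc n) ∷ ℓ (suc n) ∷ []) 0 (1 ✕ χ 0 ⊑ χ 1 :- χ 2 ∶ up′ ∷ 1 ✕ χ 1 :+ χ
            3 :- χ 2 :- χ 3 ⊑ χ 4 ∶ low′ ∷ []) (# 0 ⊑ χ 4 :- χ 0)
        eb = E-bounds n (ℕₚ.<⇒≤ m<y)
        mb = mul-bounds 0≤d d≤ (proj₁ eb) (proj₂ eb)
        mb₁ = proj₁ mb
        mb₂ = proj₂ mb

      W-sqrt : 1 ≤ₙ y → - (ι 48 * ι s * H y) ≤ W y × W y ≤ ι 48 * ι s * H y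
      W-sqrt 1≤y = from y 1≤y ℕₚ.≤-refl
        where
        from : ∀ n → 1 ≤ₙ n → n ≤ₙ y → - (ι 48 * ι s * H n) ≤ W n × W n ≤ ι 48 * ι s * H n
        from n@(suc m) 1≤n n≤y =
          (certify (s ∷ []) (c ∷ H m ∷ Wn ∷ ℓ n ∷ En ∷ H n ∷ []) 0 (1 ✕ :- (# 2 :* χ 0 :* χ 1) ⊑ χ 2 :- χ 3 :* χ 4 ∶
              ab₁ ∷ 1 ✕ :- (χ 5 :* χ 0) ⊑ χ 3 :* χ 4 ∶ mb₁ ∷ 2 ✕ χ 0 :* χ 1 ⊑ χ 0 :* χ 5 ∶ cH ∷ 3 ✕ χ 0 :* χ 5 ≐ # 16
              :* ν 0 :* χ 5 ∶ cong (_* H n) c≡ ∷ []) (:- (# 48 :* ν 0 :* χ 5) ⊑ χ 2)) ,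
          (certify (s ∷ []) (Wn ∷ ℓ n ∷ En ∷ c ∷ H m ∷ H n ∷ []) 0 (1 ✕ χ 0 :- χ 1 :* χ 2 ⊑ # 2 :* χ 3 :* χ 4 ∶ ab₂ ∷
              1 ✕ χ 1 :* χ 2 ⊑ χ 5 :* χ 3 ∶ mb₂ ∷ 2 ✕ χ 3 :* χ 4 ⊑ χ 3 :* χ 5 ∶ cH ∷ 3 ✕ χ 3 :* χ 5 ≐ # 16 :* ν 0 :* χ
              5 ∶ cong (_* H n) c≡ ∷ []) (χ 0 ⊑ # 48 :* ν 0 :* χ 5))
          where
          c≡ : c ≡ ι 16 * ι s
          c≡ = refl
          Wn = W n
          En = ∑ n g
          ab = abel m n≤y
          ab₁ = proj₁ ab
          ab₂ = proj₂ ab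
          eb = E-bounds n n≤y
          ℓ≤H : ℓ n ≤ H n
          ℓ≤H = certify [] (ℓ n ∷ H n ∷ γ ∷ []) 0 (1 ✕ χ 0 ⊑ χ 1 :- χ 2 ∶ ℓ-upper n 1≤n (ℕₚ.≤-trans n≤y y≤X) ∷ 1 ✕ #
              0 ⊑ χ 2 ∶ 0≤γ ∷ []) (χ 0 ⊑ χ 1)
          mb = mul-bounds (ℓ-nonNeg n) ℓ≤H (proj₁ eb) (proj₂ eb)
          mb₁ = proj₁ mb
          mb₂ = proj₂ mb
          cH : c * H m ≤ c * H n
          cH = *-monoˡ c (certify (s ∷ []) [] 0 [] (# 0 ⊑ # 16 :* ν 0)) (H-mono (ℕₚ.n≤1+n m))

      -- By `H≤`, s H y is at most s K + 2 s² / k, and `am` with q = k K replaces s K by k K² + s² /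
      -- k. The total 48 · 3 s² / k is s² / j for k = 144 j, and 48 k K² is the constant `B j`.
      sH-bound : ∀ j → 1 ≤ₙ j → ι 48 * ι s * H y ≤ ι (B j) + ι y * inv j
      sH-bound j 1≤j = certify (s ∷ k ∷ K ∷ y ∷ B j ∷ []) (H y ∷ inv k ∷ inv (k *ₙ K) ∷ inv j ∷ []) 0 (48 ✕ ν 0 :* χ
          0 ⊑ ν 0 :* (# 2 :* (ν 1 :+ ν 0 :* χ 1) :+ # 3) ∶ *-monoˡ (ι s) (0≤ι s) H≤ ∷ 48 ✕ ν 2 :* ν 0 ⊑ ν 2 :* (⌜ ν 1
          :* ν 2 ⌝ :+ ν 0 :* ν 0 :* χ 2) ∶ *-monoˡ (ι K) (0≤ι K) (am s {k *ₙ K} 1≤kK) ∷ 48 ✕ ν 0 :* ν 0 :* (ν 2 :* χ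
          2) ≐ ν 0 :* ν 0 :* χ 1 ∶ cong (ι s * ι s *_) invK ∷ 144 ✕ χ 1 :* ⌜ ν 0 :* ν 0 ⌝ ⊑ χ 1 :* ν 3 ∶ *-monoˡ (inv
          k) (0≤inv k) (ι-mono lo) ∷ 1 ✕ ν 3 :* (# 144 :* χ 1) ≐ ν 3 :* χ 3 ∶ cong (ι y *_) (ι*inv-* {144} {j} (s≤s
          z≤n) 1≤j) ∷ 48 ✕ ⌜ # 2 :* ν 1 :+ # 3 ⌝ :* ν 0 ≐ ν 2 :* ν 0 ∶ sym (cong (λ t → ι t * ι s) K≡) ∷ 1 ✕ ⌜ # 48 :*
          ν 1 :* (ν 2 :* ν 2) ⌝ ≐ ν 4 ∶ sym (cong ι B≡) ∷ []) (# 48 :* ν 0 :* χ 0 ⊑ ν 4 :+ ν 3 :* χ 3)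
        where
        k = 144 *ₙ j
        K = 2 *ₙ k +ₙ 3
        B≡ : B j ≡ 48 *ₙ k *ₙ (K *ₙ K)
        B≡ = B-def j
        K≡ : K ≡ 2 *ₙ k +ₙ 3
        K≡ = refl
        1≤k : 1 ≤ₙ k
        1≤k = ℕₚ.*-mono-≤ {1} {144} (s≤s z≤n) 1≤j
        1≤K : 1 ≤ₙ K
        1≤K = certify (k ∷ []) [] 0 [] (# 1 ⊑ₙ # 2 :* ν 0 :+ # 3)
        1≤kK : 1 ≤ₙ k *ₙ K
        1≤kK = ℕₚ.*-mono-≤ 1≤k 1≤K
        invK : ι K * inv (k *ₙ K) ≡ inv k
        invK = trans (cong (λ t → ι K * inv t) (ℕₚ.*-comm k K)) (ι*inv-* 1≤K 1≤k)
        H≤ : H y ≤ ι 2 * (ι k + ι s * inv k) + ι 3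
        H≤ = certify (k ∷ s ∷ []) (H y ∷ H s ∷ γ ∷ inv s ∷ inv k ∷ []) 0 (1 ✕ χ 0 ⊑ # 2 :* χ 1 :- χ 2 :+ # 3 :* χ 3 ∶
            H-sqrt-upper y s 1≤s lo hi y≤X ∷ 1 ✕ # 0 ⊑ χ 2 ∶ 0≤γ ∷ 3 ✕ χ 3 ⊑ # 1 ∶ inv≤1 s ∷ 2 ✕ χ 1 ⊑ ν 0 :+ ν 1 :* χ
            4 ∶ H-sublinear s 1≤k ∷ []) (χ 0 ⊑ # 2 :* (ν 0 :+ ν 1 :* χ 4) :+ # 3)

  ∣W∣≤ : ∀ j y → 1 ≤ₙ j → 1 ≤ₙ y → y ≤ₙ X → ∣ W y ∣ ≤ ι (B j) + ι y * inv j
  ∣W∣≤ j y 1≤j 1≤y y≤X with isqrt y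
  ... | zero , lo , hi = contradiction (ℕₚ.<-≤-trans hi 1≤y) (ℕₚ.<-irrefl refl)
  ... | s@(suc _) , lo , hi = ℚₚ.≤-trans (∣∣≤ (proj₁ Wb) (proj₂ Wb)) (sH-bound y s (s≤s z≤n) lo hi y≤X j 1≤j)
    where Wb = W-sqrt y s (s≤s z≤n) lo hi y≤X 1≤y

  -- Möbius inversion costs a factor log x on the error y / j. As j is free, the bound is still o(x
  -- log x).
  ∣V∣≤ : ∀ j x → 1 ≤ₙ j → 1 ≤ₙ x → x ≤ₙ X → ∣ V x ∣ ≤ ι x * ι (B j) + ι x * H x * inv j
  ∣V∣≤ j x 1≤j 1≤x x≤X = ℚₚ.≤-trans (∣V∣≤∑∣W∣ V x 1≤x) (ℚₚ.≤-trans (∑-mono x {g = λ d → ι (B j) + ι x * inv j * inv d} term)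
    (ℚₚ.≤-reflexive (trans (∑-+ x (λ _ → ι (B j)) (λ d → ι x * inv j * inv d)) (trans
      (cong₂ _+_ (∑-const x (ι (B j))) (∑-*ˡ x (ι x * inv j) inv))
      (certify (x ∷ B j ∷ []) (inv j ∷ H x ∷ []) 0 [] (ν 0 :* ν 1 :+ ν 0 :* χ 0 :* χ 1 ≐ ν 0 :* ν 1 :+ ν 0 :* χ 1 :*
          χ 0))))))
    where
    term : ∀ d → d <ₙ x → ∣ ∑ (x ÷ suc d) (λ c → V (x ÷ suc d ÷ c)) ∣ ≤ ι (B j) + ι x * inv j * inv (suc d)
    term d d<x = certify (B j ∷ q ∷ x ∷ []) (∣ ∑ q (λ c → V (q ÷ c)) ∣ ∷ inv j ∷ inv (suc d) ∷ []) 0 (1 ✕ χ 0 ⊑ ν 0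
        :+ ν 1 :* χ 1 ∶ subst (λ t → ∣ t ∣ ≤ ι (B j) + ι q * inv j) (sym (V*1≡W q q≤X)) (∣W∣≤ j q 1≤j (÷-big (s≤s z≤n)
        d<x) q≤X) ∷ 1 ✕ χ 1 :* ν 1 ⊑ χ 1 :* (ν 2 :* χ 2) ∶ *-monoˡ (inv j) (0≤inv j) (÷≤ x {suc d} (s≤s z≤n)) ∷ []) (χ
        0 ⊑ ν 0 :+ ν 2 :* χ 1 :* χ 2)
      where q = x ÷ suc d
            q≤X : q ≤ₙ X
            q≤X = ℕₚ.≤-trans (÷-≤ x (suc d)) x≤X

  private
    module _ (x : ℕ) (x≤X : x ≤ₙ X) where
      z = x ÷ 2
      2z≤x : 2 *ₙ z ≤ₙ x
      2z≤x = subst (_≤ₙ x) (ℕₚ.*-comm z 2) (÷-lower x 2)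
      x≤2z+1 : x ≤ₙ 2 *ₙ z +ₙ 1
      x≤2z+1 = certify (x ∷ z ∷ []) [] 0 (1 ✕ ν 0 ⊏ₙ ν 1 :* # 2 :+ # 2 ∶ ÷-upper x 2 (s≤s z≤n) ∷ []) (ν 0 ⊑ₙ # 2 :* ν
          1 :+ # 1)
      z≤x = ÷-≤ x 2
      z≤X = ℕₚ.≤-trans z≤x x≤X
      coef : ℕ → ℚ
      coef a = Λ a * (ι (x ÷ a) - ι 2 * ι (x ÷ a ÷ 2))

      T-2T : ∑ x coef ≡ T x - ι 2 * T z
      T-2T = trans (∑-cong x λ a _ → (certify (x ÷ suc a ∷ x ÷ suc a ÷ 2 ∷ []) (Λ (suc a) ∷ []) 0 [] (χ 0 :* (ν 0 :-
          # 2 :* ν 1) ≐ χ 0 :* ν 0 :- # 2 :* (χ 0 :* ν 1))))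
        (trans (∑-- x (λ a → Λ a * ι (x ÷ a)) (λ a → ι 2 * (Λ a * ι (x ÷ a ÷ 2)))) (cong₂ _-_ (sym (T≡∑Λ÷ x x≤X))
          (trans (∑-*ˡ x (ι 2) (λ a → Λ a * ι (x ÷ a ÷ 2))) (cong (ι 2 *_) (trans
            (trans (∑-cong x λ a _ → cong (λ t → Λ (suc a) * ι t) (÷-comm x (suc a) 2))
              (∑-extend (λ a → Λ a * ι (z ÷ a)) z≤x λ a z≤a _ → trans (cong (λ t → Λ (suc a) * ι t) (÷-small (s≤s z≤a))) (ℚₚ.*-zeroʳ (Λ (suc a)))))
            (sym (T≡∑Λ÷ z z≤X)))))))

      coef-nonNeg : ∀ a → 0ℚ ≤ coef a
      coef-nonNeg a = *-nonNeg (Λ-nonNeg a) (certify (x ÷ a ÷ 2 ∷ x ÷ a ∷ []) [] 0 (1 ✕ ν 0 :* # 2 ⊑ₙ ν 1 ∶ ÷-lower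
          (x ÷ a) 2 ∷ []) (# 0 ⊑ ν 1 :- # 2 :* ν 0))

      -- Chebyshev's device: ⌊x / a⌋ - 2 ⌊x / 2a⌋ is never negative, and at least 1 for z < a ≤ x.
      ψ-diff : ψ x - ψ z ≤ T x - ι 2 * T z
      ψ-diff = certify [] (∑ x Λ ∷ ∑ z Λ ∷ ∑ x coef ∷ ∑ z coef ∷ T x ∷ T z ∷ []) 0 (1 ✕ χ 0 :- χ 1 ⊑ χ 2 :- χ 3 ∶
          ∑-between z x Λ coef z≤x big ∷ 1 ✕ χ 2 ≐ χ 4 :- # 2 :* χ 5 ∶ T-2T ∷ 1 ✕ # 0 ⊑ χ 3 ∶ ∑-nonNeg z {coef} (λ a _
          → coef-nonNeg (suc a)) ∷ []) (χ 0 :- χ 1 ⊑ χ 4 :- # 2 :* χ 5)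
        where
        big : ∀ a → z ≤ₙ a → a <ₙ x → Λ (suc a) ≤ coef (suc a)
        big a z≤a a<x = certify [] (Λ (suc a) ∷ coef (suc a) ∷ []) 0 (1 ✕ χ 0 :* # 1 ⊑ χ 1 ∶ *-monoˡ (Λ (suc a))
            (Λ-nonNeg (suc a)) 1≤ ∷ []) (χ 0 ⊑ χ 1)
          where
          zero÷ : x ÷ suc a ÷ 2 ≡ 0
          zero÷ = trans (÷-comm x (suc a) 2) (÷-small (s≤s z≤a))
          1≤ : 1ℚ ≤ ι (x ÷ suc a) - ι 2 * ι (x ÷ suc a ÷ 2)
          1≤ = certify (x ÷ suc a ∷ x ÷ suc a ÷ 2 ∷ []) [] 0 (1 ✕ # 1 ⊑ₙ ν 0 ∶ ÷-big {x} {suc a} (s≤s z≤n) a<x ∷ 2 ✕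
              ν 1 ≐ₙ # 0 ∶ zero÷ ∷ []) (# 1 ⊑ ν 0 :- # 2 :* ν 1)

      T-2T≤ : 1 ≤ₙ x → T x - ι 2 * T z ≤ ι 5 * ι x
      T-2T≤ 1≤x with z in z≡
      ... | zero = subst (λ t → T t - ι 2 * 0ℚ ≤ ι 5 * ι t) (sym x≡1) (certify [] (ℓ 1 ∷ []) 0 (1 ✕ χ 0 ≐ # 0 ∶ ℓ1 ∷
          []) (# 0 :+ χ 0 :- # 2 :* # 0 ⊑ # 5 :* # 1))
        where x≡1 : x ≡ 1
              x≡1 = ℕₚ.≤-antisym (subst (λ t → x ≤ₙ 2 *ₙ t +ₙ 1) z≡ x≤2z+1) 1≤x
      ... | v@(suc _) = certify (x ∷ v ∷ []) (T x ∷ H x ∷ γ ∷ H v ∷ T v ∷ []) 0 (1 ✕ χ 0 ⊑ (ν 0 :+ # 1) :* χ 1 :- ν 0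
          :- χ 2 :* ν 0 ∶ T-upper x x≤X ∷ 2 ✕ ν 1 :* χ 3 :- ν 1 :- χ 2 :* ν 1 ⊑ χ 4 ∶ T-lower v v≤X ∷ 1 ✕ (ν 0 :+ # 1)
          :* χ 1 ⊑ (ν 0 :+ # 1) :* (χ 3 :+ # 2) ∶ *-monoˡ (ι x + 1ℚ) (certify (x ∷ []) [] 0 [] (# 0 ⊑ ν 0 :+ # 1)) Hx≤
          ∷ 1 ✕ χ 3 :* ν 0 ⊑ χ 3 :* ⌜ # 2 :* ν 1 :+ # 1 ⌝ ∶ *-monoˡ (H v) (0≤H v) (ι-mono x≤) ∷ 2 ✕ χ 3 ⊑ ν 1 ∶ H-≤ v
          ∷ 1 ✕ χ 2 :* ⌜ # 2 :* ν 1 ⌝ ⊑ χ 2 :* ν 0 ∶ *-monoˡ γ 0≤γ (ι-mono 2v≤) ∷ 2 ✕ # 2 :* ν 1 ⊑ₙ ν 0 ∶ 2v≤ ∷ 2 ✕ #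
          1 ⊑ₙ ν 0 ∶ 1≤x ∷ []) (χ 0 :- # 2 :* χ 4 ⊑ # 5 :* ν 0)
        where
        x≤ : x ≤ₙ 2 *ₙ v +ₙ 1
        x≤ = subst (λ t → x ≤ₙ 2 *ₙ t +ₙ 1) z≡ x≤2z+1
        2v≤ : 2 *ₙ v ≤ₙ x
        2v≤ = subst (λ t → 2 *ₙ t ≤ₙ x) z≡ 2z≤x
        1≤v : 1 ≤ₙ v
        1≤v = s≤s z≤n
        v≤x : v ≤ₙ x
        v≤x = certify (v ∷ x ∷ []) [] 0 (1 ✕ # 2 :* ν 0 ⊑ₙ ν 1 ∶ 2v≤ ∷ []) (ν 0 ⊑ₙ ν 1)
        v≤X = ℕₚ.≤-trans v≤x x≤X
        Hx≤ : H x ≤ H v + ι 2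
        Hx≤ = certify (x ∷ v ∷ []) (H x ∷ H v ∷ inv v ∷ []) 0 (1 ✕ χ 0 :- χ 1 ⊑ (ν 0 :- ν 1) :* χ 2 ∶ H-growth 1≤v
            v≤x ∷ 1 ✕ χ 2 :* ν 0 ⊑ χ 2 :* ⌜ # 3 :* ν 1 ⌝ ∶ *-monoˡ (inv v) (0≤inv v) (ι-mono (certify (x ∷ v ∷ []) []
            0 (1 ✕ ν 0 ⊑ₙ # 2 :* ν 1 :+ # 1 ∶ x≤ ∷ 1 ✕ # 1 ⊑ₙ ν 1 ∶ 1≤v ∷ []) (ν 0 ⊑ₙ # 3 :* ν 1))) ∷ 2 ✕ ν 1 :* χ 2 ≐
            # 1 ∶ ι*inv 1≤v ∷ []) (χ 0 ⊑ χ 1 :+ # 2)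

    -- Repeated halving gives 5 x + 5 x / 2 + ..., at most 10 x.
    chebyshev′ : ∀ f x → x ≤ₙ f → x ≤ₙ X → ψ x ≤ ι 10 * ι x
    chebyshev′ f zero _ _ = certify [] [] 0 [] (# 0 ⊑ # 10 :* # 0)
    chebyshev′ (suc f) x@(suc x-1) x≤f x≤X = certify (x ∷ v ∷ []) (ψ x ∷ ψ v ∷ T x ∷ T v ∷ []) 0 (1 ✕ χ 0 :- χ 1 ⊑ χ
        2 :- # 2 :* χ 3 ∶ ψ-diff x x≤X ∷ 1 ✕ χ 2 :- # 2 :* χ 3 ⊑ # 5 :* ν 0 ∶ T-2T≤ x x≤X (s≤s z≤n) ∷ 1 ✕ χ 1 ⊑ # 10
        :* ν 1 ∶ chebyshev′ f v v≤f (z≤X x x≤X) ∷ 5 ✕ # 2 :* ν 1 ⊑ₙ ν 0 ∶ 2z≤x x x≤X ∷ []) (χ 0 ⊑ # 10 :* ν 0)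
      where
      v = x ÷ 2
      v≤f : v ≤ₙ f
      v≤f = certify (v ∷ x-1 ∷ f ∷ []) [] 1 (1 ✕ # 2 :* ν 0 ⊑ₙ # 1 :+ ν 1 ∶ 2z≤x x x≤X ∷ 2 ✕ # 1 :+ ν 1 ⊑ₙ # 1 :+ ν 2
          ∶ x≤f ∷ []) (ν 0 ⊑ₙ ν 2)

  chebyshev : ∀ x → x ≤ₙ X → ψ x ≤ ι 10 * ι x
  chebyshev x = chebyshev′ x x ℕₚ.≤-refl

  -- Mertens' sum. Replacing ⌊x / a⌋ by x / a in T x = Σ Λ a ⌊x / a⌋ costs at most ψ x, which is
  -- O(x) by Chebyshev; hence R x is log x up to a constant.
  R : ℕ → ℚ
  R x = ∑ x (λ a → Λ a * inv a)

  R-mono : ∀ {m n} → m ≤ₙ n → R m ≤ R n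
  R-mono = ∑-upTo-mono (λ a → Λ a * inv a) (λ a → *-nonNeg (Λ-nonNeg a) (0≤inv a))

  private
    module _ (x : ℕ) (1≤x : 1 ≤ₙ x) (x≤X : x ≤ₙ X) where
      T≤xR : T x ≤ ι x * R x
      T≤xR = ℚₚ.≤-trans (ℚₚ.≤-reflexive (T≡∑Λ÷ x x≤X)) (ℚₚ.≤-trans
        (∑-mono x {g = λ a → ι x * (Λ a * inv a)} λ a _ → (certify (x ÷ suc a ∷ x ∷ []) (Λ (suc a) ∷ inv (suc a) ∷
            []) 0 (1 ✕ χ 0 :* ν 0 ⊑ χ 0 :* (ν 1 :* χ 1) ∶ *-monoˡ (Λ (suc a)) (Λ-nonNeg (suc a)) (÷≤ x {suc a} (s≤s
            z≤n)) ∷ []) (χ 0 :* ν 0 ⊑ ν 1 :* (χ 0 :* χ 1))))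
        (ℚₚ.≤-reflexive (∑-*ˡ x (ι x) (λ a → Λ a * inv a))))
      xR≤T : ι x * R x - ψ x ≤ T x
      xR≤T = ℚₚ.≤-trans (ℚₚ.≤-reflexive (trans (cong (ℚ._- ψ x) (sym (∑-*ˡ x (ι x) (λ a → Λ a * inv a)))) (sym (∑-- x (λ a → ι x * (Λ a * inv a)) Λ))))
        (ℚₚ.≤-trans (∑-mono x {g = λ a → Λ a * ι (x ÷ a)} λ a _ → (certify (x ∷ x ÷ suc a ∷ []) (Λ (suc a) ∷ inv (suc
            a) ∷ []) 0 (1 ✕ χ 0 :* (ν 0 :* χ 1 :- # 1) ⊑ χ 0 :* ν 1 ∶ *-monoˡ (Λ (suc a)) (Λ-nonNeg (suc a)) (÷≥ x
            {suc a} (s≤s z≤n)) ∷ []) (ν 0 :* (χ 0 :* χ 1) :- χ 0 ⊑ χ 0 :* ν 1)))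
        (ℚₚ.≤-reflexive (sym (T≡∑Λ÷ x x≤X))))

  mertens-upper : ∀ x → 1 ≤ₙ x → x ≤ₙ X → R x ≤ H x + ι 10
  mertens-upper x 1≤x x≤X = ι-cancelˡ 1≤x (certify (x ∷ []) (R x ∷ ψ x ∷ T x ∷ H x ∷ γ ∷ []) 0 (1 ✕ ν 0 :* χ 0 :- χ 1
      ⊑ χ 2 ∶ xR≤T x 1≤x x≤X ∷ 1 ✕ χ 1 ⊑ # 10 :* ν 0 ∶ chebyshev x x≤X ∷ 1 ✕ χ 2 ⊑ (ν 0 :+ # 1) :* χ 3 :- ν 0 :- χ 4
      :* ν 0 ∶ T-upper x x≤X ∷ 1 ✕ # 0 ⊑ χ 4 :* ν 0 ∶ *-nonNeg 0≤γ (0≤ι x) ∷ 1 ✕ χ 3 ⊑ ν 0 ∶ H-≤ x ∷ []) (ν 0 :* χ 0 ⊑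
      ν 0 :* (χ 3 :+ # 10)))

  mertens-lower : ∀ x → 1 ≤ₙ x → x ≤ₙ X → H x - ι 2 ≤ R x
  mertens-lower x 1≤x x≤X = ι-cancelˡ 1≤x (certify (x ∷ []) (T x ∷ R x ∷ H x ∷ γ ∷ []) 0 (1 ✕ χ 0 ⊑ ν 0 :* χ 1 ∶ T≤xR
      x 1≤x x≤X ∷ 1 ✕ ν 0 :* χ 2 :- ν 0 :- χ 3 :* ν 0 ⊑ χ 0 ∶ T-lower x x≤X ∷ 1 ✕ ν 0 :* χ 3 ⊑ ν 0 :* # 1 ∶ *-monoˡ (ι
      x) (0≤ι x) γ≤1 ∷ []) (ν 0 :* (χ 2 :- # 2) ⊑ ν 0 :* χ 1))

-- Primes in intervals of bounded ratio

abstract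
  -- Collects the errors of order y, without a factor log y, in `selberg-upper` and `selberg-lower`.
  D : ℕ → ℕ → ℕ
  D r j = 12 *ₙ r *ₙ r +ₙ 45 *ₙ r +ₙ 2 *ₙ r *ₙ B (2 *ₙ r *ₙ j)

  D-def : ∀ r j → D r j ≡ 12 *ₙ r *ₙ r +ₙ 45 *ₙ r +ₙ 2 *ₙ r *ₙ B (2 *ₙ r *ₙ j)
  D-def r j = refl

module Intervals {X : ℕ} (L : LogUpTo X) (1≤X : 1 ≤ₙ X) where
  open LogUpTo L public
  open Selberg L 1≤X public
  open Bounds L 1≤X public

  -- The contribution to S of the products of two prime powers.
  S₂ : ℕ → ℚ
  S₂ z = ∑ z (λ a → Λ a * ψ (z ÷ a))

  module _ (r j y y′ : ℕ) (1≤r : 1 ≤ₙ r) (1≤j : 1 ≤ₙ j) (1≤y : 1 ≤ₙ y) (y≤y′ : y ≤ₙ y′) (y′≤ry : y′ ≤ₙ r *ₙ y) (y′≤X : y′ ≤ₙ X) where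
    private
      1≤y′ = ℕₚ.≤-trans 1≤y y≤y′
      -- The error term is met at two end points, both at most r y; with this j₀ their sum is y H y
      -- / j to first order.
      j₀ = 2 *ₙ r *ₙ j
      1≤2r : 1 ≤ₙ 2 *ₙ r
      1≤2r = certify (r ∷ []) [] 0 (2 ✕ # 1 ⊑ₙ ν 0 ∶ 1≤r ∷ []) (# 1 ⊑ₙ # 2 :* ν 0)
      A : ℕ → ℚ
      A z = ∑ z (λ a → Λ a * ℓ a)
      b = B j₀

      Λ*const : ∀ z c → ∑ z (λ a → Λ a * c) ≡ ψ z * c
      Λ*const z c = ∑-*ʳ z c Λ

      ℓ≤ : ∀ i → y ≤ₙ i → i <ₙ y′ → ℓ (suc i) ≤ H y′
      ℓ≤ i _ i<y′ = certify [] (ℓ (suc i) ∷ H (suc i) ∷ γ ∷ H y′ ∷ []) 0 (1 ✕ χ 0 ⊑ χ 1 :- χ 2 ∶ ℓ-upper (suc i) (s≤s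
          z≤n) (ℕₚ.≤-trans i<y′ y′≤X) ∷ 1 ✕ # 0 ⊑ χ 2 ∶ 0≤γ ∷ 1 ✕ χ 1 ⊑ χ 3 ∶ H-mono i<y′ ∷ []) (χ 0 ⊑ χ 3)
      ℓ≥ : ∀ i → y ≤ₙ i → i <ₙ y′ → H y - ι 2 ≤ ℓ (suc i)
      ℓ≥ i y≤i i<y′ = certify [] (H (suc i) ∷ γ ∷ inv (suc i) ∷ ℓ (suc i) ∷ H y ∷ []) 0 (1 ✕ χ 0 :- χ 1 :- χ 2 ⊑ χ 3
          ∶ ℓ-lower (suc i) (s≤s z≤n) (ℕₚ.≤-trans i<y′ y′≤X) ∷ 1 ✕ χ 1 ⊑ # 1 ∶ γ≤1 ∷ 1 ✕ χ 2 ⊑ # 1 ∶ inv≤1 (suc i) ∷ 1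
          ✕ χ 4 ⊑ χ 0 ∶ H-mono (ℕₚ.m≤n⇒m≤1+n y≤i) ∷ []) (χ 4 :- # 2 ⊑ χ 3)

      A≤ : A y′ - A y ≤ (ψ y′ - ψ y) * H y′
      A≤ = certify [] (A y′ ∷ A y ∷ ∑ y′ (λ a → Λ a * H y′) ∷ ∑ y (λ a → Λ a * H y′) ∷ ψ y′ ∷ H y′ ∷ ψ y ∷ []) 0 (1 ✕
          χ 0 :- χ 1 ⊑ χ 2 :- χ 3 ∶ ∑-between y y′ (λ a → Λ a * ℓ a) (λ a → Λ a * H y′) y≤y′ (λ i p q → *-monoˡ (Λ
          (suc i)) (Λ-nonNeg (suc i)) (ℓ≤ i p q)) ∷ 1 ✕ χ 2 ≐ χ 4 :* χ 5 ∶ Λ*const y′ (H y′) ∷ 1 ✕ χ 6 :* χ 5 ≐ χ 3 ∶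
          sym (Λ*const y (H y′)) ∷ []) (χ 0 :- χ 1 ⊑ (χ 4 :- χ 6) :* χ 5)
      A≥ : (ψ y′ - ψ y) * (H y - ι 2) ≤ A y′ - A y
      A≥ = certify [] (∑ y′ (λ a → Λ a * (H y - ι 2)) ∷ ∑ y (λ a → Λ a * (H y - ι 2)) ∷ A y′ ∷ A y ∷ ψ y′ ∷ H y ∷ ψ y
          ∷ []) 0 (1 ✕ χ 0 :- χ 1 ⊑ χ 2 :- χ 3 ∶ ∑-between y y′ (λ a → Λ a * (H y - ι 2)) (λ a → Λ a * ℓ a) y≤y′ (λ i
          p q → *-monoˡ (Λ (suc i)) (Λ-nonNeg (suc i)) (ℓ≥ i p q)) ∷ 1 ✕ χ 4 :* (χ 5 :- # 2) ≐ χ 0 ∶ sym (Λ*const y′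
          (H y - ι 2)) ∷ 1 ✕ χ 1 ≐ χ 6 :* (χ 5 :- # 2) ∶ Λ*const y (H y - ι 2) ∷ []) ((χ 4 :- χ 6) :* (χ 5 :- # 2) ⊑ χ
          2 :- χ 3)
      T≤ : T y′ - T y ≤ (ι y′ - ι y) * H y′
      T≤ = ∑-between-≤ y y′ (H y′) y≤y′ ℓ≤
      T≥ : (ι y′ - ι y) * (H y - ι 2) ≤ T y′ - T y
      T≥ = ∑-between-≥ y y′ (H y - ι 2) y≤y′ ℓ≥

      ry≥ : ι y′ ≤ ι r * ι y
      ry≥ = certify (y′ ∷ r ∷ y ∷ []) [] 0 (1 ✕ ν 0 ⊑ₙ ν 1 :* ν 2 ∶ y′≤ry ∷ []) (ν 0 ⊑ ν 1 :* ν 2)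
      H′≤ : H y′ ≤ H y + ι r
      H′≤ = certify (y′ ∷ y ∷ r ∷ []) (H y′ ∷ H y ∷ inv y ∷ []) 0 (1 ✕ χ 0 :- χ 1 ⊑ (ν 0 :- ν 1) :* χ 2 ∶ H-growth
          1≤y y≤y′ ∷ 1 ✕ χ 2 :* ν 0 ⊑ χ 2 :* (ν 2 :* ν 1) ∶ *-monoˡ (inv y) (0≤inv y) ry≥ ∷ 1 ✕ ν 2 :* (ν 1 :* χ 2) ≐
          ν 2 :* # 1 ∶ cong (ι r *_) (ι*inv 1≤y) ∷ 1 ✕ # 1 ≐ ν 1 :* χ 2 ∶ sym (ι*inv 1≤y) ∷ []) (χ 0 ⊑ χ 1 :+ ν 2)
      0≤m : 0ℚ ≤ ψ y′ - ψ y
      0≤m = certify [] (ψ y ∷ ψ y′ ∷ []) 0 (1 ✕ χ 0 ⊑ χ 1 ∶ ψ-mono y≤y′ ∷ []) (# 0 ⊑ χ 1 :- χ 0)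
      m≤ : ψ y′ - ψ y ≤ ι 10 * ι r * ι y
      m≤ = certify (y′ ∷ r ∷ y ∷ []) (ψ y′ ∷ ψ y ∷ []) 0 (1 ✕ χ 0 ⊑ # 10 :* ν 0 ∶ chebyshev y′ y′≤X ∷ 1 ✕ # 0 ⊑ χ 1 ∶
          0≤ψ y ∷ 10 ✕ ν 0 ⊑ ν 1 :* ν 2 ∶ ry≥ ∷ []) (χ 0 :- χ 1 ⊑ # 10 :* ν 1 :* ν 2)
      d≤ : ι y′ - ι y ≤ ι r * ι y
      d≤ = certify (y′ ∷ r ∷ y ∷ []) [] 0 (1 ✕ ν 0 ⊑ ν 1 :* ν 2 ∶ ry≥ ∷ []) (ν 0 :- ν 2 ⊑ ν 1 :* ν 2)
      0≤d : 0ℚ ≤ ι y′ - ι y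
      0≤d = certify (y ∷ y′ ∷ []) [] 0 (1 ✕ ν 0 ⊑ₙ ν 1 ∶ y≤y′ ∷ []) (# 0 ⊑ ν 1 :- ν 0)

      inv-j₀ : ι 2 * ι r * inv j₀ ≡ inv j
      inv-j₀ = trans (cong (_* inv j₀) (sym (ι-* 2 r))) (ι*inv-* 1≤2r 1≤j)

      V₀ : ℚ
      V₀ = ι r * ι y * ι b + ι r * ι y * (H y + ι r) * inv j₀
      V≤ : ∀ u → 1 ≤ₙ u → u ≤ₙ y′ → ∣ V u ∣ ≤ V₀
      V≤ u 1≤u u≤y′ = certify (u ∷ b ∷ r ∷ y ∷ []) (∣ V u ∣ ∷ H u ∷ inv j₀ ∷ H y ∷ []) 0 (1 ✕ χ 0 ⊑ ν 0 :* ν 1 :+ ν 0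
          :* χ 1 :* χ 2 ∶ ∣V∣≤ j₀ u (ℕₚ.*-mono-≤ 1≤2r 1≤j) 1≤u (ℕₚ.≤-trans u≤y′ y′≤X) ∷ 1 ✕ ν 1 :* ν 0 ⊑ ν 1 :* (ν 2
          :* ν 3) ∶ *-monoˡ (ι b) (0≤ι b) u≤ ∷ 1 ✕ χ 2 :* (ν 0 :* χ 1) ⊑ χ 2 :* (ν 2 :* ν 3 :* (χ 3 :+ ν 2)) ∶ *-monoˡ
          (inv j₀) (0≤inv j₀) (*-mono-nonNeg (0≤H u) u≤ Hu≤ 0≤ry) ∷ []) (χ 0 ⊑ ν 2 :* ν 3 :* ν 1 :+ ν 2 :* ν 3 :* (χ 3
          :+ ν 2) :* χ 2)
        where
        u≤ : ι u ≤ ι r * ι y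
        u≤ = ℚₚ.≤-trans (ι-mono u≤y′) ry≥
        Hu≤ : H u ≤ H y + ι r
        Hu≤ = ℚₚ.≤-trans (H-mono u≤y′) H′≤
        0≤ry : 0ℚ ≤ ι r * ι y
        0≤ry = *-nonNeg (0≤ι r) (0≤ι y)
      V₀≤ : ι 2 * V₀ ≤ ι y * H y * inv j + ι y * (ι 2 * ι r * ι b + ι r)
      V₀≤ = certify (y ∷ r ∷ b ∷ []) (H y ∷ inv j₀ ∷ inv j ∷ []) 0 (1 ✕ ν 0 :* (χ 0 :+ ν 1) :* (# 2 :* ν 1 :* χ 1) ≐
          ν 0 :* (χ 0 :+ ν 1) :* χ 2 ∶ cong (λ t → ι y * (H y + ι r) * t) inv-j₀ ∷ 1 ✕ ν 0 :* ν 1 :* χ 2 ⊑ ν 0 :* ν 1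
          :* # 1 ∶ *-monoˡ (ι y * ι r) (*-nonNeg (0≤ι y) (0≤ι r)) (inv≤1 j) ∷ []) (# 2 :* (ν 1 :* ν 0 :* ν 2 :+ ν 1 :*
          ν 0 :* (χ 0 :+ ν 1) :* χ 1) ⊑ ν 0 :* χ 0 :* χ 2 :+ ν 0 :* (# 2 :* ν 1 :* ν 2 :+ ν 1))
      Vy = V≤ y 1≤y y≤y′
      Vy′ = V≤ y′ 1≤y′ ℕₚ.≤-refl
      Dval : ι (D r j) * ι y ≡ (ι 12 * ι r * ι r + ι 45 * ι r + ι 2 * ι r * ι b) * ι y
      Dval = certify (D r j ∷ y ∷ r ∷ b ∷ []) [] 0 (1 ✕ ν 0 :* ν 1 ≐ ⌜ # 12 :* ν 2 :* ν 2 :+ # 45 :* ν 2 :+ # 2 :* ν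
          2 :* ν 3 ⌝ :* ν 1 ∶ cong (λ t → ι t * ι y) (D-def r j) ∷ []) (ν 0 :* ν 1 ≐ (# 12 :* ν 2 :* ν 2 :+ # 45 :* ν
          2 :+ # 2 :* ν 2 :* ν 3) :* ν 1)
      nn₁ : 0ℚ ≤ ι r * ι y
      nn₁ = *-nonNeg (0≤ι r) (0≤ι y)
      nn₂ : 0ℚ ≤ ι r * ι r * ι y
      nn₂ = *-nonNeg (*-nonNeg (0≤ι r) (0≤ι r)) (0≤ι y)
      mγ = mul-bounds 0≤m ℚₚ.≤-refl (ℚₚ.≤-trans (certify [] [] 0 [] (:- # 1 ⊑ # 0)) 0≤γ) γ≤1
      mγ₀ : 0ℚ ≤ (ψ y′ - ψ y) * γ
      mγ₀ = *-nonNeg 0≤m 0≤γ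
      mγ₁ = proj₂ mγ

    -- Selberg's formula at y′ minus that at y. Between them ℓ differs from H y by O(1) since y′ ≤ r
    -- y, so the terms Λ ℓ amount to H y times the mass, up to O(y).
    selberg-upper : S₂ y′ - S₂ y + H y * (ψ y′ - ψ y) ≤ ι 2 * (ι y′ - ι y) * H y + ι y * (H y * inv j + ι (D r j))
    selberg-upper = certify (y′ ∷ y ∷ r ∷ b ∷ D r j ∷ []) (ψ y′ ∷ ψ y ∷ H y ∷ A y′ ∷ A y ∷ T y′ ∷ T y ∷ H y′ ∷ ∣ V y
        ∣ ∷ V₀ ∷ ∣ V y′ ∣ ∷ S₂ y ∷ γ ∷ S₂ y′ ∷ inv j ∷ []) 0 (1 ✕ (χ 0 :- χ 1) :* (χ 2 :- # 2) ⊑ χ 3 :- χ 4 ∶ A≥ ∷ 2 ✕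
        χ 5 :- χ 6 ⊑ (ν 0 :- ν 1) :* χ 7 ∶ T≤ ∷ 2 ✕ (ν 0 :- ν 1) :* χ 7 ⊑ (ν 0 :- ν 1) :* (χ 2 :+ ν 2) ∶ *-monoˡ (ι y′
        - ι y) 0≤d H′≤ ∷ 2 ✕ ν 2 :* (ν 0 :- ν 1) ⊑ ν 2 :* (ν 2 :* ν 1) ∶ *-monoˡ (ι r) (0≤ι r) d≤ ∷ 1 ✕ χ 8 ⊑ χ 9 ∶ Vy
        ∷ 1 ✕ χ 10 ⊑ χ 9 ∶ Vy′ ∷ 1 ✕ :- χ 8 ⊑ χ 4 :+ χ 11 :- # 2 :* χ 6 :+ # 2 :* χ 12 :* χ 1 ∶ -∣∣≤ (V y) ∷ 1 ✕ χ 3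
        :+ χ 13 :- # 2 :* χ 5 :+ # 2 :* χ 12 :* χ 0 ⊑ χ 10 ∶ ≤∣∣ (V y′) ∷ 1 ✕ # 2 :* χ 9 ⊑ ν 1 :* χ 2 :* χ 14 :+ ν 1
        :* (# 2 :* ν 2 :* ν 3 :+ ν 2) ∶ V₀≤ ∷ 2 ✕ χ 0 :- χ 1 ⊑ # 10 :* ν 2 :* ν 1 ∶ m≤ ∷ 2 ✕ # 0 ⊑ (χ 0 :- χ 1) :* χ
        12 ∶ mγ₀ ∷ 1 ✕ (# 12 :* ν 2 :* ν 2 :+ # 45 :* ν 2 :+ # 2 :* ν 2 :* ν 3) :* ν 1 ≐ ν 4 :* ν 1 ∶ sym (Dval) ∷ 24
        ✕ # 0 ⊑ ν 2 :* ν 1 ∶ nn₁ ∷ 10 ✕ # 0 ⊑ ν 2 :* ν 2 :* ν 1 ∶ nn₂ ∷ []) (χ 13 :- χ 11 :+ χ 2 :* (χ 0 :- χ 1) ⊑ # 2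
        :* (ν 0 :- ν 1) :* χ 2 :+ ν 1 :* (χ 2 :* χ 14 :+ ν 4))

    selberg-lower : ι 2 * (ι y′ - ι y) * H y ≤ S₂ y′ - S₂ y + H y * (ψ y′ - ψ y) + ι y * (H y * inv j + ι (D r j))
    selberg-lower = certify (y′ ∷ y ∷ r ∷ b ∷ D r j ∷ []) (A y′ ∷ A y ∷ ψ y′ ∷ ψ y ∷ H y′ ∷ H y ∷ T y′ ∷ T y ∷ ∣ V y
        ∣ ∷ V₀ ∷ ∣ V y′ ∣ ∷ S₂ y′ ∷ γ ∷ S₂ y ∷ inv j ∷ []) 0 (1 ✕ χ 0 :- χ 1 ⊑ (χ 2 :- χ 3) :* χ 4 ∶ A≤ ∷ 2 ✕ (ν 0 :-
        ν 1) :* (χ 5 :- # 2) ⊑ χ 6 :- χ 7 ∶ T≥ ∷ 1 ✕ (χ 2 :- χ 3) :* χ 4 ⊑ (χ 2 :- χ 3) :* (χ 5 :+ ν 2) ∶ *-monoˡ (ψ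
        y′ - ψ y) 0≤m H′≤ ∷ 4 ✕ ν 0 :- ν 1 ⊑ ν 2 :* ν 1 ∶ d≤ ∷ 1 ✕ ν 2 :* (χ 2 :- χ 3) ⊑ ν 2 :* (# 10 :* ν 2 :* ν 1) ∶
        *-monoˡ (ι r) (0≤ι r) m≤ ∷ 1 ✕ χ 8 ⊑ χ 9 ∶ Vy ∷ 1 ✕ χ 10 ⊑ χ 9 ∶ Vy′ ∷ 1 ✕ :- χ 10 ⊑ χ 0 :+ χ 11 :- # 2 :* χ 6
        :+ # 2 :* χ 12 :* χ 2 ∶ -∣∣≤ (V y′) ∷ 1 ✕ χ 1 :+ χ 13 :- # 2 :* χ 7 :+ # 2 :* χ 12 :* χ 3 ⊑ χ 8 ∶ ≤∣∣ (V y) ∷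
        1 ✕ # 2 :* χ 9 ⊑ ν 1 :* χ 5 :* χ 14 :+ ν 1 :* (# 2 :* ν 2 :* ν 3 :+ ν 2) ∶ V₀≤ ∷ 2 ✕ χ 2 :- χ 3 ⊑ # 10 :* ν 2
        :* ν 1 ∶ m≤ ∷ 2 ✕ (χ 2 :- χ 3) :* χ 12 ⊑ (χ 2 :- χ 3) :* # 1 ∶ mγ₁ ∷ 1 ✕ (# 12 :* ν 2 :* ν 2 :+ # 45 :* ν 2 :+
        # 2 :* ν 2 :* ν 3) :* ν 1 ≐ ν 4 :* ν 1 ∶ sym (Dval) ∷ 20 ✕ # 0 ⊑ ν 2 :* ν 1 ∶ nn₁ ∷ 2 ✕ # 0 ⊑ ν 2 :* ν 2 :* ν
        1 ∶ nn₂ ∷ []) (# 2 :* (ν 0 :- ν 1) :* χ 5 ⊑ χ 11 :- χ 13 :+ χ 5 :* (χ 2 :- χ 3) :+ ν 1 :* (χ 5 :* χ 14 :+ ν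
        4))

    private
      S₂-mono : S₂ y ≤ S₂ y′
      S₂-mono = ℚₚ.≤-trans (∑-mono y λ a _ → *-monoˡ (Λ (suc a)) (Λ-nonNeg (suc a)) (ψ-mono (÷-monoˡ (suc a) y≤y′)))
        (∑-upTo-mono (λ a → Λ a * ψ (y′ ÷ a)) (λ a → *-nonNeg (Λ-nonNeg a) (0≤ψ (y′ ÷ a))) y≤y′)

    brun-titchmarsh : ι j * ι (D r j) ≤ H y → ψ y′ - ψ y ≤ ι 2 * (ι y′ - ι y) + ι 2 * ι y * inv j
    brun-titchmarsh big = ℚₚ.*-cancelˡ-≤-pos (H y) {{ℚ.positive (ℚₚ.<-≤-trans 0<1 (1≤H 1≤y))}}
      (certify (y′ ∷ y ∷ D r j ∷ j ∷ []) (S₂ y′ ∷ S₂ y ∷ H y ∷ ψ y′ ∷ ψ y ∷ inv j ∷ []) 0 (1 ✕ χ 0 :- χ 1 :+ χ 2 :*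
          (χ 3 :- χ 4) ⊑ # 2 :* (ν 0 :- ν 1) :* χ 2 :+ ν 1 :* (χ 2 :* χ 5 :+ ν 2) ∶ selberg-upper ∷ 1 ✕ χ 1 ⊑ χ 0 ∶
          S₂-mono ∷ 1 ✕ ν 1 :* χ 5 :* (ν 3 :* ν 2) ⊑ ν 1 :* χ 5 :* χ 2 ∶ *-monoˡ (ι y * inv j) (*-nonNeg (0≤ι y)
          (0≤inv j)) big ∷ 1 ✕ ν 1 :* ν 2 :* # 1 ≐ ν 1 :* ν 2 :* (ν 3 :* χ 5) ∶ sym (cong (λ t → ι y * ι (D r j) * t)
          (ι*inv 1≤j)) ∷ []) (χ 2 :* (χ 3 :- χ 4) ⊑ χ 2 :* (# 2 :* (ν 0 :- ν 1) :+ # 2 :* ν 1 :* χ 5)))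

H-double : ∀ x → 1 ≤ₙ x → H x + inv 2 ≤ H (2 *ₙ x)
H-double x 1≤x = certify (x ∷ []) (inv (2 *ₙ x) ∷ H (2 *ₙ x) ∷ H x ∷ inv 2 ∷ []) 0 (1 ✕ (⌜ # 2 :* ν 0 ⌝ :- ν 0) :* χ
    0 ⊑ χ 1 :- χ 2 ∶ ∑-between-≥ x (2 *ₙ x) {inv} (inv (2 *ₙ x)) (ℕₚ.m≤m+n x (x +ₙ 0)) (λ i x≤i i< → inv-anti (s≤s
    z≤n) i<) ∷ 1 ✕ χ 3 ≐ ν 0 :* χ 0 ∶ sym (trans (cong (λ t → ι x * inv t) (ℕₚ.*-comm 2 x)) (ι*inv-* {x} {2} 1≤x (s≤s
    z≤n))) ∷ []) (χ 2 :+ χ 3 ⊑ χ 1)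

abstract
  -- Each doubling of x adds at least 1/2 to H, so k = 4 ^ m works.
  H-multiple : ∀ m → ∃[ k ] (1 ≤ₙ k × (∀ x → 1 ≤ₙ x → H x + ι m ≤ H (k *ₙ x)))
  H-multiple zero = 1 , s≤s z≤n , λ x _ → ℚₚ.≤-reflexive (trans (ℚₚ.+-identityʳ (H x)) (cong H (sym (ℕₚ.*-identityˡ x))))
  H-multiple (suc m) with H-multiple m
  ... | k , 1≤k , hk = 2 *ₙ (2 *ₙ k) , (certify (k ∷ []) [] 0 (4 ✕ # 1 ⊑ₙ ν 0 ∶ 1≤k ∷ []) (# 1 ⊑ₙ # 2 :* (# 2 :* ν
      0))) , λ x 1≤x → goal x 1≤x
    where
    goal : ∀ x → 1 ≤ₙ x → H x + ι (suc m) ≤ H (2 *ₙ (2 *ₙ k) *ₙ x)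
    goal x 1≤x = certify (m ∷ []) (H x ∷ H (k *ₙ x) ∷ inv 2 ∷ H (2 *ₙ (k *ₙ x)) ∷ H (2 *ₙ (2 *ₙ (k *ₙ x))) ∷ H (2 *ₙ
        (2 *ₙ k) *ₙ x) ∷ []) 0 (1 ✕ χ 0 :+ ν 0 ⊑ χ 1 ∶ hk x 1≤x ∷ 1 ✕ χ 1 :+ χ 2 ⊑ χ 3 ∶ H-double (k *ₙ x) 1≤kx ∷ 1 ✕
        χ 3 :+ χ 2 ⊑ χ 4 ∶ H-double (2 *ₙ (k *ₙ x)) (ℕₚ.≤-trans 1≤kx (ℕₚ.m≤m+n (k *ₙ x) _)) ∷ 1 ✕ χ 4 ≐ χ 5 ∶ cong H e
        ∷ 1 ✕ # 1 ≐ # 2 :* χ 2 ∶ sym (half) ∷ []) (χ 0 :+ ⌜ # 1 :+ ν 0 ⌝ ⊑ χ 5)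
      where
      1≤kx : 1 ≤ₙ k *ₙ x
      1≤kx = ℕₚ.*-mono-≤ 1≤k 1≤x
      half : ι 2 * inv 2 ≡ 1ℚ
      half = ι*inv {2} (s≤s z≤n)
      e : 2 *ₙ (2 *ₙ (k *ₙ x)) ≡ 2 *ₙ (2 *ₙ k) *ₙ x
      e = certify (k ∷ x ∷ []) [] 0 [] (# 2 :* (# 2 :* (ν 0 :* ν 1)) ≐ₙ # 2 :* (# 2 :* ν 0) :* ν 1)

  H-unbounded : ∀ m → ∃[ k ] (1 ≤ₙ k × (∀ x → k ≤ₙ x → ι m ≤ H x))
  H-unbounded m with H-multiple m
  ... | k , 1≤k , hk = k , 1≤k , λ x k≤x → (certify (m ∷ []) (H 1 ∷ H (k *ₙ 1) ∷ H k ∷ H x ∷ []) 0 (1 ✕ χ 0 :+ ν 0 ⊑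
      χ 1 ∶ hk 1 ℕₚ.≤-refl ∷ 1 ✕ χ 1 ≐ χ 2 ∶ cong H (ℕₚ.*-identityʳ k) ∷ 1 ✕ χ 2 ⊑ χ 3 ∶ H-mono k≤x ∷ 1 ✕ # 0 ⊑ χ 0 ∶
      0≤H 1 ∷ []) (ν 0 ⊑ χ 3))

-- Erdős' gap-shrinking step

search : ∀ {P : ℕ → Set} → (∀ a → Dec (P a)) → ∀ z → (∃[ a ] (1 ≤ₙ a × a ≤ₙ z × P a)) ⊎ (∀ a → a <ₙ z → ¬ P (suc a))
search P? zero = inj₂ λ _ ()
search P? (suc z) with search P? z
... | inj₁ (a , 1≤a , a≤z , p) = inj₁ (a , 1≤a , ℕₚ.m≤n⇒m≤1+n a≤z , p)
... | inj₂ none with P? (suc z)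
...   | yes p = inj₁ (suc z , s≤s z≤n , ℕₚ.≤-refl , p)
...   | no ¬p = inj₂ λ a a<1+z → case (ℕₚ.m≤n⇒m<n∨m≡n (ℕₚ.m<1+n⇒m≤n a<1+z)) of λ where
        (inj₁ a<z) → none a a<z
        (inj₂ refl) → ¬p

∑-𝟙-≤′ : ∀ m n f → (∀ i → 0ℚ ≤ f i) → ∑ n (λ i → 𝟙 (i ℕ.≤? m) * f i) ≤ ∑ m f
∑-𝟙-≤′ m n f 0≤f with ℕₚ.≤-total m n
... | inj₁ m≤n = ℚₚ.≤-reflexive (∑-𝟙-≤ f m≤n)
... | inj₂ n≤m = ℚₚ.≤-trans (∑-mono n λ i _ → (certify [] (𝟙 (suc i ℕ.≤? m) ∷ f (suc i) ∷ []) 0 (1 ✕ χ 0 :* χ 1 ⊑ # 1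
    :* χ 1 ∶ ℚₚ.*-monoʳ-≤-nonNeg (f (suc i)) {{ℚ.nonNegative (0≤f (suc i))}} (𝟙-≤1 (suc i ℕ.≤? m)) ∷ []) (χ 0 :* χ 1 ⊑
    χ 1))) (∑-upTo-mono f 0≤f n≤m)

inv-cross : ∀ {a b k l} → 1 ≤ₙ a → 1 ≤ₙ b → k *ₙ a ≤ₙ l *ₙ b → ι k * inv b ≤ ι l * inv a
inv-cross {a} {b} {k} {l} 1≤a 1≤b h = certify (k ∷ a ∷ l ∷ b ∷ []) (inv a ∷ inv b ∷ []) 0 (1 ✕ χ 0 :* χ 1 :* ⌜ ν 0 :*
    ν 1 ⌝ ⊑ χ 0 :* χ 1 :* ⌜ ν 2 :* ν 3 ⌝ ∶ *-monoˡ (inv a * inv b) (*-nonNeg (0≤inv a) (0≤inv b)) (ι-mono h) ∷ 1 ✕ ν 0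
    :* χ 1 :* # 1 ≐ ν 0 :* χ 1 :* (ν 1 :* χ 0) ∶ sym (cong (λ t → ι k * inv b * t) (ι*inv 1≤a)) ∷ 1 ✕ ν 2 :* χ 0 :* (ν
    3 :* χ 1) ≐ ν 2 :* χ 0 :* # 1 ∶ cong (λ t → ι l * inv a * t) (ι*inv 1≤b) ∷ []) (ν 0 :* χ 1 ⊑ ν 2 :* χ 0)

abstract
  -- The errors of order x in `total-defect`; the last summand is the contribution of the a beyond
  -- Z.
  excess : ℕ → ℕ → ℕ → ℕ
  excess r j Y = 20 *ₙ r +ₙ 10 +ₙ D r j +ₙ 10 *ₙ r *ₙ (2 *ₙ r *ₙ Y +ₙ 12)

  excess-def : ∀ r j Y → excess r j Y ≡ 20 *ₙ r +ₙ 10 +ₙ D r j +ₙ 10 *ₙ r *ₙ (2 *ₙ r *ₙ Y +ₙ 12)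
  excess-def r j Y = refl

  -- See `inner-large`: a factor Ω comes from `overlapping`, one from a ≤ Ω m, a factor 2 Ω from u ≥
  -- m / (2 Ω), and e from the mass hypothesis.
  gain⁻¹ : ℕ → ℕ → ℕ
  gain⁻¹ e Ω = 2 *ₙ e *ₙ Ω *ₙ Ω *ₙ Ω

  gain⁻¹-def : ∀ e Ω → gain⁻¹ e Ω ≡ 2 *ₙ e *ₙ Ω *ₙ Ω *ₙ Ω
  gain⁻¹-def e Ω = refl

-- η is the relative error allowed everywhere and 1 / b = 4 η.  An interval (x , x′] carrying
-- little mass forces the mass h a of (x / a , x′ / a] to be maximal for most a, and then
-- that of (x / (a b) , x′ / (a b)] to be minimal for most b.  Since consecutive primes are
-- not far apart, some intervals of the two kinds overlap.
module Step {X : ℕ} (L : LogUpTo X) (1≤X : 1 ≤ₙ X) (n q e N r Ω b j Y b₁ : ℕ)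
  (1≤n : 1 ≤ₙ n) (1≤q : 1 ≤ₙ q) (1≤e : 1 ≤ₙ e) (1≤b : 1 ≤ₙ b) (1≤j : 1 ≤ₙ j)
  (Ω≡ : Ω ≡ q +ₙ 2 *ₙ n) (r≡ : r ≡ 2 +ₙ 8 *ₙ n)
  (j≡ : ι 16 * ι r * ι Ω * inv j ≡ inv b)
  (j≤Y : j ≤ₙ Y) (Ω≤Y : Ω ≤ₙ Y) (Y-large : ∀ y → Y ≤ₙ y → ι j * ι (D r j) ≤ H y)
  (mass : ∀ u u′ → N ≤ₙ u → (q +ₙ 4 *ₙ n) *ₙ u ≤ₙ q *ₙ u′ → u′ ≤ₙ X → inv e * ι u ≤ Selberg.ψ L 1≤X u′ - Selberg.ψ L 1≤X u)
  (b₁≥₁ : Ω *ₙ q ≤ₙ b₁) (b₁≥₂ : 2 *ₙ Ω *ₙ (N +ₙ 1) ≤ₙ b₁)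
  (x x′ : ℕ) (x≤x′ : x ≤ₙ x′) (x′≤X : x′ ≤ₙ X)
  (x′-lower : (q +ₙ 3 *ₙ n) *ₙ x ≤ₙ q *ₙ x′ +ₙ q) (x′-upper : q *ₙ x′ ≤ₙ (q +ₙ 3 *ₙ n) *ₙ x)
  (x-large : 2 *ₙ q ≤ₙ x) where

  open Intervals L 1≤X

  η β Δ M : ℚ
  η = ι 4 * ι r * ι Ω * inv j
  β = inv b
  Δ = ι x′ - ι x
  M = ι 2 * Δ + η * ι x

  -- M / a is the Brun-Titchmarsh bound for the mass of the rescaled interval (x / a , x′ / a], and
  -- `ρ a` is what is missing to that maximum.
  h′ ρ : ℕ → ℚ
  h′ a = ψ (x′ ÷ a) - ψ (x ÷ a)
  ρ a = M * inv a - h′ a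

  -- For a ≤ Z the rescaled intervals start beyond Y, where Brun-Titchmarsh is available.
  Z : ℕ
  Z = x ÷ Y

  4η : ι 4 * η ≡ β
  4η = certify (r ∷ Ω ∷ []) (inv j ∷ inv b ∷ []) 0 (1 ✕ # 16 :* ν 0 :* ν 1 :* χ 0 ≐ χ 1 ∶ j≡ ∷ []) (# 4 :* (# 4 :* ν
      0 :* ν 1 :* χ 0) ≐ χ 1)

  x≤X : x ≤ₙ X
  x≤X = ℕₚ.≤-trans x≤x′ x′≤X

  1≤Y : 1 ≤ₙ Y
  1≤Y = ℕₚ.≤-trans 1≤j j≤Y

  1≤x : 1 ≤ₙ x
  1≤x = certify (q ∷ x ∷ []) [] 0 (1 ✕ # 2 :* ν 0 ⊑ₙ ν 1 ∶ x-large ∷ 2 ✕ # 1 ⊑ₙ ν 0 ∶ 1≤q ∷ []) (# 1 ⊑ₙ ν 1)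

  1≤r : 1 ≤ₙ r
  1≤r = certify (r ∷ n ∷ []) [] 0 (1 ✕ # 2 :+ # 8 :* ν 1 ≐ₙ ν 0 ∶ sym (r≡) ∷ []) (# 1 ⊑ₙ ν 0)

  1≤Ω : 1 ≤ₙ Ω
  1≤Ω = certify (Ω ∷ q ∷ n ∷ []) [] 0 (1 ✕ ν 1 :+ # 2 :* ν 2 ≐ₙ ν 0 ∶ sym (Ω≡) ∷ 1 ✕ # 1 ⊑ₙ ν 1 ∶ 1≤q ∷ []) (# 1 ⊑ₙ ν
      0)

  q≤Ω : q ≤ₙ Ω
  q≤Ω = certify (Ω ∷ q ∷ n ∷ []) [] 0 (1 ✕ ν 1 :+ # 2 :* ν 2 ≐ₙ ν 0 ∶ sym (Ω≡) ∷ []) (ν 1 ⊑ₙ ν 0)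

  private
    x′≤ : x′ ≤ₙ (1 +ₙ 3 *ₙ n) *ₙ x
    x′≤ = ℕₚ.*-cancelˡ-≤ q {{ℕ.>-nonZero 1≤q}} (certify (q ∷ x′ ∷ n ∷ x ∷ []) [] 0 (1 ✕ ν 0 :* ν 1 ⊑ₙ (ν 0 :+ # 3 :*
        ν 2) :* ν 3 ∶ x′-upper ∷ 3 ✕ # 1 :* (ν 2 :* ν 3) ⊑ₙ ν 0 :* (ν 2 :* ν 3) ∶ ℕₚ.*-monoˡ-≤ (n *ₙ x) 1≤q ∷ []) (ν 0
        :* ν 1 ⊑ₙ ν 0 :* ((# 1 :+ # 3 :* ν 2) :* ν 3)))

    x′≤rx : x′ ≤ₙ r *ₙ x
    x′≤rx = certify (x′ ∷ n ∷ x ∷ r ∷ []) [] 0 (2 ✕ ν 0 ⊑ₙ (# 1 :+ # 3 :* ν 1) :* ν 2 ∶ x′≤ ∷ 1 ✕ (# 2 :+ # 8 :* ν 1)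
        :* ν 2 ≐ₙ ν 3 :* ν 2 ∶ sym (cong (_*ₙ x) r≡) ∷ []) (ν 0 ⊑ₙ ν 3 :* ν 2)

    0≤j⁻ : 0ℚ ≤ inv j
    0≤j⁻ = 0≤inv j

    rΩ≥1 : 1ℚ ≤ ι r * ι Ω
    rΩ≥1 = certify (r ∷ Ω ∷ []) [] 0 (1 ✕ # 1 ⊑ ⌜ ν 0 :* ν 1 ⌝ ∶ ι-mono (ℕₚ.*-mono-≤ 1≤r 1≤Ω) ∷ []) (# 1 ⊑ ν 0 :* ν
        1)

    4j≤η : ι 4 * inv j ≤ η
    4j≤η = certify (r ∷ Ω ∷ []) (inv j ∷ []) 0 (4 ✕ χ 0 :* # 1 ⊑ χ 0 :* (ν 0 :* ν 1) ∶ *-monoˡ (inv j) 0≤j⁻ rΩ≥1 ∷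
        []) (# 4 :* χ 0 ⊑ # 4 :* ν 0 :* ν 1 :* χ 0)

    4rj≤η : ι 4 * ι r * inv j ≤ η
    4rj≤η = certify (r ∷ Ω ∷ []) (inv j ∷ []) 0 (4 ✕ ν 0 :* χ 0 :* # 1 ⊑ ν 0 :* χ 0 :* ν 1 ∶ *-monoˡ (ι r * inv j)
        (*-nonNeg (0≤ι r) 0≤j⁻) (ι-mono 1≤Ω) ∷ []) (# 4 :* ν 0 :* χ 0 ⊑ # 4 :* ν 0 :* ν 1 :* χ 0)

    0≤η : 0ℚ ≤ η
    0≤η = certify [] (inv j ∷ η ∷ []) 0 (1 ✕ # 4 :* χ 0 ⊑ χ 1 ∶ 4j≤η ∷ 4 ✕ # 0 ⊑ χ 0 ∶ 0≤j⁻ ∷ []) (# 0 ⊑ χ 1)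

    0≤Δ : 0ℚ ≤ Δ
    0≤Δ = certify (x ∷ x′ ∷ []) [] 0 (1 ✕ ν 0 ⊑ₙ ν 1 ∶ x≤x′ ∷ []) (# 0 ⊑ ν 1 :- ν 0)

    floors : ∀ u v a a′ → 1 ≤ₙ a → 1 ≤ₙ a′ → 1 ≤ₙ u ÷ a → ι v * inv a′ ≤ (ι 1 + ι 4 * ι n) * (ι u * inv a) → v ÷ a′ ≤ₙ r *ₙ (u ÷ a)
    floors u v a a′ 1≤a 1≤a′ 1≤y h = certify (v ÷ a′ ∷ v ∷ n ∷ u ∷ u ÷ a ∷ r ∷ []) (inv a′ ∷ inv a ∷ []) 0 (1 ✕ ν 0 ⊑
        ν 1 :* χ 0 ∶ ÷≤ v 1≤a′ ∷ 1 ✕ ν 1 :* χ 0 ⊑ (# 1 :+ # 4 :* ν 2) :* (ν 3 :* χ 1) ∶ h ∷ 1 ✕ (# 1 :+ # 4 :* ν 2) :*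
        (ν 3 :* χ 1) ⊑ (# 1 :+ # 4 :* ν 2) :* (# 2 :* ν 4) ∶ *-monoˡ (ι 1 + ι 4 * ι n) (certify (n ∷ []) [] 0 [] (# 0
        ⊑ # 1 :+ # 4 :* ν 0)) (certify (u ∷ u ÷ a ∷ []) (inv a ∷ []) 0 (1 ✕ ν 0 :* χ 0 :- # 1 ⊑ ν 1 ∶ ÷≥ u 1≤a ∷ 1 ✕ #
        1 ⊑ₙ ν 1 ∶ 1≤y ∷ []) (ν 0 :* χ 0 ⊑ # 2 :* ν 1)) ∷ 1 ✕ (# 2 :+ # 8 :* ν 2) :* ν 4 ≐ₙ ν 5 :* ν 4 ∶ sym (cong
        (_*ₙ (u ÷ a)) r≡) ∷ []) (ν 0 ⊑ₙ ν 5 :* ν 4)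

    1≤uaj : ∀ u a → 1 ≤ₙ a → Y ≤ₙ u ÷ a → 1ℚ ≤ ι u * inv a * inv j
    1≤uaj u a 1≤a Y≤ = certify (j ∷ u ∷ []) (inv j ∷ inv a ∷ []) 0 (1 ✕ χ 0 :* ν 0 ⊑ χ 0 :* (ν 1 :* χ 1) ∶ *-monoˡ
        (inv j) 0≤j⁻ (ℚₚ.≤-trans (ι-mono (ℕₚ.≤-trans j≤Y Y≤)) (÷≤ u 1≤a)) ∷ 1 ✕ # 1 ≐ ν 0 :* χ 0 ∶ sym (ι*inv 1≤j) ∷
        []) (# 1 ⊑ ν 1 :* χ 1 :* χ 0)

    -- Brun-Titchmarsh with the floors removed: the rounding of u / a costs at most 2, which `1≤uaj`
    -- pays by doubling the error term.
    short : ∀ u v a a′ → 1 ≤ₙ a → 1 ≤ₙ a′ → Y ≤ₙ u ÷ a → u ÷ a ≤ₙ v ÷ a′ → v ÷ a′ ≤ₙ X → ι v * inv a′ ≤ (ι 1 + ι 4 * ι n) * (ι u * inv a) →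
      ψ (v ÷ a′) - ψ (u ÷ a) ≤ ι 2 * (ι v * inv a′ - ι u * inv a) + ι 4 * (ι u * inv a) * inv j
    short u v a a′ 1≤a 1≤a′ Y≤ le ≤X h =
      (certify (v ÷ a′ ∷ u ÷ a ∷ v ∷ u ∷ []) (ψ (v ÷ a′) ∷ ψ (u ÷ a) ∷ inv j ∷ inv a′ ∷ inv a ∷ []) 0 (1 ✕ χ 0 :- χ 1
          ⊑ # 2 :* (ν 0 :- ν 1) :+ # 2 :* ν 1 :* χ 2 ∶ brun-titchmarsh r j (u ÷ a) (v ÷ a′) 1≤r 1≤j 1≤y le (floors u v
          a a′ 1≤a 1≤a′ 1≤y h) ≤X (Y-large (u ÷ a) Y≤) ∷ 2 ✕ ν 0 ⊑ ν 2 :* χ 3 ∶ ÷≤ v 1≤a′ ∷ 2 ✕ ν 3 :* χ 4 :- # 1 ⊑ ν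
          1 ∶ ÷≥ u 1≤a ∷ 2 ✕ χ 2 :* ν 1 ⊑ χ 2 :* (ν 3 :* χ 4) ∶ *-monoˡ (inv j) 0≤j⁻ (÷≤ u 1≤a) ∷ 2 ✕ # 1 ⊑ ν 3 :* χ 4
          :* χ 2 ∶ 1≤uaj u a 1≤a Y≤ ∷ []) (χ 0 :- χ 1 ⊑ # 2 :* (ν 2 :* χ 3 :- ν 3 :* χ 4) :+ # 4 :* (ν 3 :* χ 4) :* χ
          2))
      where 1≤y = ℕₚ.≤-trans 1≤Y Y≤

    Y≤÷ : ∀ {a} → 1 ≤ₙ a → a ≤ₙ Z → Y ≤ₙ x ÷ a
    Y≤÷ {a} 1≤a a≤Z = ÷-greatest 1≤a (subst (_≤ₙ x) (ℕₚ.*-comm a Y) (÷-smallest a≤Z))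

    x′a : ∀ a → ι x′ * inv a ≤ (ι 1 + ι 4 * ι n) * (ι x * inv a)
    x′a a = certify (x′ ∷ n ∷ x ∷ []) (inv a ∷ []) 0 (1 ✕ χ 0 :* ν 0 ⊑ χ 0 :* ⌜ (# 1 :+ # 3 :* ν 1) :* ν 2 ⌝ ∶
        *-monoˡ (inv a) (0≤inv a) (ι-mono x′≤) ∷ 1 ✕ # 0 ⊑ ν 1 :* ν 2 :* χ 0 ∶ *-nonNeg (*-nonNeg (0≤ι n) (0≤ι x))
        (0≤inv a) ∷ []) (ν 0 :* χ 0 ⊑ (# 1 :+ # 4 :* ν 1) :* (ν 2 :* χ 0))

  h′-nonNeg : ∀ a → 0ℚ ≤ h′ a
  h′-nonNeg a = certify [] (ψ (x ÷ a) ∷ ψ (x′ ÷ a) ∷ []) 0 (1 ✕ χ 0 ⊑ χ 1 ∶ ψ-mono (÷-monoˡ a x≤x′) ∷ []) (# 0 ⊑ χ 1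
      :- χ 0)

  ρ-nonNeg : ∀ a → 1 ≤ₙ a → a ≤ₙ Z → 0ℚ ≤ ρ a
  ρ-nonNeg a 1≤a a≤Z = certify (x′ ∷ x ∷ []) (ψ (x′ ÷ a) ∷ ψ (x ÷ a) ∷ inv a ∷ inv j ∷ η ∷ []) 0 (1 ✕ χ 0 :- χ 1 ⊑ #
      2 :* (ν 0 :* χ 2 :- ν 1 :* χ 2) :+ # 4 :* (ν 1 :* χ 2) :* χ 3 ∶ short x x′ a a 1≤a 1≤a (Y≤÷ 1≤a a≤Z) (÷-monoˡ a
      x≤x′) (ℕₚ.≤-trans (÷-≤ x′ a) x′≤X) (x′a a) ∷ 1 ✕ ν 1 :* χ 2 :* (# 4 :* χ 3) ⊑ ν 1 :* χ 2 :* χ 4 ∶ *-monoˡ (ι x *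
      inv a) (*-nonNeg (0≤ι x) (0≤inv a)) 4j≤η ∷ []) (# 0 ⊑ (# 2 :* (ν 0 :- ν 1) :+ χ 4 :* ν 1) :* χ 2 :- (χ 0 :- χ
      1))

  module _ (a m : ℕ) (1≤a : 1 ≤ₙ a) (1≤m : 1 ≤ₙ m) (a≤Z : a ≤ₙ Z) (m≤Z : m ≤ₙ Z) (near₁ : q *ₙ m ≤ₙ Ω *ₙ a) (near₂ : q *ₙ a ≤ₙ Ω *ₙ m) where
    private
      c₁ : ι q * inv a ≤ ι Ω * inv m
      c₁ = inv-cross {m} {a} {q} {Ω} 1≤m 1≤a near₁
      c₂ : ι q * inv m ≤ ι Ω * inv a
      c₂ = inv-cross {a} {m} {q} {Ω} 1≤a 1≤m near₂
      0≤xa : 0ℚ ≤ ι x * inv a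
      0≤xa = *-nonNeg (0≤ι x) (0≤inv a)
      wide : ∀ c d u → ι q * c ≤ ι Ω * d → 0ℚ ≤ d → ι u * c ≤ (ι 1 + ι 4 * ι n) * (ι u * d)
      wide c d u h 0≤d = ι-cancelˡ 1≤q (certify (u ∷ q ∷ Ω ∷ n ∷ []) (c ∷ d ∷ []) 0 (1 ✕ ν 0 :* (ν 1 :* χ 0) ⊑ ν 0 :*
          (ν 2 :* χ 1) ∶ *-monoˡ (ι u) (0≤ι u) h ∷ 1 ✕ ν 2 :* (ν 0 :* χ 1) ≐ ⌜ ν 1 :+ # 2 :* ν 3 ⌝ :* (ν 0 :* χ 1) ∶
          cong (λ t → ι t * (ι u * d)) Ω≡ ∷ 4 ✕ ν 3 :* (ν 0 :* χ 1) :* # 1 ⊑ ν 3 :* (ν 0 :* χ 1) :* ν 1 ∶ *-monoˡ (ι n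
          * (ι u * d)) (*-nonNeg (0≤ι n) (*-nonNeg (0≤ι u) 0≤d)) (ι-mono 1≤q) ∷ 2 ✕ # 0 ⊑ ν 3 :* (ν 0 :* χ 1) ∶
          *-nonNeg (0≤ι n) (*-nonNeg (0≤ι u) 0≤d) ∷ []) (ν 1 :* (ν 0 :* χ 0) ⊑ ν 1 :* ((# 1 :+ # 4 :* ν 3) :* (ν 0 :*
          χ 1))))
      gain : ι x * inv a ≤ inv a * (ι 2 * ι n * ι x - ι 2 * ι q)
      gain = certify (q ∷ x ∷ n ∷ []) (inv a ∷ []) 0 (1 ✕ χ 0 :* ⌜ # 2 :* ν 0 ⌝ ⊑ χ 0 :* ν 1 ∶ *-monoˡ (inv a) (0≤inv
          a) (ι-mono x-large) ∷ 2 ✕ ν 1 :* χ 0 :* # 1 ⊑ ν 1 :* χ 0 :* ν 2 ∶ *-monoˡ (ι x * inv a) 0≤xa (ι-mono 1≤n) ∷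
          []) (ν 1 :* χ 0 ⊑ χ 0 :* (# 2 :* ν 2 :* ν 1 :- # 2 :* ν 0))
      endpoint : inv a * (ι (q +ₙ 3 *ₙ n) * ι x) ≤ inv a * (ι q * ι x′ + ι q)
      endpoint = *-monoˡ (inv a) (0≤inv a) (certify (q ∷ n ∷ x ∷ x′ ∷ []) [] 0 (1 ✕ (ν 0 :+ # 3 :* ν 1) :* ν 2 ⊑ₙ ν 0
          :* ν 3 :+ ν 0 ∶ x′-lower ∷ []) (⌜ ν 0 :+ # 3 :* ν 1 ⌝ :* ν 2 ⊑ ν 0 :* ν 3 :+ ν 0))
      small : ι 4 * (ι x * inv a) * inv j ≤ η * (ι x * inv a)
      small = certify (x ∷ []) (inv a ∷ inv j ∷ η ∷ []) 0 (1 ✕ ν 0 :* χ 0 :* (# 4 :* χ 1) ⊑ ν 0 :* χ 0 :* χ 2 ∶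
          *-monoˡ (ι x * inv a) 0≤xa 4j≤η ∷ []) (# 4 :* (ν 0 :* χ 0) :* χ 1 ⊑ χ 2 :* (ν 0 :* χ 0))
      Yx′ : ∀ {c} → 1 ≤ₙ c → c ≤ₙ Z → Y ≤ₙ x′ ÷ c
      Yx′ {c} 1≤c c≤Z = ℕₚ.≤-trans (Y≤÷ 1≤c c≤Z) (÷-monoˡ c x≤x′)

    -- Let m ≤ a. The mass of (x / a , x′ / a] is at most that of (x / a , x / m] plus that of (x /
    -- m , x′ / m]. The first piece has ratio at most Ω / q = 1 + 2n/q, hence mass at most about
    -- (4n/q) x / a, while the maximum M / a is about (6n/q) x / a. The gap (2n/q) x / a must be
    -- filled by ρ a + h′ m, and half of it covers the rounding of x′. For a ≤ m the outer piece is
    -- (x′ / m , x′ / a].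
    overlapping : ι x * inv a ≤ ι Ω * (ρ a + h′ m)
    overlapping with ℕₚ.≤-total m a
    ... | inj₁ m≤a = certify (x ∷ n ∷ q ∷ x′ ∷ Ω ∷ []) (inv a ∷ ψ (x ÷ m) ∷ ψ (x ÷ a) ∷ inv m ∷ inv j ∷ η ∷ ψ (x′ ÷
        a) ∷ ψ (x′ ÷ m) ∷ ρ a ∷ h′ m ∷ []) 0 (1 ✕ ν 0 :* χ 0 ⊑ χ 0 :* (# 2 :* ν 1 :* ν 0 :- # 2 :* ν 2) ∶ gain ∷ 2 ✕ χ
        0 :* (⌜ ν 2 :+ # 3 :* ν 1 ⌝ :* ν 0) ⊑ χ 0 :* (ν 2 :* ν 3 :+ ν 2) ∶ endpoint ∷ 1 ✕ ν 2 :* (χ 1 :- χ 2) ⊑ ν 2 :*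
        (# 2 :* (ν 0 :* χ 3 :- ν 0 :* χ 0) :+ # 4 :* (ν 0 :* χ 0) :* χ 4) ∶ *-monoˡ (ι q) (0≤ι q) bt ∷ 1 ✕ ν 2 :* (# 4
        :* (ν 0 :* χ 0) :* χ 4) ⊑ ν 2 :* (χ 5 :* (ν 0 :* χ 0)) ∶ *-monoˡ (ι q) (0≤ι q) small ∷ 1 ✕ ν 2 :* χ 6 ⊑ ν 2 :*
        χ 7 ∶ *-monoˡ (ι q) (0≤ι q) (ψ-mono (÷-antimonoʳ x′ 1≤m m≤a)) ∷ 2 ✕ ν 0 :* (ν 2 :* χ 3) ⊑ ν 0 :* (ν 4 :* χ 0)
        ∶ *-monoˡ (ι x) (0≤ι x) c₂ ∷ 2 ✕ ν 4 :* (ν 0 :* χ 0) ≐ ⌜ ν 2 :+ # 2 :* ν 1 ⌝ :* (ν 0 :* χ 0) ∶ cong (λ t → ι t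
        * (ι x * inv a)) Ω≡ ∷ 1 ✕ ν 2 :* (χ 8 :+ χ 9) ⊑ ν 4 :* (χ 8 :+ χ 9) ∶ ℚₚ.*-monoʳ-≤-nonNeg (ρ a + h′ m)
        {{ℚ.nonNegative (ℚₚ.+-mono-≤ (ρ-nonNeg a 1≤a a≤Z) (h′-nonNeg m))}} (ι-mono q≤Ω) ∷ 1 ✕ ν 2 :* ((# 2 :* (ν 3 :-
        ν 0) :+ χ 5 :* ν 0) :* χ 0 :- (χ 6 :- χ 2) :+ (χ 7 :- χ 1)) ≐ ν 2 :* (χ 8 :+ χ 9) ∶ sym (ρ-def) ∷ []) (ν 0 :*
        χ 0 ⊑ ν 4 :* (χ 8 :+ χ 9))
      where
      ρ-def : ι q * (ρ a + h′ m) ≡ ι q * ((ι 2 * (ι x′ - ι x) + η * ι x) * inv a - (ψ (x′ ÷ a) - ψ (x ÷ a)) + (ψ (x′ ÷ m) - ψ (x ÷ m)))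
      ρ-def = refl
      bt : ψ (x ÷ m) - ψ (x ÷ a) ≤ ι 2 * (ι x * inv m - ι x * inv a) + ι 4 * (ι x * inv a) * inv j
      bt = short x x a m 1≤a 1≤m (Y≤÷ 1≤a a≤Z) (÷-antimonoʳ x 1≤m m≤a) (ℕₚ.≤-trans (÷-≤ x m) x≤X) (wide (inv m) (inv a) x c₂ (0≤inv a))
    ... | inj₂ a≤m = certify (x ∷ n ∷ q ∷ x′ ∷ Ω ∷ []) (inv a ∷ ψ (x′ ÷ a) ∷ ψ (x′ ÷ m) ∷ inv m ∷ inv j ∷ η ∷ ψ (x ÷
        m) ∷ ψ (x ÷ a) ∷ ρ a ∷ h′ m ∷ []) 0 (1 ✕ ν 0 :* χ 0 ⊑ χ 0 :* (# 2 :* ν 1 :* ν 0 :- # 2 :* ν 2) ∶ gain ∷ 2 ✕ χ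
        0 :* (⌜ ν 2 :+ # 3 :* ν 1 ⌝ :* ν 0) ⊑ χ 0 :* (ν 2 :* ν 3 :+ ν 2) ∶ endpoint ∷ 1 ✕ ν 4 :* (χ 1 :- χ 2) ⊑ ν 4 :*
        (# 2 :* (ν 3 :* χ 0 :- ν 3 :* χ 3) :+ # 4 :* (ν 3 :* χ 3) :* χ 4) ∶ *-monoˡ (ι Ω) (0≤ι Ω) bt ∷ 1 ✕ ν 4 :* (# 4
        :* (ν 3 :* χ 3) :* χ 4) ⊑ ν 4 :* (χ 5 :* (ν 0 :* χ 0)) ∶ *-monoˡ (ι Ω) (0≤ι Ω) small′ ∷ 1 ✕ ν 4 :* χ 6 ⊑ ν 4
        :* χ 7 ∶ *-monoˡ (ι Ω) (0≤ι Ω) (ψ-mono (÷-antimonoʳ x 1≤a a≤m)) ∷ 2 ✕ ν 3 :* (ν 2 :* χ 0) ⊑ ν 3 :* (ν 4 :* χ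
        3) ∶ *-monoˡ (ι x′) (0≤ι x′) c₁ ∷ 2 ✕ ν 4 :* (ν 0 :* χ 0) ≐ ⌜ ν 2 :+ # 2 :* ν 1 ⌝ :* (ν 0 :* χ 0) ∶ cong (λ t
        → ι t * (ι x * inv a)) Ω≡ ∷ 1 ✕ ν 4 :* ((# 2 :* (ν 3 :- ν 0) :+ χ 5 :* ν 0) :* χ 0 :- (χ 1 :- χ 7) :+ (χ 2 :-
        χ 6)) ≐ ν 4 :* (χ 8 :+ χ 9) ∶ sym (ρ-def) ∷ []) (ν 0 :* χ 0 ⊑ ν 4 :* (χ 8 :+ χ 9))
      where
      ρ-def : ι Ω * (ρ a + h′ m) ≡ ι Ω * ((ι 2 * (ι x′ - ι x) + η * ι x) * inv a - (ψ (x′ ÷ a) - ψ (x ÷ a)) + (ψ (x′ ÷ m) - ψ (x ÷ m)))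
      ρ-def = refl
      bt : ψ (x′ ÷ a) - ψ (x′ ÷ m) ≤ ι 2 * (ι x′ * inv a - ι x′ * inv m) + ι 4 * (ι x′ * inv m) * inv j
      bt = short x′ x′ m a 1≤m 1≤a (Yx′ 1≤m m≤Z) (÷-antimonoʳ x′ 1≤a a≤m) (ℕₚ.≤-trans (÷-≤ x′ a) x′≤X) (wide (inv a) (inv m) x′ c₁ (0≤inv m))
      small′ : ι 4 * (ι x′ * inv m) * inv j ≤ η * (ι x * inv a)
      small′ = certify (x′ ∷ r ∷ x ∷ []) (inv j ∷ inv m ∷ inv a ∷ η ∷ []) 0 (1 ✕ # 4 :* χ 0 :* (ν 0 :* χ 1) ⊑ # 4 :*
          χ 0 :* (⌜ ν 1 :* ν 2 ⌝ :* χ 2) ∶ *-monoˡ (ι 4 * inv j) (*-nonNeg (0≤ι 4) 0≤j⁻) (*-mono-nonNeg (0≤inv m)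
          (ι-mono x′≤rx) (inv-anti 1≤a a≤m) (0≤ι (r *ₙ x))) ∷ 1 ✕ ν 2 :* χ 2 :* (# 4 :* ν 1 :* χ 0) ⊑ ν 2 :* χ 2 :* χ
          3 ∶ *-monoˡ (ι x * inv a) 0≤xa 4rj≤η ∷ []) (# 4 :* (ν 0 :* χ 1) :* χ 0 ⊑ χ 3 :* (ν 2 :* χ 2))
  S₂-diff : ∀ {y y′} → y ≤ₙ y′ → S₂ y′ - S₂ y ≡ ∑ y′ (λ b → Λ b * (ψ (y′ ÷ b) - ψ (y ÷ b)))
  S₂-diff {y} {y′} y≤y′ = trans (cong (ℚ._-_ (S₂ y′)) (sym (∑-extend (λ b → Λ b * ψ (y ÷ b)) y≤y′ λ b y≤b _ →
      trans (cong (λ t → Λ (suc b) * ψ t) (÷-small (s≤s y≤b))) (ℚₚ.*-zeroʳ (Λ (suc b))))))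
    (trans (sym (∑-- y′ (λ b → Λ b * ψ (y′ ÷ b)) (λ b → Λ b * ψ (y ÷ b))))
      (∑-cong y′ λ b _ → (certify [] (Λ (suc b) ∷ ψ (y′ ÷ suc b) ∷ ψ (y ÷ suc b) ∷ []) 0 [] (χ 0 :* χ 1 :- χ 0 :* χ 2
          ≐ χ 0 :* (χ 1 :- χ 2)))))

  D₃ G₀ : ℕ
  D₃ = excess r j Y
  G₀ = gain⁻¹ e Ω

  module _ (b≡ : b ≡ 200 *ₙ G₀ *ₙ (Ω *ₙ Ω)) (few : ψ x′ - ψ x ≤ inv j * ι x)
    (H-large₁ : ι (4 *ₙ b *ₙ D₃) ≤ H x) (H-large₂ : ι (55 +ₙ 8 *ₙ Y *ₙ Ω +ₙ 4 *ₙ b₁) ≤ H x) (x-square : (Y *ₙ Ω) *ₙ (Y *ₙ Ω) ≤ₙ x) where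

    private
      Hx = H x
      0≤x : 0ℚ ≤ ι x
      0≤x = 0≤ι x
      0≤Hx = 0≤H x
      1≤YΩ : 1 ≤ₙ Y *ₙ Ω
      1≤YΩ = ℕₚ.*-mono-≤ 1≤Y 1≤Ω

      sq = isqrt x
      z = proj₁ sq
      z²≤x : z *ₙ z ≤ₙ x
      z²≤x = proj₁ (proj₂ sq)
      x<z² : x <ₙ suc z *ₙ suc z
      x<z² = proj₂ (proj₂ sq)
      YΩ≤z : Y *ₙ Ω ≤ₙ z
      YΩ≤z = ℕₚ.≮⇒≥ λ z<YΩ → ℕₚ.<⇒≱ x<z² (ℕₚ.≤-trans (ℕₚ.*-mono-≤ z<YΩ z<YΩ) x-square)
      1≤z = ℕₚ.≤-trans 1≤YΩ YΩ≤z
      Y≤z : Y ≤ₙ z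
      Y≤z = ℕₚ.≤-trans (certify (Y ∷ Ω ∷ []) [] 0 (1 ✕ ν 0 :* # 1 ⊑ₙ ν 0 :* ν 1 ∶ ℕₚ.*-monoʳ-≤ Y 1≤Ω ∷ []) (ν 0 ⊑ₙ ν
          0 :* ν 1)) YΩ≤z
      z≤Z : z ≤ₙ Z
      z≤Z = ÷-greatest 1≤Y (ℕₚ.≤-trans (ℕₚ.*-monoʳ-≤ z Y≤z) z²≤x)
      1≤Z = ℕₚ.≤-trans 1≤z z≤Z
      Z≤x = ÷-≤ x Y
      Z≤X = ℕₚ.≤-trans Z≤x x≤X
      z≤X = ℕₚ.≤-trans z≤Z Z≤X
      Hx≤2Hz : Hx ≤ ι 2 * H z + ι 3
      Hx≤2Hz = certify [] (Hx ∷ H z ∷ γ ∷ inv z ∷ []) 0 (1 ✕ χ 0 ⊑ # 2 :* χ 1 :- χ 2 :+ # 3 :* χ 3 ∶ H-sqrt-upper x z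
          1≤z z²≤x x<z² x≤X ∷ 1 ✕ # 0 ⊑ χ 2 ∶ 0≤γ ∷ 3 ✕ χ 3 ⊑ # 1 ∶ inv≤1 z ∷ []) (χ 0 ⊑ # 2 :* χ 1 :+ # 3)

      η≤1 : η ≤ 1ℚ
      η≤1 = certify [] (η ∷ β ∷ []) 3 (1 ✕ # 4 :* χ 0 ≐ χ 1 ∶ 4η ∷ 1 ✕ χ 1 ⊑ # 1 ∶ inv≤1 b ∷ []) (χ 0 ⊑ # 1)
      D₃≤ : ι D₃ ≤ η * Hx
      D₃≤ = certify (b ∷ D₃ ∷ []) (η ∷ Hx ∷ β ∷ []) 0 (1 ✕ χ 0 :* ⌜ # 4 :* ν 0 :* ν 1 ⌝ ⊑ χ 0 :* χ 1 ∶ *-monoˡ η 0≤η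
          H-large₁ ∷ 1 ✕ χ 2 :* (ν 0 :* ν 1) ≐ # 4 :* χ 0 :* (ν 0 :* ν 1) ∶ sym (cong (λ t → t * (ι b * ι D₃)) 4η) ∷ 1
          ✕ # 1 :* ν 1 ≐ ν 0 :* χ 2 :* ν 1 ∶ sym (cong (λ t → t * ι D₃) (ι*inv 1≤b)) ∷ []) (ν 1 ⊑ χ 0 :* χ 1)

      -- Z is x / Y up to rounding, so R grows by a bounded amount between Z and x′; with
      -- Chebyshev's bound for `h′ a` the contribution is O(x).
      tail : ∑ x′ (λ a → Λ a * h′ a) - ∑ Z (λ a → Λ a * h′ a) ≤ ι 10 * ι r * ι x * (ι 2 * ι r * ι Y + ι 12)
      tail = certify (x′ ∷ r ∷ x ∷ Y ∷ []) (∑ x′ (λ a → Λ a * h′ a) ∷ ∑ Z (λ a → Λ a * h′ a) ∷ ∑ x′ (λ a → ι 10 * ι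
          x′ * (Λ a * inv a)) ∷ ∑ Z (λ a → ι 10 * ι x′ * (Λ a * inv a)) ∷ R x′ ∷ R Z ∷ []) 0 (1 ✕ χ 0 :- χ 1 ⊑ χ 2 :-
          χ 3 ∶ ∑-between Z x′ (λ a → Λ a * h′ a) (λ a → ι 10 * ι x′ * (Λ a * inv a)) Z≤x′ bound ∷ 1 ✕ χ 2 ≐ # 10 :* ν
          0 :* χ 4 ∶ ∑-*ˡ x′ (ι 10 * ι x′) (λ a → Λ a * inv a) ∷ 1 ✕ # 10 :* ν 0 :* χ 5 ≐ χ 3 ∶ sym (∑-*ˡ Z (ι 10 * ι
          x′) (λ a → Λ a * inv a)) ∷ 10 ✕ ν 0 :* (χ 4 :- χ 5) ⊑ ⌜ ν 1 :* ν 2 ⌝ :* (# 2 :* ν 1 :* ν 3 :+ # 12) ∶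
          *-mono-nonNeg RR≥0 (ι-mono x′≤rx) RR≤ (0≤ι (r *ₙ x)) ∷ []) (χ 0 :- χ 1 ⊑ # 10 :* ν 1 :* ν 2 :* (# 2 :* ν 1
          :* ν 3 :+ # 12))
        where
        Z≤x′ = ℕₚ.≤-trans Z≤x x≤x′
        bound : ∀ a → Z ≤ₙ a → a <ₙ x′ → Λ (suc a) * h′ (suc a) ≤ ι 10 * ι x′ * (Λ (suc a) * inv (suc a))
        bound a _ _ = certify (x′ ∷ []) (Λ (suc a) ∷ h′ (suc a) ∷ inv (suc a) ∷ []) 0 (1 ✕ χ 0 :* χ 1 ⊑ χ 0 :* (# 10
            :* (ν 0 :* χ 2)) ∶ *-monoˡ (Λ (suc a)) (Λ-nonNeg (suc a)) h≤ ∷ []) (χ 0 :* χ 1 ⊑ # 10 :* ν 0 :* (χ 0 :* χ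
            2))
          where h≤ : h′ (suc a) ≤ ι 10 * (ι x′ * inv (suc a))
                h≤ = certify (x′ ÷ suc a ∷ x′ ∷ []) (ψ (x′ ÷ suc a) ∷ ψ (x ÷ suc a) ∷ inv (suc a) ∷ []) 0 (1 ✕ χ 0 ⊑
                    # 10 :* ν 0 ∶ chebyshev (x′ ÷ suc a) (ℕₚ.≤-trans (÷-≤ x′ (suc a)) x′≤X) ∷ 1 ✕ # 0 ⊑ χ 1 ∶ 0≤ψ (x ÷
                    suc a) ∷ 10 ✕ ν 0 ⊑ ν 1 :* χ 2 ∶ ÷≤ x′ {suc a} (s≤s z≤n) ∷ []) (χ 0 :- χ 1 ⊑ # 10 :* (ν 1 :* χ 2))
        RR≥0 : 0ℚ ≤ R x′ - R Z
        RR≥0 = certify [] (R Z ∷ R x′ ∷ []) 0 (1 ✕ χ 0 ⊑ χ 1 ∶ R-mono Z≤x′ ∷ []) (# 0 ⊑ χ 1 :- χ 0)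
        x≤2ZY : x ≤ₙ 2 *ₙ Z *ₙ Y
        x≤2ZY = certify (x ∷ Z ∷ Y ∷ []) [] 0 (1 ✕ ν 0 ⊏ₙ ν 1 :* ν 2 :+ ν 2 ∶ ÷-upper x Y 1≤Y ∷ 1 ✕ # 1 :* ν 2 ⊑ₙ ν 1
            :* ν 2 ∶ ℕₚ.*-monoˡ-≤ Y 1≤Z ∷ []) (ν 0 ⊑ₙ # 2 :* ν 1 :* ν 2)
        RR≤ : R x′ - R Z ≤ ι 2 * ι r * ι Y + ι 12
        RR≤ = certify (x′ ∷ Z ∷ r ∷ Y ∷ []) (R x′ ∷ H x′ ∷ H Z ∷ R Z ∷ inv Z ∷ []) 0 (1 ✕ χ 0 ⊑ χ 1 :+ # 10 ∶
            mertens-upper x′ (ℕₚ.≤-trans 1≤x x≤x′) x′≤X ∷ 1 ✕ χ 2 :- # 2 ⊑ χ 3 ∶ mertens-lower Z 1≤Z Z≤X ∷ 1 ✕ χ 1 :-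
            χ 2 ⊑ (ν 0 :- ν 1) :* χ 4 ∶ H-growth 1≤Z Z≤x′ ∷ 1 ✕ χ 4 :* ν 0 ⊑ χ 4 :* ⌜ ν 2 :* (# 2 :* ν 1 :* ν 3) ⌝ ∶
            *-monoˡ (inv Z) (0≤inv Z) (ι-mono (ℕₚ.≤-trans x′≤rx (ℕₚ.*-monoʳ-≤ r x≤2ZY))) ∷ 2 ✕ ν 2 :* ν 3 :* (ν 1 :* χ
            4) ≐ ν 2 :* ν 3 :* # 1 ∶ cong (λ t → ι r * ι Y * t) (ι*inv 1≤Z) ∷ 1 ✕ # 1 ≐ ν 1 :* χ 4 ∶ sym (ι*inv 1≤Z) ∷
            []) (χ 0 :- χ 3 ⊑ # 2 :* ν 2 :* ν 3 :+ # 12)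

    -- As (x , x′] carries little mass, `selberg-lower` forces S₂ x′ - S₂ x = Σ Λ a h′ a to be
    -- almost 2 Δ H x. By Mertens, Σ Λ a M / a is about M H x, so the rescaled intervals are nearly
    -- full on average.
    total-defect : ∑ Z (λ a → Λ a * ρ a) ≤ β * (ι x * Hx)
    total-defect = certify (x′ ∷ x ∷ r ∷ Y ∷ D r j ∷ D₃ ∷ []) (∑ Z (λ a → Λ a * ρ a) ∷ η ∷ R Z ∷ ∑ Z (λ a → Λ a * h′
        a) ∷ Hx ∷ ∑ x′ (λ a → Λ a * h′ a) ∷ S₂ x′ ∷ S₂ x ∷ ψ x′ ∷ ψ x ∷ inv j ∷ β ∷ []) 1 (2 ✕ χ 0 ≐ (# 2 :* (ν 0 :- ν
        1) :+ χ 1 :* ν 1) :* χ 2 :- χ 3 ∶ expand ∷ 2 ✕ (# 2 :* (ν 0 :- ν 1) :+ χ 1 :* ν 1) :* χ 2 ⊑ (# 2 :* (ν 0 :- ν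
        1) :+ χ 1 :* ν 1) :* (χ 4 :+ # 10) ∶ *-monoˡ M 0≤M RZ≤ ∷ 2 ✕ χ 5 :- χ 3 ⊑ # 10 :* ν 2 :* ν 1 :* (# 2 :* ν 2 :*
        ν 3 :+ # 12) ∶ tail ∷ 2 ✕ χ 6 :- χ 7 ≐ χ 5 ∶ S₂-diff x≤x′ ∷ 2 ✕ # 2 :* (ν 0 :- ν 1) :* χ 4 ⊑ χ 6 :- χ 7 :+ χ 4
        :* (χ 8 :- χ 9) :+ ν 1 :* (χ 4 :* χ 10 :+ ν 4) ∶ selberg-lower r j x x′ 1≤r 1≤j 1≤x x≤x′ x′≤rx x′≤X ∷ 2 ✕ χ 4
        :* (χ 8 :- χ 9) ⊑ χ 4 :* (χ 10 :* ν 1) ∶ *-monoˡ Hx 0≤Hx few ∷ 1 ✕ ν 1 :* χ 4 :* (# 4 :* χ 10) ⊑ ν 1 :* χ 4 :*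
        χ 1 ∶ *-monoˡ (ι x * Hx) (*-nonNeg 0≤x 0≤Hx) 4j≤η ∷ 20 ✕ ν 1 :* χ 1 ⊑ ν 1 :* # 1 ∶ *-monoˡ (ι x) 0≤x η≤1 ∷ 40
        ✕ ν 0 ⊑ₙ ν 2 :* ν 1 ∶ x′≤rx ∷ 2 ✕ ν 1 :* ν 5 ⊑ ν 1 :* (χ 1 :* χ 4) ∶ *-monoˡ (ι x) 0≤x D₃≤ ∷ 2 ✕ ν 1 :* (# 20
        :* ν 2 :+ # 10 :+ ν 4 :+ # 10 :* ν 2 :* (# 2 :* ν 2 :* ν 3 :+ # 12)) ≐ ν 1 :* ν 5 ∶ sym (cong (λ t → ι x * t)
        D₃≡) ∷ 2 ✕ ν 1 :* χ 4 :* (# 4 :* χ 1) ≐ ν 1 :* χ 4 :* χ 11 ∶ cong (λ t → ι x * Hx * t) 4η ∷ 3 ✕ # 0 ⊑ ν 1 :* χ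
        4 :* χ 1 ∶ *-nonNeg (*-nonNeg 0≤x 0≤Hx) 0≤η ∷ []) (χ 0 ⊑ χ 11 :* (ν 1 :* χ 4))
      where
      D₃≡ : ι D₃ ≡ ι 20 * ι r + ι 10 + ι (D r j) + ι 10 * ι r * (ι 2 * ι r * ι Y + ι 12)
      D₃≡ = certify (D₃ ∷ r ∷ D r j ∷ Y ∷ []) [] 0 (1 ✕ ν 0 ≐ₙ # 20 :* ν 1 :+ # 10 :+ ν 2 :+ # 10 :* ν 1 :* (# 2 :* ν
          1 :* ν 3 :+ # 12) ∶ excess-def r j Y ∷ []) (ν 0 ≐ # 20 :* ν 1 :+ # 10 :+ ν 2 :+ # 10 :* ν 1 :* (# 2 :* ν 1
          :* ν 3 :+ # 12))
      0≤M : 0ℚ ≤ M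
      0≤M = certify (x ∷ []) (Δ ∷ η ∷ []) 0 (2 ✕ # 0 ⊑ χ 0 ∶ 0≤Δ ∷ 1 ✕ # 0 ⊑ χ 1 :* ν 0 ∶ *-nonNeg 0≤η 0≤x ∷ []) (# 0
          ⊑ # 2 :* χ 0 :+ χ 1 :* ν 0)
      RZ≤ : R Z ≤ Hx + ι 10
      RZ≤ = certify [] (R Z ∷ H Z ∷ Hx ∷ []) 0 (1 ✕ χ 0 ⊑ χ 1 :+ # 10 ∶ mertens-upper Z 1≤Z Z≤X ∷ 1 ✕ χ 1 ⊑ χ 2 ∶
          H-mono Z≤x ∷ []) (χ 0 ⊑ χ 2 :+ # 10)
      expand : ∑ Z (λ a → Λ a * ρ a) ≡ M * R Z - ∑ Z (λ a → Λ a * h′ a)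
      expand = trans (∑-cong Z λ a _ → (certify [] (Λ (suc a) ∷ M ∷ inv (suc a) ∷ h′ (suc a) ∷ []) 0 [] (χ 0 :* (χ 1
          :* χ 2 :- χ 3) ≐ χ 1 :* (χ 0 :* χ 2) :- χ 0 :* χ 3)))
        (trans (∑-- Z (λ a → M * (Λ a * inv a)) (λ a → Λ a * h′ a)) (cong (ℚ._- ∑ Z (λ a → Λ a * h′ a)) (∑-*ˡ Z M (λ a → Λ a * inv a))))

    -- Otherwise Σ Λ a ρ a over a ≤ z would exceed 4 β x R z, about 2 β x H x as log z is half of
    -- log x: twice what `total-defect` allows. Keeping a₀ below √x leaves a long range for the
    -- second factor c.
    full-interval : ∃[ a₀ ] (1 ≤ₙ a₀ × a₀ ≤ₙ z × ι a₀ * ρ a₀ ≤ ι 4 * β * ι x)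
    full-interval = [ id , refute ]′ (search (λ a → ι a * ρ a ℚ.≤? ι 4 * β * ι x) z)
      where
      refute : (∀ a → a <ₙ z → ¬ (ι (suc a) * ρ (suc a) ≤ ι 4 * β * ι x)) → ∃[ a₀ ] (1 ≤ₙ a₀ × a₀ ≤ₙ z × ι a₀ * ρ a₀ ≤ ι 4 * β * ι x)
      refute none = contradiction
          (ι-cancelˡ {x} 1≤x (certify (b ∷ x ∷ []) (β ∷ Hx ∷ []) 0 (1 ✕ ν 0 :* (χ 0 :* ν 1 :* χ 1) ⊑ ν 0 :* (χ 0 :* ν
              1 :* # 14) ∶ *-monoˡ (ι b) (0≤ι b) above ∷ 14 ✕ ν 1 :* (ν 0 :* χ 0) ≐ ν 1 :* # 1 ∶ cong (λ t → ι x * t)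
              (ι*inv 1≤b) ∷ 1 ✕ ν 1 :* χ 1 :* # 1 ≐ ν 1 :* χ 1 :* (ν 0 :* χ 0) ∶ sym (cong (λ t → ι x * Hx * t) (ι*inv
              1≤b)) ∷ []) (ν 1 :* χ 1 ⊑ ν 1 :* # 14))) (λ h14 → ℚₚ.<-irrefl refl (certify (Y ∷ Ω ∷ b₁ ∷ []) (Hx ∷ [])
                  0 (1 ✕ χ 0 ⊑ # 14 ∶ h14 ∷ 1 ✕ ⌜ # 55 :+ # 8 :* ν 0 :* ν 1 :+ # 4 :* ν 2 ⌝ ⊑ χ 0 ∶ H-large₂ ∷ []) (χ
                  0 ⊏ χ 0)))
        where
        ∑-upTo-Z : ∑ z (λ a → Λ a * ρ a) ≤ ∑ Z (λ a → Λ a * ρ a)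
        ∑-upTo-Z = certify (Z ∷ z ∷ []) (∑ Z (λ a → Λ a * ρ a) ∷ ∑ z (λ a → Λ a * ρ a) ∷ []) 0 (1 ✕ (ν 0 :- ν 1) :* #
            0 ⊑ χ 0 :- χ 1 ∶ (∑-between-≥ z Z {λ a → Λ a * ρ a} 0ℚ z≤Z (λ a _ a<Z → *-nonNeg (Λ-nonNeg (suc a))
            (ρ-nonNeg (suc a) (s≤s z≤n) a<Z))) ∷ []) (χ 1 ⊑ χ 0)
        below : ι 4 * β * ι x * R z ≤ ∑ z (λ a → Λ a * ρ a)
        below = ℚₚ.≤-trans (ℚₚ.≤-reflexive (sym (∑-*ˡ z (ι 4 * β * ι x) (λ a → Λ a * inv a)))) (∑-mono z term)
          where
          term : ∀ a → a <ₙ z → ι 4 * β * ι x * (Λ (suc a) * inv (suc a)) ≤ Λ (suc a) * ρ (suc a)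
          term a a<z = certify (x ∷ a ∷ []) (Λ (suc a) ∷ inv (suc a) ∷ β ∷ ρ (suc a) ∷ []) 0 (1 ✕ χ 0 :* χ 1 :* (# 4
              :* χ 2 :* ν 0) ⊑ χ 0 :* χ 1 :* (⌜ # 1 :+ ν 1 ⌝ :* χ 3) ∶ *-monoˡ (Λ (suc a) * inv (suc a)) (*-nonNeg
              (Λ-nonNeg (suc a)) (0≤inv (suc a))) (ℚₚ.<⇒≤ (ℚₚ.≰⇒> (none a a<z))) ∷ 1 ✕ χ 0 :* χ 3 :* (⌜ # 1 :+ ν 1 ⌝
              :* χ 1) ≐ χ 0 :* χ 3 :* # 1 ∶ cong (λ t → Λ (suc a) * ρ (suc a) * t) (ι*inv {suc a} (s≤s z≤n)) ∷ []) (#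
              4 :* χ 2 :* ν 0 :* (χ 0 :* χ 1) ⊑ χ 0 :* χ 3)
        above : β * ι x * Hx ≤ β * ι x * ι 14
        above = certify (x ∷ []) (∑ z (λ a → Λ a * ρ a) ∷ ∑ Z (λ a → Λ a * ρ a) ∷ β ∷ Hx ∷ R z ∷ H z ∷ []) 0 (1 ✕ χ 0
            ⊑ χ 1 ∶ ∑-upTo-Z ∷ 1 ✕ χ 1 ⊑ χ 2 :* (ν 0 :* χ 3) ∶ total-defect ∷ 1 ✕ # 4 :* χ 2 :* ν 0 :* χ 4 ⊑ χ 0 ∶
            below ∷ 4 ✕ χ 2 :* ν 0 :* (χ 5 :- # 2) ⊑ χ 2 :* ν 0 :* χ 4 ∶ *-monoˡ (β * ι x) (*-nonNeg (0≤inv b) 0≤x)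
            (mertens-lower z 1≤z z≤X) ∷ 2 ✕ χ 2 :* ν 0 :* χ 3 ⊑ χ 2 :* ν 0 :* (# 2 :* χ 5 :+ # 3) ∶ *-monoˡ (β * ι x)
            (*-nonNeg (0≤inv b) 0≤x) Hx≤2Hz ∷ []) (χ 2 :* ν 0 :* χ 3 ⊑ χ 2 :* ν 0 :* # 14)

    module _ (a₀ : ℕ) (1≤a₀ : 1 ≤ₙ a₀) (a₀≤z : a₀ ≤ₙ z) (full : ι a₀ * ρ a₀ ≤ ι 4 * β * ι x) where
      private
        a₀≤Z = ℕₚ.≤-trans a₀≤z z≤Z
        y = x ÷ a₀
        y′ = x′ ÷ a₀
        Y≤y = Y≤÷ 1≤a₀ a₀≤Z
        1≤y = ℕₚ.≤-trans 1≤Y Y≤y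
        y≤y′ = ÷-monoˡ a₀ x≤x′
        y′≤X = ℕₚ.≤-trans (÷-≤ x′ a₀) x′≤X
        y≤x = ÷-≤ x a₀
        i₀ = inv a₀
        0≤i₀ = 0≤inv a₀
        b₂ = x ÷ (Y *ₙ Ω *ₙ a₀)
        1≤W : 1 ≤ₙ Y *ₙ Ω *ₙ a₀
        1≤W = ℕₚ.*-mono-≤ 1≤YΩ 1≤a₀

        ρ₀ : ρ a₀ ≤ ι 4 * β * (ι x * i₀)
        ρ₀ = certify (a₀ ∷ x ∷ []) (i₀ ∷ ρ a₀ ∷ β ∷ []) 0 (1 ✕ χ 0 :* (ν 0 :* χ 1) ⊑ χ 0 :* (# 4 :* χ 2 :* ν 1) ∶
            *-monoˡ i₀ 0≤i₀ full ∷ 1 ✕ χ 1 :* # 1 ≐ χ 1 :* (ν 0 :* χ 0) ∶ sym (cong (λ t → ρ a₀ * t) (ι*inv 1≤a₀)) ∷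
            []) (χ 1 ⊑ # 4 :* χ 2 :* (ν 1 :* χ 0))

        -- Apply `selberg-upper` to the nearly full interval (y , y′]: its mass uses up almost all
        -- of 2 (y′ - y) H y and leaves little for S₂.
        S₂-small : S₂ y′ - S₂ y ≤ ι 4 * β * (ι x * i₀) * Hx
        S₂-small = ℚₚ.≤-trans step (*-mono-Hy (H-mono y≤x))
          where
          *-mono-Hy : H y ≤ Hx → ι 4 * β * (ι x * i₀) * H y ≤ ι 4 * β * (ι x * i₀) * Hx
          *-mono-Hy = *-monoˡ (ι 4 * β * (ι x * i₀)) (*-nonNeg (*-nonNeg (0≤ι 4) (0≤inv b)) (*-nonNeg 0≤x 0≤i₀))
          M≡ : h′ a₀ ≡ (ι 2 * (ι x′ - ι x) + η * ι x) * i₀ - ρ a₀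
          M≡ = certify [] (h′ a₀ ∷ M ∷ i₀ ∷ []) 0 [] (χ 0 ≐ χ 1 :* χ 2 :- (χ 1 :* χ 2 :- χ 0))
          step : S₂ y′ - S₂ y ≤ ι 4 * β * (ι x * i₀) * H y
          step = certify (y′ ∷ y ∷ D r j ∷ j ∷ x′ ∷ x ∷ []) (S₂ y′ ∷ S₂ y ∷ H y ∷ h′ a₀ ∷ inv j ∷ i₀ ∷ η ∷ ρ a₀ ∷ β ∷
              []) 0 (1 ✕ χ 0 :- χ 1 :+ χ 2 :* χ 3 ⊑ # 2 :* (ν 0 :- ν 1) :* χ 2 :+ ν 1 :* (χ 2 :* χ 4 :+ ν 2) ∶
              selberg-upper r j y y′ 1≤r 1≤j 1≤y y≤y′ (floors x x′ a₀ a₀ 1≤a₀ 1≤a₀ 1≤y (x′a a₀)) y′≤X ∷ 1 ✕ ν 1 :* χ 4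
              :* (ν 3 :* ν 2) ⊑ ν 1 :* χ 4 :* χ 2 ∶ *-monoˡ (ι y * inv j) (*-nonNeg (0≤ι y) 0≤j⁻) (Y-large y Y≤y) ∷ 1
              ✕ ν 1 :* ν 2 :* # 1 ≐ ν 1 :* ν 2 :* (ν 3 :* χ 4) ∶ sym (cong (λ t → ι y * ι (D r j) * t) (ι*inv 1≤j)) ∷
              2 ✕ χ 2 :* ν 0 ⊑ χ 2 :* (ν 4 :* χ 5) ∶ *-monoˡ (H y) (0≤H y) (÷≤ x′ 1≤a₀) ∷ 2 ✕ χ 2 :* (ν 5 :* χ 5 :- #
              1) ⊑ χ 2 :* ν 1 ∶ *-monoˡ (H y) (0≤H y) (÷≥ x 1≤a₀) ∷ 2 ✕ χ 2 :* χ 4 :* ν 1 ⊑ χ 2 :* χ 4 :* (ν 5 :* χ 5)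
              ∶ *-monoˡ (H y * inv j) (*-nonNeg (0≤H y) 0≤j⁻) (÷≤ x 1≤a₀) ∷ 2 ✕ χ 2 :* # 1 ⊑ χ 2 :* (ν 5 :* χ 5 :* χ
              4) ∶ *-monoˡ (H y) (0≤H y) (1≤uaj x a₀ 1≤a₀ Y≤y) ∷ 1 ✕ χ 2 :* (ν 5 :* χ 5) :* (# 4 :* χ 4) ⊑ χ 2 :* (ν 5
              :* χ 5) :* χ 6 ∶ *-monoˡ (H y * (ι x * i₀)) (*-nonNeg (0≤H y) (*-nonNeg 0≤x 0≤i₀)) 4j≤η ∷ 1 ✕ χ 2 :* χ 7
              ⊑ χ 2 :* (# 4 :* χ 8 :* (ν 5 :* χ 5)) ∶ *-monoˡ (H y) (0≤H y) ρ₀ ∷ 1 ✕ χ 2 :* ((# 2 :* (ν 4 :- ν 5) :+ χ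
              6 :* ν 5) :* χ 5 :- χ 7) ≐ χ 2 :* χ 3 ∶ sym (cong (λ t → H y * t) M≡) ∷ []) (χ 0 :- χ 1 ⊑ # 4 :* χ 8 :*
              (ν 5 :* χ 5) :* χ 2)

        b₂≤y′ : b₂ ≤ₙ y′
        b₂≤y′ = ℕₚ.≤-trans (÷-antimonoʳ x 1≤a₀ (certify (a₀ ∷ Y ∷ Ω ∷ []) [] 0 (1 ✕ # 1 :* ν 0 ⊑ₙ ν 1 :* ν 2 :* ν 0 ∶
            ℕₚ.*-monoˡ-≤ a₀ 1≤YΩ ∷ []) (ν 0 ⊑ₙ ν 1 :* ν 2 :* ν 0))) y≤y′

        -- Since x ÷ a₀ ÷ c is x ÷ (a₀ c), the sum is part of S₂ y′ - S₂ y. So most of the intervals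
        -- at a₀ c are nearly empty.
        empties : ∑ b₂ (λ c → Λ c * h′ (a₀ *ₙ c)) ≤ ι 4 * β * (ι x * i₀) * Hx
        empties = ℚₚ.≤-trans (∑-upTo-mono (λ c → Λ c * h′ (a₀ *ₙ c)) (λ c → *-nonNeg (Λ-nonNeg c) (h′-nonNeg (a₀ *ₙ c))) b₂≤y′)
          (ℚₚ.≤-trans (ℚₚ.≤-reflexive (trans (∑-cong y′ λ c _ → cong₂ (λ s t → Λ (suc c) * (ψ s - ψ t)) (sym (÷-÷ x′ a₀ (suc c))) (sym (÷-÷ x a₀ (suc c))))
             (sym (S₂-diff y≤y′)))) S₂-small)

        near? : ∀ m a → Dec (q *ₙ m <ₙ Ω *ₙ a × q *ₙ a ≤ₙ Ω *ₙ m)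
        near? m a = (q *ₙ m ℕ.<? Ω *ₙ a) ×-dec (q *ₙ a ℕ.≤? Ω *ₙ m)

        -- `inner c` confronts the interval at a₀ c, typically empty, with those at all a near a₀ c,
        -- typically full. It is bounded below by `overlapping` and above after separating ρ (`F₁`)
        -- from h′ (`F₂`).
        inner F₁ F₂ : ℕ → ℚ
        F₁ c = ∑ Z (λ a → 𝟙 (near? (a₀ *ₙ c) a) * (Λ a * ρ a))
        F₂ c = ∑ Z (λ a → 𝟙 (near? (a₀ *ₙ c) a) * Λ a)
        inner c = ∑ Z (λ a → 𝟙 (near? (a₀ *ₙ c) a) * (Λ a * (ρ a + h′ (a₀ *ₙ c))))

        Ωm≤Z : ∀ {c} → c ≤ₙ b₂ → Ω *ₙ (a₀ *ₙ c) ≤ₙ Z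
        Ωm≤Z {c} c≤b₂ = ÷-greatest 1≤Y (certify (c ∷ Y ∷ Ω ∷ a₀ ∷ x ∷ []) [] 0 (1 ✕ ν 0 :* (ν 1 :* ν 2 :* ν 3) ⊑ₙ ν 4
            ∶ (÷-smallest {x} {Y *ₙ Ω *ₙ a₀} {c} c≤b₂) ∷ []) (ν 2 :* (ν 3 :* ν 0) :* ν 1 ⊑ₙ ν 4))

        term-nonNeg : ∀ c a → a <ₙ Z → 0ℚ ≤ 𝟙 (near? (a₀ *ₙ c) (suc a)) * (Λ (suc a) * (ρ (suc a) + h′ (a₀ *ₙ c)))
        term-nonNeg c a a<Z = *-nonNeg (𝟙-nonNeg (near? (a₀ *ₙ c) (suc a))) (*-nonNeg (Λ-nonNeg (suc a))
          (ℚₚ.+-mono-≤ (ρ-nonNeg (suc a) (s≤s z≤n) a<Z) (h′-nonNeg (a₀ *ₙ c))))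

        inner-nonNeg : ∀ c → 0ℚ ≤ inner c
        inner-nonNeg c = ∑-nonNeg Z (term-nonNeg c)

        module _ (c : ℕ) (b₁≤c : b₁ ≤ₙ c) (1≤c : 1 ≤ₙ c) (c≤b₂ : c ≤ₙ b₂) where
          m = a₀ *ₙ c
          1≤m : 1 ≤ₙ m
          1≤m = ℕₚ.*-mono-≤ 1≤a₀ 1≤c
          c≤m : c ≤ₙ m
          c≤m = certify (c ∷ a₀ ∷ []) [] 0 (1 ✕ # 1 :* ν 0 ⊑ₙ ν 1 :* ν 0 ∶ ℕₚ.*-monoˡ-≤ c 1≤a₀ ∷ []) (ν 0 ⊑ₙ ν 1 :* ν
              0)
          b₁≤m = ℕₚ.≤-trans b₁≤c c≤m
          u = (q *ₙ m) ÷ Ω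
          u′ = (Ω *ₙ m) ÷ q
          u′≤Z : u′ ≤ₙ Z
          u′≤Z = ℕₚ.≤-trans (÷-≤ (Ω *ₙ m) q) (Ωm≤Z c≤b₂)
          m≤Z : m ≤ₙ Z
          m≤Z = ℕₚ.≤-trans (certify (m ∷ Ω ∷ []) [] 0 (1 ✕ # 1 :* ν 0 ⊑ₙ ν 1 :* ν 0 ∶ ℕₚ.*-monoˡ-≤ m 1≤Ω ∷ []) (ν 0
              ⊑ₙ ν 1 :* ν 0)) (Ωm≤Z c≤b₂)
          u<₁ : q *ₙ m <ₙ u *ₙ Ω +ₙ Ω
          u<₁ = ÷-upper (q *ₙ m) Ω 1≤Ω
          2ΩN≤m : 2 *ₙ Ω *ₙ (N +ₙ 1) ≤ₙ m
          2ΩN≤m = ℕₚ.≤-trans b₁≥₂ b₁≤m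
          m<Ωu : m <ₙ u *ₙ Ω +ₙ Ω
          m<Ωu = certify (q ∷ m ∷ u ∷ Ω ∷ []) [] 0 (1 ✕ ν 0 :* ν 1 ⊏ₙ ν 2 :* ν 3 :+ ν 3 ∶ u<₁ ∷ 1 ✕ # 1 :* ν 1 ⊑ₙ ν 0
              :* ν 1 ∶ ℕₚ.*-monoˡ-≤ m 1≤q ∷ []) (ν 1 ⊏ₙ ν 2 :* ν 3 :+ ν 3)
          m≤2Ωu : m ≤ₙ 2 *ₙ (Ω *ₙ u)
          m≤2Ωu = certify (m ∷ u ∷ Ω ∷ N ∷ []) [] 0 (2 ✕ ν 0 ⊏ₙ ν 1 :* ν 2 :+ ν 2 ∶ m<Ωu ∷ 1 ✕ # 2 :* ν 2 :* (ν 3 :+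
              # 1) ⊑ₙ ν 0 ∶ 2ΩN≤m ∷ []) (ν 0 ⊑ₙ # 2 :* (ν 2 :* ν 1))
          N≤u : N ≤ₙ u
          N≤u = ℕₚ.m<1+n⇒m≤n (ℕₚ.*-cancelˡ-< Ω N (suc u) (certify (m ∷ Ω ∷ u ∷ N ∷ []) [] 1 (1 ✕ ν 0 ⊑ₙ # 2 :* (ν 1
              :* ν 2) ∶ m≤2Ωu ∷ 1 ✕ # 2 :* ν 1 :* (ν 3 :+ # 1) ⊑ₙ ν 0 ∶ 2ΩN≤m ∷ 4 ✕ # 1 ⊑ₙ ν 1 ∶ 1≤Ω ∷ []) (ν 1 :* ν 3
              ⊏ₙ ν 1 :* (# 1 :+ ν 2))))
          -- Ω² = q (q + 4 n) + 4 n², so the window from q m / Ω to Ω m / q has ratio above 1 + 4 n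
          -- / q; the surplus 4 n² m pays for rounding because m ≥ Ω q.
          ratio : (q +ₙ 4 *ₙ n) *ₙ u ≤ₙ q *ₙ u′
          ratio = ℕₚ.*-cancelˡ-≤ Ω {{ℕ.>-nonZero 1≤Ω}} (certify (q ∷ n ∷ u ∷ Ω ∷ m ∷ u′ ∷ []) [] 0 (1 ✕ (ν 0 :+ # 4
              :* ν 1) :* (ν 2 :* ν 3) ⊑ₙ (ν 0 :+ # 4 :* ν 1) :* (ν 0 :* ν 4) ∶ ℕₚ.*-monoʳ-≤ (q +ₙ 4 *ₙ n) (÷-lower (q
              *ₙ m) Ω) ∷ 1 ✕ ν 3 :* (ν 3 :* ν 4) ⊑ₙ ν 3 :* (ν 5 :* ν 0 :+ ν 0) ∶ ℕₚ.*-monoʳ-≤ Ω (ℕₚ.<⇒≤ (÷-upper (Ω *ₙ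
              m) q 1≤q)) ∷ 4 ✕ ν 3 :* ν 0 ⊑ₙ ν 4 ∶ ℕₚ.≤-trans b₁≥₁ b₁≤m ∷ 1 ✕ (ν 0 :+ # 2 :* ν 1) :* ((ν 0 :+ # 2 :* ν
              1) :* ν 4) ≐ₙ ν 3 :* (ν 3 :* ν 4) ∶ sym (cong (λ t → t *ₙ (t *ₙ m)) Ω≡) ∷ 4 ✕ # 1 :* (# 1 :* ν 4) ⊑ₙ ν 1
              :* (ν 1 :* ν 4) ∶ ℕₚ.*-mono-≤ 1≤n (ℕₚ.*-monoˡ-≤ m 1≤n) ∷ []) (ν 3 :* ((ν 0 :+ # 4 :* ν 1) :* ν 2) ⊑ₙ ν 3
              :* (ν 0 :* ν 5)))
          u≤u′ : u ≤ₙ u′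
          u≤u′ = ℕₚ.*-cancelˡ-≤ q {{ℕ.>-nonZero 1≤q}} (certify (q ∷ n ∷ u ∷ u′ ∷ []) [] 0 (1 ✕ (ν 0 :+ # 4 :* ν 1) :*
              ν 2 ⊑ₙ ν 0 :* ν 3 ∶ ratio ∷ []) (ν 0 :* ν 2 ⊑ₙ ν 0 :* ν 3))
          Ωm = Ω *ₙ m
          1≤Ωm = ℕₚ.*-mono-≤ 1≤Ω 1≤m
          G : ℕ → ℚ
          G a = 𝟙 (near? m a) * (Λ a * (ρ a + h′ m))
          near-term : ∀ a → u ≤ₙ a → a <ₙ u′ → ι x * inv Ωm * Λ (suc a) ≤ ι Ω * G (suc a)
          near-term a u≤a a<u′ = certify (Ω ∷ x ∷ []) (𝟙 (near? m (suc a)) ∷ Λ (suc a) ∷ ρ (suc a) ∷ h′ m ∷ inv (suc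
              a) ∷ inv Ωm ∷ []) 0 (1 ✕ ν 0 :* (# 1 :* (χ 1 :* (χ 2 :+ χ 3))) ≐ ν 0 :* (χ 0 :* (χ 1 :* (χ 2 :+ χ 3))) ∶
              sym (cong (λ t → ι Ω * (t * (Λ (suc a) * (ρ (suc a) + h′ m)))) (𝟙-yes (near? m (suc a)) (n₁ , n₂))) ∷ 1
              ✕ χ 1 :* (ν 1 :* χ 4) ⊑ χ 1 :* (ν 0 :* (χ 2 :+ χ 3)) ∶ *-monoˡ (Λ (suc a)) (Λ-nonNeg (suc a))
              (overlapping (suc a) m (s≤s z≤n) 1≤m (ℕₚ.≤-trans a<u′ u′≤Z) m≤Z (ℕₚ.<⇒≤ n₁) n₂) ∷ 1 ✕ χ 1 :* ν 1 :* χ 5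
              ⊑ χ 1 :* ν 1 :* χ 4 ∶ *-monoˡ (Λ (suc a) * ι x) (*-nonNeg (Λ-nonNeg (suc a)) 0≤x) (inv-anti {suc a} {Ωm}
              (s≤s z≤n) (ℕₚ.≤-trans a<u′ (÷-≤ Ωm q))) ∷ []) (ν 1 :* χ 5 :* χ 1 ⊑ ν 0 :* (χ 0 :* (χ 1 :* (χ 2 :+ χ
              3))))
            where
            n₁ : q *ₙ m <ₙ Ω *ₙ suc a
            n₁ = ℕₚ.<-≤-trans u<₁ (certify (u ∷ Ω ∷ a ∷ []) [] 0 (1 ✕ ν 0 :* ν 1 ⊑ₙ ν 2 :* ν 1 ∶ ℕₚ.*-monoˡ-≤ Ω u≤a ∷
                []) (ν 0 :* ν 1 :+ ν 1 ⊑ₙ ν 1 :* (# 1 :+ ν 2)))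
            n₂ : q *ₙ suc a ≤ₙ Ω *ₙ m
            n₂ = subst (_≤ₙ Ω *ₙ m) (ℕₚ.*-comm (suc a) q) (÷-smallest {Ω *ₙ m} {q} {suc a} a<u′)

          -- The window has mass at least u / e, where u ≥ m / (2 Ω), and each a in it is weighted
          -- by at least x / (Ω · Ω m) through `overlapping`.
          inner-large : ι x ≤ ι G₀ * inner c
          inner-large = certify (e ∷ Ω ∷ x ∷ u ∷ m ∷ G₀ ∷ []) (inv Ωm ∷ inv e ∷ inner c ∷ []) 0 (1 ✕ ν 0 :* ν 1 :* ν
              1 :* # 2 :* (ν 2 :* χ 0 :* (χ 1 :* ν 3)) ⊑ ν 0 :* ν 1 :* ν 1 :* # 2 :* (ν 1 :* χ 2) ∶ *-monoˡ (ι e * ι Ω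
              * ι Ω * ι 2) 0≤eΩΩ scaled ∷ 1 ✕ ν 0 :* ν 1 :* (ν 2 :* χ 0 :* χ 1 :* ν 4) ⊑ ν 0 :* ν 1 :* (ν 2 :* χ 0 :*
              χ 1 :* ⌜ # 2 :* (ν 1 :* ν 3) ⌝) ∶ *-monoˡ (ι e * ι Ω) (*-nonNeg (0≤ι e) (0≤ι Ω)) (*-monoˡ (ι x * inv Ωm
              * inv e) 0≤t (ι-mono m≤2Ωu)) ∷ 1 ✕ ν 2 :* (ν 0 :* χ 1) :* # 1 ≐ ν 2 :* (ν 0 :* χ 1) :* (⌜ ν 1 :* ν 4 ⌝
              :* χ 0) ∶ sym (cong (λ t → ι x * (ι e * inv e) * t) (ι*inv 1≤Ωm)) ∷ 1 ✕ ν 2 :* # 1 ≐ ν 2 :* (ν 0 :* χ 1)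
              ∶ sym (cong (λ t → ι x * t) (ι*inv 1≤e)) ∷ 1 ✕ # 2 :* ν 0 :* ν 1 :* ν 1 :* ν 1 :* χ 2 ≐ ν 5 :* χ 2 ∶ sym
              (G₀≡) ∷ []) (ν 2 ⊑ ν 5 :* χ 2)
            where
            0≤t : 0ℚ ≤ ι x * inv Ωm * inv e
            0≤t = *-nonNeg (*-nonNeg 0≤x (0≤inv Ωm)) (0≤inv e)
            0≤eΩΩ : 0ℚ ≤ ι e * ι Ω * ι Ω * ι 2
            0≤eΩΩ = *-nonNeg (*-nonNeg (*-nonNeg (0≤ι e) (0≤ι Ω)) (0≤ι Ω)) (0≤ι 2)
            G₀≡ : ι G₀ * inner c ≡ ι 2 * ι e * ι Ω * ι Ω * ι Ω * inner c
            G₀≡ = certify (G₀ ∷ e ∷ Ω ∷ []) (inner c ∷ []) 0 (1 ✕ ν 0 :* χ 0 ≐ ⌜ # 2 :* ν 1 :* ν 2 :* ν 2 :* ν 2 ⌝ :*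
                χ 0 ∶ cong (λ t → ι t * inner c) (gain⁻¹-def e Ω) ∷ []) (ν 0 :* χ 0 ≐ # 2 :* ν 1 :* ν 2 :* ν 2 :* ν 2
                :* χ 0)
            scaled : ι x * inv Ωm * (inv e * ι u) ≤ ι Ω * inner c
            scaled = certify (x ∷ u ∷ Ω ∷ []) (inv Ωm ∷ inv e ∷ ψ u′ ∷ ψ u ∷ ∑ u′ (λ a → ι x * inv Ωm * Λ a) ∷ ∑ u (λ
                a → ι x * inv Ωm * Λ a) ∷ ∑ u′ (λ a → ι Ω * G a) ∷ ∑ u (λ a → ι Ω * G a) ∷ ∑ u′ G ∷ ∑ u G ∷ inner c ∷
                []) 0 (1 ✕ ν 0 :* χ 0 :* (χ 1 :* ν 1) ⊑ ν 0 :* χ 0 :* (χ 2 :- χ 3) ∶ *-monoˡ (ι x * inv Ωm) (*-nonNeg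
                0≤x (0≤inv Ωm)) (mass u u′ N≤u ratio (ℕₚ.≤-trans u′≤Z Z≤X)) ∷ 1 ✕ χ 4 :- χ 5 ⊑ χ 6 :- χ 7 ∶ ∑-between
                u u′ (λ a → ι x * inv Ωm * Λ a) (λ a → ι Ω * G a) u≤u′ near-term ∷ 1 ✕ ν 0 :* χ 0 :* χ 2 ≐ χ 4 ∶ sym
                (∑-*ˡ u′ (ι x * inv Ωm) Λ) ∷ 1 ✕ χ 5 ≐ ν 0 :* χ 0 :* χ 3 ∶ ∑-*ˡ u (ι x * inv Ωm) Λ ∷ 1 ✕ χ 6 ≐ ν 2 :*
                χ 8 ∶ ∑-*ˡ u′ (ι Ω) G ∷ 1 ✕ ν 2 :* χ 9 ≐ χ 7 ∶ sym (∑-*ˡ u (ι Ω) G) ∷ 1 ✕ # 0 ⊑ ν 2 :* χ 9 ∶ *-nonNeg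
                (0≤ι Ω) (∑-nonNeg u {G} (λ a a<u → term-nonNeg c a (ℕₚ.<-≤-trans a<u (ℕₚ.≤-trans u≤u′ u′≤Z)))) ∷ 1 ✕ ν
                2 :* χ 8 ⊑ ν 2 :* χ 10 ∶ *-monoˡ (ι Ω) (0≤ι Ω) up ∷ []) (ν 0 :* χ 0 :* (χ 1 :* ν 1) ⊑ ν 2 :* χ 10)
              where
              up : ∑ u′ G ≤ ∑ Z G
              up = certify (Z ∷ u′ ∷ []) (∑ Z G ∷ ∑ u′ G ∷ []) 0 (1 ✕ (ν 0 :- ν 1) :* # 0 ⊑ χ 0 :- χ 1 ∶ ∑-between-≥
                  u′ Z {G} 0ℚ u′≤Z (λ a _ a<Z → term-nonNeg c a a<Z) ∷ []) (χ 1 ⊑ χ 0)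

        -- The weights Λ c / c sum to about H x / 2. So the lower bound for `F` has the order x H x
        -- of the upper one, and the factor β in the latter decides.
        F : ℚ
        F = ∑ b₂ (λ c → Λ c * inv c * inner c)

        Λinv-nonNeg : ∀ c → 0ℚ ≤ Λ c * inv c
        Λinv-nonNeg c = *-nonNeg (Λ-nonNeg c) (0≤inv c)

        F-lower : b₁ ≤ₙ b₂ → ι x * (R b₂ - R b₁) ≤ ι G₀ * F
        F-lower b₁≤b₂ = certify (x ∷ G₀ ∷ []) (∑ b₂ (λ c → ι x * (Λ c * inv c)) ∷ ∑ b₁ (λ c → ι x * (Λ c * inv c)) ∷
            ∑ b₂ (λ c → ι G₀ * (Λ c * inv c * inner c)) ∷ ∑ b₁ (λ c → ι G₀ * (Λ c * inv c * inner c)) ∷ R b₂ ∷ R b₁ ∷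
            F ∷ []) 0 (1 ✕ χ 0 :- χ 1 ⊑ χ 2 :- χ 3 ∶ ∑-between b₁ b₂ (λ c → ι x * (Λ c * inv c)) (λ c → ι G₀ * (Λ c *
            inv c * inner c)) b₁≤b₂ term ∷ 1 ✕ ν 0 :* χ 4 ≐ χ 0 ∶ sym (∑-*ˡ b₂ (ι x) (λ c → Λ c * inv c)) ∷ 1 ✕ χ 1 ≐
            ν 0 :* χ 5 ∶ ∑-*ˡ b₁ (ι x) (λ c → Λ c * inv c) ∷ 1 ✕ χ 2 ≐ ν 1 :* χ 6 ∶ ∑-*ˡ b₂ (ι G₀) (λ c → Λ c * inv c
            * inner c) ∷ 1 ✕ # 0 ⊑ χ 3 ∶ ∑-nonNeg b₁ (λ c _ → *-nonNeg (0≤ι G₀) (*-nonNeg (Λinv-nonNeg (suc c))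
            (inner-nonNeg (suc c)))) ∷ []) (ν 0 :* (χ 4 :- χ 5) ⊑ ν 1 :* χ 6)
          where
          term : ∀ c → b₁ ≤ₙ c → c <ₙ b₂ → ι x * (Λ (suc c) * inv (suc c)) ≤ ι G₀ * (Λ (suc c) * inv (suc c) * inner (suc c))
          term c b₁≤c c<b₂ = certify (x ∷ G₀ ∷ []) (Λ (suc c) ∷ inv (suc c) ∷ inner (suc c) ∷ []) 0 (1 ✕ χ 0 :* χ 1
              :* ν 0 ⊑ χ 0 :* χ 1 :* (ν 1 :* χ 2) ∶ *-monoˡ (Λ (suc c) * inv (suc c)) (Λinv-nonNeg (suc c))
              (inner-large (suc c) (ℕₚ.m≤n⇒m≤1+n b₁≤c) (s≤s z≤n) c<b₂) ∷ []) (ν 0 :* (χ 0 :* χ 1) ⊑ ν 1 :* (χ 0 :* χ 1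
              :* χ 2))

        inner-split : ∀ c → inner c ≡ F₁ c + h′ (a₀ *ₙ c) * F₂ c
        inner-split c = trans (∑-cong Z λ a _ → (certify [] (𝟙 (near? (a₀ *ₙ c) (suc a)) ∷ Λ (suc a) ∷ ρ (suc a) ∷ h′
            (a₀ *ₙ c) ∷ []) 0 [] (χ 0 :* (χ 1 :* (χ 2 :+ χ 3)) ≐ χ 0 :* (χ 1 :* χ 2) :+ χ 3 :* (χ 0 :* χ 1))))
          (trans (∑-+ Z (λ a → 𝟙 (near? (a₀ *ₙ c) a) * (Λ a * ρ a)) (λ a → h′ (a₀ *ₙ c) * (𝟙 (near? (a₀ *ₙ c) a) * Λ a)))
            (cong (ℚ._+_ (F₁ c)) (∑-*ˡ Z (h′ (a₀ *ₙ c)) (λ a → 𝟙 (near? (a₀ *ₙ c) a) * Λ a))))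

        F₂≤ : ∀ c → c ≤ₙ b₂ → F₂ c ≤ ι 10 * ι (Ω *ₙ (a₀ *ₙ c))
        F₂≤ c c≤b₂ = ℚₚ.≤-trans (∑-mono Z λ a _ → ℚₚ.*-monoʳ-≤-nonNeg (Λ (suc a)) {{ℚ.nonNegative (Λ-nonNeg (suc a))}} (restrict a))
          (ℚₚ.≤-trans (∑-𝟙-≤′ Ωac Z Λ Λ-nonNeg) (chebyshev Ωac (ℕₚ.≤-trans (Ωm≤Z c≤b₂) Z≤X)))
          where
          Ωac = Ω *ₙ (a₀ *ₙ c)
          restrict : ∀ a → 𝟙 (near? (a₀ *ₙ c) (suc a)) ≤ 𝟙 (suc a ℕ.≤? Ωac)
          restrict a = 𝟙-elim (near? (a₀ *ₙ c) (suc a)) (λ t → t ≤ 𝟙 (suc a ℕ.≤? Ωac))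
            (λ (_ , n₂) → ℚₚ.≤-reflexive (sym (𝟙-yes (suc a ℕ.≤? Ωac) (ℕₚ.≤-trans (certify (a ∷ q ∷ []) [] 0 (1 ✕ # 1
                :* (# 1 :+ ν 0) ⊑ₙ ν 1 :* (# 1 :+ ν 0) ∶ ℕₚ.*-monoˡ-≤ (suc a) 1≤q ∷ []) (# 1 :+ ν 0 ⊑ₙ ν 1 :* (# 1 :+
                ν 0))) n₂))))
            (𝟙-nonNeg (suc a ℕ.≤? Ωac))

        -- After exchanging the sums, a fixed a is near a₀ c only if c is within a factor Ω of a /
        -- a₀, and over such c the sum of Λ c / c is bounded by Chebyshev.
        F₁-sum : ∑ b₂ (λ c → Λ c * inv c * F₁ c) ≤ ι 10 * ι Ω * ι Ω * (β * (ι x * Hx))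
        F₁-sum = ℚₚ.≤-trans (ℚₚ.≤-reflexive swap) (ℚₚ.≤-trans (∑-mono Z term) (ℚₚ.≤-trans (ℚₚ.≤-reflexive (∑-*ˡ Z (ι 10 * ι Ω * ι Ω) (λ a → Λ a * ρ a)))
            (*-monoˡ (ι 10 * ι Ω * ι Ω) (*-nonNeg (*-nonNeg (0≤ι 10) (0≤ι Ω)) (0≤ι Ω)) total-defect)))
          where
          E : ℕ → ℕ → ℚ
          E a c = 𝟙 (near? (a₀ *ₙ c) a) * (Λ c * inv c)
          swap : ∑ b₂ (λ c → Λ c * inv c * F₁ c) ≡ ∑ Z (λ a → Λ a * ρ a * ∑ b₂ (E a))
          swap = trans (∑-cong b₂ λ c _ → trans (sym (∑-*ˡ Z (Λ (suc c) * inv (suc c)) (λ a → 𝟙 (near? (a₀ *ₙ suc c) a) * (Λ a * ρ a))))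
              (∑-cong Z λ a _ → (certify [] (Λ (suc c) ∷ inv (suc c) ∷ 𝟙 (near? (a₀ *ₙ suc c) (suc a)) ∷ Λ (suc a) ∷
                  ρ (suc a) ∷ []) 0 [] (χ 0 :* χ 1 :* (χ 2 :* (χ 3 :* χ 4)) ≐ χ 3 :* χ 4 :* (χ 2 :* (χ 0 :* χ 1))))))
            (trans (∑-swap b₂ Z (λ c a → Λ a * ρ a * E a c)) (∑-cong Z λ a _ → ∑-*ˡ b₂ (Λ (suc a) * ρ (suc a)) (E (suc a))))
          term : ∀ a-1 → a-1 <ₙ Z → Λ (suc a-1) * ρ (suc a-1) * ∑ b₂ (E (suc a-1)) ≤ ι 10 * ι Ω * ι Ω * (Λ (suc a-1) * ρ (suc a-1))
          term a-1 a≤Z = certify (Ω ∷ []) (Λ a ∷ ρ a ∷ ∑ b₂ (E a) ∷ []) 0 (1 ✕ χ 0 :* χ 1 :* χ 2 ⊑ χ 0 :* χ 1 :* (#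
              10 :* ν 0 :* ν 0) ∶ *-monoˡ (Λ a * ρ a) (*-nonNeg (Λ-nonNeg a) (ρ-nonNeg a (s≤s z≤n) a≤Z)) E≤ ∷ []) (χ 0
              :* χ 1 :* χ 2 ⊑ # 10 :* ν 0 :* ν 0 :* (χ 0 :* χ 1))
            where
            a = suc a-1
            v = (Ω *ₙ a) ÷ a₀
            k = ι Ω * ι a₀ * inv a
            v≤X : v ≤ₙ X
            v≤X = ℕₚ.≤-trans (÷-≤ (Ω *ₙ a) a₀) (ℕₚ.≤-trans (ℕₚ.*-mono-≤ Ω≤Y a≤Z) (ℕₚ.≤-trans (subst (_≤ₙ x) (ℕₚ.*-comm Z Y) (÷-lower x Y)) x≤X))
            E-term : ∀ c → c <ₙ b₂ → E a (suc c) ≤ k * (𝟙 (suc c ℕ.≤? v) * Λ (suc c))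
            E-term c _ = 𝟙-elim (near? (a₀ *ₙ suc c) a) (λ t → t * (Λ (suc c) * inv (suc c)) ≤ k * (𝟙 (suc c ℕ.≤? v) * Λ (suc c))) inside
              (certify [] (k ∷ 𝟙 (suc c ℕ.≤? v) ∷ Λ (suc c) ∷ inv (suc c) ∷ []) 0 (1 ✕ # 0 ⊑ χ 0 :* (χ 1 :* χ 2) ∶
                  *-nonNeg (*-nonNeg (*-nonNeg (0≤ι Ω) (0≤ι a₀)) (0≤inv a)) (*-nonNeg (𝟙-nonNeg (suc c ℕ.≤? v))
                  (Λ-nonNeg (suc c))) ∷ []) (# 0 :* (χ 2 :* χ 3) ⊑ χ 0 :* (χ 1 :* χ 2)))
              where
              inside : (q *ₙ (a₀ *ₙ suc c) <ₙ Ω *ₙ a × q *ₙ a ≤ₙ Ω *ₙ (a₀ *ₙ suc c)) → 1ℚ * (Λ (suc c) * inv (suc c)) ≤ k * (𝟙 (suc c ℕ.≤? v) * Λ (suc c))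
              inside (n₁ , n₂) = certify (Ω ∷ a₀ ∷ []) (Λ (suc c) ∷ inv (suc c) ∷ inv a ∷ k ∷ 𝟙 (suc c ℕ.≤? v) ∷ [])
                  0 (1 ✕ χ 0 :* (# 1 :* χ 1) ⊑ χ 0 :* (⌜ ν 0 :* ν 1 ⌝ :* χ 2) ∶ *-monoˡ (Λ (suc c)) (Λ-nonNeg (suc c))
                  ic ∷ 1 ✕ ν 0 :* ν 1 :* χ 2 :* (# 1 :* χ 0) ≐ χ 3 :* (χ 4 :* χ 0) ∶ sym (cong (λ t → k * (t * Λ (suc
                  c))) (𝟙-yes (suc c ℕ.≤? v) c≤v)) ∷ []) (# 1 :* (χ 0 :* χ 1) ⊑ χ 3 :* (χ 4 :* χ 0))
                where
                c≤v : suc c ≤ₙ v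
                c≤v = ÷-greatest 1≤a₀ (ℕₚ.≤-trans (certify (a₀ ∷ c ∷ q ∷ []) [] 0 (1 ✕ # 1 :* (ν 0 :* (# 1 :+ ν 1))
                    ⊑ₙ ν 2 :* (ν 0 :* (# 1 :+ ν 1)) ∶ ℕₚ.*-monoˡ-≤ (a₀ *ₙ suc c) 1≤q ∷ []) ((# 1 :+ ν 1) :* ν 0 ⊑ₙ ν 2
                    :* (ν 0 :* (# 1 :+ ν 1)))) (ℕₚ.<⇒≤ n₁))
                ic : ι 1 * inv (suc c) ≤ ι (Ω *ₙ a₀) * inv a
                ic = inv-cross {a} {suc c} {1} {Ω *ₙ a₀} (s≤s z≤n) (s≤s z≤n) (certify (q ∷ a ∷ Ω ∷ a₀ ∷ c ∷ []) [] 0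
                    (1 ✕ ν 0 :* ν 1 ⊑ₙ ν 2 :* (ν 3 :* (# 1 :+ ν 4)) ∶ n₂ ∷ 1 ✕ # 1 :* ν 1 ⊑ₙ ν 0 :* ν 1 ∶ ℕₚ.*-monoˡ-≤
                    a 1≤q ∷ []) (# 1 :* ν 1 ⊑ₙ ν 2 :* ν 3 :* (# 1 :+ ν 4)))
            E≤ : ∑ b₂ (E a) ≤ ι 10 * ι Ω * ι Ω
            E≤ = certify (Ω ∷ a₀ ∷ a ∷ []) (∑ b₂ (E a) ∷ ∑ b₂ (λ c → k * (𝟙 (c ℕ.≤? v) * Λ c)) ∷ inv a ∷ ∑ b₂ (λ c →
                𝟙 (c ℕ.≤? v) * Λ c) ∷ i₀ ∷ []) 0 (1 ✕ χ 0 ⊑ χ 1 ∶ (∑-mono b₂ {E a} {λ c → k * (𝟙 (c ℕ.≤? v) * Λ c)}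
                E-term) ∷ 1 ✕ χ 1 ≐ ν 0 :* ν 1 :* χ 2 :* χ 3 ∶ ∑-*ˡ b₂ k (λ c → 𝟙 (c ℕ.≤? v) * Λ c) ∷ 1 ✕ ν 0 :* ν 1
                :* χ 2 :* χ 3 ⊑ ν 0 :* ν 1 :* χ 2 :* (# 10 :* (⌜ ν 0 :* ν 2 ⌝ :* χ 4)) ∶ *-monoˡ k 0≤k ψv ∷ 1 ✕ # 10
                :* ν 0 :* ν 0 :* (ν 2 :* χ 2) :* (ν 1 :* χ 4) ≐ # 10 :* ν 0 :* ν 0 :* (ν 2 :* χ 2) :* # 1 ∶ cong (λ t
                → ι 10 * ι Ω * ι Ω * (ι a * inv a) * t) (ι*inv 1≤a₀) ∷ 1 ✕ # 10 :* ν 0 :* ν 0 :* (ν 2 :* χ 2) ≐ # 10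
                :* ν 0 :* ν 0 :* # 1 ∶ cong (λ t → ι 10 * ι Ω * ι Ω * t) (ι*inv {a} (s≤s z≤n)) ∷ []) (χ 0 ⊑ # 10 :* ν
                0 :* ν 0)
              where
              0≤k : 0ℚ ≤ k
              0≤k = *-nonNeg (*-nonNeg (0≤ι Ω) (0≤ι a₀)) (0≤inv a)
              ψv : ∑ b₂ (λ c → 𝟙 (c ℕ.≤? v) * Λ c) ≤ ι 10 * (ι (Ω *ₙ a) * i₀)
              ψv = ℚₚ.≤-trans (∑-𝟙-≤′ v b₂ Λ Λ-nonNeg) (ℚₚ.≤-trans (chebyshev v v≤X) (*-monoˡ (ι 10) (0≤ι 10) (÷≤ (Ω *ₙ a) 1≤a₀)))

        -- 10 comes from `F₁-sum`, and 40 = 10 · 4 from `empties`: there F₂ c is at most 10 Ω a₀ c,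
        -- whose factor c cancels the weight 1 / c.
        F-upper : F ≤ ι 50 * ι Ω * ι Ω * (β * (ι x * Hx))
        F-upper = certify (Ω ∷ x ∷ a₀ ∷ []) (F ∷ ∑ b₂ (λ c → Λ c * inv c * F₁ c) ∷ ∑ b₂ (λ c → Λ c * inv c * (h′ (a₀
            *ₙ c) * F₂ c)) ∷ β ∷ Hx ∷ ∑ b₂ (λ c → ι 10 * ι Ω * ι a₀ * (Λ c * h′ (a₀ *ₙ c))) ∷ ∑ b₂ (λ c → Λ c * h′ (a₀
            *ₙ c)) ∷ i₀ ∷ []) 0 (1 ✕ χ 0 ≐ χ 1 :+ χ 2 ∶ split ∷ 1 ✕ χ 1 ⊑ # 10 :* ν 0 :* ν 0 :* (χ 3 :* (ν 1 :* χ 4))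
            ∶ F₁-sum ∷ 1 ✕ χ 2 ⊑ χ 5 ∶ (∑-mono b₂ {λ c → Λ c * inv c * (h′ (a₀ *ₙ c) * F₂ c)} {λ c → ι 10 * ι Ω * ι a₀
            * (Λ c * h′ (a₀ *ₙ c))} term) ∷ 1 ✕ χ 5 ≐ # 10 :* ν 0 :* ν 2 :* χ 6 ∶ ∑-*ˡ b₂ (ι 10 * ι Ω * ι a₀) (λ c → Λ
            c * h′ (a₀ *ₙ c)) ∷ 1 ✕ # 10 :* ν 0 :* ν 2 :* χ 6 ⊑ # 10 :* ν 0 :* ν 2 :* (# 4 :* χ 3 :* (ν 1 :* χ 7) :* χ
            4) ∶ *-monoˡ (ι 10 * ι Ω * ι a₀) (*-nonNeg (*-nonNeg (0≤ι 10) (0≤ι Ω)) (0≤ι a₀)) empties ∷ 40 ✕ ν 0 :* (χ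
            3 :* (ν 1 :* χ 4)) :* (ν 2 :* χ 7) ≐ ν 0 :* (χ 3 :* (ν 1 :* χ 4)) :* # 1 ∶ cong (λ t → ι Ω * (β * (ι x *
            Hx)) * t) (ι*inv 1≤a₀) ∷ 40 ✕ ν 0 :* (χ 3 :* (ν 1 :* χ 4)) :* # 1 ⊑ ν 0 :* (χ 3 :* (ν 1 :* χ 4)) :* ν 0 ∶
            *-monoˡ (ι Ω * (β * (ι x * Hx))) (*-nonNeg (0≤ι Ω) (*-nonNeg (0≤inv b) (*-nonNeg 0≤x 0≤Hx))) (ι-mono 1≤Ω)
            ∷ []) (χ 0 ⊑ # 50 :* ν 0 :* ν 0 :* (χ 3 :* (ν 1 :* χ 4)))
          where
          split : F ≡ ∑ b₂ (λ c → Λ c * inv c * F₁ c) + ∑ b₂ (λ c → Λ c * inv c * (h′ (a₀ *ₙ c) * F₂ c))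
          split = trans (∑-cong b₂ λ c _ → trans (cong (Λ (suc c) * inv (suc c) *_) (inner-split (suc c))) (ℚₚ.*-distribˡ-+ (Λ (suc c) * inv (suc c)) (F₁ (suc c)) _))
            (∑-+ b₂ (λ c → Λ c * inv c * F₁ c) (λ c → Λ c * inv c * (h′ (a₀ *ₙ c) * F₂ c)))
          term : ∀ c → c <ₙ b₂ → Λ (suc c) * inv (suc c) * (h′ (a₀ *ₙ suc c) * F₂ (suc c)) ≤ ι 10 * ι Ω * ι a₀ * (Λ (suc c) * h′ (a₀ *ₙ suc c))
          term c c<b₂ = certify (Ω ∷ a₀ ∷ c ∷ []) (Λ (suc c) ∷ inv (suc c) ∷ h′ (a₀ *ₙ suc c) ∷ F₂ (suc c) ∷ []) 0 (1
              ✕ χ 0 :* χ 1 :* χ 2 :* χ 3 ⊑ χ 0 :* χ 1 :* χ 2 :* (# 10 :* ⌜ ν 0 :* (ν 1 :* (# 1 :+ ν 2)) ⌝) ∶ *-monoˡ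
              (Λ (suc c) * inv (suc c) * h′ (a₀ *ₙ suc c)) (*-nonNeg (Λinv-nonNeg (suc c)) (h′-nonNeg (a₀ *ₙ suc c)))
              (F₂≤ (suc c) c<b₂) ∷ 1 ✕ # 10 :* ν 0 :* ν 1 :* (χ 0 :* χ 2) :* (⌜ # 1 :+ ν 2 ⌝ :* χ 1) ≐ # 10 :* ν 0 :*
              ν 1 :* (χ 0 :* χ 2) :* # 1 ∶ cong (λ t → ι 10 * ι Ω * ι a₀ * (Λ (suc c) * h′ (a₀ *ₙ suc c)) * t) (ι*inv
              {suc c} (s≤s z≤n)) ∷ []) (χ 0 :* χ 1 :* (χ 2 :* χ 3) ⊑ # 10 :* ν 0 :* ν 1 :* (χ 0 :* χ 2))

        -- As a₀ ≤ z and z² ≤ x, b₂ is at least about z / (Y Ω), so only a constant is lost against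
        -- H z.
        Hb₂ : H z - ι 2 * ι (Y *ₙ Ω) ≤ H b₂
        Hb₂ = [ low , high ]′ (ℕₚ.≤-total z b₂)
          where
          low : z ≤ₙ b₂ → H z - ι 2 * ι (Y *ₙ Ω) ≤ H b₂
          low z≤b₂ = certify (Y ∷ Ω ∷ []) (H z ∷ H b₂ ∷ []) 0 (1 ✕ χ 0 ⊑ χ 1 ∶ H-mono z≤b₂ ∷ []) (χ 0 :- # 2 :* ⌜ ν 0
              :* ν 1 ⌝ ⊑ χ 1)
          1≤b₂ : 1 ≤ₙ b₂
          1≤b₂ = ÷-big 1≤W (ℕₚ.≤-trans (ℕₚ.*-mono-≤ YΩ≤z a₀≤z) z²≤x)
          z< : z <ₙ b₂ *ₙ (Y *ₙ Ω) +ₙ Y *ₙ Ω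
          z< = ℕₚ.*-cancelʳ-< a₀ z (b₂ *ₙ (Y *ₙ Ω) +ₙ Y *ₙ Ω) (ℕₚ.≤-<-trans (ℕₚ.≤-trans (ℕₚ.*-monoʳ-≤ z a₀≤z) z²≤x)
            (certify (x ∷ b₂ ∷ Y ∷ Ω ∷ a₀ ∷ []) [] 0 (1 ✕ ν 0 ⊏ₙ ν 1 :* (ν 2 :* ν 3 :* ν 4) :+ ν 2 :* ν 3 :* ν 4 ∶
                ÷-upper x (Y *ₙ Ω *ₙ a₀) 1≤W ∷ []) (ν 0 ⊏ₙ (ν 1 :* (ν 2 :* ν 3) :+ ν 2 :* ν 3) :* ν 4)))
          z≤ : z ≤ₙ 2 *ₙ b₂ *ₙ (Y *ₙ Ω)
          z≤ = certify (z ∷ b₂ ∷ Y ∷ Ω ∷ []) [] 0 (1 ✕ ν 0 ⊏ₙ ν 1 :* (ν 2 :* ν 3) :+ ν 2 :* ν 3 ∶ z< ∷ 1 ✕ # 1 :* (ν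
              2 :* ν 3) ⊑ₙ ν 1 :* (ν 2 :* ν 3) ∶ ℕₚ.*-monoˡ-≤ (Y *ₙ Ω) 1≤b₂ ∷ []) (ν 0 ⊑ₙ # 2 :* ν 1 :* (ν 2 :* ν 3))
          high : b₂ ≤ₙ z → H z - ι 2 * ι (Y *ₙ Ω) ≤ H b₂
          high b₂≤z = certify (z ∷ b₂ ∷ Y ∷ Ω ∷ []) (H z ∷ H b₂ ∷ inv b₂ ∷ []) 0 (1 ✕ χ 0 :- χ 1 ⊑ (ν 0 :- ν 1) :* χ
              2 ∶ H-growth 1≤b₂ b₂≤z ∷ 1 ✕ χ 2 :* ν 0 ⊑ χ 2 :* ⌜ # 2 :* ν 1 :* (ν 2 :* ν 3) ⌝ ∶ *-monoˡ (inv b₂)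
              (0≤inv b₂) (ι-mono z≤) ∷ 2 ✕ ⌜ ν 2 :* ν 3 ⌝ :* (ν 1 :* χ 2) ≐ ⌜ ν 2 :* ν 3 ⌝ :* # 1 ∶ cong (λ t → ι (Y
              *ₙ Ω) * t) (ι*inv 1≤b₂) ∷ 1 ✕ # 1 ≐ ν 1 :* χ 2 ∶ sym (ι*inv 1≤b₂) ∷ []) (χ 0 :- # 2 :* ⌜ ν 2 :* ν 3 ⌝ ⊑
              χ 1)

        b₂≤X : b₂ ≤ₙ X
        b₂≤X = ℕₚ.≤-trans (÷-≤ x (Y *ₙ Ω *ₙ a₀)) x≤X
        1≤b₁ : 1 ≤ₙ b₁
        1≤b₁ = ℕₚ.≤-trans (ℕₚ.*-mono-≤ 1≤Ω 1≤q) b₁≥₁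

      impossible : ⊥
      impossible = [ high , low ]′ (ℕₚ.≤-total b₁ b₂)
        where
        low : b₂ ≤ₙ b₁ → ⊥
        low b₂≤b₁ = ℚₚ.<-irrefl refl (certify (Y ∷ Ω ∷ b₁ ∷ []) (H z ∷ H b₂ ∷ Hx ∷ H b₁ ∷ []) 1 (2 ✕ χ 0 :- # 2 :* ⌜
            ν 0 :* ν 1 ⌝ ⊑ χ 1 ∶ Hb₂ ∷ 1 ✕ χ 2 ⊑ # 2 :* χ 0 :+ # 3 ∶ Hx≤2Hz ∷ 2 ✕ χ 1 ⊑ χ 3 ∶ H-mono b₂≤b₁ ∷ 2 ✕ χ 3 ⊑
            ν 2 ∶ H-≤ b₁ ∷ 1 ✕ ⌜ # 55 :+ # 8 :* ν 0 :* ν 1 :+ # 4 :* ν 2 ⌝ ⊑ χ 2 ∶ H-large₂ ∷ []) (χ 2 ⊏ χ 2))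
        -- Mertens and `Hb₂` give 4 (R b₂ - R b₁) ≥ 2 H x - 54 - 8 Y Ω - 4 b₁, while `R≤` allows H
        -- x; the 55 in `H-large₂` is one more than 54.
        high : b₁ ≤ₙ b₂ → ⊥
        high b₁≤b₂ = ℚₚ.<-irrefl refl (certify (Y ∷ Ω ∷ b₁ ∷ []) (H z ∷ H b₂ ∷ Hx ∷ H b₁ ∷ R b₂ ∷ R b₁ ∷ []) 3 (4 ✕ χ
            0 :- # 2 :* ⌜ ν 0 :* ν 1 ⌝ ⊑ χ 1 ∶ Hb₂ ∷ 2 ✕ χ 2 ⊑ # 2 :* χ 0 :+ # 3 ∶ Hx≤2Hz ∷ 4 ✕ χ 3 ⊑ ν 2 ∶ H-≤ b₁ ∷ 1
            ✕ # 4 :* (χ 4 :- χ 5) ⊑ χ 2 ∶ R≤ ∷ 4 ✕ χ 1 :- # 2 ⊑ χ 4 ∶ mertens-lower b₂ (ℕₚ.≤-trans 1≤b₁ b₁≤b₂) b₂≤X ∷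
            4 ✕ χ 5 ⊑ χ 3 :+ # 10 ∶ mertens-upper b₁ 1≤b₁ (ℕₚ.≤-trans b₁≤b₂ b₂≤X) ∷ 1 ✕ ⌜ # 55 :+ # 8 :* ν 0 :* ν 1 :+
            # 4 :* ν 2 ⌝ ⊑ χ 2 ∶ H-large₂ ∷ []) (χ 2 ⊏ χ 2))
          where
          -- The 200 in the choice of b is 4 times the 50 of `F-upper`.
          R≤ : ι 4 * (R b₂ - R b₁) ≤ Hx
          R≤ = ι-cancelˡ 1≤x (certify (x ∷ G₀ ∷ Ω ∷ b ∷ []) (R b₂ ∷ R b₁ ∷ F ∷ β ∷ Hx ∷ []) 0 (4 ✕ ν 0 :* (χ 0 :- χ
              1) ⊑ ν 1 :* χ 2 ∶ F-lower b₁≤b₂ ∷ 4 ✕ ν 1 :* χ 2 ⊑ ν 1 :* (# 50 :* ν 2 :* ν 2 :* (χ 3 :* (ν 0 :* χ 4)))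
              ∶ *-monoˡ (ι G₀) (0≤ι G₀) F-upper ∷ 1 ✕ ν 0 :* χ 4 :* (ν 3 :* χ 3) ≐ ν 0 :* χ 4 :* # 1 ∶ cong (λ t → ι x
              * Hx * t) (ι*inv 1≤b) ∷ 1 ✕ ν 0 :* χ 4 :* (⌜ # 200 :* ν 1 :* (ν 2 :* ν 2) ⌝ :* χ 3) ≐ ν 0 :* χ 4 :* (ν 3
              :* χ 3) ∶ sym (cong (λ t → ι x * Hx * (ι t * β)) b≡) ∷ []) (ν 0 :* (# 4 :* (χ 0 :- χ 1)) ⊑ ν 0 :* χ 4))

    contradictory : ⊥
    contradictory = let a₀ , 1≤a₀ , a₀≤z , full = full-interval in impossible a₀ 1≤a₀ a₀≤z full

-- Gaps between consecutive primes

-- Intervals of ratio 1 + 4n / q carry a positive proportion of mass.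
Mass : ℕ → ℕ → Set
Mass n q = ∃[ e ] ∃[ N ] (1 ≤ₙ e × (∀ {X} (L : LogUpTo X) (1≤X : 1 ≤ₙ X) x x′ → N ≤ₙ x → (q +ₙ 4 *ₙ n) *ₙ x ≤ₙ q *ₙ x′ → x′ ≤ₙ X →
  inv e * ι x ≤ Selberg.ψ L 1≤X x′ - Selberg.ψ L 1≤X x))

private
  module _ (n q e N : ℕ) (1≤n : 1 ≤ₙ n) (1≤q : 1 ≤ₙ q) (1≤e : 1 ≤ₙ e)
    (mass : ∀ {X} (L : LogUpTo X) (1≤X : 1 ≤ₙ X) x x′ → N ≤ₙ x → (q +ₙ 4 *ₙ n) *ₙ x ≤ₙ q *ₙ x′ → x′ ≤ₙ X →
      inv e * ι x ≤ Selberg.ψ L 1≤X x′ - Selberg.ψ L 1≤X x) where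

    -- The new proportion is 1 / j, since less mass than x / j would be `few` in `Step`. All
    -- thresholds on x are added up in `N′`.
    shrink-with : ∀ Ω r b j → Ω ≡ q +ₙ 2 *ₙ n → r ≡ 2 +ₙ 8 *ₙ n → b ≡ 200 *ₙ gain⁻¹ e Ω *ₙ (Ω *ₙ Ω) → 1 ≤ₙ b → 1 ≤ₙ j →
      ι 16 * ι r * ι Ω * inv j ≡ inv b → Mass (3 *ₙ n) (4 *ₙ q)
    shrink-with Ω r b j Ω≡ r≡ b≡ 1≤b 1≤j j≡ = j , N′ , 1≤j , bound
      where
      HY = H-unbounded (j *ₙ D r j)
      Y = proj₁ HY +ₙ (j +ₙ Ω)
      b₁ = Ω *ₙ q +ₙ 2 *ₙ Ω *ₙ (N +ₙ 1)
      H₁ = H-unbounded (4 *ₙ b *ₙ excess r j Y)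
      H₂ = H-unbounded (55 +ₙ 8 *ₙ Y *ₙ Ω +ₙ 4 *ₙ b₁)
      N′ = proj₁ H₁ +ₙ (proj₁ H₂ +ₙ (2 *ₙ q +ₙ (Y *ₙ Ω) *ₙ (Y *ₙ Ω)))
      bound : ∀ {X} (L : LogUpTo X) (1≤X : 1 ≤ₙ X) x x′ → N′ ≤ₙ x → (4 *ₙ q +ₙ 4 *ₙ (3 *ₙ n)) *ₙ x ≤ₙ 4 *ₙ q *ₙ x′ → x′ ≤ₙ X →
        inv j * ι x ≤ Selberg.ψ L 1≤X x′ - Selberg.ψ L 1≤X x
      bound {X} L 1≤X x x′ N′≤x long x′≤X = ℚₚ.≮⇒≥ λ few → Step.contradictory L 1≤X n q e N r Ω b j Y b₁ 1≤n 1≤q 1≤e 1≤b 1≤j Ω≡ r≡ j≡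
          (ℕₚ.≤-trans (ℕₚ.m≤m+n j Ω) (ℕₚ.m≤n+m (j +ₙ Ω) (proj₁ HY))) (ℕₚ.≤-trans (ℕₚ.m≤n+m Ω j) (ℕₚ.m≤n+m (j +ₙ Ω) (proj₁ HY)))
          (λ y Y≤y → subst (_≤ H y) (ι-* j (D r j)) (proj₂ (proj₂ HY) y (ℕₚ.≤-trans (ℕₚ.m≤m+n (proj₁ HY) (j +ₙ Ω)) Y≤y)))
          (mass L 1≤X) (ℕₚ.m≤m+n (Ω *ₙ q) _) (ℕₚ.m≤n+m _ (Ω *ₙ q))
          x x″ x≤x″ (ℕₚ.≤-trans x″≤x′ x′≤X)
          (certify (q ∷ n ∷ x ∷ x″ ∷ []) [] 0 (1 ✕ (ν 0 :+ # 3 :* ν 1) :* ν 2 ⊏ₙ ν 3 :* ν 0 :+ ν 0 ∶ ÷-upper ((q +ₙ 3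
              *ₙ n) *ₙ x) q 1≤q ∷ []) ((ν 0 :+ # 3 :* ν 1) :* ν 2 ⊑ₙ ν 0 :* ν 3 :+ ν 0))
          (subst (_≤ₙ (q +ₙ 3 *ₙ n) *ₙ x) (ℕₚ.*-comm x″ q) (÷-lower ((q +ₙ 3 *ₙ n) *ₙ x) q))
          (ℕₚ.≤-trans (ℕₚ.m≤m+n (2 *ₙ q) _) N₃≤x) b≡
          (certify (x ∷ []) (Selberg.ψ L 1≤X x″ ∷ Selberg.ψ L 1≤X x′ ∷ Selberg.ψ L 1≤X x ∷ inv j ∷ []) 0 (1 ✕ χ 0 ⊑ χ
              1 ∶ Selberg.ψ-mono L 1≤X x″≤x′ ∷ 1 ✕ χ 1 :- χ 2 ⊏ χ 3 :* ν 0 ∶ few ∷ []) (χ 0 :- χ 2 ⊑ χ 3 :* ν 0))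
          (proj₂ (proj₂ H₁) x (ℕₚ.≤-trans (ℕₚ.m≤m+n (proj₁ H₁) _) N′≤x))
          (proj₂ (proj₂ H₂) x (ℕₚ.≤-trans (ℕₚ.m≤m+n (proj₁ H₂) _) N₂≤x))
          (ℕₚ.≤-trans (ℕₚ.m≤n+m _ (2 *ₙ q)) N₃≤x)
        where
        N₂≤x = ℕₚ.≤-trans (ℕₚ.m≤n+m _ (proj₁ H₁)) N′≤x
        N₃≤x = ℕₚ.≤-trans (ℕₚ.m≤n+m _ (proj₁ H₂)) N₂≤x
        -- `Mass` admits any longer interval, whereas `Step` treats one of exactly the critical
        -- ratio up to rounding; monotonicity of ψ passes from one to the other.
        x″ = ((q +ₙ 3 *ₙ n) *ₙ x) ÷ q
        x≤x″ : x ≤ₙ x″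
        x≤x″ = ÷-greatest 1≤q (certify (x ∷ q ∷ n ∷ []) [] 0 [] (ν 0 :* ν 1 ⊑ₙ (ν 1 :+ # 3 :* ν 2) :* ν 0))
        x″≤x′ : x″ ≤ₙ x′
        x″≤x′ = ℕₚ.*-cancelˡ-≤ q {{ℕ.>-nonZero 1≤q}} (certify (x″ ∷ q ∷ n ∷ x ∷ x′ ∷ []) [] 3 (4 ✕ ν 0 :* ν 1 ⊑ₙ (ν 1
            :+ # 3 :* ν 2) :* ν 3 ∶ ÷-lower ((q +ₙ 3 *ₙ n) *ₙ x) q ∷ 1 ✕ (# 4 :* ν 1 :+ # 4 :* (# 3 :* ν 2)) :* ν 3 ⊑ₙ
            # 4 :* ν 1 :* ν 4 ∶ long ∷ []) (ν 1 :* ν 0 ⊑ₙ ν 1 :* ν 4))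

  gain-pos : ∀ {e Ω} → 1 ≤ₙ e → 1 ≤ₙ Ω → 1 ≤ₙ gain⁻¹ e Ω
  gain-pos {e} {Ω} 1≤e 1≤Ω = subst (1 ≤ₙ_) (sym (gain⁻¹-def e Ω)) (ℕₚ.*-mono-≤ (ℕₚ.*-mono-≤ (ℕₚ.*-mono-≤ {1} {2 *ₙ e} (ℕₚ.*-mono-≤ {1} {2} (s≤s z≤n) 1≤e) 1≤Ω) 1≤Ω) 1≤Ω)

-- With C = 4 n / q the new pair stands for 3 C / 4; keeping numerator and denominator apart avoids
-- division.
shrink : ∀ n q → 1 ≤ₙ n → 1 ≤ₙ q → Mass n q → Mass (3 *ₙ n) (4 *ₙ q)
shrink n q 1≤n 1≤q (e , N , 1≤e , mass) = shrink-with n q e N 1≤n 1≤q 1≤e mass Ω r b (c *ₙ b) refl refl refl 1≤b (ℕₚ.*-mono-≤ 1≤c 1≤b)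
    (trans (cong (_* inv (c *ₙ b)) (certify (r ∷ Ω ∷ []) [] 0 [] (# 16 :* ν 0 :* ν 1 ≐ ⌜ # 16 :* ν 0 :* ν 1 ⌝))) (ι*inv-* 1≤c 1≤b))
  where
  Ω r b c : ℕ
  Ω = q +ₙ 2 *ₙ n
  r = 2 +ₙ 8 *ₙ n
  b = 200 *ₙ gain⁻¹ e Ω *ₙ (Ω *ₙ Ω)
  c = 16 *ₙ r *ₙ Ω
  1≤Ω : 1 ≤ₙ Ω
  1≤Ω = ℕₚ.≤-trans 1≤q (ℕₚ.m≤m+n q _)
  1≤c : 1 ≤ₙ c
  1≤c = ℕₚ.*-mono-≤ {1} {16 *ₙ r} (ℕₚ.*-mono-≤ {1} {16} {1} {r} (s≤s z≤n) (s≤s z≤n)) 1≤Ω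
  1≤b : 1 ≤ₙ b
  1≤b = ℕₚ.*-mono-≤ {1} {200 *ₙ gain⁻¹ e Ω} (ℕₚ.*-mono-≤ {1} {200} (s≤s z≤n) (gain-pos 1≤e 1≤Ω)) (ℕₚ.*-mono-≤ 1≤Ω 1≤Ω)

-- A ratio that raises H by 13 raises Mertens' sum by 13 - 10 - 2 = 1, and beyond x each Λ a / a is
-- at most Λ a / x.
mass-base : ∃[ n ] (1 ≤ₙ n × Mass n 1)
mass-base with H-multiple 13
... | k , 1≤k , hk = k , 1≤k , 1 , 1 , s≤s z≤n , bound
  where
  bound : ∀ {X} (L : LogUpTo X) (1≤X : 1 ≤ₙ X) x x′ → 1 ≤ₙ x → (1 +ₙ 4 *ₙ k) *ₙ x ≤ₙ 1 *ₙ x′ → x′ ≤ₙ X →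
    inv 1 * ι x ≤ Selberg.ψ L 1≤X x′ - Selberg.ψ L 1≤X x
  bound L 1≤X x x′ 1≤x long x′≤X = certify (x ∷ []) (R x′ ∷ R x ∷ ∑ x′ (λ a → Λ a * inv x) ∷ ∑ x (λ a → Λ a * inv x)
      ∷ ψ x′ ∷ inv x ∷ ψ x ∷ inv 1 ∷ []) 0 (1 ✕ ν 0 :* # 1 ⊑ ν 0 :* (χ 0 :- χ 1) ∶ *-monoˡ (ι x) (0≤ι x) R≥ ∷ 1 ✕ ν 0
      :* (χ 0 :- χ 1) ⊑ ν 0 :* (χ 2 :- χ 3) ∶ *-monoˡ (ι x) (0≤ι x) (∑-between x x′ (λ a → Λ a * inv a) (λ a → Λ a *
      inv x) x≤x′ (λ a x≤a _ → *-monoˡ (Λ (suc a)) (Λ-nonNeg (suc a)) (inv-anti 1≤x (ℕₚ.m≤n⇒m≤1+n x≤a)))) ∷ 1 ✕ ν 0 :*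
      χ 2 ≐ ν 0 :* (χ 4 :* χ 5) ∶ cong (ι x *_) (∑-*ʳ x′ (inv x) Λ) ∷ 1 ✕ ν 0 :* (χ 6 :* χ 5) ≐ ν 0 :* χ 3 ∶ sym (cong
      (ι x *_) (∑-*ʳ x (inv x) Λ)) ∷ 1 ✕ (χ 4 :- χ 6) :* (ν 0 :* χ 5) ≐ (χ 4 :- χ 6) :* # 1 ∶ cong (λ t → (ψ x′ - ψ x)
      * t) (ι*inv 1≤x) ∷ 1 ✕ χ 7 :* ν 0 ≐ # 1 :* ν 0 ∶ cong (_* ι x) inv1 ∷ []) (χ 7 :* ν 0 ⊑ χ 4 :- χ 6)
    where
    open Intervals L 1≤X
    inv1 : inv 1 ≡ 1ℚ
    inv1 = refl
    kx≤x′ : k *ₙ x ≤ₙ x′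
    kx≤x′ = certify (k ∷ x ∷ x′ ∷ []) [] 0 (1 ✕ (# 1 :+ # 4 :* ν 0) :* ν 1 ⊑ₙ # 1 :* ν 2 ∶ long ∷ []) (ν 0 :* ν 1 ⊑ₙ
        ν 2)
    x≤x′ : x ≤ₙ x′
    x≤x′ = certify (k ∷ x ∷ x′ ∷ []) [] 0 (1 ✕ (# 1 :+ # 4 :* ν 0) :* ν 1 ⊑ₙ # 1 :* ν 2 ∶ long ∷ []) (ν 1 ⊑ₙ ν 2)
    R≥ : 1ℚ ≤ R x′ - R x
    R≥ = certify [] (H x ∷ H (k *ₙ x) ∷ H x′ ∷ R x′ ∷ R x ∷ []) 0 (1 ✕ χ 0 :+ # 13 ⊑ χ 1 ∶ hk x 1≤x ∷ 1 ✕ χ 1 ⊑ χ 2 ∶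
        H-mono kx≤x′ ∷ 1 ✕ χ 2 :- # 2 ⊑ χ 3 ∶ mertens-lower x′ (ℕₚ.≤-trans 1≤x x≤x′) x′≤X ∷ 1 ✕ χ 4 ⊑ χ 0 :+ # 10 ∶
        mertens-upper x 1≤x (ℕₚ.≤-trans x≤x′ x′≤X) ∷ []) (# 1 ⊑ χ 3 :- χ 4)

mass-iterate : ∀ n → 1 ≤ₙ n → Mass n 1 → ∀ k → Mass (3 ^ k *ₙ n) (4 ^ k)
mass-iterate n 1≤n m zero = subst (λ t → Mass t 1) (sym (ℕₚ.*-identityˡ n)) m
mass-iterate n 1≤n m (suc k) = subst (λ t → Mass t (4 ^ suc k)) (sym (ℕₚ.*-assoc 3 (3 ^ k) n))
  (shrink (3 ^ k *ₙ n) (4 ^ k) (ℕₚ.*-mono-≤ (1≤^ k (s≤s z≤n)) 1≤n) (1≤^ k (s≤s z≤n)) (mass-iterate n 1≤n m k))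

-- (4/3) ^ k ≥ 1 + k / 3, with denominators cleared.
bernoulli : ∀ k → 3 ^ k *ₙ (3 +ₙ k) ≤ₙ 3 *ₙ 4 ^ k
bernoulli zero = ℕₚ.≤-refl
bernoulli (suc k) = certify (3 ^ k ∷ k ∷ 4 ^ k ∷ []) [] 0 (4 ✕ ν 0 :* (# 3 :+ ν 1) ⊑ₙ # 3 :* ν 2 ∶ bernoulli k ∷ [])
    (# 3 :* ν 0 :* (# 3 :+ (# 1 :+ ν 1)) ⊑ₙ # 3 :* (# 4 :* ν 2))

-- From mass to primes: proper prime powers are negligible

module PrimePowers {X : ℕ} (L : LogUpTo X) (1≤X : 1 ≤ₙ X) where
  open Intervals L 1≤X

  private
    -- If p ^ m ≤ x′, then m w p is at most ℓ (p ^ m), which is at most H x′.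
    powers : ∀ x′ {p} → Prime p → p ≤ₙ X → x′ ≤ₙ X → ∀ m → m ≤ₙ X → wₚ p * ∑ m (λ k → 𝟙 (p ^ k ℕ.≤? x′)) ≤ H x′
    powers x′ {p} pr p≤X x′≤X zero _ = certify [] (H x′ ∷ wₚ p ∷ []) 0 (1 ✕ # 0 ⊑ χ 0 ∶ 0≤H x′ ∷ []) (χ 1 :* # 0 ⊑ χ
        0)
    powers x′ {p} pr p≤X x′≤X m@(suc m-1) m≤X with p ^ m ℕ.≤? x′
    ... | no _ = certify [] (wₚ p ∷ ∑ m-1 (λ k → 𝟙 (p ^ k ℕ.≤? x′)) ∷ H x′ ∷ []) 0 (1 ✕ χ 0 :* χ 1 ⊑ χ 2 ∶ powers x′
        pr p≤X x′≤X m-1 (ℕₚ.<⇒≤ m≤X) ∷ []) (χ 0 :* (χ 1 :+ # 0) ⊑ χ 2)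
    ... | yes p^m≤x′ = certify (m-1 ∷ []) (wₚ p ∷ ∑ m-1 (λ k → 𝟙 (p ^ k ℕ.≤? x′)) ∷ count X p (p ^ m *ₙ 1) ∷ ℓ (p ^ m
        *ₙ 1) ∷ H (p ^ m *ₙ 1) ∷ γ ∷ H x′ ∷ []) 0 (1 ✕ χ 0 :* χ 1 ⊑ χ 0 :* (ν 0 :* # 1) ∶ *-monoˡ (wₚ p) (0≤wₚ p) (∑-≤
        m-1 {λ k → 𝟙 (p ^ k ℕ.≤? x′)} 1ℚ (λ k _ → 𝟙-≤1 (p ^ suc k ℕ.≤? x′))) ∷ 1 ✕ χ 0 :* ⌜ # 1 :+ ν 0 ⌝ ≐ χ 0 :* χ 2
        ∶ sym (cong (wₚ p *_) count≡) ∷ 1 ✕ χ 0 :* χ 2 ⊑ χ 3 ∶ term ∷ 1 ✕ χ 3 ⊑ χ 4 :- χ 5 ∶ ℓ-upper (p ^ m *ₙ 1)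
        1≤p^m p^m≤X ∷ 1 ✕ # 0 ⊑ χ 5 ∶ 0≤γ ∷ 1 ✕ χ 4 ⊑ χ 6 ∶ H-mono p^m≤x′′ ∷ []) (χ 0 :* (χ 1 :+ # 1) ⊑ χ 6)
      where
      2≤p = prime⇒2≤ pr
      p^m≤x′′ : p ^ m *ₙ 1 ≤ₙ x′
      p^m≤x′′ = subst (_≤ₙ x′) (sym (ℕₚ.*-identityʳ (p ^ m))) p^m≤x′
      p^m≤X = ℕₚ.≤-trans p^m≤x′′ x′≤X
      1≤p^m : 1 ≤ₙ p ^ m *ₙ 1
      1≤p^m = ℕₚ.*-mono-≤ (1≤^ m (ℕₚ.<⇒≤ 2≤p)) (ℕₚ.≤-refl {1})
      count≡ : count X p (p ^ m *ₙ 1) ≡ ι m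
      count≡ = count-padic X pr m 1 (λ d → ℕₚ.<⇒≱ 2≤p (ℕₚ.≤-reflexive (∣1⇒≡1 d))) m≤X
      term : wₚ p * count X p (p ^ m *ₙ 1) ≤ ℓ (p ^ m *ₙ 1)
      term = single-≤ p (ℕₚ.<⇒≤ 2≤p) p≤X
        where
        single-≤ : ∀ i → 1 ≤ₙ i → i ≤ₙ X → wₚ i * count X i (p ^ m *ₙ 1) ≤ ∑ X (λ i → wₚ i * count X i (p ^ m *ₙ 1))
        single-≤ (suc i) _ i<X = ℚₚ.≤-trans (certify [] (∑ i f ∷ f (suc i) ∷ []) 0 (1 ✕ # 0 ⊑ χ 0 ∶ ∑-nonNeg i {f} (λ
            l _ → f-nonNeg (suc l)) ∷ []) (χ 1 ⊑ χ 0 :+ χ 1)) (∑-upTo-mono f f-nonNeg i<X)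
          where
          f : ℕ → ℚ
          f i = wₚ i * count X i (p ^ m *ₙ 1)
          f-nonNeg : ∀ i → 0ℚ ≤ f i
          f-nonNeg i = *-nonNeg (0≤wₚ i) (∑-nonNeg X λ k _ → 𝟙-nonNeg (i ^ suc k ∣? p ^ m *ₙ 1))

  -- What remains are powers p ^ k with k ≥ 2, whose p is at most s, and each such p contributes at
  -- most H x′. With s about √x′ this is less than any fixed proportion of x.
  no-prime-mass : ∀ x x′ s → x ≤ₙ x′ → x′ ≤ₙ X → s ≤ₙ X → x′ <ₙ suc s *ₙ suc s → (∀ p → x <ₙ p → p ≤ₙ x′ → ¬ Prime p) → ψ x′ - ψ x ≤ ι s * H x′
  no-prime-mass x x′ s x≤x′ x′≤X s≤X x′< none = certify (s ∷ []) (ψ x′ ∷ ψ x ∷ ∑ x′ Λ² ∷ ∑ x Λ² ∷ H x′ ∷ []) 0 (1 ✕ χ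
      0 :- χ 1 ⊑ χ 2 :- χ 3 ∶ ∑-between x x′ Λ Λ² x≤x′ few ∷ 1 ✕ # 0 ⊑ χ 3 ∶ ∑-nonNeg x {Λ²} (λ a _ → Λ²-nonNeg (suc
      a)) ∷ 1 ✕ χ 2 ⊑ ν 0 :* χ 4 ∶ total ∷ []) (χ 0 :- χ 1 ⊑ ν 0 :* χ 4)
    where
    Λ² : ℕ → ℚ
    Λ² a = ∑ s (λ p → wₚ p * ∑ X (λ k → 𝟙 (p ^ k ℕ.≟ a)))
    Λ²-nonNeg : ∀ a → 0ℚ ≤ Λ² a
    Λ²-nonNeg a = ∑-nonNeg s λ p _ → *-nonNeg (0≤wₚ (suc p)) (∑-nonNeg X λ k _ → 𝟙-nonNeg (suc p ^ suc k ℕ.≟ a))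
    few : ∀ a → x ≤ₙ a → a <ₙ x′ → Λ (suc a) ≤ Λ² (suc a)
    few a x≤a a<x′ = ℚₚ.≤-reflexive (∑-extend (λ p → wₚ p * ∑ X (λ k → 𝟙 (p ^ k ℕ.≟ suc a))) s≤X λ p s≤p _ →
        trans (wₚ-cong (suc p) {y = 0ℚ} λ pr → ∑-zero X λ k _ → 𝟙-no (suc p ^ suc k ℕ.≟ suc a) (not k p s≤p pr)) (ℚₚ.*-zeroʳ (wₚ (suc p))))
      where
      not : ∀ k p → s ≤ₙ p → Prime (suc p) → suc p ^ suc k ≢ suc a
      not zero p s≤p pr e = none (suc a) (s≤s x≤a) a<x′ (subst Prime (trans (sym (ℕₚ.*-identityʳ (suc p))) e) pr)
      not (suc k) p s≤p pr e = ℕₚ.<⇒≱ x′< (ℕₚ.≤-trans (ℕₚ.*-mono-≤ (s≤s s≤p) (s≤s s≤p)) (ℕₚ.≤-trans big (ℕₚ.≤-trans (ℕₚ.≤-reflexive e) a<x′)))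
        where big : suc p *ₙ suc p ≤ₙ suc p *ₙ (suc p *ₙ suc p ^ k)
              big = ℕₚ.*-monoʳ-≤ (suc p) (subst (_≤ₙ suc p *ₙ suc p ^ k) (ℕₚ.*-identityʳ (suc p)) (ℕₚ.*-monoʳ-≤ (suc p) (1≤^ k (s≤s z≤n))))
    total : ∑ x′ Λ² ≤ ι s * H x′
    total = ℚₚ.≤-trans (ℚₚ.≤-reflexive (trans (∑-swap x′ s (λ a p → wₚ p * ∑ X (λ k → 𝟙 (p ^ k ℕ.≟ a)))) (∑-cong s {g = λ p → wₚ p * ∑ X (λ k → ∑ x′ (λ a → 𝟙 (p ^ k ℕ.≟ a)))} λ p _ →
          trans (∑-*ˡ x′ (wₚ (suc p)) (λ a → ∑ X (λ k → 𝟙 (suc p ^ k ℕ.≟ a)))) (cong (wₚ (suc p) *_) (∑-swap x′ X (λ a k → 𝟙 (suc p ^ k ℕ.≟ a)))))))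
        (∑-≤ s (H x′) per-prime)
      where
      hits : ∀ p k → ∑ x′ (λ a → 𝟙 (suc p ^ suc k ℕ.≟ a)) ≤ 𝟙 (suc p ^ suc k ℕ.≤? x′)
      hits p k = 𝟙-cases (suc p ^ suc k ℕ.≤? x′)
        where
        v = suc p ^ suc k
        𝟙-cases : (d : Dec (v ≤ₙ x′)) → ∑ x′ (λ a → 𝟙 (v ℕ.≟ a)) ≤ 𝟙 d
        𝟙-cases (yes v≤x′) = ℚₚ.≤-reflexive (trans (∑-single x′ v (λ a → 𝟙 (v ℕ.≟ a)) (1≤^ (suc k) (s≤s z≤n)) v≤x′ (λ a _ ne → 𝟙-no (v ℕ.≟ suc a) (ne ∘ sym))) (𝟙-yes (v ℕ.≟ v) refl))
        𝟙-cases (no v≰x′) = ℚₚ.≤-reflexive (∑-zero x′ λ a a<x′ → 𝟙-no (v ℕ.≟ suc a) λ e → v≰x′ (subst (_≤ₙ x′) (sym e) a<x′))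
      per-prime : ∀ p → p <ₙ s → wₚ (suc p) * ∑ X (λ k → ∑ x′ (λ a → 𝟙 (suc p ^ k ℕ.≟ a))) ≤ H x′
      per-prime p p<s = by (prime? (suc p))
        where
        bnd : wₚ (suc p) * ∑ X (λ k → ∑ x′ (λ a → 𝟙 (suc p ^ k ℕ.≟ a))) ≤ wₚ (suc p) * ∑ X (λ k → 𝟙 (suc p ^ k ℕ.≤? x′))
        bnd = *-monoˡ (wₚ (suc p)) (0≤wₚ (suc p)) (∑-mono X λ k _ → hits p k)
        by : Dec (Prime (suc p)) → wₚ (suc p) * ∑ X (λ k → ∑ x′ (λ a → 𝟙 (suc p ^ k ℕ.≟ a))) ≤ H x′
        by (yes pr) = ℚₚ.≤-trans bnd (powers x′ pr (ℕₚ.≤-trans p<s s≤X) x′≤X X ℕₚ.≤-refl)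
        by (no ¬pr) = ℚₚ.≤-trans (ℚₚ.≤-reflexive (trans (wₚ-cong (suc p) {y = 0ℚ} λ pr → contradiction pr ¬pr) (ℚₚ.*-zeroʳ (wₚ (suc p))))) (0≤H x′)

-- Enough rounds of `shrink` bring the ratio down to 1 + 1 / (2 c), and the mass of such an interval
-- cannot come from proper prime powers alone.
prime-gap : ∀ c → 1 ≤ₙ c → ∃[ N ] (∀ x → N ≤ₙ x → ∃[ p ] (Prime p × x <ₙ p × c *ₙ p ≤ₙ (c +ₙ 1) *ₙ x))
prime-gap c 1≤c = conclude mass-base
  where
  conclude : ∃[ n ] (1 ≤ₙ n × Mass n 1) → ∃[ N ] (∀ x → N ≤ₙ x → ∃[ p ] (Prime p × x <ₙ p × c *ₙ p ≤ₙ (c +ₙ 1) *ₙ x))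
  conclude (n , 1≤n , m₀) = finish {3 ^ k *ₙ n} {4 ^ k} (mass-iterate n 1≤n m₀ k) narrow
    where
    -- The 8 in `narrow` means 4 n / q ≤ 1 / (2 c), so that half of x / c is left for the rounding
    -- of x′; 24 = 3 · 8 is what `bernoulli` then asks for.
    k = 24 *ₙ (n *ₙ c)
    narrow : 8 *ₙ ((3 ^ k *ₙ n) *ₙ c) ≤ₙ 4 ^ k
    narrow = ℕₚ.*-cancelˡ-≤ 3 (ℕₚ.≤-trans (certify (3 ^ k ∷ n ∷ c ∷ []) [] 0 [] (# 3 :* (# 8 :* (ν 0 :* ν 1 :* ν 2))
        ⊑ₙ ν 0 :* (# 3 :+ # 24 :* (ν 1 :* ν 2)))) (bernoulli k))
    finish : ∀ {n q} → Mass n q → 8 *ₙ (n *ₙ c) ≤ₙ q → ∃[ N ] (∀ x → N ≤ₙ x → ∃[ p ] (Prime p × x <ₙ p × c *ₙ p ≤ₙ (c +ₙ 1) *ₙ x))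
    finish {n} {q} (e , N , 1≤e , mass) narrow = N +ₙ (2 *ₙ c +ₙ t *ₙ t) , find
      where
      -- H s ≤ 8 e + s / (8 e) reduces 2 e (2 H s + 3) < s to s > 64 e² + 12 e.
      t = 64 *ₙ (e *ₙ e) +ₙ 12 *ₙ e +ₙ 2
      find : ∀ x → N +ₙ (2 *ₙ c +ₙ t *ₙ t) ≤ₙ x → ∃[ p ] (Prime p × x <ₙ p × c *ₙ p ≤ₙ (c +ₙ 1) *ₙ x)
      find x big = [ (λ (p , _ , p≤x′ , pr , x<p) → p , pr , x<p , ℕₚ.≤-trans (ℕₚ.*-monoʳ-≤ c p≤x′) cx′≤) , (λ none → ⊥-elim (absurd none)) ]′
          (search (λ p → prime? p ×-dec (x ℕ.<? p)) x′)
        where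
        x′ = ((c +ₙ 1) *ₙ x) ÷ c
        cx′≤ : c *ₙ x′ ≤ₙ (c +ₙ 1) *ₙ x
        cx′≤ = subst (_≤ₙ (c +ₙ 1) *ₙ x) (ℕₚ.*-comm x′ c) (÷-lower ((c +ₙ 1) *ₙ x) c)
        N≤x = ℕₚ.≤-trans (ℕₚ.m≤m+n N _) big
        2c≤x : 2 *ₙ c ≤ₙ x
        2c≤x = ℕₚ.≤-trans (ℕₚ.m≤m+n (2 *ₙ c) _) (ℕₚ.≤-trans (ℕₚ.m≤n+m _ N) big)
        tt≤x : t *ₙ t ≤ₙ x
        tt≤x = ℕₚ.≤-trans (ℕₚ.m≤n+m _ (2 *ₙ c)) (ℕₚ.≤-trans (ℕₚ.m≤n+m _ N) big)
        x≤x′ : x ≤ₙ x′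
        x≤x′ = ÷-greatest 1≤c (certify (x ∷ c ∷ []) [] 0 [] (ν 0 :* ν 1 ⊑ₙ (ν 1 :+ # 1) :* ν 0))
        x′≤2x : x′ ≤ₙ 2 *ₙ x
        x′≤2x = ℕₚ.*-cancelˡ-≤ c {{ℕ.>-nonZero 1≤c}} (certify (c ∷ x′ ∷ x ∷ []) [] 0 (1 ✕ ν 0 :* ν 1 ⊑ₙ (ν 0 :+ # 1)
            :* ν 2 ∶ cx′≤ ∷ 1 ✕ # 1 :* ν 2 ⊑ₙ ν 0 :* ν 2 ∶ ℕₚ.*-monoˡ-≤ x 1≤c ∷ []) (ν 0 :* ν 1 ⊑ₙ ν 0 :* (# 2 :* ν
            2)))
        1≤x : 1 ≤ₙ x
        1≤x = certify (c ∷ x ∷ []) [] 0 (1 ✕ # 2 :* ν 0 ⊑ₙ ν 1 ∶ 2c≤x ∷ 2 ✕ # 1 ⊑ₙ ν 0 ∶ 1≤c ∷ []) (# 1 ⊑ₙ ν 1)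
        1≤x′ = ℕₚ.≤-trans 1≤x x≤x′
        wide : (q +ₙ 4 *ₙ n) *ₙ x ≤ₙ q *ₙ x′
        wide = ℕₚ.*-cancelˡ-≤ c {{ℕ.>-nonZero 1≤c}} (certify (q ∷ c ∷ x ∷ x′ ∷ n ∷ []) [] 1 (2 ✕ ν 0 :* ((ν 1 :+ # 1)
            :* ν 2) ⊑ₙ ν 0 :* (ν 3 :* ν 1 :+ ν 1) ∶ ℕₚ.*-monoʳ-≤ q (ℕₚ.<⇒≤ (÷-upper ((c +ₙ 1) *ₙ x) c 1≤c)) ∷ 1 ✕ # 8
            :* (ν 4 :* ν 1) :* ν 2 ⊑ₙ ν 0 :* ν 2 ∶ ℕₚ.*-monoˡ-≤ x narrow ∷ 1 ✕ ν 0 :* (# 2 :* ν 1) ⊑ₙ ν 0 :* ν 2 ∶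
            ℕₚ.*-monoʳ-≤ q 2c≤x ∷ []) (ν 1 :* ((ν 0 :+ # 4 :* ν 4) :* ν 2) ⊑ₙ ν 1 :* (ν 0 :* ν 3)))
        L = logUpTo x′ 1≤x′
        open Intervals L 1≤x′ using (ψ; H-sqrt-upper; 0≤γ; γ)
        sq = isqrt x′
        s = proj₁ sq
        s²≤x′ = proj₁ (proj₂ sq)
        x′<s² = proj₂ (proj₂ sq)
        t≤s+1 : t ≤ₙ suc s
        t≤s+1 = ℕₚ.≮⇒≥ λ s<t → ℕₚ.<⇒≱ x′<s² (ℕₚ.≤-trans (ℕₚ.*-mono-≤ (ℕₚ.<⇒≤ s<t) (ℕₚ.<⇒≤ s<t)) (ℕₚ.≤-trans tt≤x x≤x′))
        1≤s : 1 ≤ₙ s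
        1≤s = certify (e ∷ s ∷ []) [] 0 (1 ✕ # 64 :* (ν 0 :* ν 0) :+ # 12 :* ν 0 :+ # 2 ⊑ₙ # 1 :+ ν 1 ∶ t≤s+1 ∷ [])
            (# 1 ⊑ₙ ν 1)
        1≤8e : 1 ≤ₙ 8 *ₙ e
        1≤8e = ℕₚ.*-mono-≤ {1} {8} (s≤s z≤n) 1≤e
        absurd : (∀ a → a <ₙ x′ → ¬ (Prime (suc a) × x <ₙ suc a)) → ⊥
        -- Without a prime, x′ ≤ 2 x ≤ 2 e s H x′ < s² ≤ x′.
        absurd none = ℚₚ.<-irrefl refl (ℚₚ.<-≤-trans small (ι-mono s²≤x′))
          where
          none′ : ∀ p → x <ₙ p → p ≤ₙ x′ → ¬ Prime p
          none′ (suc a) x<p p≤x′ pr = none a p≤x′ (pr , x<p)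
          H≤ : H x′ ≤ ι 2 * H s + ι 3
          H≤ = certify [] (H x′ ∷ H s ∷ γ ∷ inv s ∷ []) 0 (1 ✕ χ 0 ⊑ # 2 :* χ 1 :- χ 2 :+ # 3 :* χ 3 ∶ H-sqrt-upper
              x′ s 1≤s s²≤x′ x′<s² ℕₚ.≤-refl ∷ 1 ✕ # 0 ⊑ χ 2 ∶ 0≤γ ∷ 3 ✕ χ 3 ⊑ # 1 ∶ inv≤1 s ∷ []) (χ 0 ⊑ # 2 :* χ 1
              :+ # 3)
          eH : ι 2 * ι e * (ι 2 * H s + ι 3) < ι s
          eH = certify (e ∷ s ∷ []) (H s ∷ inv (8 *ₙ e) ∷ []) 1 (2 ✕ # 4 :* ν 0 :* χ 0 ⊑ # 4 :* ν 0 :* (⌜ # 8 :* ν 0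
              ⌝ :+ ν 1 :* χ 1) ∶ *-monoˡ (ι 4 * ι e) (*-nonNeg (0≤ι 4) (0≤ι e)) (H-sublinear s 1≤8e) ∷ 1 ✕ ν 1 :* (⌜ #
              8 :* ν 0 ⌝ :* χ 1) ≐ ν 1 :* # 1 ∶ cong (λ u → ι s * u) (ι*inv 1≤8e) ∷ 1 ✕ # 64 :* (ν 0 :* ν 0) :+ # 12
              :* ν 0 :+ # 2 ⊑ₙ # 1 :+ ν 1 ∶ t≤s+1 ∷ []) (# 2 :* ν 0 :* (# 2 :* χ 0 :+ # 3) ⊏ ν 1)
          x≤ : ι x ≤ ι e * (ι s * H x′)
          x≤ = certify (e ∷ x ∷ s ∷ []) (inv e ∷ H x′ ∷ []) 0 (1 ✕ ν 0 :* (χ 0 :* ν 1) ⊑ ν 0 :* (ν 2 :* χ 1) ∶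
              *-monoˡ (ι e) (0≤ι e) (ℚₚ.≤-trans (mass L 1≤x′ x x′ N≤x wide ℕₚ.≤-refl) (PrimePowers.no-prime-mass L
              1≤x′ x x′ s x≤x′ ℕₚ.≤-refl (ℕₚ.≤-trans (n≤n*n s) s²≤x′) x′<s² none′)) ∷ 1 ✕ # 1 :* ν 1 ≐ ν 0 :* χ 0 :* ν
              1 ∶ sym (cong (λ u → u * ι x) (ι*inv 1≤e)) ∷ []) (ν 1 ⊑ ν 0 :* (ν 2 :* χ 1))
          small : ι x′ < ι (s *ₙ s)
          small = ℚₚ.≤-<-trans (certify (x′ ∷ x ∷ e ∷ s ∷ []) (H x′ ∷ H s ∷ []) 0 (1 ✕ ν 0 ⊑ₙ # 2 :* ν 1 ∶ x′≤2x ∷ 2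
              ✕ ν 1 ⊑ ν 2 :* (ν 3 :* χ 0) ∶ x≤ ∷ 2 ✕ ν 2 :* ν 3 :* χ 0 ⊑ ν 2 :* ν 3 :* (# 2 :* χ 1 :+ # 3) ∶ *-monoˡ
              (ι e * ι s) (*-nonNeg (0≤ι e) (0≤ι s)) H≤ ∷ []) (ν 0 ⊑ ν 3 :* (# 2 :* ν 2 :* (# 2 :* χ 1 :+ # 3))))
            (ℚₚ.<-≤-trans (ℚₚ.*-monoʳ-<-pos (ι s) {{ℚ.positive (ℚₚ.<-≤-trans 0<1 (ι-mono 1≤s))}} eH) (ℚₚ.≤-reflexive (sym (ι-* s s))))

-- A dense C₄-free graph, and the triple system of its edges joined to a fixed vertex

unique-map : ∀ {A B : Set} {P : A → Set} {f : A → B} → (∀ {x y} → P x → P y → f x ≡ f y → x ≡ y) → ∀ {xs} → All P xs → Unique xs → Unique (map f xs)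
unique-map inj [] [] = []
unique-map inj (px ∷ pxs) (x∉xs ∷ uxs) = Allₚ.map⁺ (All.zipWith (λ (py , x≢y) e → x≢y (inj px py e)) (pxs , x∉xs)) ∷ unique-map inj pxs uxs

length-cartesianProduct : ∀ {A B : Set} (xs : List A) (ys : List B) → length (cartesianProduct xs ys) ≡ length xs *ₙ length ys
length-cartesianProduct [] ys = refl
length-cartesianProduct (x ∷ xs) ys = trans (Listₚ.length-++ (map (x ,_) ys)) (cong₂ _+ₙ_ (Listₚ.length-map (x ,_) ys) (length-cartesianProduct xs ys))

pairs : ℕ → List (ℕ × ℕ)
pairs zero = []
pairs (suc k) = map (_, k) (upTo k) ++ pairs k

pairs-ordered : ∀ k → All (λ (x , x′) → x <ₙ x′ × x′ <ₙ k) (pairs k)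
pairs-ordered zero = []
pairs-ordered (suc k) = Allₚ.++⁺ (Allₚ.map⁺ (All.map (λ x<k → x<k , ℕₚ.≤-refl) (Allₚ.all-upTo k)))
  (All.map (λ (a , b) → a , ℕₚ.m<n⇒m<1+n b) (pairs-ordered k))

pairs-unique : ∀ k → Unique (pairs k)
pairs-unique zero = []
pairs-unique (suc k) = Uniqueₚ.++⁺ (Uniqueₚ.map⁺ (λ { refl → refl }) (Uniqueₚ.upTo⁺ k)) (pairs-unique k)
  λ { (a , b) → disjoint a b }
  where
  disjoint : ∀ {v} → v ∈ map (_, k) (upTo k) → v ∈ pairs k → ⊥
  disjoint a b with ∈-map⁻ (_, k) a
  ... | _ , _ , refl = ℕₚ.<-irrefl refl (proj₂ (All.lookup (pairs-ordered k) b))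

pairs-length : ∀ k → 2 *ₙ length (pairs k) +ₙ k ≡ k *ₙ k
pairs-length zero = refl
pairs-length (suc k) = certify (length (pairs (suc k)) ∷ k ∷ length (pairs k) ∷ []) [] 0 (2 ✕ ν 0 ≐ₙ ν 1 :+ ν 2 ∶
    trans (Listₚ.length-++ (map (_, k) (upTo k))) (cong (_+ₙ length (pairs k)) (trans (Listₚ.length-map (_, k) (upTo
    k)) (Listₚ.length-upTo k))) ∷ 1 ✕ # 2 :* ν 2 :+ ν 1 ≐ₙ ν 1 :* ν 1 ∶ pairs-length k ∷ []) (# 2 :* ν 0 :+ (# 1 :+ ν
    1) ≐ₙ (# 1 :+ ν 1) :* (# 1 :+ ν 1))

module ErdősRényi (p : ℕ) (pr : Prime p) (n-1 : ℕ) (p²≤ : p *ₙ p ≤ₙ n-1) where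

  private instance
    p≢0 : NonZero p
    p≢0 = prime⇒nonZero pr

  -- The points (x , y) and (u , v) of the affine plane over ℤ/p are adjacent when y + v ≡ x u.
  record Adj (x y u v : ℕ) : Set where
    constructor adj
    field
      k l : ℕ
      congruence : y +ₙ v +ₙ k *ₙ p ≡ x *ₙ u +ₙ l *ₙ p

  Adj-sym : ∀ {x y u v} → Adj x y u v → Adj u v x y
  Adj-sym {x} {y} {u} {v} (adj k l e) = adj k l (certify (y ∷ v ∷ k ∷ p ∷ x ∷ u ∷ l ∷ []) [] 0 (1 ✕ ν 0 :+ ν 1 :+ ν 2
      :* ν 3 ≐ₙ ν 4 :* ν 5 :+ ν 6 :* ν 3 ∶ e ∷ []) (ν 1 :+ ν 0 :+ ν 2 :* ν 3 ≐ₙ ν 5 :* ν 4 :+ ν 6 :* ν 3))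

  residue : ∀ {a b} k l → a <ₙ p → b <ₙ p → a +ₙ k *ₙ p ≡ b +ₙ l *ₙ p → a ≡ b
  residue {a} {b} k l a<p b<p e = trans (sym (trans (ℕ/.[m+kn]%n≡m%n a k p) (ℕ/.m<n⇒m%n≡m a<p)))
    (trans (cong (ℕ._% p) e) (trans (ℕ/.[m+kn]%n≡m%n b l p) (ℕ/.m<n⇒m%n≡m b<p)))

  private
    product-∣ : ∀ d d′ k l → d *ₙ d′ +ₙ k *ₙ p ≡ l *ₙ p → d <ₙ p → d′ <ₙ p → d ≡ 0 ⊎ d′ ≡ 0
    product-∣ d d′ k l e d<p d′<p with euclidsLemma d d′ pr (∣m+n∣m⇒∣n (divides l (trans (ℕₚ.+-comm (k *ₙ p) (d *ₙ d′)) e)) (n∣m*n k))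
    ... | inj₁ h = inj₁ (small d h d<p)
      where small : ∀ d → p ∣ d → d <ₙ p → d ≡ 0
            small zero _ _ = refl
            small (suc d) h d<p = contradiction (∣⇒≤ h) (ℕₚ.<⇒≱ d<p)
    ... | inj₂ h = inj₂ (small d′ h d′<p)
      where small : ∀ d → p ∣ d → d <ₙ p → d ≡ 0
            small zero _ _ = refl
            small (suc d) h d<p = contradiction (∣⇒≤ h) (ℕₚ.<⇒≱ d<p)

    -- The alternating sum of the four congruences is (x₂ - x₁) (u₂ - u₁) ≡ 0 modulo p. The order
    -- assumptions turn both differences into natural numbers; `core′` removes them by symmetry.
    core : ∀ {x₁ y₁ x₂ y₂ u₁ v₁ u₂ v₂} → x₁ ≤ₙ x₂ → u₁ ≤ₙ u₂ → x₂ <ₙ p → u₂ <ₙ p →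
      Adj x₁ y₁ u₁ v₁ → Adj x₁ y₁ u₂ v₂ → Adj x₂ y₂ u₁ v₁ → Adj x₂ y₂ u₂ v₂ → x₁ ≡ x₂ ⊎ u₁ ≡ u₂
    core {x₁} {y₁} {x₂} {y₂} {u₁} {v₁} {u₂} {v₂} x≤ u≤ x₂<p u₂<p (adj k₁ l₁ e₁) (adj k₂ l₂ e₂) (adj k₃ l₃ e₃) (adj k₄ l₄ e₄) =
      [ (λ d≡0 → inj₁ (trans (sym (ℕₚ.+-identityʳ x₁)) (trans (cong (x₁ +ₙ_) (sym d≡0)) (ℕₚ.m+[n∸m]≡n x≤))))
      , (λ d≡0 → inj₂ (trans (sym (ℕₚ.+-identityʳ u₁)) (trans (cong (u₁ +ₙ_) (sym d≡0)) (ℕₚ.m+[n∸m]≡n u≤)))) ]′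
      (product-∣ d d′ (k₂ +ₙ k₃ +ₙ l₁ +ₙ l₄) (k₁ +ₙ k₄ +ₙ l₂ +ₙ l₃) eq (ℕₚ.≤-<-trans (ℕₚ.m∸n≤m x₂ x₁) x₂<p) (ℕₚ.≤-<-trans (ℕₚ.m∸n≤m u₂ u₁) u₂<p))
      where
      d = x₂ ∸ₙ x₁
      d′ = u₂ ∸ₙ u₁
      x₂≡ : x₂ ≡ x₁ +ₙ d
      x₂≡ = sym (ℕₚ.m+[n∸m]≡n x≤)
      u₂≡ : u₂ ≡ u₁ +ₙ d′
      u₂≡ = sym (ℕₚ.m+[n∸m]≡n u≤)
      eq : d *ₙ d′ +ₙ (k₂ +ₙ k₃ +ₙ l₁ +ₙ l₄) *ₙ p ≡ (k₁ +ₙ k₄ +ₙ l₂ +ₙ l₃) *ₙ p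
      eq = certify (y₁ ∷ v₁ ∷ k₁ ∷ p ∷ x₁ ∷ u₁ ∷ l₁ ∷ v₂ ∷ k₂ ∷ d′ ∷ l₂ ∷ y₂ ∷ k₃ ∷ d ∷ l₃ ∷ k₄ ∷ l₄ ∷ []) [] 0 (1 ✕
          ν 4 :* ν 5 :+ ν 6 :* ν 3 ≐ₙ ν 0 :+ ν 1 :+ ν 2 :* ν 3 ∶ sym (e₁) ∷ 1 ✕ ν 0 :+ ν 7 :+ ν 8 :* ν 3 ≐ₙ ν 4 :* (ν
          5 :+ ν 9) :+ ν 10 :* ν 3 ∶ trans e₂ (cong (λ t → x₁ *ₙ t +ₙ l₂ *ₙ p) u₂≡) ∷ 1 ✕ ν 11 :+ ν 1 :+ ν 12 :* ν 3
          ≐ₙ (ν 4 :+ ν 13) :* ν 5 :+ ν 14 :* ν 3 ∶ trans e₃ (cong (λ t → t *ₙ u₁ +ₙ l₃ *ₙ p) x₂≡) ∷ 1 ✕ (ν 4 :+ ν 13)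
          :* (ν 5 :+ ν 9) :+ ν 16 :* ν 3 ≐ₙ ν 11 :+ ν 7 :+ ν 15 :* ν 3 ∶ sym (trans e₄ (cong₂ (λ s t → s *ₙ t +ₙ l₄ *ₙ
          p) x₂≡ u₂≡)) ∷ []) (ν 13 :* ν 9 :+ (ν 8 :+ ν 12 :+ ν 6 :+ ν 16) :* ν 3 ≐ₙ (ν 2 :+ ν 15 :+ ν 10 :+ ν 14) :* ν
          3)

    core′ : ∀ {x₁ y₁ x₂ y₂ u₁ v₁ u₂ v₂} → x₁ <ₙ p → x₂ <ₙ p → u₁ <ₙ p → u₂ <ₙ p →
      Adj x₁ y₁ u₁ v₁ → Adj x₁ y₁ u₂ v₂ → Adj x₂ y₂ u₁ v₁ → Adj x₂ y₂ u₂ v₂ → x₁ ≡ x₂ ⊎ u₁ ≡ u₂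
    core′ {x₁} {_} {x₂} {_} {u₁} {_} {u₂} x₁<p x₂<p u₁<p u₂<p a b c d with ℕₚ.≤-total x₁ x₂ | ℕₚ.≤-total u₁ u₂
    ... | inj₁ h | inj₁ h′ = core h h′ x₂<p u₂<p a b c d
    ... | inj₁ h | inj₂ h′ = [ inj₁ , inj₂ ∘ sym ]′ (core h h′ x₂<p u₁<p b a d c)
    ... | inj₂ h | inj₁ h′ = [ inj₁ ∘ sym , inj₂ ]′ (core h h′ x₁<p u₂<p c d a b)
    ... | inj₂ h | inj₂ h′ = [ inj₁ ∘ sym , inj₂ ∘ sym ]′ (core h h′ x₁<p u₁<p d c b a)

    same : ∀ {x y₁ y₂ u v} → y₁ <ₙ p → y₂ <ₙ p → Adj x y₁ u v → Adj x y₂ u v → y₁ ≡ y₂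
    same {x} {y₁} {y₂} {u} {v} y₁<p y₂<p (adj k₁ l₁ e₁) (adj k₂ l₂ e₂) = residue (k₁ +ₙ l₂) (k₂ +ₙ l₁) y₁<p y₂<p
      (certify (y₁ ∷ v ∷ k₁ ∷ p ∷ x ∷ u ∷ l₁ ∷ y₂ ∷ k₂ ∷ l₂ ∷ []) [] 0 (1 ✕ ν 0 :+ ν 1 :+ ν 2 :* ν 3 ≐ₙ ν 4 :* ν 5 :+
          ν 6 :* ν 3 ∶ e₁ ∷ 1 ✕ ν 4 :* ν 5 :+ ν 9 :* ν 3 ≐ₙ ν 7 :+ ν 1 :+ ν 8 :* ν 3 ∶ sym (e₂) ∷ []) (ν 0 :+ (ν 2 :+
          ν 9) :* ν 3 ≐ₙ ν 7 :+ (ν 8 :+ ν 6) :* ν 3))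

  C₄-free : ∀ {x₁ y₁ x₂ y₂ u₁ v₁ u₂ v₂} → x₁ <ₙ p → x₂ <ₙ p → u₁ <ₙ p → u₂ <ₙ p → y₁ <ₙ p → y₂ <ₙ p → v₁ <ₙ p → v₂ <ₙ p →
    Adj x₁ y₁ u₁ v₁ → Adj x₁ y₁ u₂ v₂ → Adj x₂ y₂ u₁ v₁ → Adj x₂ y₂ u₂ v₂ → (x₁ ≡ x₂ × y₁ ≡ y₂) ⊎ (u₁ ≡ u₂ × v₁ ≡ v₂)
  C₄-free x₁<p x₂<p u₁<p u₂<p y₁<p y₂<p v₁<p v₂<p a b c d with core′ x₁<p x₂<p u₁<p u₂<p a b c d
  ... | inj₁ refl = inj₁ (refl , same y₁<p y₂<p a c)
  ... | inj₂ refl = inj₂ (refl , same v₁<p v₂<p (Adj-sym a) (Adj-sym b))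

  fin : ℕ → Fin (suc n-1)
  fin m = fromℕ< (ℕ/.m%n<n m (suc n-1))

  toℕ-fin : ∀ {m} → m ≤ₙ n-1 → toℕ (fin m) ≡ m
  toℕ-fin {m} m≤ = trans (Finₚ.toℕ-fromℕ< (ℕ/.m%n<n m (suc n-1))) (ℕ/.m<n⇒m%n≡m (s≤s m≤))

  -- Vertex 0 is reserved for the apex, hence the `suc`.
  code : ℕ → ℕ → ℕ
  code x y = suc (y +ₙ x *ₙ p)

  code-≤ : ∀ {x y} → x <ₙ p → y <ₙ p → code x y ≤ₙ n-1
  code-≤ {x} {y} x<p y<p = ℕₚ.≤-trans (certify (x ∷ p ∷ y ∷ []) [] 0 (1 ✕ (# 1 :+ ν 0) :* ν 1 ⊑ₙ ν 1 :* ν 1 ∶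
      ℕₚ.*-monoˡ-≤ p x<p ∷ 1 ✕ ν 2 ⊏ₙ ν 1 ∶ y<p ∷ []) (# 1 :+ (ν 2 :+ ν 0 :* ν 1) ⊑ₙ ν 1 :* ν 1)) p²≤

  code-injective : ∀ {x y u v} → y <ₙ p → v <ₙ p → code x y ≡ code u v → x ≡ u × y ≡ v
  code-injective {x} {y} {u} {v} y<p v<p e = ℕₚ.*-cancelʳ-≡ x u p (ℕₚ.+-cancelˡ-≡ v (x *ₙ p) (u *ₙ p) (subst (λ t → t +ₙ x *ₙ p ≡ v +ₙ u *ₙ p) y≡v e′)) , y≡v
    where
    e′ : y +ₙ x *ₙ p ≡ v +ₙ u *ₙ p
    e′ = ℕₚ.suc-injective e
    y≡v : y ≡ v
    y≡v = residue x u y<p v<p e′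

  partner : ℕ → ℕ → ℕ → ℕ
  partner x x′ y = (x *ₙ x′ +ₙ (p ∸ₙ y)) ℕ.% p

  partner-< : ∀ x x′ y → partner x x′ y <ₙ p
  partner-< x x′ y = ℕ/.m%n<n (x *ₙ x′ +ₙ (p ∸ₙ y)) p

  partner-Adj : ∀ x x′ y → y <ₙ p → Adj x y x′ (partner x x′ y)
  partner-Adj x x′ y y<p = adj q 1 (certify (s ∷ t ∷ q ∷ p ∷ x ∷ x′ ∷ c ∷ y ∷ []) [] 0 (1 ✕ ν 1 :+ ν 2 :* ν 3 ≐ₙ ν 0
      ∶ sym (ℕ/.m≡m%n+[m/n]*n s p) ∷ 1 ✕ ν 0 ≐ₙ ν 4 :* ν 5 :+ ν 6 ∶ s≡ ∷ 1 ✕ ν 7 :+ ν 6 ≐ₙ ν 3 ∶ ℕₚ.m+[n∸m]≡n (ℕₚ.<⇒≤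
      y<p) ∷ []) (ν 7 :+ ν 1 :+ ν 2 :* ν 3 ≐ₙ ν 4 :* ν 5 :+ # 1 :* ν 3))
    where
    c = p ∸ₙ y
    s = x *ₙ x′ +ₙ c
    t = partner x x′ y
    q = s ℕ./ p
    s≡ : s ≡ x *ₙ x′ +ₙ c
    s≡ = refl

  -- An edge is determined by the first coordinates x < x′ of its ends and the second coordinate of
  -- one end. This lists each edge once and in sorted order; edges with x = x′, only O(p²) of them,
  -- are left out together with the loops.
  labels : List ((ℕ × ℕ) × ℕ)
  labels = cartesianProduct (pairs p) (upTo p)

  Valid : (ℕ × ℕ) × ℕ → Set
  Valid ((x , x′) , y) = (x <ₙ x′ × x′ <ₙ p) × y <ₙ p

  labels-valid : All Valid labels
  labels-valid = Allₚ.cartesianProduct⁺ (setoid (ℕ × ℕ)) (setoid ℕ) (pairs p) (upTo p)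
    (λ a b → All.lookup (pairs-ordered p) a , All.lookup (Allₚ.all-upTo p) b)

  triple : (ℕ × ℕ) × ℕ → Fin (suc n-1) × Fin (suc n-1) × Fin (suc n-1)
  triple ((x , x′) , y) = fin 0 , fin (code x y) , fin (code x′ (partner x x′ y))

  private
    fin-injective : ∀ {m m′} → m ≤ₙ n-1 → m′ ≤ₙ n-1 → fin m ≡ fin m′ → m ≡ m′
    fin-injective h h′ e = trans (sym (toℕ-fin h)) (trans (cong toℕ e) (toℕ-fin h′))

  triple-injective : ∀ {s t} → Valid s → Valid t → triple s ≡ triple t → s ≡ t
  triple-injective {(x , x′) , y} {(u , u′) , v} ((x<x′ , x′<p) , y<p) ((u<u′ , u′<p) , v<p) e =
    cong₂ _,_ (cong₂ _,_ (proj₁ c₁) (proj₁ c₂)) (proj₂ c₁)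
    where
    x<p = ℕₚ.<-trans x<x′ x′<p
    u<p = ℕₚ.<-trans u<u′ u′<p
    c₁ : x ≡ u × y ≡ v
    c₁ = code-injective {x} {y} {u} {v} y<p v<p (fin-injective {code x y} {code u v} (code-≤ {x} {y} x<p y<p) (code-≤ {u} {v} u<p v<p) (cong (λ t → proj₁ (proj₂ t)) e))
    c₂ : x′ ≡ u′ × partner x x′ y ≡ partner u u′ v
    c₂ = code-injective {x′} {partner x x′ y} {u′} {partner u u′ v} (partner-< x x′ y) (partner-< u u′ v)
      (fin-injective {code x′ (partner x x′ y)} {code u′ (partner u u′ v)} (code-≤ {x′} {partner x x′ y} x′<p (partner-< x x′ y)) (code-≤ {u′} {partner u u′ v} u′<p (partner-< u u′ v)) (cong (λ t → proj₂ (proj₂ t)) e))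

  H₀ : Hyp3 (suc n-1)
  H₀ = record
    { edges = map triple labels
    ; ordered = Allₚ.map⁺ (All.map (λ { {(x , x′) , y} v → sorted v }) labels-valid)
    ; nodup = unique-map {P = Valid} triple-injective labels-valid (Uniqueₚ.cartesianProduct⁺ (pairs-unique p) (Uniqueₚ.upTo⁺ p))
    }
    where
    sorted : ∀ {x x′ y} → Valid ((x , x′) , y) → fin 0 Fin.< fin (code x y) × fin (code x y) Fin.< fin (code x′ (partner x x′ y))
    sorted {x} {x′} {y} ((x<x′ , x′<p) , y<p) =
      subst₂ _<ₙ_ (sym (toℕ-fin {0} z≤n)) (sym c≡) (s≤s z≤n) ,
      subst₂ _<ₙ_ (sym c≡) (sym (toℕ-fin {code x′ (partner x x′ y)} (code-≤ {x′} {partner x x′ y} x′<p (partner-< x x′ y))))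
        (certify (x ∷ p ∷ x′ ∷ y ∷ partner x x′ y ∷ []) [] 0 (1 ✕ (# 1 :+ ν 0) :* ν 1 ⊑ₙ ν 2 :* ν 1 ∶ ℕₚ.*-monoˡ-≤ p
            x<x′ ∷ 1 ✕ ν 3 ⊏ₙ ν 1 ∶ y<p ∷ []) (# 1 :+ (ν 3 :+ ν 0 :* ν 1) ⊏ₙ # 1 :+ (ν 4 :+ ν 2 :* ν 1)))
      where x<p = ℕₚ.<-trans x<x′ x′<p
            c≡ : toℕ (fin (code x y)) ≡ code x y
            c≡ = toℕ-fin {code x y} (code-≤ {x} {y} x<p y<p)

  size : 2 *ₙ ∣E∣ H₀ +ₙ p *ₙ p ≡ p *ₙ p *ₙ p
  size = certify (∣E∣ H₀ ∷ length (pairs p) ∷ p ∷ []) [] 0 (1 ✕ # 2 :* ν 0 ≐ₙ # 2 :* (ν 1 :* ν 2) ∶ cong (λ t → 2 *ₙ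
      t) len ∷ 1 ✕ (# 2 :* ν 1 :+ ν 2) :* ν 2 ≐ₙ ν 2 :* ν 2 :* ν 2 ∶ cong (_*ₙ p) (pairs-length p) ∷ []) (# 2 :* ν 0
      :+ ν 2 :* ν 2 ≐ₙ ν 2 :* ν 2 :* ν 2)
    where
    len : ∣E∣ H₀ ≡ length (pairs p) *ₙ p
    len = trans (Listₚ.length-map triple labels) (trans (length-cartesianProduct (pairs p) (upTo p)) (cong (length (pairs p) *ₙ_) (Listₚ.length-upTo p)))

  record Point (s : Fin (suc n-1)) (x y : ℕ) : Set where
    constructor point
    field
      toℕ≡ : toℕ s ≡ code x y
      x<p : x <ₙ p
      y<p : y <ₙ p

  Joined : Fin (suc n-1) → Fin (suc n-1) → Set
  Joined s t = ∃[ x ] ∃[ y ] ∃[ u ] ∃[ v ] (Point s x y × Point t u v × Adj x y u v)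

  Joined-sym : ∀ {s t} → Joined s t → Joined t s
  Joined-sym (x , y , u , v , P , Q , a) = u , v , x , y , Q , P , Adj-sym a

  private
    point-unique : ∀ {s x y u v} → Point s x y → Point s u v → x ≡ u × y ≡ v
    point-unique {s} {x} {y} {u} {v} (point e _ y<p) (point e′ _ v<p) = code-injective {x} {y} {u} {v} y<p v<p (trans (sym e) e′)

    same-point : ∀ {s t x y u v} → Point s x y → Point t u v → x ≡ u × y ≡ v → s ≡ t
    same-point (point e _ _) (point e′ _ _) (refl , refl) = Finₚ.toℕ-injective (trans e (sym e′))

    transport : ∀ {x y u v x′ y′ u′ v′} → x ≡ x′ × y ≡ y′ → u ≡ u′ × v ≡ v′ → Adj x y u v → Adj x′ y′ u′ v′
    transport (refl , refl) (refl , refl) a = a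

    four-cycle : ∀ {a b c d x y u v x₂ y₂ u₂ v₂} → Point a x y → Point b u v → Point c x₂ y₂ → Point d u₂ v₂ →
      Adj x y u v → Adj u v x₂ y₂ → Adj x₂ y₂ u₂ v₂ → Adj x y u₂ v₂ → a ≡ c ⊎ b ≡ d
    four-cycle Pa@(point _ x<p y<p) Pb@(point _ u<p v<p) Pc@(point _ x₂<p y₂<p) Pd@(point _ u₂<p v₂<p) ab bc cd ad =
      [ inj₁ ∘ same-point Pa Pc , inj₂ ∘ same-point Pb Pd ]′ (C₄-free x<p x₂<p u<p u₂<p y<p y₂<p v<p v₂<p ab ad (Adj-sym bc) cd)

  Joined-C₄-free : ∀ {a b c d} → Joined a b → Joined b c → Joined c d → Joined a d → a ≡ c ⊎ b ≡ d
  Joined-C₄-free (_ , _ , _ , _ , Pa , Pb , ab) (_ , _ , _ , _ , Pb′ , Pc , bc) (_ , _ , _ , _ , Pc′ , Pd , cd) (_ , _ , _ , _ , Pa′ , Pd′ , ad) =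
    four-cycle Pa Pb Pc Pd ab (transport (point-unique Pb′ Pb) (refl , refl) bc) (transport (point-unique Pc′ Pc) (refl , refl) cd)
      (transport (point-unique Pa′ Pa) (point-unique Pd′ Pd) ad)

  EdgeShape : Fin (suc n-1) × Fin (suc n-1) × Fin (suc n-1) → Set
  EdgeShape (a , s , t) = a ≡ fin 0 × Joined s t

  triple-shape : ∀ t → Valid t → EdgeShape (triple t)
  triple-shape ((x , x′) , y) ((x<x′ , x′<p) , y<p) = refl , x , y , x′ , partner x x′ y , P , Q , partner-Adj x x′ y y<p
    where
    x<p : x <ₙ p
    x<p = ℕₚ.<-trans x<x′ x′<p
    P : Point (fin (code x y)) x y
    P = point (toℕ-fin {code x y} (code-≤ {x} {y} x<p y<p)) x<p y<p
    Q : Point (fin (code x′ (partner x x′ y))) x′ (partner x x′ y)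
    Q = point (toℕ-fin {code x′ (partner x x′ y)} (code-≤ {x′} {partner x x′ y} x′<p (partner-< x x′ y))) x′<p (partner-< x x′ y)

  edge-shape : All EdgeShape (Hyp3.edges H₀)
  edge-shape = Allₚ.map⁺ (All.map (λ {t} v → triple-shape t v) labels-valid)

  joins : ∀ {e s t} → EdgeShape e → s ≢ fin 0 → t ≢ fin 0 → s ≢ t → s ∈₃ e → t ∈₃ e → Joined s t
  joins (refl , j) s≢0 _ _ (inj₁ e) _ = contradiction e s≢0
  joins (refl , j) _ t≢0 _ (inj₂ _) (inj₁ e) = contradiction e t≢0
  joins _ _ _ s≢t (inj₂ (inj₁ refl)) (inj₂ (inj₁ refl)) = contradiction refl s≢t
  joins (refl , j) _ _ _ (inj₂ (inj₁ refl)) (inj₂ (inj₂ refl)) = j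
  joins (refl , j) _ _ _ (inj₂ (inj₂ refl)) (inj₂ (inj₁ refl)) = Joined-sym j
  joins _ _ _ s≢t (inj₂ (inj₂ refl)) (inj₂ (inj₂ refl)) = contradiction refl s≢t

  -- The apex lies in every triple, so a vertex of C₄ placed there would be on both of the disjoint
  -- edges 01 and 23. Hence S avoids the apex, and the four triples give a 4-cycle of the graph.
  trace-free : ¬ ContainsTrace C4 H₀
  trace-free (ψ , φ , ψ-inj , _ , cond) = [ (λ e → contradiction (ψ-inj e) λ ()) , (λ e → contradiction (ψ-inj e) λ ()) ]′
      (Joined-C₄-free (edge 0F 0F 1F (λ ()) (inj₁ refl) (inj₂ refl)) (edge 1F 1F 2F (λ ()) (inj₁ refl) (inj₂ refl))
        (edge 2F 2F 3F (λ ()) (inj₁ refl) (inj₂ refl)) (edge 3F 0F 3F (λ ()) (inj₁ refl) (inj₂ refl)))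
    where
    open import Data.Fin.Patterns using (0F; 1F; 2F; 3F)
    open Equivalence
    shape : ∀ i → EdgeShape (lookup (Hyp3.edges H₀) (φ i))
    shape i = All.lookup edge-shape (∈-lookup (φ i))
    apex∈ : ∀ i → fin 0 ∈₃ lookup (Hyp3.edges H₀) (φ i)
    apex∈ i = inj₁ (sym (proj₁ (shape i)))
    not-apex : ∀ v → ψ v ≢ fin 0
    not-apex v e with to (cond 0F v) (subst (_∈₃ lookup (Hyp3.edges H₀) (φ 0F)) (sym e) (apex∈ 0F))
                    | to (cond 2F v) (subst (_∈₃ lookup (Hyp3.edges H₀) (φ 2F)) (sym e) (apex∈ 2F))
    ... | inj₁ refl | inj₁ ()
    ... | inj₁ refl | inj₂ ()
    ... | inj₂ refl | inj₁ ()
    ... | inj₂ refl | inj₂ ()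
    edge : ∀ i a b → a ≢ b → (a ≡ proj₁ (lookup (Graph.edges C4) i) ⊎ a ≡ proj₂ (lookup (Graph.edges C4) i)) →
      (b ≡ proj₁ (lookup (Graph.edges C4) i) ⊎ b ≡ proj₂ (lookup (Graph.edges C4) i)) → Joined (ψ a) (ψ b)
    edge i a b a≢b ha hb = joins (shape i) (not-apex a) (not-apex b) (a≢b ∘ ψ-inj) (from (cond i a) ha) (from (cond i b) hb)

-- Sums over lists

∑ˡ : ∀ {A : Set} → List A → (A → ℚ) → ℚ
∑ˡ [] f = 0ℚ
∑ˡ (x ∷ xs) f = f x + ∑ˡ xs f

module _ {A : Set} where

  ∑ˡ-mono : ∀ (xs : List A) {f g} → (∀ x → x ∈ xs → f x ≤ g x) → ∑ˡ xs f ≤ ∑ˡ xs g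
  ∑ˡ-mono [] h = ℚₚ.≤-refl
  ∑ˡ-mono (x ∷ xs) h = ℚₚ.+-mono-≤ (h x (here refl)) (∑ˡ-mono xs λ y y∈ → h y (there y∈))

  ∑ˡ-cong : ∀ (xs : List A) {f g} → (∀ x → x ∈ xs → f x ≡ g x) → ∑ˡ xs f ≡ ∑ˡ xs g
  ∑ˡ-cong [] h = refl
  ∑ˡ-cong (x ∷ xs) h = cong₂ _+_ (h x (here refl)) (∑ˡ-cong xs λ y y∈ → h y (there y∈))

  ∑ˡ-+ : ∀ (xs : List A) f g → ∑ˡ xs (λ x → f x + g x) ≡ ∑ˡ xs f + ∑ˡ xs g
  ∑ˡ-+ [] f g = refl
  ∑ˡ-+ (x ∷ xs) f g = certify [] (∑ˡ xs (λ x → f x + g x) ∷ ∑ˡ xs f ∷ ∑ˡ xs g ∷ f x ∷ g x ∷ []) 0 (1 ✕ χ 0 ≐ χ 1 :+ χ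
      2 ∶ ∑ˡ-+ xs f g ∷ []) (χ 3 :+ χ 4 :+ χ 0 ≐ χ 3 :+ χ 1 :+ (χ 4 :+ χ 2))

  ∑ˡ-*ˡ : ∀ (xs : List A) c f → ∑ˡ xs (λ x → c * f x) ≡ c * ∑ˡ xs f
  ∑ˡ-*ˡ [] c f = sym (ℚₚ.*-zeroʳ c)
  ∑ˡ-*ˡ (x ∷ xs) c f = certify [] (∑ˡ xs (λ x → c * f x) ∷ c ∷ ∑ˡ xs f ∷ f x ∷ []) 0 (1 ✕ χ 0 ≐ χ 1 :* χ 2 ∶ ∑ˡ-*ˡ xs
      c f ∷ []) (χ 1 :* χ 3 :+ χ 0 ≐ χ 1 :* (χ 3 :+ χ 2))

  ∑ˡ-const : ∀ (xs : List A) c → ∑ˡ xs (λ _ → c) ≡ ι (length xs) * c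
  ∑ˡ-const [] c = sym (ℚₚ.*-zeroˡ c)
  ∑ˡ-const (x ∷ xs) c = certify (length xs ∷ []) (∑ˡ xs (λ _ → c) ∷ c ∷ []) 0 (1 ✕ χ 0 ≐ ν 0 :* χ 1 ∶ ∑ˡ-const xs c ∷
      []) (χ 1 :+ χ 0 ≐ ⌜ # 1 :+ ν 0 ⌝ :* χ 1)

  ∑ˡ-nonNeg : ∀ (xs : List A) {f} → (∀ x → 0ℚ ≤ f x) → 0ℚ ≤ ∑ˡ xs f
  ∑ˡ-nonNeg [] h = ℚₚ.≤-refl
  ∑ˡ-nonNeg (x ∷ xs) h = ℚₚ.+-mono-≤ (h x) (∑ˡ-nonNeg xs h)

  ∑ˡ-swap : ∀ {B : Set} (xs : List A) (ys : List B) (f : A → B → ℚ) → ∑ˡ xs (λ x → ∑ˡ ys (f x)) ≡ ∑ˡ ys (λ y → ∑ˡ xs (λ x → f x y))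
  ∑ˡ-swap [] ys f = sym (trans (∑ˡ-zero ys) refl)
    where ∑ˡ-zero : ∀ {B : Set} (ys : List B) → ∑ˡ ys (λ _ → 0ℚ) ≡ 0ℚ
          ∑ˡ-zero [] = refl
          ∑ˡ-zero (y ∷ ys) = trans (ℚₚ.+-identityˡ _) (∑ˡ-zero ys)
  ∑ˡ-swap (x ∷ xs) ys f = trans (cong (ℚ._+_ (∑ˡ ys (f x))) (∑ˡ-swap xs ys f)) (sym (helper ys (f x) (λ y → ∑ˡ xs (λ x → f x y))))
    where helper : ∀ {B : Set} (ys : List B) (f g : B → ℚ) → ∑ˡ ys (λ x → f x + g x) ≡ ∑ˡ ys f + ∑ˡ ys g
          helper [] f g = refl
          helper (y ∷ ys) f g = certify [] (∑ˡ ys (λ x → f x + g x) ∷ ∑ˡ ys f ∷ ∑ˡ ys g ∷ f y ∷ g y ∷ []) 0 (1 ✕ χ 0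
              ≐ χ 1 :+ χ 2 ∶ helper ys f g ∷ []) (χ 3 :+ χ 4 :+ χ 0 ≐ χ 3 :+ χ 1 :+ (χ 4 :+ χ 2))

  -- Induction on the list; a new entry brings the cross terms 2 f x f y, each at most f x² + f y².
  cauchy-schwarz : ∀ (xs : List A) f → ∑ˡ xs f * ∑ˡ xs f ≤ ι (length xs) * ∑ˡ xs (λ x → f x * f x)
  cauchy-schwarz [] f = ℚₚ.≤-refl
  cauchy-schwarz (x ∷ xs) f = certify (length xs ∷ []) (∑ˡ xs f ∷ ∑ˡ xs (λ x → f x * f x) ∷ f x ∷ []) 0 (1 ✕ χ 0 :* χ
      0 ⊑ ν 0 :* χ 1 ∶ cauchy-schwarz xs f ∷ 1 ✕ # 2 :* (χ 2 :* χ 0) ⊑ ν 0 :* (χ 2 :* χ 2) :+ χ 1 ∶ cross xs ∷ []) ((χ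
      2 :+ χ 0) :* (χ 2 :+ χ 0) ⊑ ⌜ # 1 :+ ν 0 ⌝ :* (χ 2 :* χ 2 :+ χ 1))
    where
    square : ∀ t → 0ℚ ≤ t * t
    square t = [ (λ h → *-nonNeg h h) , (λ h → subst (0ℚ ≤_) (certify [] (t ∷ []) 0 [] (:- χ 0 :* :- χ 0 ≐ χ 0 :* χ
        0)) (*-nonNeg (ℚₚ.neg-antimono-≤ h) (ℚₚ.neg-antimono-≤ h))) ]′ (ℚₚ.≤-total 0ℚ t)
    cross : ∀ ys → ι 2 * (f x * ∑ˡ ys f) ≤ ι (length ys) * (f x * f x) + ∑ˡ ys (λ x → f x * f x)
    cross [] = certify [] (f x ∷ []) 0 [] (# 2 :* (χ 0 :* # 0) ⊑ # 0 :* (χ 0 :* χ 0) :+ # 0)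
    cross (y ∷ ys) = certify (length ys ∷ []) (f x ∷ ∑ˡ ys f ∷ ∑ˡ ys (λ x → f x * f x) ∷ f y ∷ []) 0 (1 ✕ # 2 :* (χ 0
        :* χ 1) ⊑ ν 0 :* (χ 0 :* χ 0) :+ χ 2 ∶ cross ys ∷ 1 ✕ # 0 ⊑ (χ 0 :- χ 3) :* (χ 0 :- χ 3) ∶ square (f x - f y)
        ∷ []) (# 2 :* (χ 0 :* (χ 3 :+ χ 1)) ⊑ ⌜ # 1 :+ ν 0 ⌝ :* (χ 0 :* χ 0) :+ (χ 3 :* χ 3 :+ χ 2))

  module _ {P : A → Set} (P? : ∀ x → Dec (P x)) where
    private
      tally : List A → ℚ
      tally xs = ∑ˡ xs (λ x → 𝟙 (P? x))

    -- This and the next two lemmas either bound a count or exhibit one witness too many, so that a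
    -- forbidden configuration becomes a numerical bound.
    count-0 : ∀ xs → tally xs ≤ 0ℚ ⊎ (∃[ x ] (x ∈ xs × P x))
    count-0 [] = inj₁ ℚₚ.≤-refl
    count-0 (x ∷ xs) with P? x
    ... | yes p = inj₂ (x , here refl , p)
    ... | no _ = [ (λ h → inj₁ (certify [] (tally xs ∷ []) 0 (1 ✕ χ 0 ⊑ # 0 ∶ h ∷ []) (# 0 :+ χ 0 ⊑ # 0))) , (λ (y , y∈ , p) → inj₂ (y , there y∈ , p)) ]′ (count-0 xs)

    count-1 : ∀ xs → Unique xs → tally xs ≤ 1ℚ ⊎ (∃[ x ] ∃[ y ] (x ∈ xs × y ∈ xs × x ≢ y × P x × P y))
    count-1 [] _ = inj₁ (ℚₚ.<⇒≤ 0<1)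
    count-1 (x ∷ xs) (x∉ ∷ u) with P? x
    ... | yes p = [ (λ h → inj₁ (certify [] (tally xs ∷ []) 0 (1 ✕ χ 0 ⊑ # 0 ∶ h ∷ []) (# 1 :+ χ 0 ⊑ # 1))) , (λ (y , y∈ , q) → inj₂ (x , y , here refl , there y∈ , All.lookup x∉ y∈ , p , q)) ]′ (count-0 xs)
    ... | no _ = [ (λ h → inj₁ (certify [] (tally xs ∷ []) 0 (1 ✕ χ 0 ⊑ # 1 ∶ h ∷ []) (# 0 :+ χ 0 ⊑ # 1))) , (λ (y , z , y∈ , z∈ , r) → inj₂ (y , z , there y∈ , there z∈ , r)) ]′ (count-1 xs u)

    count-2 : ∀ xs → Unique xs → tally xs ≤ ι 2 ⊎ (∃[ x ] ∃[ y ] ∃[ z ] (x ∈ xs × y ∈ xs × z ∈ xs × x ≢ y × x ≢ z × y ≢ z × P x × P y × P z))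
    count-2 [] _ = inj₁ (0≤ι 2)
    count-2 (x ∷ xs) (x∉ ∷ u) with P? x
    ... | yes p = [ (λ h → inj₁ (certify [] (tally xs ∷ []) 0 (1 ✕ χ 0 ⊑ # 1 ∶ h ∷ []) (# 1 :+ χ 0 ⊑ # 2))) , (λ (y , z , y∈ , z∈ , y≢z , q , r) →
            inj₂ (x , y , z , here refl , there y∈ , there z∈ , All.lookup x∉ y∈ , All.lookup x∉ z∈ , y≢z , p , q , r)) ]′ (count-1 xs u)
    ... | no _ = [ (λ h → inj₁ (certify [] (tally xs ∷ []) 0 (1 ✕ χ 0 ⊑ # 2 ∶ h ∷ []) (# 0 :+ χ 0 ⊑ # 2))) , (λ (y , z , t , y∈ , z∈ , t∈ , r) → inj₂ (y , z , t , there y∈ , there z∈ , there t∈ , r)) ]′ (count-2 xs u)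

  ∑ˡ-single : ∀ (_≟_ : DecidableEquality A) xs a → Unique xs → a ∈ xs → ∑ˡ xs (λ x → 𝟙 (x ≟ a)) ≡ 1ℚ
  ∑ˡ-single _≟_ (x ∷ xs) .x (x∉ ∷ u) (here refl) = trans (cong₂ _+_ (𝟙-yes (x ≟ x) refl)
    (trans (∑ˡ-cong xs λ y y∈ → 𝟙-no (y ≟ x) λ e → All.lookup x∉ y∈ (sym e)) (trans (∑ˡ-const xs 0ℚ) (ℚₚ.*-zeroʳ (ι (length xs)))))) (ℚₚ.+-identityʳ 1ℚ)
  ∑ˡ-single _≟_ (x ∷ xs) a (x∉ ∷ u) (there a∈) = trans (cong₂ _+_ (𝟙-no (x ≟ a) (All.lookup x∉ a∈)) (∑ˡ-single _≟_ xs a u a∈)) (ℚₚ.+-identityˡ 1ℚ)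

𝟙-× : ∀ {P Q : Set} (d : Dec P) (e : Dec Q) → 𝟙 (d ×-dec e) ≡ 𝟙 d * 𝟙 e
𝟙-× (yes _) (yes _) = refl
𝟙-× (yes _) (no _) = refl
𝟙-× (no _) e = sym (ℚₚ.*-zeroˡ (𝟙 e))

𝟙-⊎ : ∀ {P Q : Set} (d : Dec P) (e : Dec Q) → ¬ (P × Q) → 𝟙 (d ⊎-dec e) ≡ 𝟙 d + 𝟙 e
𝟙-⊎ (yes p) (yes q) ¬pq = contradiction (p , q) ¬pq
𝟙-⊎ (yes _) (no _) _ = refl
𝟙-⊎ (no _) e _ = trans (𝟙-same e) (sym (ℚₚ.+-identityˡ (𝟙 e)))
  where 𝟙-same : ∀ {P Q : Set} {¬p : ¬ P} (e : Dec Q) → 𝟙 (no ¬p ⊎-dec e) ≡ 𝟙 e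
        𝟙-same (yes _) = refl
        𝟙-same (no _) = refl

-- Edge counting in a graph with few common neighbours

module CommonNeighbours (n : ℕ) where
  Vs : List (Fin n)
  Vs = allFin n

  ∑∑ : (Fin n → Fin n → ℚ) → ℚ
  ∑∑ f = ∑ˡ Vs (λ u → ∑ˡ Vs (f u))

  ∑∑-mono : ∀ {f g} → (∀ u v → f u v ≤ g u v) → ∑∑ f ≤ ∑∑ g
  ∑∑-mono h = ∑ˡ-mono Vs λ u _ → ∑ˡ-mono Vs λ v _ → h u v

  ∣Vs∣ : length Vs ≡ n
  ∣Vs∣ = Listₚ.length-tabulate id

  ∑-≟ : ∀ a → ∑ˡ Vs (λ x → 𝟙 (x Fin.≟ a)) ≡ 1ℚ
  ∑-≟ a = ∑ˡ-single Fin._≟_ Vs a (Uniqueₚ.allFin⁺ n) (∈-allFin a)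

  -- The Kővári-Sós-Turán count: by Cauchy-Schwarz (Σ A)² is at most n Σ d², and Σ d² is the sum of
  -- all codegrees. The diagonal u = v contributes at most Σ A, and `B` bounds the excess of a
  -- codegree over 1.
  edge-bound : ∀ (A B : Fin n → Fin n → ℚ) → (∀ w u → A w u * A w u ≤ A w u) → (∀ u v → 0ℚ ≤ B u v) →
    (∀ u v → u ≢ v → ∑ˡ Vs (λ w → A w u * A w v) ≤ 1ℚ + B u v) → ∑∑ A * ∑∑ A ≤ ι n * (ι n * ι n + ∑∑ B + ∑∑ A)
  edge-bound A B A² 0≤B few = certify (length Vs ∷ n ∷ []) (∑∑ A ∷ ∑ˡ Vs (λ w → d w * d w) ∷ ∑∑ B ∷ []) 0 (1 ✕ χ 0 :*
      χ 0 ⊑ ν 0 :* χ 1 ∶ cauchy-schwarz Vs d ∷ 1 ✕ ν 0 :* χ 1 ≐ ν 1 :* χ 1 ∶ cong (λ t → ι t * ∑ˡ Vs (λ w → d w * d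
      w)) ∣Vs∣ ∷ 1 ✕ ν 1 :* χ 1 ⊑ ν 1 :* (ν 1 :* ν 1 :+ χ 2 :+ χ 0) ∶ *-monoˡ (ι n) (0≤ι n) squares ∷ []) (χ 0 :* χ 0
      ⊑ ν 1 :* (ν 1 :* ν 1 :+ χ 2 :+ χ 0))
    where
    d : Fin n → ℚ
    d w = ∑ˡ Vs (A w)
    c : Fin n → ℚ
    c u = ∑ˡ Vs (λ w → A w u)
    C : Fin n → Fin n → ℚ
    C u v = ∑ˡ Vs (λ w → A w u * A w v)
    expand : ∑ˡ Vs (λ w → d w * d w) ≡ ∑∑ C
    expand = trans (∑ˡ-cong Vs λ w _ → trans (sym (∑ˡ-*ˡ Vs (d w) (A w))) (trans (∑ˡ-cong Vs λ v _ → trans (ℚₚ.*-comm (d w) (A w v)) (sym (∑ˡ-*ˡ Vs (A w v) (A w))))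
                 (trans (∑ˡ-swap Vs Vs (λ v u → A w v * A w u)) (∑ˡ-cong Vs λ u _ → ∑ˡ-cong Vs λ v _ → ℚₚ.*-comm (A w v) (A w u)))))
      (trans (∑ˡ-swap Vs Vs (λ w u → ∑ˡ Vs (λ v → A w u * A w v))) (∑ˡ-cong Vs λ u _ → ∑ˡ-swap Vs Vs (λ w v → A w u * A w v)))
    0≤A² : ∀ w u → 0ℚ ≤ A w u * A w u
    0≤A² w u = [ (λ h → *-nonNeg h h) , (λ h → subst (0ℚ ≤_) (certify [] (A w u ∷ []) 0 [] (:- χ 0 :* :- χ 0 ≐ χ 0 :*
        χ 0)) (*-nonNeg (ℚₚ.neg-antimono-≤ h) (ℚₚ.neg-antimono-≤ h))) ]′ (ℚₚ.≤-total 0ℚ (A w u))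
    pointwise : ∀ u v → C u v ≤ 1ℚ + B u v + c u * 𝟙 (v Fin.≟ u)
    pointwise u v with v Fin.≟ u
    ... | yes refl = certify [] (C u u ∷ c u ∷ B u u ∷ []) 0 (1 ✕ χ 0 ⊑ χ 1 ∶ ∑ˡ-mono Vs (λ w _ → A² w u) ∷ 1 ✕ # 0 ⊑
        χ 2 ∶ 0≤B u u ∷ []) (χ 0 ⊑ # 1 :+ χ 2 :+ χ 1 :* # 1)
    ... | no v≢u = certify [] (C u v ∷ B u v ∷ c u ∷ []) 0 (1 ✕ χ 0 ⊑ # 1 :+ χ 1 ∶ few u v (v≢u ∘ sym) ∷ []) (χ 0 ⊑ #
        1 :+ χ 1 :+ χ 2 :* # 0)
    rows : ∀ u → ∑ˡ Vs (λ v → 1ℚ + B u v + c u * 𝟙 (v Fin.≟ u)) ≡ ι n + ∑ˡ Vs (B u) + c u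
    rows u = trans (∑ˡ-+ Vs (λ v → 1ℚ + B u v) (λ v → c u * 𝟙 (v Fin.≟ u))) (cong₂ _+_
      (trans (∑ˡ-+ Vs (λ _ → 1ℚ) (B u)) (cong (ℚ._+ ∑ˡ Vs (B u)) (trans (∑ˡ-const Vs 1ℚ) (trans (ℚₚ.*-identityʳ (ι (length Vs))) (cong ι ∣Vs∣)))))
      (trans (∑ˡ-*ˡ Vs (c u) (λ v → 𝟙 (v Fin.≟ u))) (trans (cong (c u *_) (∑-≟ u)) (ℚₚ.*-identityʳ (c u)))))
    squares : ∑ˡ Vs (λ w → d w * d w) ≤ ι n * ι n + ∑∑ B + ∑∑ A
    squares = ℚₚ.≤-trans (ℚₚ.≤-reflexive expand) (ℚₚ.≤-trans (∑∑-mono pointwise) (ℚₚ.≤-reflexive (trans (∑ˡ-cong Vs λ u _ → rows u)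
      (trans (∑ˡ-+ Vs (λ u → ι n + ∑ˡ Vs (B u)) c) (cong₂ _+_
        (trans (∑ˡ-+ Vs (λ _ → ι n) (λ u → ∑ˡ Vs (B u))) (cong (ℚ._+ ∑∑ B) (trans (∑ˡ-const Vs (ι n)) (cong (λ t → ι t * ι n) ∣Vs∣))))
        (∑ˡ-swap Vs Vs (λ u w → A w u)))))))

-- Triple systems without a C₄ trace

Triple : ℕ → Set
Triple n = Fin n × Fin n × Fin n

Sorted : ∀ {n} → Triple n → Set
Sorted (a , b , c) = a Fin.< b × b Fin.< c

_∈₃?_ : ∀ {n} (v : Fin n) (e : Triple n) → Dec (v ∈₃ e)
v ∈₃? (a , b , c) = (v Fin.≟ a) ⊎-dec ((v Fin.≟ b) ⊎-dec (v Fin.≟ c))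

module _ {n : ℕ} where

  -- Choosing a first element of e leaves at most two others.
  others : ∀ {a : Fin n} {e} → a ∈₃ e → ∃[ y ] ∃[ z ] (∀ t → t ∈₃ e → t ≡ a ⊎ t ≡ y ⊎ t ≡ z)
  others {e = x , y , z} (inj₁ refl) = y , z , λ t h → h
  others {e = x , y , z} (inj₂ (inj₁ refl)) = x , z , λ { t (inj₁ e) → inj₂ (inj₁ e) ; t (inj₂ (inj₁ e)) → inj₁ e ; t (inj₂ (inj₂ e)) → inj₂ (inj₂ e) }
  others {e = x , y , z} (inj₂ (inj₂ refl)) = x , y , λ { t (inj₁ e) → inj₂ (inj₁ e) ; t (inj₂ (inj₁ e)) → inj₂ (inj₂ e) ; t (inj₂ (inj₂ e)) → inj₁ e }

  full : ∀ {a b c d : Fin n} {e} → a ∈₃ e → b ∈₃ e → c ∈₃ e → a ≢ b → a ≢ c → b ≢ c → d ∈₃ e → d ≡ a ⊎ d ≡ b ⊎ d ≡ c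
  full {a} {b} {c} {d} {e} a∈ b∈ c∈ a≢b a≢c b≢c d∈ with others {e = e} a∈
  ... | y , z , only with only b b∈ | only c c∈ | only d d∈
  ... | inj₁ b≡a | _ | _ = contradiction (sym b≡a) a≢b
  ... | _ | inj₁ c≡a | _ = contradiction (sym c≡a) a≢c
  ... | _ | _ | inj₁ d≡a = inj₁ d≡a
  ... | inj₂ (inj₁ refl) | inj₂ (inj₁ refl) | _ = contradiction refl b≢c
  ... | inj₂ (inj₂ refl) | inj₂ (inj₂ refl) | _ = contradiction refl b≢c
  ... | inj₂ (inj₁ refl) | inj₂ (inj₂ refl) | inj₂ d≡ = inj₂ d≡
  ... | inj₂ (inj₂ refl) | inj₂ (inj₁ refl) | inj₂ (inj₁ d≡) = inj₂ (inj₂ d≡)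
  ... | inj₂ (inj₂ refl) | inj₂ (inj₁ refl) | inj₂ (inj₂ d≡) = inj₂ (inj₁ d≡)

  sorted-≡ : ∀ {e f : Triple n} → Sorted e → Sorted f → (∀ t → t ∈₃ e → t ∈₃ f) → e ≡ f
  sorted-≡ {x , y , z} {x′ , y′ , z′} (x<y , y<z) (x′<y′ , y′<z′) sub = go (sub x (inj₁ refl)) (sub y (inj₂ (inj₁ refl))) (sub z (inj₂ (inj₂ refl)))
    where
    go : x ∈₃ (x′ , y′ , z′) → y ∈₃ (x′ , y′ , z′) → z ∈₃ (x′ , y′ , z′) → (x , y , z) ≡ (x′ , y′ , z′)
    go (inj₁ refl) (inj₂ (inj₁ refl)) (inj₂ (inj₂ refl)) = refl
    go (inj₁ refl) (inj₁ refl) _ = contradiction x<y (ℕₚ.<-irrefl refl)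
    go (inj₂ (inj₁ refl)) (inj₁ refl) _ = contradiction x<y (ℕₚ.<-asym x′<y′)
    go (inj₂ (inj₂ refl)) (inj₁ refl) _ = contradiction x<y (ℕₚ.<-asym (ℕₚ.<-trans x′<y′ y′<z′))
    go (inj₂ (inj₁ refl)) (inj₂ (inj₁ refl)) _ = contradiction x<y (ℕₚ.<-irrefl refl)
    go (inj₂ (inj₂ refl)) (inj₂ (inj₁ refl)) _ = contradiction x<y (ℕₚ.<-asym y′<z′)
    go _ (inj₂ (inj₂ refl)) (inj₁ refl) = contradiction y<z (ℕₚ.<-asym (ℕₚ.<-trans x′<y′ y′<z′))
    go _ (inj₂ (inj₂ refl)) (inj₂ (inj₁ refl)) = contradiction y<z (ℕₚ.<-asym y′<z′)
    go _ (inj₂ (inj₂ refl)) (inj₂ (inj₂ refl)) = contradiction y<z (ℕₚ.<-irrefl refl)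
    go _ (inj₂ (inj₁ refl)) (inj₁ refl) = contradiction y<z (ℕₚ.<-asym x′<y′)
    go _ (inj₂ (inj₁ refl)) (inj₂ (inj₁ refl)) = contradiction y<z (ℕₚ.<-irrefl refl)

  sorted-≡₃ : ∀ {e f : Triple n} {a b c} → Sorted e → Sorted f → a ≢ b → a ≢ c → b ≢ c →
    a ∈₃ e → b ∈₃ e → c ∈₃ e → a ∈₃ f → b ∈₃ f → c ∈₃ f → e ≡ f
  sorted-≡₃ {e} {f} se sf a≢b a≢c b≢c ae be ce af bf cf = sorted-≡ se sf λ t t∈ → into t (full {e = e} ae be ce a≢b a≢c b≢c t∈)
    where into : ∀ t → t ≡ _ ⊎ t ≡ _ ⊎ t ≡ _ → t ∈₃ f
          into t (inj₁ refl) = af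
          into t (inj₂ (inj₁ refl)) = bf
          into t (inj₂ (inj₂ refl)) = cf

module TraceFree {n : ℕ} (Hy : Hyp3 n) (free : ¬ ContainsTrace C4 Hy) where
  open Hyp3 Hy using () renaming (edges to E; ordered to E-ordered; nodup to E-unique)


  sortedE : ∀ {e} → e ∈ E → Sorted e
  sortedE {a , b , c} e∈ = All.lookup E-ordered e∈

  -- A triple that can serve as the image of the pair a b when S consists of a, b, c and d.
  record Ok (a b c d : Fin n) : Set where
    constructor ok
    field
      {edge} : Triple n
      edge∈ : edge ∈ E
      a∈ : a ∈₃ edge
      b∈ : b ∈₃ edge
      c∉ : ¬ (c ∈₃ edge)
      d∉ : ¬ (d ∈₃ edge)

  AllIn : (a b c d : Fin n) → Set
  AllIn a b c d = ∀ {e} → e ∈ E → a ∈₃ e → b ∈₃ e → c ∈₃ e ⊎ d ∈₃ e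

  ok? : ∀ a b c d → Ok a b c d ⊎ AllIn a b c d
  ok? a b c d with any? (λ e → (a ∈₃? e) ×-dec (b ∈₃? e) ×-dec ¬? (c ∈₃? e) ×-dec ¬? (d ∈₃? e)) E
  ... | yes found with find∈ found
  ...   | e , e∈ , a∈ , b∈ , c∉ , d∉ = inj₁ (ok e∈ a∈ b∈ c∉ d∉)
  ok? a b c d | no none = inj₂ λ {e} e∈ a∈ b∈ → by e e∈ a∈ b∈ (c ∈₃? e) (d ∈₃? e)
    where
    by : ∀ e → e ∈ E → a ∈₃ e → b ∈₃ e → Dec (c ∈₃ e) → Dec (d ∈₃ e) → c ∈₃ e ⊎ d ∈₃ e
    by e e∈ a∈ b∈ (yes c∈) _ = inj₁ c∈
    by e e∈ a∈ b∈ (no _) (yes d∈) = inj₂ d∈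
    by e e∈ a∈ b∈ (no c∉) (no d∉) = contradiction (lose e∈ (a∈ , b∈ , c∉ , d∉)) none

  -- Injectivity of `φ` comes for free: a triple meets S in the two ends of its pair, and different
  -- edges of C₄ have different ends.
  no-cycle : ∀ {a b c d} → a ≢ b → a ≢ c → a ≢ d → b ≢ c → b ≢ d → c ≢ d → Ok a b c d → Ok b c d a → Ok c d a b → Ok a d b c → ⊥
  no-cycle {a} {b} {c} {d} a≢b a≢c a≢d b≢c b≢d c≢d ab bc cd ad = free (ψ , φ , ψ-inj , φ-inj , cond)
    where
    open import Data.Fin.Patterns using (0F; 1F; 2F; 3F)
    ψ : Fin 4 → Fin n
    ψ 0F = a
    ψ 1F = b
    ψ 2F = c
    ψ 3F = d
    edge∈ : ∀ i → ∃[ e ] (e ∈ E)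
    edge∈ 0F = _ , Ok.edge∈ ab
    edge∈ 1F = _ , Ok.edge∈ bc
    edge∈ 2F = _ , Ok.edge∈ cd
    edge∈ 3F = _ , Ok.edge∈ ad
    φ : Fin 4 → Fin (length E)
    φ i = Any.index (proj₂ (edge∈ i))
    at : ∀ i → proj₁ (edge∈ i) ≡ lookup E (φ i)
    at i = Anyₚ.lookup-index (proj₂ (edge∈ i))
    ψ-inj : ∀ {i j} → ψ i ≡ ψ j → i ≡ j
    ψ-inj {0F} {0F} _ = refl
    ψ-inj {0F} {1F} e = contradiction e a≢b
    ψ-inj {0F} {2F} e = contradiction e a≢c
    ψ-inj {0F} {3F} e = contradiction e a≢d
    ψ-inj {1F} {0F} e = contradiction (sym e) a≢b
    ψ-inj {1F} {1F} _ = refl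
    ψ-inj {1F} {2F} e = contradiction e b≢c
    ψ-inj {1F} {3F} e = contradiction e b≢d
    ψ-inj {2F} {0F} e = contradiction (sym e) a≢c
    ψ-inj {2F} {1F} e = contradiction (sym e) b≢c
    ψ-inj {2F} {2F} _ = refl
    ψ-inj {2F} {3F} e = contradiction e c≢d
    ψ-inj {3F} {0F} e = contradiction (sym e) a≢d
    ψ-inj {3F} {1F} e = contradiction (sym e) b≢d
    ψ-inj {3F} {2F} e = contradiction (sym e) c≢d
    ψ-inj {3F} {3F} _ = refl
    End : Fin 4 → Fin 4 → Set
    End i v = v ≡ proj₁ (lookup (Graph.edges C4) i) ⊎ v ≡ proj₂ (lookup (Graph.edges C4) i)
    yes⇔ : ∀ i v → ψ v ∈₃ proj₁ (edge∈ i) → End i v → (ψ v ∈₃ lookup E (φ i)) ⇔ End i v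
    yes⇔ i v p q = mk⇔ (λ _ → q) (λ _ → subst (ψ v ∈₃_) (at i) p)
    no⇔ : ∀ i v → ¬ (ψ v ∈₃ proj₁ (edge∈ i)) → ¬ End i v → (ψ v ∈₃ lookup E (φ i)) ⇔ End i v
    no⇔ i v p q = mk⇔ (λ h → contradiction (subst (ψ v ∈₃_) (sym (at i)) h) p) (λ h → contradiction h q)
    cond : ∀ i v → (ψ v ∈₃ lookup E (φ i)) ⇔ End i v
    cond 0F 0F = yes⇔ 0F 0F (Ok.a∈ ab) (inj₁ refl)
    cond 0F 1F = yes⇔ 0F 1F (Ok.b∈ ab) (inj₂ refl)
    cond 0F 2F = no⇔ 0F 2F (Ok.c∉ ab) λ { (inj₁ ()) ; (inj₂ ()) }
    cond 0F 3F = no⇔ 0F 3F (Ok.d∉ ab) λ { (inj₁ ()) ; (inj₂ ()) }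
    cond 1F 0F = no⇔ 1F 0F (Ok.d∉ bc) λ { (inj₁ ()) ; (inj₂ ()) }
    cond 1F 1F = yes⇔ 1F 1F (Ok.a∈ bc) (inj₁ refl)
    cond 1F 2F = yes⇔ 1F 2F (Ok.b∈ bc) (inj₂ refl)
    cond 1F 3F = no⇔ 1F 3F (Ok.c∉ bc) λ { (inj₁ ()) ; (inj₂ ()) }
    cond 2F 0F = no⇔ 2F 0F (Ok.c∉ cd) λ { (inj₁ ()) ; (inj₂ ()) }
    cond 2F 1F = no⇔ 2F 1F (Ok.d∉ cd) λ { (inj₁ ()) ; (inj₂ ()) }
    cond 2F 2F = yes⇔ 2F 2F (Ok.a∈ cd) (inj₁ refl)
    cond 2F 3F = yes⇔ 2F 3F (Ok.b∈ cd) (inj₂ refl)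
    cond 3F 0F = yes⇔ 3F 0F (Ok.a∈ ad) (inj₁ refl)
    cond 3F 1F = no⇔ 3F 1F (Ok.c∉ ad) λ { (inj₁ ()) ; (inj₂ ()) }
    cond 3F 2F = no⇔ 3F 2F (Ok.d∉ ad) λ { (inj₁ ()) ; (inj₂ ()) }
    cond 3F 3F = yes⇔ 3F 3F (Ok.b∈ ad) (inj₂ refl)
    move : ∀ i j v → φ i ≡ φ j → End i v → End j v
    move i j v eq h = Equivalence.to (cond j v) (subst (λ t → ψ v ∈₃ lookup E t) eq (Equivalence.from (cond i v) h))
    φ-inj : ∀ {i j} → φ i ≡ φ j → i ≡ j
    φ-inj {0F} {0F} _ = refl
    φ-inj {0F} {1F} e = case move 0F 1F 0F e (inj₁ refl) of λ { (inj₁ ()) ; (inj₂ ()) }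
    φ-inj {0F} {2F} e = case move 0F 2F 0F e (inj₁ refl) of λ { (inj₁ ()) ; (inj₂ ()) }
    φ-inj {0F} {3F} e = case move 0F 3F 1F e (inj₂ refl) of λ { (inj₁ ()) ; (inj₂ ()) }
    φ-inj {1F} {0F} e = case move 1F 0F 2F e (inj₂ refl) of λ { (inj₁ ()) ; (inj₂ ()) }
    φ-inj {1F} {1F} _ = refl
    φ-inj {1F} {2F} e = case move 1F 2F 1F e (inj₁ refl) of λ { (inj₁ ()) ; (inj₂ ()) }
    φ-inj {1F} {3F} e = case move 1F 3F 1F e (inj₁ refl) of λ { (inj₁ ()) ; (inj₂ ()) }
    φ-inj {2F} {0F} e = case move 2F 0F 2F e (inj₁ refl) of λ { (inj₁ ()) ; (inj₂ ()) }
    φ-inj {2F} {1F} e = case move 2F 1F 3F e (inj₂ refl) of λ { (inj₁ ()) ; (inj₂ ()) }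
    φ-inj {2F} {2F} _ = refl
    φ-inj {2F} {3F} e = case move 2F 3F 2F e (inj₁ refl) of λ { (inj₁ ()) ; (inj₂ ()) }
    φ-inj {3F} {0F} e = case move 3F 0F 3F e (inj₂ refl) of λ { (inj₁ ()) ; (inj₂ ()) }
    φ-inj {3F} {1F} e = case move 3F 1F 0F e (inj₁ refl) of λ { (inj₁ ()) ; (inj₂ ()) }
    φ-inj {3F} {2F} e = case move 3F 2F 0F e (inj₁ refl) of λ { (inj₁ ()) ; (inj₂ ()) }
    φ-inj {3F} {3F} _ = refl

  Has : Fin n → Fin n → Triple n → Set
  Has u v e = u ≢ v × u ∈₃ e × v ∈₃ e

  Has-sym : ∀ {u v e} → Has u v e → Has v u e
  Has-sym (u≢v , p , q) = u≢v ∘ sym , q , p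

  has? : ∀ u v e → Dec (Has u v e)
  has? u v e = ¬? (u Fin.≟ v) ×-dec ((u ∈₃? e) ×-dec (v ∈₃? e))

  record Heavy (u v : Fin n) : Set where
    constructor heavy
    field
      {e f} : Triple n
      e∈ : e ∈ E
      f∈ : f ∈ E
      e≢f : e ≢ f
      has-e : Has u v e
      has-f : Has u v f

  Heavy-sym : ∀ {u v} → Heavy u v → Heavy v u
  Heavy-sym (heavy {e} {f} e∈ f∈ e≢f h k) = heavy e∈ f∈ e≢f (Has-sym {e = e} h) (Has-sym {e = f} k)

  _≟₃_ : DecidableEquality (Triple n)
  _≟₃_ = ≡-dec Fin._≟_ (≡-dec Fin._≟_ Fin._≟_)

  heavy? : ∀ u v → Dec (Heavy u v)
  heavy? u v with any? (λ e → any? (λ f → ¬? (e ≟₃ f) ×-dec (has? u v e ×-dec has? u v f)) E) E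
  ... | yes found with find∈ found
  ...   | e , e∈ , found′ with find∈ found′
  ...     | f , f∈ , e≢f , h , k = yes (heavy e∈ f∈ e≢f h k)
  heavy? u v | no none = no λ { (heavy e∈ f∈ e≢f h k) → none (lose e∈ (lose f∈ (e≢f , h , k))) }

  light-unique : ∀ {u v e f} → ¬ Heavy u v → e ∈ E → f ∈ E → Has u v e → Has u v f → e ≡ f
  light-unique {u} {v} {e} {f} ¬h e∈ f∈ h k with e ≟₃ f
  ... | yes e≡f = e≡f
  ... | no e≢f = contradiction (heavy e∈ f∈ e≢f h k) ¬h

  record Tri (a b c : Fin n) : Set where
    constructor tri
    field
      {edge} : Triple n
      edge∈ : edge ∈ E
      a∈ : a ∈₃ edge
      b∈ : b ∈₃ edge
      c∈ : c ∈₃ edge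

  tri-ok : ∀ {u a b c d} → u ≢ a → u ≢ b → a ≢ b → c ≢ u → c ≢ a → c ≢ b → d ≢ u → d ≢ a → d ≢ b → Tri u a b → Ok a b c d
  tri-ok {u} {a} {b} {c} {d} u≢a u≢b a≢b cu ca cb du da db (tri {e} e∈ u∈ a∈ b∈) = ok e∈ a∈ b∈ (out cu ca cb) (out du da db)
    where out : ∀ {c} → c ≢ u → c ≢ a → c ≢ b → ¬ (c ∈₃ e)
          out cu ca cb c∈ = [ cu , [ ca , cb ]′ ]′ (full {e = e} u∈ a∈ b∈ u≢a u≢b a≢b c∈)

  -- Two different triples through a and b have their third vertices in {c, d}, and these cannot
  -- coincide; so both choices occur.
  heavy-split : ∀ {a b c d} → Heavy a b → AllIn a b c d → c ≢ a → c ≢ b → d ≢ a → d ≢ b → Tri a b c × Tri a b d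
  heavy-split {a} {b} {c} {d} (heavy {e} {f} e∈ f∈ e≢f (a≢b , ae , be) (_ , af , bf)) all ca cb da db with all e∈ ae be | all f∈ af bf
  ... | inj₁ ce | inj₂ df = tri e∈ ae be ce , tri f∈ af bf df
  ... | inj₂ de | inj₁ cf = tri f∈ af bf cf , tri e∈ ae be de
  ... | inj₁ ce | inj₁ cf = contradiction (sorted-≡₃ {e = e} {f} (sortedE e∈) (sortedE f∈) a≢b (ca ∘ sym) (cb ∘ sym) ae be ce af bf cf) e≢f
  ... | inj₂ de | inj₂ df = contradiction (sorted-≡₃ {e = e} {f} (sortedE e∈) (sortedE f∈) a≢b (da ∘ sym) (db ∘ sym) ae be de af bf df) e≢f

  -- How the cycle u w₁ v w₂ of heavy pairs fails to be a trace at one of the two pairs through u.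
  record Served (u v w₁ w₂ : Fin n) : Set where
    constructor served
    field
      base : Tri u w₁ w₂
      leaf : (AllIn u w₁ v w₂ × Tri u w₁ v) ⊎ (AllIn u w₂ v w₁ × Tri u w₂ v)

  tri-swap : ∀ {a b c} → Tri a b c → Tri a c b
  tri-swap (tri e∈ p q r) = tri e∈ p r q

  tri-rot : ∀ {a b c} → Tri a b c → Tri b a c
  tri-rot (tri e∈ p q r) = tri e∈ q p r

  all-swap : ∀ {a b c d} → AllIn a b c d → AllIn a b d c
  all-swap h e∈ p q = [ inj₂ , inj₁ ]′ (h e∈ p q)

  all-rot : ∀ {a b c d} → AllIn a b c d → AllIn b a c d
  all-rot h e∈ p q = h e∈ q p

  served-swap : ∀ {u v w₁ w₂} → Served u v w₁ w₂ → Served u v w₂ w₁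
  served-swap (served t l) = served (tri-swap t) ([ inj₂ , inj₁ ]′ l)

  module _ {u v w₁ w₂ : Fin n} (u≢v : u ≢ v) (w₁≢w₂ : w₁ ≢ w₂) (w₁u : Heavy w₁ u) (w₁v : Heavy w₁ v) (w₂u : Heavy w₂ u) (w₂v : Heavy w₂ v) where
    private
      w₁≢u = proj₁ (Heavy.has-e w₁u)
      w₁≢v = proj₁ (Heavy.has-e w₁v)
      w₂≢u = proj₁ (Heavy.has-e w₂u)
      w₂≢v = proj₁ (Heavy.has-e w₂v)

    -- As u w₁ v w₂ is not a trace, one of its four pairs satisfies `AllIn`, and `heavy-split`
    -- supplies the two triples. A failing pair at u gives the first alternative, one at v the
    -- second.
    one-serves : Served u v w₁ w₂ ⊎ Served v u w₁ w₂
    one-serves = go (ok? u w₁ v w₂) (ok? w₁ v w₂ u) (ok? v w₂ u w₁) (ok? u w₂ w₁ v)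
      where
      go : Ok u w₁ v w₂ ⊎ AllIn u w₁ v w₂ → Ok w₁ v w₂ u ⊎ AllIn w₁ v w₂ u → Ok v w₂ u w₁ ⊎ AllIn v w₂ u w₁ → Ok u w₂ w₁ v ⊎ AllIn u w₂ w₁ v →
        Served u v w₁ w₂ ⊎ Served v u w₁ w₂
      go (inj₁ o₁) (inj₁ o₂) (inj₁ o₃) (inj₁ o₄) = ⊥-elim (no-cycle (w₁≢u ∘ sym) u≢v (w₂≢u ∘ sym) w₁≢v w₁≢w₂ (w₂≢v ∘ sym) o₁ o₂ o₃ o₄)
      go (inj₂ all) _ _ _ = let t₁ , t₂ = heavy-split (Heavy-sym w₁u) all (u≢v ∘ sym) (w₁≢v ∘ sym) w₂≢u (w₁≢w₂ ∘ sym) in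
        inj₁ (served t₂ (inj₁ (all , t₁)))
      go _ (inj₂ all) _ _ = let t₁ , t₂ = heavy-split w₁v all (w₁≢w₂ ∘ sym) w₂≢v (w₁≢u ∘ sym) u≢v in
        inj₂ (served (tri-rot t₁) (inj₁ (all-swap (all-rot all) , tri-rot t₂)))
      go _ _ (inj₂ all) _ = let t₁ , t₂ = heavy-split (Heavy-sym w₂v) all u≢v (w₂≢u ∘ sym) w₁≢v w₁≢w₂ in
        inj₂ (served (tri-swap t₂) (inj₂ (all , t₁)))
      go _ _ _ (inj₂ all) = let t₁ , t₂ = heavy-split (Heavy-sym w₂u) all w₁≢u w₁≢w₂ (u≢v ∘ sym) (w₂≢v ∘ sym) in
        inj₁ (served (tri-swap t₁) (inj₂ (all-swap all , t₂)))

    -- The triple in `leaf` contains both u and v.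
    shadow : ∃[ e ] (e ∈ E × Has u v e)
    shadow = [ (λ { (served _ (inj₁ (_ , tri e∈ p _ r))) → _ , e∈ , u≢v , p , r ; (served _ (inj₂ (_ , tri e∈ p _ r))) → _ , e∈ , u≢v , p , r })
             , (λ { (served _ (inj₁ (_ , tri e∈ p _ r))) → _ , e∈ , u≢v , r , p ; (served _ (inj₂ (_ , tri e∈ p _ r))) → _ , e∈ , u≢v , r , p }) ]′ one-serves

  module _ {u v : Fin n} (u≢v : u ≢ v) where

    private
      excluded : ∀ {a b w₁ w₂ w₃} → w₁ ≢ a → w₁ ≢ b → w₂ ≢ a → w₂ ≢ b → w₃ ≢ a → a ≢ b → w₁ ≢ w₂ → w₁ ≢ w₃ → w₂ ≢ w₃ → w₃ ≢ b →
        AllIn a w₁ b w₂ → Tri a w₁ w₃ → ⊥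
      excluded w₁≢a w₁≢b w₂≢a w₂≢b w₃≢a a≢b w₁≢w₂ w₁≢w₃ w₂≢w₃ w₃≢b all (tri {e} e∈ a∈ w₁∈ w₃∈) with all e∈ a∈ w₁∈
      ... | inj₁ b∈ = [ a≢b ∘ sym , [ w₁≢b ∘ sym , w₃≢b ∘ sym ]′ ]′ (full {e = e} a∈ w₁∈ w₃∈ (w₁≢a ∘ sym) (w₃≢a ∘ sym) w₁≢w₃ b∈)
      ... | inj₂ w₂∈ = [ w₂≢a , [ w₁≢w₂ ∘ sym , w₂≢w₃ ]′ ]′ (full {e = e} a∈ w₁∈ w₃∈ (w₁≢a ∘ sym) (w₃≢a ∘ sym) w₁≢w₃ w₂∈)

    -- If a leaf is at the shared w₁, its `AllIn` is contradicted by the base triple u w₁ w of the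
    -- other. Otherwise the triples u w₁ w₂, u w₁ w₃, u w₃ v, u w₂ v, all through u, form a trace of
    -- the cycle w₂ w₁ w₃ v.
    twice-served : ∀ {w₁ w₂ w₃} → w₁ ≢ u → w₁ ≢ v → w₂ ≢ u → w₂ ≢ v → w₃ ≢ u → w₃ ≢ v → w₁ ≢ w₂ → w₁ ≢ w₃ → w₂ ≢ w₃ →
      Served u v w₁ w₂ → Served u v w₁ w₃ → ⊥
    twice-served 1u 1v 2u 2v 3u 3v n₁₂ n₁₃ n₂₃ (served t₂ (inj₁ (all , _))) (served t₃ _) = excluded 1u 1v 2u 2v 3u u≢v n₁₂ n₁₃ n₂₃ 3v all t₃
    twice-served 1u 1v 2u 2v 3u 3v n₁₂ n₁₃ n₂₃ (served t₂ (inj₂ _)) (served t₃ (inj₁ (all , _))) = excluded 1u 1v 3u 3v 2u u≢v n₁₃ n₁₂ (n₂₃ ∘ sym) 2v all t₂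
    twice-served 1u 1v 2u 2v 3u 3v n₁₂ n₁₃ n₂₃ (served t₂ (inj₂ (_ , s₂))) (served t₃ (inj₂ (_ , s₃))) =
      no-cycle (n₁₂ ∘ sym) n₂₃ 2v n₁₃ 1v 3v
        (tri-ok (2u ∘ sym) (1u ∘ sym) (n₁₂ ∘ sym) 3u (n₂₃ ∘ sym) (n₁₃ ∘ sym) (u≢v ∘ sym) (2v ∘ sym) (1v ∘ sym) (tri-swap t₂))
        (tri-ok (1u ∘ sym) (3u ∘ sym) n₁₃ (u≢v ∘ sym) (1v ∘ sym) (3v ∘ sym) 2u (n₁₂ ∘ sym) n₂₃ t₃)
        (tri-ok (3u ∘ sym) u≢v 3v 2u n₂₃ 2v 1u n₁₃ 1v s₃)
        (tri-ok (2u ∘ sym) u≢v 2v 1u n₁₂ 1v 3u (n₂₃ ∘ sym) 3v s₂)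

  -- Each of the three pairs among the wᵢ is served at u or at v, so two of them are served at the
  -- same vertex; they share a wᵢ, and `twice-served` applies.
  three-common : ∀ {u v w₁ w₂ w₃} → u ≢ v → w₁ ≢ w₂ → w₁ ≢ w₃ → w₂ ≢ w₃ →
    Heavy w₁ u → Heavy w₁ v → Heavy w₂ u → Heavy w₂ v → Heavy w₃ u → Heavy w₃ v → ⊥
  three-common {u} {v} {w₁} {w₂} {w₃} u≢v n₁₂ n₁₃ n₂₃ h1u h1v h2u h2v h3u h3v =
    go (one-serves u≢v n₁₂ h1u h1v h2u h2v) (one-serves u≢v n₁₃ h1u h1v h3u h3v) (one-serves u≢v n₂₃ h2u h2v h3u h3v)
    where
    1u = proj₁ (Heavy.has-e h1u)
    1v = proj₁ (Heavy.has-e h1v)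
    2u = proj₁ (Heavy.has-e h2u)
    2v = proj₁ (Heavy.has-e h2v)
    3u = proj₁ (Heavy.has-e h3u)
    3v = proj₁ (Heavy.has-e h3v)
    v≢u = u≢v ∘ sym
    go : Served u v w₁ w₂ ⊎ Served v u w₁ w₂ → Served u v w₁ w₃ ⊎ Served v u w₁ w₃ → Served u v w₂ w₃ ⊎ Served v u w₂ w₃ → ⊥
    go (inj₁ a) (inj₁ b) _ = twice-served u≢v 1u 1v 2u 2v 3u 3v n₁₂ n₁₃ n₂₃ a b
    go (inj₂ a) (inj₂ b) _ = twice-served v≢u 1v 1u 2v 2u 3v 3u n₁₂ n₁₃ n₂₃ a b
    go (inj₁ a) (inj₂ _) (inj₁ c) = twice-served u≢v 2u 2v 1u 1v 3u 3v (n₁₂ ∘ sym) n₂₃ n₁₃ (served-swap a) c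
    go (inj₂ a) (inj₁ _) (inj₂ c) = twice-served v≢u 2v 2u 1v 1u 3v 3u (n₁₂ ∘ sym) n₂₃ n₁₃ (served-swap a) c
    go (inj₁ _) (inj₂ b) (inj₂ c) = twice-served v≢u 3v 3u 1v 1u 2v 2u (n₁₃ ∘ sym) (n₂₃ ∘ sym) n₁₂ (served-swap b) (served-swap c)
    go (inj₂ _) (inj₁ b) (inj₁ c) = twice-served u≢v 3u 3v 1u 1v 2u 2v (n₁₃ ∘ sym) (n₂₃ ∘ sym) n₁₂ (served-swap b) (served-swap c)

-- Counting the triples through light and heavy pairs

module EdgeCount {n : ℕ} (Hy : Hyp3 n) (free : ¬ ContainsTrace C4 Hy) where
  open Hyp3 Hy using () renaming (edges to E; nodup to E-unique)
  open TraceFree Hy free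
  open CommonNeighbours n

  private
    term≤∑ˡ : ∀ {A : Set} {xs : List A} {x} (f : A → ℚ) → (∀ x → 0ℚ ≤ f x) → x ∈ xs → f x ≤ ∑ˡ xs f
    term≤∑ˡ {xs = x ∷ xs} f 0≤f (here refl) = certify [] (∑ˡ xs f ∷ f x ∷ []) 0 (1 ✕ # 0 ⊑ χ 0 ∶ ∑ˡ-nonNeg xs {f} 0≤f
        ∷ []) (χ 1 ⊑ χ 1 :+ χ 0)
    term≤∑ˡ {xs = y ∷ xs} {x} f 0≤f (there x∈) = certify [] (f x ∷ ∑ˡ xs f ∷ f y ∷ []) 0 (1 ✕ χ 0 ⊑ χ 1 ∶ term≤∑ˡ f
        0≤f x∈ ∷ 1 ✕ # 0 ⊑ χ 2 ∶ 0≤f y ∷ []) (χ 0 ⊑ χ 2 :+ χ 1)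

    𝟙² : ∀ {P : Set} (d : Dec P) → 𝟙 d * 𝟙 d ≤ 𝟙 d
    𝟙² (yes _) = ℚₚ.≤-refl
    𝟙² (no _) = ℚₚ.≤-refl

    distinct : ∀ {a b c} → (a , b , c) ∈ E → a ≢ b × a ≢ c × b ≢ c
    distinct e∈ = let a<b , b<c = sortedE e∈ in
      (λ { refl → ℕₚ.<-irrefl refl a<b }) , (λ { refl → ℕₚ.<-asym a<b b<c }) , (λ { refl → ℕₚ.<-irrefl refl b<c })

    has-𝟙 : ∀ u v e → 𝟙 (has? u v e) ≡ 𝟙 (u ∈₃? e) * (𝟙 (v ∈₃? e) - 𝟙 (v Fin.≟ u))
    has-𝟙 u v e with v Fin.≟ u
    ... | yes refl = trans (𝟙-no (has? u u e) λ (u≢u , _) → u≢u refl) (sym (idem (u ∈₃? e)))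
      where idem : ∀ {P : Set} (d : Dec P) → 𝟙 d * (𝟙 d - 1ℚ) ≡ 0ℚ
            idem (yes _) = refl
            idem (no _) = refl
    ... | no v≢u = trans (𝟙-iff (has? u v e) ((u ∈₃? e) ×-dec (v ∈₃? e)) proj₂ (λ h → v≢u ∘ sym , h))
        (trans (𝟙-× (u ∈₃? e) (v ∈₃? e)) (certify [] (𝟙 (u ∈₃? e) ∷ 𝟙 (v ∈₃? e) ∷ []) 0 [] (χ 0 :* χ 1 ≐ χ 0 :* (χ 1
            :- # 0))))

    ∈-sum : ∀ {e} → e ∈ E → ∑ˡ Vs (λ v → 𝟙 (v ∈₃? e)) ≡ ι 3
    ∈-sum {a , b , c} e∈ = let a≢b , a≢c , b≢c = distinct e∈ in trans
      (∑ˡ-cong Vs λ v _ → trans (𝟙-⊎ (v Fin.≟ a) ((v Fin.≟ b) ⊎-dec (v Fin.≟ c)) (λ { (refl , inj₁ e) → a≢b e ; (refl , inj₂ e) → a≢c e }))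
        (cong (ℚ._+_ (𝟙 (v Fin.≟ a))) (𝟙-⊎ (v Fin.≟ b) (v Fin.≟ c) λ { (refl , e) → b≢c e })))
      (trans (∑ˡ-+ Vs (λ v → 𝟙 (v Fin.≟ a)) (λ v → 𝟙 (v Fin.≟ b) + 𝟙 (v Fin.≟ c)))
        (trans (cong₂ _+_ (∑-≟ a) (trans (∑ˡ-+ Vs (λ v → 𝟙 (v Fin.≟ b)) (λ v → 𝟙 (v Fin.≟ c))) (cong₂ _+_ (∑-≟ b) (∑-≟ c)))) refl))

    has-sum : ∀ {e} → e ∈ E → ∑∑ (λ u v → 𝟙 (has? u v e)) ≡ ι 6
    has-sum {e} e∈ = trans (∑ˡ-cong Vs λ u _ → trans (∑ˡ-cong Vs λ v _ → has-𝟙 u v e) (trans (∑ˡ-*ˡ Vs (𝟙 (u ∈₃? e)) (λ v → 𝟙 (v ∈₃? e) - 𝟙 (v Fin.≟ u)))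
        (trans (cong (𝟙 (u ∈₃? e) *_) (row u)) (ℚₚ.*-comm (𝟙 (u ∈₃? e)) (ι 2)))))
      (trans (∑ˡ-*ˡ Vs (ι 2) (λ u → 𝟙 (u ∈₃? e))) (cong (ι 2 *_) (∈-sum e∈)))
      where
      row : ∀ u → ∑ˡ Vs (λ v → 𝟙 (v ∈₃? e) - 𝟙 (v Fin.≟ u)) ≡ ι 2
      row u = certify [] (∑ˡ Vs (λ v → 𝟙 (v ∈₃? e) - 𝟙 (v Fin.≟ u) + 𝟙 (v Fin.≟ u)) ∷ ∑ˡ Vs (λ v → 𝟙 (v ∈₃? e) - 𝟙 (v
          Fin.≟ u)) ∷ ∑ˡ Vs (λ v → 𝟙 (v Fin.≟ u)) ∷ ∑ˡ Vs (λ v → 𝟙 (v ∈₃? e)) ∷ []) 0 (1 ✕ χ 1 :+ χ 2 ≐ χ 0 ∶ sym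
          (∑ˡ-+ Vs (λ v → 𝟙 (v ∈₃? e) - 𝟙 (v Fin.≟ u)) (λ v → 𝟙 (v Fin.≟ u))) ∷ 1 ✕ χ 0 ≐ χ 3 ∶ ∑ˡ-cong Vs (λ v _ →
          cancel (𝟙 (v ∈₃? e)) (𝟙 (v Fin.≟ u))) ∷ 1 ✕ χ 3 ≐ # 3 ∶ ∈-sum e∈ ∷ 1 ✕ # 1 ≐ χ 2 ∶ sym (∑-≟ u) ∷ []) (χ 1 ≐
          # 2)
        where cancel : ∀ s t → s - t + t ≡ s
              cancel s t = certify [] (s ∷ t ∷ []) 0 [] (χ 0 :- χ 1 :+ χ 1 ≐ χ 0)

    third : ∀ {u v e} → e ∈ E → Has u v e → ∃[ w ] (w ∈₃ e × w ≢ u × w ≢ v)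
    third {u} {v} {a , b , c} e∈ (u≢v , u∈ , v∈) = let a≢b , a≢c , b≢c = distinct e∈ in go a≢b a≢c b≢c u∈ v∈
      where
      go : a ≢ b → a ≢ c → b ≢ c → u ∈₃ (a , b , c) → v ∈₃ (a , b , c) → ∃[ w ] (w ∈₃ (a , b , c) × w ≢ u × w ≢ v)
      go a≢b a≢c b≢c (inj₁ refl) (inj₁ refl) = contradiction refl u≢v
      go a≢b a≢c b≢c (inj₁ refl) (inj₂ (inj₁ refl)) = c , inj₂ (inj₂ refl) , a≢c ∘ sym , b≢c ∘ sym
      go a≢b a≢c b≢c (inj₁ refl) (inj₂ (inj₂ refl)) = b , inj₂ (inj₁ refl) , a≢b ∘ sym , b≢c
      go a≢b a≢c b≢c (inj₂ (inj₁ refl)) (inj₁ refl) = c , inj₂ (inj₂ refl) , b≢c ∘ sym , a≢c ∘ sym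
      go a≢b a≢c b≢c (inj₂ (inj₁ refl)) (inj₂ (inj₁ refl)) = contradiction refl u≢v
      go a≢b a≢c b≢c (inj₂ (inj₁ refl)) (inj₂ (inj₂ refl)) = a , inj₁ refl , a≢b , a≢c
      go a≢b a≢c b≢c (inj₂ (inj₂ refl)) (inj₁ refl) = b , inj₂ (inj₁ refl) , b≢c , a≢b ∘ sym
      go a≢b a≢c b≢c (inj₂ (inj₂ refl)) (inj₂ (inj₁ refl)) = a , inj₁ refl , a≢c , a≢b
      go a≢b a≢c b≢c (inj₂ (inj₂ refl)) (inj₂ (inj₂ refl)) = contradiction refl u≢v

  Γ Shadow : Fin n → Fin n → ℚ
  Γ u v = 𝟙 (heavy? u v)
  Shadow u v = 𝟙 (any? (has? u v) E)

  ∑Shadow : ∑∑ Shadow ≤ ι 6 * ι (∣E∣ Hy)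
  ∑Shadow = ℚₚ.≤-trans (∑∑-mono shadow-≤) (ℚₚ.≤-reflexive (trans
      (trans (∑ˡ-cong Vs λ u _ → ∑ˡ-swap Vs E (λ v e → 𝟙 (has? u v e))) (∑ˡ-swap Vs E (λ u e → ∑ˡ Vs (λ v → 𝟙 (has? u v e)))))
      (trans (∑ˡ-cong E λ e e∈ → has-sum e∈) (trans (∑ˡ-const E (ι 6)) (ℚₚ.*-comm (ι (length E)) (ι 6))))))
    where
    shadow-≤ : ∀ u v → Shadow u v ≤ ∑ˡ E (λ e → 𝟙 (has? u v e))
    shadow-≤ u v with any? (has? u v) E
    ... | no _ = ∑ˡ-nonNeg E λ e → 𝟙-nonNeg (has? u v e)
    ... | yes found = let e , e∈ , h = find∈ found in
          ℚₚ.≤-trans (ℚₚ.≤-reflexive (sym (𝟙-yes (has? u v e) h))) (term≤∑ˡ (λ e → 𝟙 (has? u v e)) (λ e → 𝟙-nonNeg (has? u v e)) e∈)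

  -- Two common neighbours force a triple through u and v by `shadow`, so `Shadow` bounds the
  -- excess; three are excluded by `three-common`.
  Γ-bound : ∑∑ Γ * ∑∑ Γ ≤ ι n * (ι n * ι n + ∑∑ Shadow + ∑∑ Γ)
  Γ-bound = edge-bound Γ Shadow (λ w u → 𝟙² (heavy? w u)) (λ u v → 𝟙-nonNeg (any? (has? u v) E)) λ u v u≢v →
      subst (_≤ 1ℚ + Shadow u v) (∑ˡ-cong Vs λ w _ → 𝟙-× (heavy? w u) (heavy? w v)) (few u v u≢v)
    where
    few : ∀ u v → u ≢ v → ∑ˡ Vs (λ w → 𝟙 (heavy? w u ×-dec heavy? w v)) ≤ 1ℚ + Shadow u v
    few u v u≢v = [ (λ ≤1 → (certify [] (∑ˡ Vs (λ w → 𝟙 (heavy? w u ×-dec heavy? w v)) ∷ Shadow u v ∷ []) 0 (1 ✕ χ 0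
        ⊑ # 1 ∶ ≤1 ∷ 1 ✕ # 0 ⊑ χ 1 ∶ 𝟙-nonNeg (any? (has? u v) E) ∷ []) (χ 0 ⊑ # 1 :+ χ 1))) , two ]′ (count-1 (λ w → heavy? w u ×-dec heavy? w v) Vs (Uniqueₚ.allFin⁺ n))
      where
      two : (∃[ x ] ∃[ y ] (x ∈ Vs × y ∈ Vs × x ≢ y × (Heavy x u × Heavy x v) × (Heavy y u × Heavy y v))) → ∑ˡ Vs (λ w → 𝟙 (heavy? w u ×-dec heavy? w v)) ≤ 1ℚ + Shadow u v
      two (x , y , _ , _ , x≢y , (xu , xv) , (yu , yv)) = [ (λ ≤2 → (certify [] (∑ˡ Vs (λ w → 𝟙 (heavy? w u ×-dec
          heavy? w v)) ∷ Shadow u v ∷ []) 0 (1 ✕ χ 0 ⊑ # 2 ∶ ≤2 ∷ 1 ✕ # 1 ≐ χ 1 ∶ sym (one) ∷ []) (χ 0 ⊑ # 1 :+ χ 1)))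
          , (λ (a , b , c , _ , _ , _ , a≢b , a≢c , b≢c , (au , av) , (bu , bv) , (cu , cv)) → ⊥-elim (three-common u≢v a≢b a≢c b≢c au av bu bv cu cv)) ]′
          (count-2 (λ w → heavy? w u ×-dec heavy? w v) Vs (Uniqueₚ.allFin⁺ n))
        where
        one : Shadow u v ≡ 1ℚ
        one = let e , e∈ , h = shadow u≢v x≢y xu xv yu yv in 𝟙-yes (any? (has? u v) E) (lose e∈ h)

  choose : ∀ {P Q R A : Set} → Dec P → Dec Q → Dec R → A → A → A → Maybe A
  choose (no _) _ _ x y z = just x
  choose (yes _) (no _) _ x y z = just y
  choose (yes _) (yes _) (no _) x y z = just z
  choose (yes _) (yes _) (yes _) x y z = nothing

  -- A pair of the triple contained in no other edge, if there is one.
  pick : Triple n → Maybe (Fin n × Fin n)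
  pick (a , b , c) = choose (heavy? a b) (heavy? a c) (heavy? b c) (a , b) (a , c) (b , c)

  PickSpec : Triple n → Maybe (Fin n × Fin n) → Set
  PickSpec e (just (x , y)) = Has x y e × ¬ Heavy x y
  PickSpec e nothing = ∀ {x y} → Has x y e → Heavy x y

  pick-spec : ∀ {e} → e ∈ E → PickSpec e (pick e)
  pick-spec {a , b , c} e∈ = let a≢b , a≢c , b≢c = distinct e∈ in go a≢b a≢c b≢c (heavy? a b) (heavy? a c) (heavy? b c)
    where
    go : a ≢ b → a ≢ c → b ≢ c → (p : Dec (Heavy a b)) (q : Dec (Heavy a c)) (r : Dec (Heavy b c)) → PickSpec (a , b , c) (choose p q r (a , b) (a , c) (b , c))
    go a≢b a≢c b≢c (no ¬h) _ _ = (a≢b , inj₁ refl , inj₂ (inj₁ refl)) , ¬h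
    go a≢b a≢c b≢c (yes _) (no ¬h) _ = (a≢c , inj₁ refl , inj₂ (inj₂ refl)) , ¬h
    go a≢b a≢c b≢c (yes _) (yes _) (no ¬h) = (b≢c , inj₂ (inj₁ refl) , inj₂ (inj₂ refl)) , ¬h
    go a≢b a≢c b≢c (yes ab) (yes ac) (yes bc) = λ
      { (x≢y , inj₁ refl , inj₁ refl) → contradiction refl x≢y
      ; (_ , inj₁ refl , inj₂ (inj₁ refl)) → ab
      ; (_ , inj₁ refl , inj₂ (inj₂ refl)) → ac
      ; (_ , inj₂ (inj₁ refl) , inj₁ refl) → Heavy-sym ab
      ; (x≢y , inj₂ (inj₁ refl) , inj₂ (inj₁ refl)) → contradiction refl x≢y
      ; (_ , inj₂ (inj₁ refl) , inj₂ (inj₂ refl)) → bc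
      ; (_ , inj₂ (inj₂ refl) , inj₁ refl) → Heavy-sym ac
      ; (_ , inj₂ (inj₂ refl) , inj₂ (inj₁ refl)) → Heavy-sym bc
      ; (x≢y , inj₂ (inj₂ refl) , inj₂ (inj₂ refl)) → contradiction refl x≢y }

  Ends : Maybe (Fin n × Fin n) → Fin n → Fin n → Set
  Ends (just (x , y)) u v = (u ≡ x × v ≡ y) ⊎ (u ≡ y × v ≡ x)
  Ends nothing u v = ⊥

  ends? : ∀ m u v → Dec (Ends m u v)
  ends? (just (x , y)) u v = ((u Fin.≟ x) ×-dec (v Fin.≟ y)) ⊎-dec ((u Fin.≟ y) ×-dec (v Fin.≟ x))
  ends? nothing u v = no λ ()

  Ends-sym : ∀ m {u v} → Ends m u v → Ends m v u
  Ends-sym (just _) (inj₁ (p , q)) = inj₂ (q , p)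
  Ends-sym (just _) (inj₂ (p , q)) = inj₁ (q , p)

  Ends-unique : ∀ m {u v w} → Ends m u v → Ends m v w → u ≡ w
  Ends-unique (just _) (inj₁ (refl , refl)) (inj₁ (refl , refl)) = refl
  Ends-unique (just _) (inj₁ (refl , refl)) (inj₂ (refl , refl)) = refl
  Ends-unique (just _) (inj₂ (refl , refl)) (inj₁ (refl , refl)) = refl
  Ends-unique (just _) (inj₂ (refl , refl)) (inj₂ (refl , refl)) = refl

  ends-light : ∀ {e u v} → e ∈ E → Ends (pick e) u v → Has u v e × ¬ Heavy u v
  ends-light {e} e∈ ends = go (pick e) (pick-spec e∈) ends
    where
    go : ∀ m → PickSpec e m → ∀ {u v} → Ends m u v → Has u v e × ¬ Heavy u v
    go (just _) spec (inj₁ (refl , refl)) = spec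
    go (just _) (h , ¬h) (inj₂ (refl , refl)) = Has-sym {e = e} h , ¬h ∘ Heavy-sym

  record Picked (u v : Fin n) : Set where
    constructor picked
    field
      {e} : Triple n
      e∈ : e ∈ E
      ends : Ends (pick e) u v

  Picked-sym : ∀ {u v} → Picked u v → Picked v u
  Picked-sym (picked {e} e∈ p) = picked e∈ (Ends-sym (pick e) p)

  picked? : ∀ u v → Dec (Picked u v)
  picked? u v with any? (λ e → ends? (pick e) u v) E
  ... | yes found = let e , e∈ , p = find∈ found in yes (picked e∈ p)
  ... | no none = no λ (picked e∈ p) → none (lose e∈ p)

  -- If the triple that picked a b contained c, it would contain the light pair b c and so be the
  -- triple that picked b c as well; but a triple picks only one pair. Likewise for d and the pair a
  -- d.
  picked-ok : ∀ {a b c d} → a ≢ c → b ≢ d → Picked a b → Picked b c → Picked a d → Ok a b c d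
  picked-ok {a} {b} {c} {d} a≢c b≢d (picked {e} e∈ ab) (picked {f} f∈ bc) (picked {g} g∈ ad) = [ id , refute ]′ (ok? a b c d)
    where
    refute : AllIn a b c d → Ok a b c d
    refute all with ends-light e∈ ab | ends-light f∈ bc | ends-light g∈ ad
    ... | (a≢b , a∈ , b∈) , _ | (b≢c , k) , ¬bc | (a≢d , l) , ¬ad with all e∈ a∈ b∈
    ...   | inj₁ c∈ = contradiction (Ends-unique (pick e) ab (subst (λ t → Ends (pick t) b c) (sym (light-unique ¬bc e∈ f∈ (b≢c , b∈ , c∈) (b≢c , k))) bc)) a≢c
    ...   | inj₂ d∈ = contradiction (Ends-unique (pick e) (Ends-sym (pick e) ab) (subst (λ t → Ends (pick t) a d) (sym (light-unique ¬ad e∈ g∈ (a≢d , a∈ , d∈) (a≢d , l))) ad)) b≢d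

  picked-≢ : ∀ {u v} → Picked u v → u ≢ v
  picked-≢ (picked e∈ p) = proj₁ (proj₁ (ends-light e∈ p))

  picked-C₄-free : ∀ {u v x y} → u ≢ v → x ≢ y → Picked x u → Picked x v → Picked y u → Picked y v → ⊥
  picked-C₄-free u≢v x≢y xu xv yu yv =
    no-cycle (picked-≢ xu ∘ sym) u≢v (picked-≢ yu ∘ sym) (picked-≢ xv) x≢y (picked-≢ yv ∘ sym)
      (picked-ok u≢v x≢y ux xv uy) (picked-ok x≢y (u≢v ∘ sym) xv vy xu)
      (picked-ok (u≢v ∘ sym) (x≢y ∘ sym) vy yu vx) (swap (picked-ok u≢v (x≢y ∘ sym) uy yv ux))
    where
    ux = Picked-sym xu
    uy = Picked-sym yu
    vx = Picked-sym xv
    vy = Picked-sym yv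
    swap : ∀ {a b c d} → Ok a b c d → Ok a b d c
    swap (ok e∈ p q r s) = ok e∈ p q s r

  Π : Fin n → Fin n → ℚ
  Π u v = 𝟙 (picked? u v)

  Π-bound : ∑∑ Π * ∑∑ Π ≤ ι n * (ι n * ι n + ∑∑ (λ _ _ → 0ℚ) + ∑∑ Π)
  Π-bound = edge-bound Π (λ _ _ → 0ℚ) (λ w u → 𝟙² (picked? w u)) (λ _ _ → ℚₚ.≤-refl) λ u v u≢v →
      subst (_≤ 1ℚ + 0ℚ) (∑ˡ-cong Vs λ w _ → 𝟙-× (picked? w u) (picked? w v))
        ([ id , (λ (x , y , _ , _ , x≢y , (xu , xv) , (yu , yv)) → ⊥-elim (picked-C₄-free u≢v x≢y xu xv yu yv)) ]′
          (count-1 (λ w → picked? w u ×-dec picked? w v) Vs (Uniqueₚ.allFin⁺ n)))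

  private
    per-pair : ∀ u v → ∑ˡ E (λ e → 𝟙 (ends? (pick e) u v)) ≤ Π u v
    per-pair u v with picked? u v
    ... | yes _ = [ id , (λ (e , f , e∈ , f∈ , e≢f , p , q) → contradiction
          (let h , ¬h = ends-light e∈ p ; k , _ = ends-light f∈ q in light-unique ¬h e∈ f∈ h k) e≢f) ]′ (count-1 (λ e → ends? (pick e) u v) E E-unique)
    ... | no none = [ id , (λ (e , e∈ , p) → contradiction (picked e∈ p) none) ]′ (count-0 (λ e → ends? (pick e) u v) E)

    ends-sum : ∀ x y → x ≢ y → ∑∑ (λ u v → 𝟙 (ends? (just (x , y)) u v)) ≡ ι 2
    ends-sum x y x≢y = trans
      (∑ˡ-cong Vs λ u _ → trans (∑ˡ-cong Vs λ v _ → trans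
          (𝟙-⊎ ((u Fin.≟ x) ×-dec (v Fin.≟ y)) ((u Fin.≟ y) ×-dec (v Fin.≟ x)) λ { ((refl , _) , (e , _)) → x≢y e })
          (cong₂ _+_ (𝟙-× (u Fin.≟ x) (v Fin.≟ y)) (𝟙-× (u Fin.≟ y) (v Fin.≟ x))))
        (trans (∑ˡ-+ Vs (λ v → 𝟙 (u Fin.≟ x) * 𝟙 (v Fin.≟ y)) (λ v → 𝟙 (u Fin.≟ y) * 𝟙 (v Fin.≟ x)))
          (cong₂ _+_ (single (𝟙 (u Fin.≟ x)) y) (single (𝟙 (u Fin.≟ y)) x))))
      (trans (∑ˡ-+ Vs (λ u → 𝟙 (u Fin.≟ x)) (λ u → 𝟙 (u Fin.≟ y))) (trans (cong₂ _+_ (∑-≟ x) (∑-≟ y)) refl))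
      where
      single : ∀ c y → ∑ˡ Vs (λ v → c * 𝟙 (v Fin.≟ y)) ≡ c
      single c y = trans (∑ˡ-*ˡ Vs c (λ v → 𝟙 (v Fin.≟ y))) (trans (cong (c *_) (∑-≟ y)) (ℚₚ.*-identityʳ c))

  IsNothing : Maybe (Fin n × Fin n) → Set
  IsNothing (just _) = ⊥
  IsNothing nothing = ⊤

  nothing? : ∀ m → Dec (IsNothing m)
  nothing? (just _) = no λ ()
  nothing? nothing = yes tt

  -- The pair u v belongs to the triple e, all of whose pairs are heavy.
  fullHas? : ∀ e u v → Dec (IsNothing (pick e) × Has u v e)
  fullHas? e u v = nothing? (pick e) ×-dec has? u v e

  private
    all-heavy : ∀ {e} → e ∈ E → IsNothing (pick e) → ∀ {x y} → Has x y e → Heavy x y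
    all-heavy {e} e∈ none = go (pick e) (pick-spec e∈) none
      where go : ∀ m → PickSpec e m → IsNothing m → ∀ {x y} → Has x y e → Heavy x y
            go nothing spec _ = spec

    -- The third vertices of such triples are distinct common neighbours of u and v in the heavy
    -- graph, and `three-common` forbids three.
    per-heavy : ∀ u v → ∑ˡ E (λ e → 𝟙 (fullHas? e u v)) ≤ ι 2 * Γ u v
    per-heavy u v with heavy? u v
    ... | no ¬h = [ id , (λ (e , e∈ , none , h) → contradiction (all-heavy e∈ none h) ¬h) ]′ (count-0 (λ e → fullHas? e u v) E)
    ... | yes _ = [ id , three ]′ (count-2 (λ e → fullHas? e u v) E E-unique)
      where
      third-≢ : ∀ {e f w w′} → e ∈ E → f ∈ E → e ≢ f → Has u v e → Has u v f → w ∈₃ e → w ≢ u → w ≢ v → w′ ∈₃ f → w ≢ w′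
      third-≢ {e} {f} e∈ f∈ e≢f (u≢v , ue , ve) (_ , uf , vf) we w≢u w≢v w′f refl =
        e≢f (sorted-≡₃ {e = e} {f} (sortedE e∈) (sortedE f∈) u≢v (w≢u ∘ sym) (w≢v ∘ sym) ue ve we uf vf w′f)
      three : (∃[ x ] ∃[ y ] ∃[ z ] (x ∈ E × y ∈ E × z ∈ E × x ≢ y × x ≢ z × y ≢ z ×
          (IsNothing (pick x) × Has u v x) × (IsNothing (pick y) × Has u v y) × (IsNothing (pick z) × Has u v z))) → _
      three (x , y , z , x∈ , y∈ , z∈ , x≢y , x≢z , y≢z , (nx , hx) , (ny , hy) , (nz , hz)) =
        let a , ax , a≢u , a≢v = third x∈ hx
            b , by , b≢u , b≢v = third y∈ hy
            c , cz , c≢u , c≢v = third z∈ hz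
            u≢v , ux , vx = hx
            _ , uy , vy = hy
            _ , uz , vz = hz
        in ⊥-elim (three-common u≢v (third-≢ x∈ y∈ x≢y hx hy ax a≢u a≢v by) (third-≢ x∈ z∈ x≢z hx hz ax a≢u a≢v cz) (third-≢ y∈ z∈ y≢z hy hz by b≢u b≢v cz)
            (all-heavy x∈ nx (a≢u , ax , ux)) (all-heavy x∈ nx (a≢v , ax , vx))
            (all-heavy y∈ ny (b≢u , by , uy)) (all-heavy y∈ ny (b≢v , by , vy))
            (all-heavy z∈ nz (c≢u , cz , uz)) (all-heavy z∈ nz (c≢v , cz , vz)))

    ends∑ full∑ : Triple n → ℚ
    ends∑ e = ∑∑ (λ u v → 𝟙 (ends? (pick e) u v))
    full∑ e = ∑∑ (λ u v → 𝟙 (fullHas? e u v))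

    exchange : ∀ (f : Triple n → Fin n → Fin n → ℚ) → ∑ˡ E (λ e → ∑∑ (f e)) ≡ ∑∑ (λ u v → ∑ˡ E (λ e → f e u v))
    exchange f = trans (∑ˡ-swap E Vs (λ e u → ∑ˡ Vs (f e u))) (∑ˡ-cong Vs λ u _ → ∑ˡ-swap E Vs (λ e v → f e u v))

    -- A triple that picks a pair is seen by two ordered pairs in `ends∑`, any other by all six in
    -- `full∑`; the weight 3 balances the cases.
    each-edge : ∀ e → e ∈ E → ι 6 ≤ ι 3 * ends∑ e + full∑ e
    each-edge e e∈ = go (pick e) (pick-spec e∈)
      where
      go : ∀ m → PickSpec e m → ι 6 ≤ ι 3 * ∑∑ (λ u v → 𝟙 (ends? m u v)) + ∑∑ (λ u v → 𝟙 (nothing? m ×-dec has? u v e))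
      go m@(just (x , y)) ((x≢y , _) , _) = certify [] (∑∑ (λ u v → 𝟙 (ends? m u v)) ∷ ∑∑ (λ u v → 𝟙 (nothing? m
          ×-dec has? u v e)) ∷ []) 0 (3 ✕ # 2 ≐ χ 0 ∶ sym (ends-sum x y x≢y) ∷ 1 ✕ # 0 ⊑ χ 1 ∶ ∑ˡ-nonNeg Vs (λ u →
          ∑ˡ-nonNeg Vs λ v → 𝟙-nonNeg (nothing? m ×-dec has? u v e)) ∷ []) (# 6 ⊑ # 3 :* χ 0 :+ χ 1)
      go nothing _ = certify [] (∑∑ (λ u v → 𝟙 (nothing? nothing ×-dec has? u v e)) ∷ ∑∑ (λ u v → 𝟙 (ends? nothing u
          v)) ∷ []) 0 (1 ✕ # 6 ≐ χ 0 ∶ sym (trans (∑ˡ-cong Vs λ u _ → ∑ˡ-cong Vs λ v _ → 𝟙-iff (nothing? nothing ×-dec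
          has? u v e) (has? u v e) proj₂ (tt ,_)) (has-sum e∈)) ∷ 3 ✕ # 0 ⊑ χ 1 ∶ ∑ˡ-nonNeg Vs (λ u → ∑ˡ-nonNeg Vs λ v
          → 𝟙-nonNeg (ends? nothing u v)) ∷ []) (# 6 ⊑ # 3 :* χ 1 :+ χ 0)

  -- Origin of 5/6: both sums are near n^{3/2} at most, so the triples with a light pair give 3/6
  -- and the others, with three heavy pairs each lying in at most two of them, give 2/6.
  edges-≤ : ι 6 * ι (∣E∣ Hy) ≤ ι 3 * ∑∑ Π + ι 2 * ∑∑ Γ
  edges-≤ = certify (∣E∣ Hy ∷ []) (∑ˡ E (λ _ → ι 6) ∷ ∑ˡ E (λ e → ι 3 * ends∑ e + full∑ e) ∷ ∑ˡ E (λ e → ι 3 * ends∑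
      e) ∷ ∑ˡ E full∑ ∷ ∑ˡ E ends∑ ∷ ∑∑ (λ u v → ∑ˡ E (λ e → 𝟙 (ends? (pick e) u v))) ∷ ∑∑ (λ u v → ∑ˡ E (λ e → 𝟙
      (fullHas? e u v))) ∷ ∑∑ Π ∷ ∑∑ (λ u v → ι 2 * Γ u v) ∷ ∑∑ Γ ∷ []) 0 (1 ✕ χ 0 ⊑ χ 1 ∶ ∑ˡ-mono E each-edge ∷ 1 ✕ ν
      0 :* # 6 ≐ χ 0 ∶ sym (∑ˡ-const E (ι 6)) ∷ 1 ✕ χ 1 ≐ χ 2 :+ χ 3 ∶ ∑ˡ-+ E (λ e → ι 3 * ends∑ e) full∑ ∷ 1 ✕ χ 2 ≐
      # 3 :* χ 4 ∶ ∑ˡ-*ˡ E (ι 3) ends∑ ∷ 3 ✕ χ 4 ≐ χ 5 ∶ exchange (λ e u v → 𝟙 (ends? (pick e) u v)) ∷ 1 ✕ χ 3 ≐ χ 6 ∶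
      exchange (λ e u v → 𝟙 (fullHas? e u v)) ∷ 3 ✕ χ 5 ⊑ χ 7 ∶ ∑∑-mono per-pair ∷ 1 ✕ χ 6 ⊑ χ 8 ∶ ∑∑-mono per-heavy ∷
      1 ✕ χ 8 ≐ # 2 :* χ 9 ∶ trans (∑ˡ-cong Vs λ u _ → ∑ˡ-*ˡ Vs (ι 2) (Γ u)) (∑ˡ-*ˡ Vs (ι 2) (λ u → ∑ˡ Vs (Γ u))) ∷
      []) (# 6 :* ν 0 ⊑ # 3 :* χ 7 :+ # 2 :* χ 9)

  private
    ∑∑-≤n² : ∀ {f} → (∀ u v → f u v ≤ 1ℚ) → ∑∑ f ≤ ι n * ι n
    ∑∑-≤n² {f} h = ℚₚ.≤-trans (∑∑-mono h) (ℚₚ.≤-reflexive (trans (∑ˡ-cong Vs λ u _ → trans (∑ˡ-const Vs 1ℚ) (trans (ℚₚ.*-identityʳ (ι (length Vs))) (cong ι ∣Vs∣)))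
      (trans (∑ˡ-const Vs (ι n)) (cong (λ t → ι t * ι n) ∣Vs∣))))

    zeros : ∑∑ (λ _ _ → 0ℚ) ≡ 0ℚ
    zeros = trans (∑ˡ-cong Vs λ u _ → trans (∑ˡ-const Vs 0ℚ) (ℚₚ.*-zeroʳ (ι (length Vs)))) (trans (∑ˡ-const Vs 0ℚ) (ℚₚ.*-zeroʳ (ι (length Vs))))

    0≤∑∑𝟙 : ∀ {P : Fin n → Fin n → Set} (d : ∀ u v → Dec (P u v)) → 0ℚ ≤ ∑∑ (λ u v → 𝟙 (d u v))
    0≤∑∑𝟙 d = ∑ˡ-nonNeg Vs λ u → ∑ˡ-nonNeg Vs λ v → 𝟙-nonNeg (d u v)

  -- s is the larger of the two sums. The `Shadow` term of `Γ-bound` is at most 6 |E| ≤ 5 s when Γ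
  -- is the larger one, so after the factor n it is of lower order than n³.
  summary : ∃[ s ] (0ℚ ≤ s × s ≤ ι n * ι n × s * s ≤ ι n * (ι n * ι n + ι 6 * s) × ι 6 * ι (∣E∣ Hy) ≤ ι 5 * s)
  summary = [ gamma , pi ]′ (ℚₚ.≤-total p g)
    where
    p g : ℚ
    p = ∑∑ Π
    g = ∑∑ Γ
    0≤p = 0≤∑∑𝟙 picked?
    0≤g = 0≤∑∑𝟙 heavy?
    gamma : p ≤ g → ∃[ s ] (0ℚ ≤ s × s ≤ ι n * ι n × s * s ≤ ι n * (ι n * ι n + ι 6 * s) × ι 6 * ι (∣E∣ Hy) ≤ ι 5 * s)
    gamma p≤g = g , 0≤g , ∑∑-≤n² (λ u v → 𝟙-≤1 (heavy? u v)) ,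
      (certify (n ∷ []) (g ∷ ∑∑ Shadow ∷ []) 0 (1 ✕ χ 0 :* χ 0 ⊑ ν 0 :* (ν 0 :* ν 0 :+ χ 1 :+ χ 0) ∶ Γ-bound ∷ 1 ✕ ν
          0 :* χ 1 ⊑ ν 0 :* (# 5 :* χ 0) ∶ *-monoˡ (ι n) (0≤ι n) S≤ ∷ []) (χ 0 :* χ 0 ⊑ ν 0 :* (ν 0 :* ν 0 :+ # 6 :* χ
          0))) , E≤
      where
      E≤ : ι 6 * ι (∣E∣ Hy) ≤ ι 5 * g
      E≤ = certify (∣E∣ Hy ∷ []) (p ∷ g ∷ []) 0 (1 ✕ # 6 :* ν 0 ⊑ # 3 :* χ 0 :+ # 2 :* χ 1 ∶ edges-≤ ∷ 3 ✕ χ 0 ⊑ χ 1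
          ∶ p≤g ∷ []) (# 6 :* ν 0 ⊑ # 5 :* χ 1)
      S≤ : ∑∑ Shadow ≤ ι 5 * g
      S≤ = ℚₚ.≤-trans ∑Shadow E≤
    pi : g ≤ p → ∃[ s ] (0ℚ ≤ s × s ≤ ι n * ι n × s * s ≤ ι n * (ι n * ι n + ι 6 * s) × ι 6 * ι (∣E∣ Hy) ≤ ι 5 * s)
    pi g≤p = p , 0≤p , ∑∑-≤n² (λ u v → 𝟙-≤1 (picked? u v)) ,
      (certify (n ∷ []) (p ∷ ∑∑ (λ _ _ → 0ℚ) ∷ []) 0 (1 ✕ χ 0 :* χ 0 ⊑ ν 0 :* (ν 0 :* ν 0 :+ χ 1 :+ χ 0) ∶ Π-bound ∷
          1 ✕ ν 0 :* χ 1 ≐ ν 0 :* # 0 ∶ cong (ι n *_) zeros ∷ 5 ✕ # 0 ⊑ ν 0 :* χ 0 ∶ *-nonNeg (0≤ι n) 0≤p ∷ []) (χ 0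
          :* χ 0 ⊑ ν 0 :* (ν 0 :* ν 0 :+ # 6 :* χ 0))) ,
      (certify (∣E∣ Hy ∷ []) (p ∷ g ∷ []) 0 (1 ✕ # 6 :* ν 0 ⊑ # 3 :* χ 0 :+ # 2 :* χ 1 ∶ edges-≤ ∷ 2 ✕ χ 1 ⊑ χ 0 ∶
          g≤p ∷ []) (# 6 :* ν 0 ⊑ # 5 :* χ 0))

-- Asymptotics

ιᶻ-numerator : ∀ p → ιᶻ (ℚ.↥ p) ≡ p * ι (ℚ.↧ₙ p)
ιᶻ-numerator p@(mkℚ z d _) = ℚₚ.toℚᵘ-injective (ℚᵘₚ.≃-trans (ℚₚ.toℚᵘ-fromℚᵘ (ℚᵘ.mkℚᵘ z 0))
  (ℚᵘₚ.≃-sym (ℚᵘₚ.≃-trans (ℚₚ.toℚᵘ-homo-* p (ι (suc d))) (ℚᵘₚ.≃-trans (ℚᵘₚ.*-congˡ {ℚᵘ.mkℚᵘ z d} (ℚₚ.toℚᵘ-fromℚᵘ (ℚᵘ.mkℚᵘ (+ suc d) 0)))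
    (ℚᵘ.*≡* (trans (ℤₚ.*-identityʳ (z ℤ.* + suc d)) (cong (λ t → z ℤ.* + t) (sym (ℕₚ.*-identityʳ (suc d))))))))))

-- k is the denominator of ε, so k ε is its numerator, a positive integer.
archimedean : ∀ ε → 0ℚ < ε → ∃[ k ] (1 ≤ₙ k × 1ℚ ≤ ι k * ε)
archimedean ε 0<ε = ℚ.↧ₙ ε , s≤s z≤n , subst (1ℚ ≤_) (trans (ιᶻ-numerator ε) (ℚₚ.*-comm ε (ι (ℚ.↧ₙ ε))))
  (ιᶻ-mono {+ 1} {ℚ.↥ ε} (ℤₚ.i<j⇒suc[i]≤j (ℤₚ.≰⇒> λ z≤0 → ℚₚ.<-irrefl refl (ℚₚ.<-≤-trans positive (ιᶻ-mono {ℚ.↥ ε} {+ 0} z≤0)))))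
  where
  positive : 0ℚ < ιᶻ (ℚ.↥ ε)
  positive = subst (0ℚ <_) (sym (ιᶻ-numerator ε)) (subst (_< ε * ι (ℚ.↧ₙ ε)) (ℚₚ.*-zeroʳ ε)
    (ℚₚ.*-monoʳ-<-pos ε {{ℚ.positive 0<ε}} {0ℚ} {ι (ℚ.↧ₙ ε)} (certify (ℚ.↧ₙ ε ∷ []) [] 0 (1 ✕ # 1 ⊑ₙ ν 0 ∶ s≤s z≤n ∷
        []) (# 0 ⊏ ν 0))))

square-cancel : ∀ {a b} → 0ℚ ≤ b → a * a ≤ b * b → a ≤ b
square-cancel {a} {b} 0≤b h = ℚₚ.≮⇒≥ λ b<a → ℚₚ.<-irrefl refl (ℚₚ.≤-<-trans h (ℚₚ.≤-<-trans (*-monoˡ b 0≤b (ℚₚ.<⇒≤ b<a))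
  (ℚₚ.*-monoˡ-<-pos a {{ℚ.positive (ℚₚ.≤-<-trans 0≤b b<a)}} b<a)))

ι-cube : ∀ n → ι (n ^ 3) ≡ ι n * ι n * ι n
ι-cube n = certify (n ^ 3 ∷ n ∷ []) [] 0 (1 ✕ ν 0 ≐ ⌜ ν 1 :* ν 1 :* ν 1 ⌝ ∶ cong ι (⟨cube⟩ n) ∷ []) (ν 0 ≐ ν 1 :* ν 1
    :* ν 1)
  where
  ⟨cube⟩ : ∀ n → n ^ 3 ≡ n *ₙ n *ₙ n
  ⟨cube⟩ n = certify (n ∷ []) [] 0 [] (ν 0 :* (ν 0 :* (ν 0 :* # 1)) ≐ₙ ν 0 :* ν 0 :* ν 0)

upper : ∀ {n k} (ε : ℚ) → 0ℚ < ε → 1ℚ ≤ ι k * ε → 44 *ₙ (k *ₙ k) ≤ₙ n → (Hy : Hyp3 n) → ¬ ContainsTrace C4 Hy →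
  ι (∣E∣ Hy) * ι (∣E∣ Hy) ≤ ((+ 5 / 6) + ε) * ((+ 5 / 6) + ε) * ι (n ^ 3)
upper {n} {k} ε 0<ε 1≤kε large Hy free = conclude (EdgeCount.summary Hy free)
  where
  E = ι (∣E∣ Hy)
  c : ℚ
  c = + 5 / 6
  6c : ι 6 * c ≡ ι 5
  6c = refl
  n³ : ℚ
  n³ = ι n * ι n * ι n
  0≤n³ : 0ℚ ≤ n³
  0≤n³ = *-nonNeg (*-nonNeg (0≤ι n) (0≤ι n)) (0≤ι n)
  0≤ε = ℚₚ.<⇒≤ 0<ε
  conclude : (∃[ s ] (0ℚ ≤ s × s ≤ ι n * ι n × s * s ≤ ι n * (ι n * ι n + ι 6 * s) × ι 6 * E ≤ ι 5 * s)) → E * E ≤ (c + ε) * (c + ε) * ι (n ^ 3)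
  conclude (s , 0≤s , s≤n² , s² , E≤s) = subst (λ t → E * E ≤ (c + ε) * (c + ε) * t) (sym (ι-cube n))
    (certify (∣E∣ Hy ∷ n ∷ []) (s ∷ ε ∷ c ∷ []) 35 (1 ✕ # 6 :* ν 0 :* (# 6 :* ν 0) ⊑ # 5 :* χ 0 :* (# 5 :* χ 0) ∶
        *-mono-nonNeg (certify (∣E∣ Hy ∷ []) [] 0 [] (# 0 ⊑ # 6 :* ν 0)) E≤s E≤s (certify [] (s ∷ []) 0 (5 ✕ # 0 ⊑ χ 0
        ∶ 0≤s ∷ []) (# 0 ⊑ # 5 :* χ 0)) ∷ 25 ✕ χ 0 :* χ 0 ⊑ ν 1 :* (ν 1 :* ν 1 :+ # 6 :* χ 0) ∶ s² ∷ 30 ✕ ν 1 :* (# 5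
        :* χ 0) ⊑ ν 1 :* (# 2 :* χ 1 :* (ν 1 :* ν 1)) ∶ *-monoˡ (ι n) (0≤ι n) s-small ∷ 1 ✕ # 5 :* # 5 :* (ν 1 :* ν 1
        :* ν 1) ≐ # 6 :* χ 2 :* (# 6 :* χ 2) :* (ν 1 :* ν 1 :* ν 1) ∶ sym (cong (λ t → t * t * n³) 6c) ∷ 12 ✕ # 5 :*
        (χ 1 :* (ν 1 :* ν 1 :* ν 1)) ≐ # 6 :* χ 2 :* (χ 1 :* (ν 1 :* ν 1 :* ν 1)) ∶ sym (cong (λ t → t * (ε * n³)) 6c)
        ∷ 36 ✕ # 0 ⊑ χ 1 :* χ 1 :* (ν 1 :* ν 1 :* ν 1) ∶ *-nonNeg (*-nonNeg 0≤ε 0≤ε) 0≤n³ ∷ []) (ν 0 :* ν 0 ⊑ (χ 2 :+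
        χ 1) :* (χ 2 :+ χ 1) :* (ν 1 :* ν 1 :* ν 1)))
    where
    -- s ≤ n² turns the bound for s² into s² ≤ 7 n³, enough for an error term; 25 · 7 ≤ 4 · 44 is
    -- the origin of the threshold 44 k².
    5ks : ι 5 * ι k * s ≤ ι 2 * (ι n * ι n)
    5ks = square-cancel (certify (n ∷ []) [] 0 [] (# 0 ⊑ # 2 :* (ν 0 :* ν 0)))
      (certify (k ∷ n ∷ []) (s ∷ []) 0 (25 ✕ ν 0 :* ν 0 :* (χ 0 :* χ 0) ⊑ ν 0 :* ν 0 :* (ν 1 :* (# 7 :* (ν 1 :* ν
          1))) ∶ *-monoˡ (ι k * ι k) (*-nonNeg (0≤ι k) (0≤ι k)) (ℚₚ.≤-trans s² (*-monoˡ (ι n) (0≤ι n) (certify (n ∷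
          []) (s ∷ []) 0 (6 ✕ χ 0 ⊑ ν 0 :* ν 0 ∶ s≤n² ∷ []) (ν 0 :* ν 0 :+ # 6 :* χ 0 ⊑ # 7 :* (ν 0 :* ν 0))))) ∷ 4 ✕
          ν 1 :* ν 1 :* ν 1 :* ⌜ # 44 :* (ν 0 :* ν 0) ⌝ ⊑ ν 1 :* ν 1 :* ν 1 :* ν 1 ∶ *-monoˡ n³ 0≤n³ (ι-mono large) ∷
          []) (# 5 :* ν 0 :* χ 0 :* (# 5 :* ν 0 :* χ 0) ⊑ # 2 :* (ν 1 :* ν 1) :* (# 2 :* (ν 1 :* ν 1))))
    s-small : ι 5 * s ≤ ι 2 * ε * (ι n * ι n)
    s-small = certify (k ∷ n ∷ []) (ε ∷ s ∷ []) 0 (1 ✕ χ 0 :* (# 5 :* ν 0 :* χ 1) ⊑ χ 0 :* (# 2 :* (ν 1 :* ν 1)) ∶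
        *-monoˡ ε 0≤ε 5ks ∷ 5 ✕ χ 1 :* # 1 ⊑ χ 1 :* (ν 0 :* χ 0) ∶ *-monoˡ s 0≤s 1≤kε ∷ []) (# 5 :* χ 1 ⊑ # 2 :* χ 0
        :* (ν 1 :* ν 1))

lower : ∀ (ε : ℚ) {k} → 1 ≤ₙ k → 1ℚ ≤ ι k * ε → Σ ℕ λ N → ∀ n-1 → N ≤ₙ n-1 → Σ (Hyp3 (suc n-1)) λ Hy → ¬ ContainsTrace C4 Hy ×
  (((+ 1 / 2) - ε ≤ 0ℚ) ⊎ (((+ 1 / 2) - ε) * ((+ 1 / 2) - ε) * ι (suc n-1 ^ 3) ≤ ι (∣E∣ Hy) * ι (∣E∣ Hy)))
lower ε {k} 1≤k 1≤kε = R₀ *ₙ R₀ , build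
  where
  m c : ℕ
  m = 2 *ₙ k
  -- This is 4 k - 1; the prime found lies between (1 - 1 / (4 k)) r and r, where r is the integer
  -- square root of n - 1.
  c = 3 *ₙ k +ₙ (k ∸ₙ 1)
  c+1 : c +ₙ 1 ≡ 4 *ₙ k
  c+1 = certify (k ∸ₙ 1 ∷ k ∷ []) [] 0 (1 ✕ # 1 :+ ν 0 ≐ₙ ν 1 ∶ ℕₚ.m+[n∸m]≡n 1≤k ∷ []) (# 3 :* ν 1 :+ ν 0 :+ # 1 ≐ₙ #
      4 :* ν 1)
  1≤c : 1 ≤ₙ c
  1≤c = certify (k ∷ k ∸ₙ 1 ∷ []) [] 0 (3 ✕ # 1 ⊑ₙ ν 0 ∶ 1≤k ∷ []) (# 1 ⊑ₙ # 3 :* ν 0 :+ ν 1)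
  primes = prime-gap c 1≤c
  N₀ = proj₁ primes
  R₀ = 2 *ₙ N₀ +ₙ 8 *ₙ k
  a : ℚ
  a = (+ 1 / 2) - ε
  2a : ι 2 * ι k * a ≤ ι k - ι 2
  2a = certify (k ∷ []) (ε ∷ + 1 / 2 ∷ []) 0 (2 ✕ # 1 ⊑ ν 0 :* χ 0 ∶ 1≤kε ∷ 1 ✕ ν 0 :* (# 2 :* χ 1) ≐ ν 0 :* # 1 ∶
      cong (ι k *_) half ∷ []) (# 2 :* ν 0 :* (χ 1 :- χ 0) ⊑ ν 0 :- # 2)
    where half : ι 2 * (+ 1 / 2) ≡ 1ℚ
          half = refl
  build : ∀ n-1 → R₀ *ₙ R₀ ≤ₙ n-1 → Σ (Hyp3 (suc n-1)) λ Hy → ¬ ContainsTrace C4 Hy × ((a ≤ 0ℚ) ⊎ (a * a * ι (suc n-1 ^ 3) ≤ ι (∣E∣ Hy) * ι (∣E∣ Hy)))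
  build n-1 large = with-prime (proj₂ primes x N₀≤x)
    where
    sq = isqrt n-1
    r = proj₁ sq
    r²≤ = proj₁ (proj₂ sq)
    <r² = proj₂ (proj₂ sq)
    R₀≤r : R₀ ≤ₙ r
    R₀≤r = ℕₚ.≮⇒≥ λ r<R₀ → ℕₚ.<⇒≱ <r² (ℕₚ.≤-trans (ℕₚ.*-mono-≤ r<R₀ r<R₀) large)
    x = (c *ₙ r) ÷ (c +ₙ 1)
    1≤c+1 : 1 ≤ₙ c +ₙ 1
    1≤c+1 = ℕₚ.m≤n+m 1 c
    N₀≤x : N₀ ≤ₙ x
    N₀≤x = ÷-greatest 1≤c+1 (ℕₚ.≤-trans (certify (N₀ ∷ c ∷ k ∷ []) [] 0 (1 ✕ ν 0 :* # 1 ⊑ₙ ν 0 :* ν 1 ∶ ℕₚ.*-monoʳ-≤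
        N₀ 1≤c ∷ []) (ν 0 :* (ν 1 :+ # 1) ⊑ₙ ν 1 :* (# 2 :* ν 0 :+ # 8 :* ν 2))) (ℕₚ.*-monoʳ-≤ c R₀≤r))
    with-prime : ∃[ p ] (Prime p × x <ₙ p × c *ₙ p ≤ₙ (c +ₙ 1) *ₙ x) →
      Σ (Hyp3 (suc n-1)) λ Hy → ¬ ContainsTrace C4 Hy × ((a ≤ 0ℚ) ⊎ (a * a * ι (suc n-1 ^ 3) ≤ ι (∣E∣ Hy) * ι (∣E∣ Hy)))
    with-prime (zero , pr , _) = contradiction pr ¬prime[0]
    with-prime (p@(suc t) , pr , x<p , cp≤) = H₀ , trace-free , [ inj₁ , inj₂ ∘ dense ]′ (ℚₚ.≤-total a 0ℚ)
      where
      p≤r : p ≤ₙ r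
      p≤r = ℕₚ.*-cancelˡ-≤ c {{ℕ.>-nonZero 1≤c}} (ℕₚ.≤-trans cp≤ (subst (_≤ₙ c *ₙ r) (ℕₚ.*-comm x (c +ₙ 1)) (÷-lower (c *ₙ r) (c +ₙ 1))))
      open ErdősRényi p pr n-1 (ℕₚ.≤-trans (ℕₚ.*-mono-≤ p≤r p≤r) r²≤)
      E = ∣E∣ H₀
      u : ℕ
      u = suc r
      -- With p = t + 1, p³ - p² is t p², at least t³. Passing from p to t and from r to u weakens 1
      -- / (4 k) to 1 / (2 k), which r ≥ 8 k affords.
      t-large : m *ₙ u ≤ₙ m *ₙ t +ₙ u
      t-large = certify (c ∷ r ∷ x ∷ t ∷ k ∷ N₀ ∷ []) [] 1 (1 ✕ ν 0 :* ν 1 ⊏ₙ ν 2 :* (ν 0 :+ # 1) :+ (ν 0 :+ # 1) ∶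
          ÷-upper (c *ₙ r) (c +ₙ 1) 1≤c+1 ∷ 1 ✕ (# 1 :+ ν 2) :* (ν 0 :+ # 1) ⊑ₙ (# 1 :+ ν 3) :* (ν 0 :+ # 1) ∶
          ℕₚ.*-monoˡ-≤ (c +ₙ 1) x<p ∷ 1 ✕ ν 1 :* (# 4 :* ν 4) ≐ₙ ν 1 :* (ν 0 :+ # 1) ∶ sym (cong (r *ₙ_) c+1) ∷ 1 ✕ ν
          3 :* (ν 0 :+ # 1) ≐ₙ ν 3 :* (# 4 :* ν 4) ∶ cong (t *ₙ_) c+1 ∷ 1 ✕ ν 0 :+ # 1 ≐ₙ # 4 :* ν 4 ∶ c+1 ∷ 1 ✕ # 2
          :* ν 5 :+ # 8 :* ν 4 ⊑ₙ ν 1 ∶ R₀≤r ∷ []) (# 2 :* ν 4 :* (# 1 :+ ν 1) ⊑ₙ # 2 :* ν 4 :* ν 3 :+ (# 1 :+ ν 1))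
      dense : 0ℚ ≤ a → a * a * ι (suc n-1 ^ 3) ≤ ι E * ι E
      dense 0≤a = ℚₚ.≤-trans (*-monoˡ (a * a) (*-nonNeg 0≤a 0≤a) cube≤)
          (ℚₚ.≤-trans (ℚₚ.≤-reflexive (certify (u ∷ []) (a ∷ []) 0 [] (χ 0 :* χ 0 :* (ν 0 :* ν 0 :* ν 0 :* (ν 0 :* ν
              0 :* ν 0)) ≐ χ 0 :* (ν 0 :* ν 0 :* ν 0) :* (χ 0 :* (ν 0 :* ν 0 :* ν 0)))))
            (*-mono-nonNeg (*-nonNeg 0≤a 0≤u³) E≥ E≥ (0≤ι E)))
        where
        0≤u³ : 0ℚ ≤ ι u * ι u * ι u
        0≤u³ = *-nonNeg (*-nonNeg (0≤ι u) (0≤ι u)) (0≤ι u)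
        n≤u² : ι (suc n-1) ≤ ι u * ι u
        n≤u² = certify (n-1 ∷ r ∷ []) [] 0 (1 ✕ ν 0 ⊏ₙ (# 1 :+ ν 1) :* (# 1 :+ ν 1) ∶ <r² ∷ []) (⌜ # 1 :+ ν 0 ⌝ ⊑ ⌜ #
            1 :+ ν 1 ⌝ :* ⌜ # 1 :+ ν 1 ⌝)
        0≤u² : 0ℚ ≤ ι u * ι u
        0≤u² = *-nonNeg (0≤ι u) (0≤ι u)
        cube≤ : ι (suc n-1 ^ 3) ≤ ι u * ι u * ι u * (ι u * ι u * ι u)
        cube≤ = ℚₚ.≤-trans (ℚₚ.≤-reflexive (ι-cube (suc n-1)))
          (ℚₚ.≤-trans (*-mono-nonNeg (0≤ι (suc n-1)) (*-mono-nonNeg (0≤ι (suc n-1)) n≤u² n≤u² 0≤u²) n≤u² (*-nonNeg 0≤u² 0≤u²))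
            (ℚₚ.≤-reflexive (certify (u ∷ []) [] 0 [] (ν 0 :* ν 0 :* (ν 0 :* ν 0) :* (ν 0 :* ν 0) ≐ ν 0 :* ν 0 :* ν 0
                :* (ν 0 :* ν 0 :* ν 0)))))
        v : ℚ
        v = ι 2 * ι k * ι u - ι u
        0≤v : 0ℚ ≤ v
        0≤v = certify (u ∷ k ∷ []) [] 0 (2 ✕ ν 0 :* # 1 ⊑ ν 0 :* ν 1 ∶ *-monoˡ (ι u) (0≤ι u) (ι-mono 1≤k) ∷ []) (# 0
            ⊑ # 2 :* ν 1 :* ν 0 :- ν 0)
        v≤ : v ≤ ι 2 * ι k * ι t
        v≤ = certify (k ∷ u ∷ t ∷ []) [] 0 (1 ✕ # 2 :* ν 0 :* ν 1 ⊑ₙ # 2 :* ν 0 :* ν 2 :+ ν 1 ∶ t-large ∷ []) (# 2 :*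
            ν 0 :* ν 1 :- ν 1 ⊑ # 2 :* ν 0 :* ν 2)
        w : ℚ
        w = ι 2 * ι k * ι t
        0≤w : 0ℚ ≤ w
        0≤w = certify (k ∷ t ∷ []) [] 0 [] (# 0 ⊑ # 2 :* ν 0 :* ν 1)
        v³ : v * v * v ≤ w * w * w
        v³ = *-mono-nonNeg 0≤v (*-mono-nonNeg 0≤v v≤ v≤ 0≤w) v≤ (*-nonNeg 0≤w 0≤w)
        -- Cubing (2 k - 1) u ≤ 2 k t gives (2 k - 1)³ u³ ≤ 8 k³ t³ ≤ 16 k³ E, and (2 k - 1)³ ≥ 8 k³
        -- - 16 k² ≥ 16 k³ a by `2a`.
        E≥ : a * (ι u * ι u * ι u) ≤ ι E
        E≥ = ι-cancelˡ {16 *ₙ (k *ₙ k *ₙ k)} (ℕₚ.*-mono-≤ {1} {16} (s≤s z≤n) (ℕₚ.*-mono-≤ (ℕₚ.*-mono-≤ 1≤k 1≤k) 1≤k))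
          (certify (k ∷ u ∷ t ∷ E ∷ []) (a ∷ []) 0 (1 ✕ # 8 :* (ν 0 :* ν 0) :* (ν 1 :* ν 1 :* ν 1) :* (# 2 :* ν 0 :*
              χ 0) ⊑ # 8 :* (ν 0 :* ν 0) :* (ν 1 :* ν 1 :* ν 1) :* (ν 0 :- # 2) ∶ *-monoˡ (ι 8 * (ι k * ι k) * (ι u *
              ι u * ι u)) (*-nonNeg (certify (k ∷ []) [] 0 [] (# 0 ⊑ # 8 :* (ν 0 :* ν 0))) 0≤u³) 2a ∷ 1 ✕ (# 2 :* ν 0
              :* ν 1 :- ν 1) :* (# 2 :* ν 0 :* ν 1 :- ν 1) :* (# 2 :* ν 0 :* ν 1 :- ν 1) ⊑ # 2 :* ν 0 :* ν 2 :* (# 2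
              :* ν 0 :* ν 2) :* (# 2 :* ν 0 :* ν 2) ∶ v³ ∷ 1 ✕ ν 1 :* ν 1 :* ν 1 :* # 1 ⊑ ν 1 :* ν 1 :* ν 1 :* ν 0 ∶
              *-monoˡ (ι u * ι u * ι u) 0≤u³ (ι-mono 1≤k) ∷ 1 ✕ # 8 :* (ν 0 :* ν 0 :* ν 0) :* ⌜ (# 1 :+ ν 2) :* (# 1
              :+ ν 2) :* (# 1 :+ ν 2) ⌝ ≐ # 8 :* (ν 0 :* ν 0 :* ν 0) :* ⌜ # 2 :* ν 3 :+ (# 1 :+ ν 2) :* (# 1 :+ ν 2) ⌝
              ∶ sym (cong (λ z → ι 8 * (ι k * ι k * ι k) * ι z) size) ∷ 16 ✕ # 0 ⊑ ⌜ ν 0 :* ν 0 :* ν 0 ⌝ :* ⌜ ν 2 :* ν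
              2 ⌝ ∶ *-nonNeg (0≤ι (k *ₙ k *ₙ k)) (0≤ι (t *ₙ t)) ∷ 8 ✕ # 0 ⊑ ⌜ ν 0 :* ν 0 :* ν 0 ⌝ :* ν 2 ∶ *-nonNeg
              (0≤ι (k *ₙ k *ₙ k)) (0≤ι t) ∷ 4 ✕ # 0 ⊑ ⌜ ν 0 :* ν 0 ⌝ :* (ν 1 :* ν 1 :* ν 1) ∶ *-nonNeg (0≤ι (k *ₙ k))
              0≤u³ ∷ []) (⌜ # 16 :* (ν 0 :* ν 0 :* ν 0) ⌝ :* (χ 0 :* (ν 1 :* ν 1 :* ν 1)) ⊑ ⌜ # 16 :* (ν 0 :* ν 0 :* ν
              0) ⌝ :* ν 3))

theorem2p3 : ∀ (ε : ℚ) → 0ℚ < ε →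
    Σ ℕ λ N → ∀ (n : ℕ) → n ≥ N →
    (Σ (Hyp3 n) λ H → ¬ ContainsTrace C4 H ×
    (((+ 1 / 2) - ε ≤ 0ℚ) ⊎
    (((+ 1 / 2) - ε) * ((+ 1 / 2) - ε) * ℕ→ℚ (n ^ 3)
    ≤ ℕ→ℚ (∣E∣ H) * ℕ→ℚ (∣E∣ H))))
    ×
    (∀ (H : Hyp3 n) → ¬ ContainsTrace C4 H →
    ℕ→ℚ (∣E∣ H) * ℕ→ℚ (∣E∣ H)
    ≤ ((+ 5 / 6) + ε) * ((+ 5 / 6) + ε) * ℕ→ℚ (n ^ 3))
theorem2p3 ε 0<ε = combine (archimedean ε 0<ε)
  where
  Goal : ℕ → Set
  Goal n = (Σ (Hyp3 n) λ H → ¬ ContainsTrace C4 H ×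
      (((+ 1 / 2) - ε ≤ 0ℚ) ⊎ (((+ 1 / 2) - ε) * ((+ 1 / 2) - ε) * ι (n ^ 3) ≤ ι (∣E∣ H) * ι (∣E∣ H))))
    × (∀ (H : Hyp3 n) → ¬ ContainsTrace C4 H → ι (∣E∣ H) * ι (∣E∣ H) ≤ ((+ 5 / 6) + ε) * ((+ 5 / 6) + ε) * ι (n ^ 3))
  combine : ∃[ k ] (1 ≤ₙ k × 1ℚ ≤ ι k * ε) → Σ ℕ λ N → ∀ n → N ≤ₙ n → Goal n
  combine (k , 1≤k , 1≤kε) = suc N₁ +ₙ 44 *ₙ (k *ₙ k) , λ { (suc n-1) (s≤s N≤n) →
      proj₂ lowerN n-1 (ℕₚ.≤-trans (ℕₚ.m≤m+n N₁ (44 *ₙ (k *ₙ k))) N≤n) ,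
      upper {k = k} ε 0<ε 1≤kε (ℕₚ.≤-trans (ℕₚ.m≤n+m (44 *ₙ (k *ₙ k)) N₁) (ℕₚ.m≤n⇒m≤1+n N≤n)) }
    where
    lowerN = lower ε {k} 1≤k 1≤kε
    N₁ = proj₁ lowerN
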